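{- Let $p$ be a prime, $s \ge 1$, and $q=p^s$. Let $m$ and $\ell$ be positive integers. For each integer $r$ with $0 \le r \le m$, there exists a $(v^+,k_r^+,\lambda_r^+,\mu_r^+)$ partial difference set $D_r^+$ in the elementary abelian $p$-group $G=\mathbb{Z}_p^{sm(2\ell+1)}$, where \begin{align*} v^+ &= q^{m(2\ell+1)},\\ k_r^+ &= \frac{(q^m-q^{m-r})(q^{m\ell}-1)(q^{m(\ell+1)}-1)}{q^m-1} + q^{m(\ell+1)}-1,\\ \lambda_r^+ &= \frac{(q^m-q^{m-r})(q^{m(\ell+1)}-1)(q^{m(\ell+1)}-q^{m(\ell+1)-r}+q^{m-r}-1)}{(q^m-1)^2} + \frac{q^{m(\ell+2)-r}+q^{m(\ell+1)-r}-2q^{m(\ell+1)}-2q^{m-r}+2}{q^m-1},\\ \mu_r^+ &= \frac{(q^m-q^{m-r})(q^{m(\ell+1)}-1)(q^{m(\ell+1)}-q^{m(\ell+1)-r}+q^{m-r}-1)}{(q^m-1)^2}. \end{align*} Consequently, the Cayley graph $\mathrm{Cay}(G,D_r^+)$ is a $(v^+,k_r^+,\lambda_r^+,\mu_r^+)$ strongly regular graph.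
   Context: Let $G$ be an additively written finite group of order $v$. A subset $D\subseteq G$ with $|D|=k$ and $0_G\notin D$ is a $(v,k,\lambda,\mu)$ partial difference set (PDS) if the differences $g-h$ with $g,h\in D$, $g\neq h$, represent each element of $D$ exactly $\lambda$ times and each nonidentity element of $G\setminus D$ exactly $\mu$ times. For $D\subseteq G$ with $0_G\notin D$ and $D=-D$, the Cayley graph $\mathrm{Cay}(G,D)$ has vertex set $G$, with $g,h$ adjacent iff $g-h\in D$. A $(v,k,\lambda,\mu)$ strongly regular graph is a $k$-regular simple graph on $v$ vertices in which any two adjacent vertices have exactly $\lambda$ common neighbours and any two distinct non-adjacent vertices have exactly $\mu$ common neighbours. -}

module Defs where

open import Data.Nat using (ℕ; zero; suc; _+_; _*_; _∸_; _^_; NonZero)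
open import Data.Nat.DivMod using (_mod_)
open import Data.Fin using (Fin; toℕ)
open import Data.Fin.Properties using () renaming (_≟_ to _≟F_)
open import Data.Vec using (Vec; []; _∷_; zipWith; map; replicate)
open import Data.Vec.Properties using (≡-dec)
open import Data.List using (List; []; _∷_; concatMap; allFin; length)
import Data.List as L
open import Data.Bool using (Bool; true; false; _∧_; not; if_then_else_)
open import Data.Product using (_×_; _,_)
open import Relation.Nullary.Decidable using (⌊_⌋)
open import Relation.Binary.PropositionalEquality using (_≡_)

module Zmod (p : ℕ) .{{_ : NonZero p}} where

  _+ₚ_ : Fin p → Fin p → Fin p
  a +ₚ b = (toℕ a + toℕ b) mod p

  -ₚ_ : Fin p → Fin p
  -ₚ a = (p ∸ toℕ a) mod p

  0ₚ : Fin p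
  0ₚ = 0 mod p

  G : ℕ → Set
  G n = Vec (Fin p) n

  _⊕_ : ∀ {n} → G n → G n → G n
  _⊕_ = zipWith _+ₚ_

  ⊖_ : ∀ {n} → G n → G n
  ⊖_ = map -ₚ_

  _⊝_ : ∀ {n} → G n → G n → G n
  g ⊝ h = g ⊕ (⊖ h)

  𝟘 : ∀ {n} → G n
  𝟘 = replicate _ 0ₚ

  _==_ : ∀ {n} → G n → G n → Bool
  g == h = ⌊ ≡-dec _≟F_ g h ⌋

  elems : (n : ℕ) → List (G n)
  elems zero = [] ∷ []
  elems (suc n) = concatMap (λ a → L.map (a ∷_) (elems n)) (allFin p)

  countB : ∀ {A : Set} → (A → Bool) → List A → ℕ
  countB P [] = 0
  countB P (x ∷ xs) = if P x then suc (countB P xs) else countB P xs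

  countPairs : (n : ℕ) → (G n → G n → Bool) → ℕ
  countPairs n P = countB (λ gh → P (Data.Product.proj₁ gh) (Data.Product.proj₂ gh))
                          (L.cartesianProduct (elems n) (elems n))

  record IsPDS (n : ℕ) (D : G n → Bool) (v k lam mu : ℕ) : Set where
    field
      order     : length (elems n) ≡ v
      size      : countB D (elems n) ≡ k
      zero∉D    : D 𝟘 ≡ false
      diffs-in  : ∀ x → (x == 𝟘) ≡ false → D x ≡ true →
                  countPairs n (λ g h → D g ∧ D h ∧ not (g == h) ∧ ((g ⊝ h) == x)) ≡ lam
      diffs-out : ∀ x → (x == 𝟘) ≡ false → D x ≡ false →
                  countPairs n (λ g h → D g ∧ D h ∧ not (g == h) ∧ ((g ⊝ h) == x)) ≡ mu

  Symmetric : (n : ℕ) → (G n → Bool) → Set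
  Symmetric n D = ∀ x → D (⊖ x) ≡ D x

  CayAdj : (n : ℕ) → (G n → Bool) → G n → G n → Bool
  CayAdj n D g h = D (g ⊝ h)

-- A (v,k,λ,μ) strongly regular graph on a finite vertex set enumerated
-- (without repetition) by the list Vs, with Boolean adjacency `adj`
-- and decidable vertex equality `eq`.
record IsSRG {V : Set} (Vs : List V) (eq : V → V → Bool) (adj : V → V → Bool)
             (v k lam mu : ℕ) : Set where
  field
    irreflexive : ∀ x → adj x x ≡ false
    symmetric   : ∀ x y → adj x y ≡ adj y x
    order       : length Vs ≡ v
    regular     : ∀ x → length (L.filterᵇ (adj x) Vs) ≡ k
    adjacent    : ∀ x y → eq x y ≡ false → adj x y ≡ true →
                  length (L.filterᵇ (λ z → adj x z ∧ adj y z) Vs) ≡ lam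
    nonadjacent : ∀ x y → eq x y ≡ false → adj x y ≡ false →
                  length (L.filterᵇ (λ z → adj x z ∧ adj y z) Vs) ≡ mu

-- Let Q = q^m, K = F_Q, and let L₁, L₂ be the extensions of K of degrees l and l + 1, so that
-- L₁ × L₂ is the required elementary abelian group. For an additive subgroup U of K of order
-- q^(m-r) (an F_p-subspace suffices), put
--   D = { (x , y) | y ≠ 0, and x = 0 or N(y)/N(x) ∉ U }.
-- The partial difference set equation is an identity between integer-valued functions on
-- L₁ × L₂. Such a function is determined by its pushforwards to K along the functionals
-- (x , y) ↦ Tr(ax) + Tr(by), which play the role of the characters; up to constants, the
-- pushforward of D can be written down explicitly, because
--   #{ y ∈ L₂ | N(y) = u, Tr(y) = t }
-- reduces to the same count for L₁ by the Hasse-Davenport relation G_(l+1) = - G_l G_1 for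
-- Gauss sums. In terms of counts, that relation follows by summing
-- Σ { deg P | P^k divides f, P monic irreducible, k ≥ 1 } = deg f over the monic polynomials f
-- with prescribed constant and subleading coefficients.

module Submission where

-- The degrees of `L₁` and `L₂` are consecutive for the following reason. For a multiplicative
-- character χ of `K`, lifted by the norms, the class `N(y) = u N(x)` contributes the product
-- `G_l(χ⁻¹) G_(l+1)(χ) = - G_l(χ⁻¹) G_l(χ)
-- G_1(χ)`. If χ is nontrivial, the two sums over `L₁` multiply to `±
-- |L₁|`, and one Gauss sum of `K` is left. Up to constants, the pushforward of the class is
-- therefore minus a multiple of the indicator of 0 minus `|L₁|` times the indicator of one point,
-- proportional to `u`. Adding up the classes with `u ∉ U` leaves `|L₁|` times the indicator of a
-- multiple of `U`. The character sums of an additive subgroup are 0 or its order, so functionals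
-- with `a, b ≠ 0` yield just two values, `θ₂` and `θ₂ + |L₁| |U| = θ₁`.
--
-- All of this is carried out in ℤ, without roots of unity. An additive character annihilates
-- constants, so statements about it become statements about functions `K → ℤ` up to a constant
-- (`Uniform`); a multiplicative one is replaced by fixing the value of a norm. Several exact counts
-- come from upper bounds that add up to the right total (`∑-squeeze`).

open import Level using (Level)
open import Algebra.Bundles using (CommutativeRing)

-- Ring solver with integer coefficients for an arbitrary commutative ring

module IntegerSolver {a b : Level} (R : CommutativeRing a b) where

  open import Algebra.Bundles using (RawRing)
  open import Algebra.Solver.Ring.AlmostCommutativeRing
  import Algebra.Solver.Ring
  import Algebra.Properties.Ring
  import Algebra.Properties.AbelianGroup
  import Algebra.Properties.Semiring.Mult.TCOptimised
  open import Data.Integer.Base as ℤ using (ℤ; +_; -[1+_]; _⊖_)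
  import Data.Integer.Properties as ℤ
  open import Data.Nat.Base as ℕ using (ℕ; zero; suc)
  import Data.Nat.Properties as ℕ
  open import Data.Maybe.Base using (Maybe; just; nothing)
  open import Relation.Nullary using (yes; no)
  open import Relation.Binary.PropositionalEquality as ≡ using (_≡_)

  open CommutativeRing R
  open Algebra.Properties.Ring ring using (-‿distribˡ-*; -‿distribʳ-*)
  open Algebra.Properties.AbelianGroup +-abelianGroup
    using () renaming (⁻¹-∙-comm to -‿+-comm; ε⁻¹≈ε to -0≈0; ⁻¹-involutive to -‿involutive)
  open Algebra.Properties.Semiring.Mult.TCOptimised semiring using (_×_; ×-homo-+; ×1-homo-*)
  open import Relation.Binary.Reasoning.Setoid setoid

  private
    -- The optimised multiple computes `1 × 1#` to `1#`, so that constants in solved equations agree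
    -- with the goal definitionally.
    nat : ℕ → Carrier
    nat n = n × 1#

    int : ℤ → Carrier
    int (+ n)     = nat n
    int -[1+ n ]  = - nat (suc n)

    nat-suc : ∀ n → nat (suc n) ≈ 1# + nat n
    nat-suc = ×-homo-+ 1# 1

    cancel : ∀ x y → (1# + x) - (1# + y) ≈ x - y
    cancel x y = begin
      (1# + x) + - (1# + y)      ≈⟨ +-cong (+-comm 1# x) (sym (-‿+-comm 1# y)) ⟩
      (x + 1#) + (- 1# + - y)    ≈⟨ +-assoc x 1# _ ⟩
      x + (1# + (- 1# + - y))    ≈⟨ +-congˡ (sym (+-assoc 1# _ _)) ⟩
      x + ((1# + - 1#) + - y)    ≈⟨ +-congˡ (+-congʳ (-‿inverseʳ 1#)) ⟩
      x + (0# + - y)             ≈⟨ +-congˡ (+-identityˡ _) ⟩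
      x - y                      ∎

    int-⊖ : ∀ m n → int (m ⊖ n) ≈ nat m - nat n
    int-⊖ zero    zero    = sym (-‿inverseʳ 0#)
    int-⊖ zero    (suc n) = sym (+-identityˡ _)
    int-⊖ (suc m) zero    = sym (trans (+-congˡ -0≈0) (+-identityʳ _))
    int-⊖ (suc m) (suc n) = begin
      int (suc m ⊖ suc n)            ≡⟨ ≡.cong int (ℤ.[1+m]⊖[1+n]≡m⊖n m n) ⟩
      int (m ⊖ n)                    ≈⟨ int-⊖ m n ⟩
      nat m - nat n                  ≈⟨ cancel (nat m) (nat n) ⟨
      (1# + nat m) - (1# + nat n)    ≈⟨ +-cong (nat-suc m) (-‿cong (nat-suc n)) ⟨
      nat (suc m) - nat (suc n)      ∎

    int-neg : ∀ i → int (ℤ.- i) ≈ - int i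
    int-neg (+ zero)   = sym -0≈0
    int-neg (+ suc n)  = refl
    int-neg -[1+ n ]   = sym (-‿involutive _)

    int-+ : ∀ i j → int (i ℤ.+ j) ≈ int i + int j
    int-+ (+ m)     (+ n)     = ×-homo-+ 1# m n
    int-+ (+ m)     -[1+ n ]  = int-⊖ m (suc n)
    int-+ -[1+ m ]  (+ n)     = trans (int-⊖ n (suc m)) (+-comm _ _)
    int-+ -[1+ m ]  -[1+ n ]  = trans
      (-‿cong (trans (reflexive (≡.cong nat (≡.cong suc (≡.sym (ℕ.+-suc m n))))) (×-homo-+ 1# (suc m) (suc n))))
      (sym (-‿+-comm _ _))

    int-*⁺ : ∀ m n → int (+ m ℤ.* + n) ≈ nat m * nat n
    int-*⁺ m n = trans (reflexive (≡.cong int (≡.sym (ℤ.pos-* m n)))) (×1-homo-* m n)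

    int-* : ∀ i j → int (i ℤ.* j) ≈ int i * int j
    int-* (+ m)     (+ n)     = int-*⁺ m n
    int-* (+ m)     -[1+ n ]  = begin
      int (+ m ℤ.* ℤ.- + suc n)     ≡⟨ ≡.cong int (≡.sym (ℤ.neg-distribʳ-* (+ m) (+ suc n))) ⟩
      int (ℤ.- (+ m ℤ.* + suc n))   ≈⟨ int-neg (+ m ℤ.* + suc n) ⟩
      - int (+ m ℤ.* + suc n)       ≈⟨ -‿cong (int-*⁺ m (suc n)) ⟩
      - (nat m * nat (suc n))       ≈⟨ -‿distribʳ-* _ _ ⟩
      nat m * - nat (suc n)         ∎
    int-* -[1+ m ]  (+ n)     = begin
      int (ℤ.- + suc m ℤ.* + n)     ≡⟨ ≡.cong int (≡.sym (ℤ.neg-distribˡ-* (+ suc m) (+ n))) ⟩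
      int (ℤ.- (+ suc m ℤ.* + n))   ≈⟨ int-neg (+ suc m ℤ.* + n) ⟩
      - int (+ suc m ℤ.* + n)       ≈⟨ -‿cong (int-*⁺ (suc m) n) ⟩
      - (nat (suc m) * nat n)       ≈⟨ -‿distribˡ-* _ _ ⟩
      - nat (suc m) * nat n         ∎
    int-* -[1+ m ]  -[1+ n ]  = begin
      int (+ suc m ℤ.* + suc n)         ≈⟨ int-*⁺ (suc m) (suc n) ⟩
      nat (suc m) * nat (suc n)         ≈⟨ -‿involutive _ ⟨
      - - (nat (suc m) * nat (suc n))   ≈⟨ -‿cong (-‿distribʳ-* _ _) ⟩
      - (nat (suc m) * - nat (suc n))   ≈⟨ -‿distribˡ-* _ _ ⟩
      - nat (suc m) * - nat (suc n)     ∎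

    ℤ-rawRing : RawRing _ _
    ℤ-rawRing = record
      { Carrier = ℤ ; _≈_ = _≡_ ; _+_ = ℤ._+_ ; _*_ = ℤ._*_ ; -_ = ℤ.-_ ; 0# = ℤ.0ℤ ; 1# = ℤ.1ℤ }

    almost : AlmostCommutativeRing _ _
    almost = fromCommutativeRing R

    morphism : ℤ-rawRing -Raw-AlmostCommutative⟶ almost
    morphism = record
      { ⟦_⟧ = int ; +-homo = int-+ ; *-homo = int-* ; -‿homo = int-neg ; 0-homo = refl ; 1-homo = refl }

    -- Comparing the integers instead of their images is sound but incomplete: identities special to
    -- characteristic `p` are not found.
    weakDec : ∀ i j → Maybe (int i ≈ int j)
    weakDec i j with i ℤ.≟ j
    ... | yes i≡j = just (reflexive (≡.cong int i≡j))
    ... | no  _   = nothing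

  open Algebra.Solver.Ring ℤ-rawRing almost morphism weakDec public
    using (solve; _:=_; _:+_; _:*_; _:-_; :-_; con; _:^_; Polynomial)

-- Finite types and sums over them

module FiniteSums where

  open import Data.List.Base using (List; []; _∷_; _++_; map; concatMap; cartesianProduct; cartesianProductWith; length)
  open import Data.List.Membership.Propositional using (_∈_)
  open import Data.List.Relation.Unary.Any as Any using (here; there)
  open import Data.List.Relation.Unary.All as All using (All; []; _∷_)
  open import Data.List.Relation.Unary.AllPairs using ([]; _∷_)
  open import Data.List.Relation.Unary.Unique.Propositional using (Unique)
  import Data.List.Relation.Unary.Unique.Propositional.Properties as Unique
  import Data.List.Membership.Propositional.Properties as ∈
  open import Data.List.Properties using (length-map; length-++)
  open import Data.Vec.Base using (Vec; []; _∷_)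
  open import Data.Vec.Properties using (≡-dec; ∷-injective)
  open import Data.Product using (_×_; _,_; ∃)
  open import Data.Product.Properties using () renaming (≡-dec to ×-≡-dec)
  open import Data.Nat.Base as ℕ using (ℕ; zero; suc)
  open import Relation.Nullary using (Dec; yes; no; contradiction)
  open import Relation.Nullary.Decidable using (map′)
  open import Relation.Binary using (DecidableEquality)
  open import Relation.Binary.PropositionalEquality
  open import Algebra.Structures using (IsCommutativeMonoid)
  open import Function.Base using (_∘_)

  record Finite (A : Set) : Set where
    infix 4 _≟_
    field
      elements : List A
      _≟_      : DecidableEquality A
      complete : ∀ x → x ∈ elements
      unique   : Unique elements

    card : ℕ
    card = length elements

    all? : {P : A → Set} → (∀ x → Dec (P x)) → Dec (∀ x → P x)
    all? P? = map′ (λ ps x → All.lookup ps (complete x)) (λ ps → All.tabulate (λ {x} _ → ps x)) (All.all? P? elements)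

    any? : {P : A → Set} → (∀ x → Dec (P x)) → Dec (∃ P)
    any? P? = map′ Any.satisfied (λ (x , px) → Any.map (λ { refl → px }) (complete x)) (Any.any? P? elements)

  open Finite using (elements; card)

  -- The recursion is that of `elems` in `Zmod`, so that the two enumerations agree by a direct
  -- induction.
  vectors : {A : Set} → List A → ∀ n → List (Vec A n)
  vectors xs zero    = [] ∷ []
  vectors xs (suc n) = concatMap (λ a → map (a ∷_) (vectors xs n)) xs

  private
    vectors-suc : {A : Set} (xs : List A) {n : ℕ} (ys : List (Vec A n)) →
                  concatMap (λ a → map (a ∷_) ys) xs ≡ cartesianProductWith _∷_ xs ys
    vectors-suc []       ys = refl
    vectors-suc (x ∷ xs) ys = cong (map (x ∷_) ys ++_) (vectors-suc xs ys)

  length-vectors : {A : Set} (xs : List A) → ∀ n → length (vectors xs n) ≡ length xs ℕ.^ n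
  length-vectors xs zero    = refl
  length-vectors xs (suc n) = trans (go xs) (cong (length xs ℕ.*_) (length-vectors xs n))
    where
    go : ∀ ys → length (concatMap (λ a → map (a ∷_) (vectors xs n)) ys) ≡ length ys ℕ.* length (vectors xs n)
    go []       = refl
    go (y ∷ ys) = trans (length-++ (map (y ∷_) (vectors xs n))) (cong₂ ℕ._+_ (length-map (y ∷_) (vectors xs n)) (go ys))

  vecFinite : {A : Set} → Finite A → ∀ n → Finite (Vec A n)
  vecFinite {A} F n = record
    { elements = vectors F.elements n ; _≟_ = ≡-dec F._≟_ ; complete = complete n ; unique = unique n }
    where
    module F = Finite F
    complete : ∀ n (v : Vec A n) → v ∈ vectors F.elements n
    complete zero    []      = here refl
    complete (suc n) (a ∷ v) = subst (a ∷ v ∈_) (sym (vectors-suc F.elements (vectors F.elements n)))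
      (∈.∈-cartesianProductWith⁺ _∷_ (F.complete a) (complete n v))
    unique : ∀ n → Unique (vectors F.elements n)
    unique zero    = [] ∷ []
    unique (suc n) = subst Unique (sym (vectors-suc F.elements (vectors F.elements n)))
      (Unique.cartesianProductWith⁺ _∷_ (λ e → ∷-injective e) F.unique (unique n))

  _×ᶠ_ : {A B : Set} → Finite A → Finite B → Finite (A × B)
  F ×ᶠ H = record
    { elements = cartesianProduct F.elements H.elements
    ; _≟_      = ×-≡-dec F._≟_ H._≟_
    ; complete = λ (a , b) → ∈.∈-cartesianProduct⁺ (F.complete a) (H.complete b)
    ; unique   = Unique.cartesianProduct⁺ F.unique H.unique
    }
    where
    module F = Finite F
    module H = Finite H

  module MonoidSum {C : Set} {_∙_ : C → C → C} {ε : C} (isCM : IsCommutativeMonoid _≡_ _∙_ ε) where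

    open IsCommutativeMonoid isCM using (assoc; comm; identityˡ; identityʳ)
    open ≡-Reasoning

    -- Over an arbitrary commutative monoid, because it serves both for sums of integers and, in
    -- `fermat`, for products in a field.
    ∑ : {A : Set} → List A → (A → C) → C
    ∑ []       f = ε
    ∑ (x ∷ xs) f = f x ∙ ∑ xs f

    infix 3 ∑
    syntax ∑ xs (λ x → e) = ∑[ x ∈ xs ] e

    when : {P : Set} → Dec P → C → C
    when (yes _) c = c
    when (no _)  c = ε

    when-cong : {P Q : Set} {p : Dec P} {q : Dec Q} {c : C} → (P → Q) → (Q → P) → when p c ≡ when q c
    when-cong {p = yes _} {yes _} f g = refl
    when-cong {p = yes x} {no ¬q} f g = contradiction (f x) ¬q
    when-cong {p = no ¬p} {yes y} f g = contradiction (g y) ¬p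
    when-cong {p = no _}  {no _}  f g = refl

    private variable
      A B : Set

    ∑-cong : (xs : List A) {f g : A → C} → (∀ x → f x ≡ g x) → ∑ xs f ≡ ∑ xs g
    ∑-cong []       e = refl
    ∑-cong (x ∷ xs) e = cong₂ _∙_ (e x) (∑-cong xs e)

    ∑-ε : (xs : List A) → ∑ xs (λ _ → ε) ≡ ε
    ∑-ε []       = refl
    ∑-ε (x ∷ xs) = trans (identityˡ _) (∑-ε xs)

    interchange : ∀ a b c d → (a ∙ b) ∙ (c ∙ d) ≡ (a ∙ c) ∙ (b ∙ d)
    interchange a b c d = begin
      (a ∙ b) ∙ (c ∙ d)   ≡⟨ assoc a b _ ⟩
      a ∙ (b ∙ (c ∙ d))   ≡⟨ cong (a ∙_) (assoc b c d) ⟨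
      a ∙ ((b ∙ c) ∙ d)   ≡⟨ cong (λ t → a ∙ (t ∙ d)) (comm b c) ⟩
      a ∙ ((c ∙ b) ∙ d)   ≡⟨ cong (a ∙_) (assoc c b d) ⟩
      a ∙ (c ∙ (b ∙ d))   ≡⟨ assoc a c _ ⟨
      (a ∙ c) ∙ (b ∙ d)   ∎

    ∑-∙ : (xs : List A) (f g : A → C) → ∑ xs (λ x → f x ∙ g x) ≡ ∑ xs f ∙ ∑ xs g
    ∑-∙ []       f g = sym (identityˡ ε)
    ∑-∙ (x ∷ xs) f g = trans (cong ((f x ∙ g x) ∙_) (∑-∙ xs f g)) (interchange _ _ _ _)

    ∑-++ : (xs ys : List A) (f : A → C) → ∑ (xs ++ ys) f ≡ ∑ xs f ∙ ∑ ys f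
    ∑-++ []       ys f = sym (identityˡ _)
    ∑-++ (x ∷ xs) ys f = trans (cong (f x ∙_) (∑-++ xs ys f)) (sym (assoc _ _ _))

    ∑-map : (h : B → A) (xs : List B) (f : A → C) → ∑ (map h xs) f ≡ ∑ xs (f ∘ h)
    ∑-map h []       f = refl
    ∑-map h (x ∷ xs) f = cong (f (h x) ∙_) (∑-map h xs f)

    ∑-concatMap : (h : B → List A) (xs : List B) (f : A → C) →
                  ∑ (concatMap h xs) f ≡ ∑ xs (λ x → ∑ (h x) f)
    ∑-concatMap h []       f = refl
    ∑-concatMap h (x ∷ xs) f = trans (∑-++ (h x) _ f) (cong (∑ (h x) f ∙_) (∑-concatMap h xs f))

    ∑-swap : (xs : List A) (ys : List B) (f : A → B → C) →
             ∑ xs (λ x → ∑ ys (f x)) ≡ ∑ ys (λ y → ∑ xs (λ x → f x y))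
    ∑-swap []       ys f = sym (∑-ε ys)
    ∑-swap (x ∷ xs) ys f = trans (cong (∑ ys (f x) ∙_) (∑-swap xs ys f)) (sym (∑-∙ ys _ _))

    ∑-vectors : ∀ n (xs : List A) (f : Vec A (suc n) → C) →
                ∑ (vectors xs (suc n)) f ≡ ∑ xs (λ a → ∑ (vectors xs n) (λ v → f (a ∷ v)))
    ∑-vectors n xs f = trans (∑-concatMap (λ a → map (a ∷_) (vectors xs n)) xs f)
      (∑-cong xs (λ a → ∑-map (a ∷_) (vectors xs n) f))

    ∑-cartesianProduct : (xs : List A) (ys : List B) (f : A × B → C) →
                         ∑ (cartesianProduct xs ys) f ≡ ∑ xs (λ x → ∑ ys (λ y → f (x , y)))
    ∑-cartesianProduct []       ys f = refl
    ∑-cartesianProduct (x ∷ xs) ys f = trans (∑-++ (map (x ,_) ys) _ f)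
      (cong₂ _∙_ (∑-map (x ,_) ys f) (∑-cartesianProduct xs ys f))

    module _ (F : Finite A) where
      open Finite F using (_≟_; complete; unique)

      private
        ∑-miss : ∀ xs a (f : A → C) → All (a ≢_) xs → ∑ xs (λ x → when (x ≟ a) (f x)) ≡ ε
        ∑-miss []       a f []           = refl
        ∑-miss (x ∷ xs) a f (a≢x ∷ a∉xs) with x ≟ a
        ... | yes x≡a = contradiction (sym x≡a) a≢x
        ... | no  _   = trans (identityˡ _) (∑-miss xs a f a∉xs)

        ∑-hit : ∀ xs a (f : A → C) → Unique xs → a ∈ xs → ∑ xs (λ x → when (x ≟ a) (f x)) ≡ f a
        ∑-hit (x ∷ xs) a f (x∉xs ∷ u) a∈ with x ≟ a | a∈
        ... | yes refl | _          = trans (cong (f x ∙_) (∑-miss xs x f x∉xs)) (identityʳ _)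
        ... | no x≢a   | here a≡x   = contradiction (sym a≡x) x≢a
        ... | no x≢a   | there a∈xs = trans (identityˡ _) (∑-hit xs a f u a∈xs)

      ∑-pick : ∀ a (f : A → C) → ∑ (elements F) (λ x → when (x ≟ a) (f x)) ≡ f a
      ∑-pick a f = ∑-hit (elements F) a f unique (complete a)

    -- Both sides are the sum of `f x` over the pairs with `y ≡ h x`, taken in the two possible
    -- orders.
    reindex : (F : Finite A) (H : Finite B) (g : B → A) (h : A → B) →
              (∀ x → g (h x) ≡ x) → (∀ y → h (g y) ≡ y) →
              (f : A → C) → ∑ (elements F) f ≡ ∑ (elements H) (f ∘ g)
    reindex F H g h gh hg f = begin
      ∑ (elements F) f
        ≡⟨ ∑-cong (elements F) (λ x → ∑-pick H (h x) (λ _ → f x)) ⟨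
      ∑ (elements F) (λ x → ∑ (elements H) (λ y → when (y H.≟ h x) (f x)))
        ≡⟨ ∑-swap (elements F) (elements H) _ ⟩
      ∑ (elements H) (λ y → ∑ (elements F) (λ x → when (y H.≟ h x) (f x)))
        ≡⟨ ∑-cong (elements H) (λ y → ∑-cong (elements F) (λ x →
             when-cong {p = y H.≟ h x} {x F.≟ g y} (λ e → trans (sym (gh x)) (cong g (sym e))) (λ e → trans (sym (hg y)) (cong h (sym e))))) ⟩
      ∑ (elements H) (λ y → ∑ (elements F) (λ x → when (x F.≟ g y) (f x)))
        ≡⟨ ∑-cong (elements H) (λ y → ∑-pick F (g y) f) ⟩
      ∑ (elements H) (f ∘ g) ∎
      where
      module F = Finite F
      module H = Finite H

-- Integer-valued sums, indicators and counting arguments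

module IntegerSums where

  open import Data.Integer.Base
  open import Data.Integer.Properties hiding (_≟_)
  open import Data.Nat.Base as ℕ using (ℕ)
  import Data.Nat.Properties as ℕ
  open import Data.List.Base using (List; []; _∷_; length)
  open import Data.List.Membership.Propositional using (_∈_)
  open import Data.List.Relation.Unary.Any using (here; there)
  open import Data.Product using (_,_; ∃)
  open import Relation.Nullary using (Dec; yes; no; ¬_; contradiction)
  open import Relation.Nullary.Decidable using (_×-dec_)
  open import Relation.Binary.PropositionalEquality
  open import Data.Integer.Tactic.RingSolver using (solve-∀)
  open FiniteSums

  open MonoidSum +-0-isCommutativeMonoid public

  ι : {P : Set} → Dec P → ℤ
  ι (yes _) = 1ℤ
  ι (no _)  = 0ℤ

  module _ {P : Set} where

    ι-yes : (p : Dec P) → P → ι p ≡ 1ℤ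
    ι-yes (yes _) x = refl
    ι-yes (no ¬x) x = contradiction x ¬x

    ι-no : (p : Dec P) → ¬ P → ι p ≡ 0ℤ
    ι-no (yes x) ¬x = contradiction x ¬x
    ι-no (no _)  ¬x = refl

    ι≥0 : (p : Dec P) → 0ℤ ≤ ι p
    ι≥0 (yes _) = +≤+ ℕ.z≤n
    ι≥0 (no _)  = +≤+ ℕ.z≤n

    ι≤1 : (p : Dec P) → ι p ≤ 1ℤ
    ι≤1 (yes _) = ≤-refl
    ι≤1 (no _)  = +≤+ ℕ.z≤n

    when-ι : (p : Dec P) (c : ℤ) → when p c ≡ ι p * c
    when-ι (yes _) c = sym (*-identityˡ c)
    when-ι (no _)  c = refl

    -- Lets an equation that holds only under `P` be used inside a sum weighted by the indicator of
    -- `P`.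
    ι-guard : (p : Dec P) {a b : ℤ} → (P → a ≡ b) → ι p * a ≡ ι p * b
    ι-guard (yes x) e = cong (1ℤ *_) (e x)
    ι-guard (no _)  e = refl

  module _ {P Q : Set} where

    ι-cong : (p : Dec P) (q : Dec Q) → (P → Q) → (Q → P) → ι p ≡ ι q
    ι-cong (yes x) q f g = sym (ι-yes q (f x))
    ι-cong (no ¬x) q f g = sym (ι-no q (λ y → ¬x (g y)))

    ι-× : (p : Dec P) (q : Dec Q) → ι (p ×-dec q) ≡ ι p * ι q
    ι-× (yes _) (yes _) = refl
    ι-× (yes _) (no _)  = refl
    ι-× (no _)  q       = refl

    ι-mono : (p : Dec P) (q : Dec Q) → (P → Q) → ι p ≤ ι q
    ι-mono (yes x) q f = ≤-reflexive (sym (ι-yes q (f x)))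
    ι-mono (no _)  q f = ι≥0 q

  private variable
    A : Set

  *-∑ : ∀ c (xs : List A) f → c * ∑ xs f ≡ ∑ xs (λ x → c * f x)
  *-∑ c []       f = *-zeroʳ c
  *-∑ c (x ∷ xs) f = trans (*-distribˡ-+ c (f x) (∑ xs f)) (cong (λ t → c * f x + t) (*-∑ c xs f))

  ∑-* : ∀ (xs : List A) f c → ∑ xs f * c ≡ ∑ xs (λ x → f x * c)
  ∑-* []       f c = refl
  ∑-* (x ∷ xs) f c = trans (*-distribʳ-+ c (f x) (∑ xs f)) (cong (λ t → f x * c + t) (∑-* xs f c))

  ∑-minus : ∀ (xs : List A) f g → ∑ xs (λ x → f x - g x) ≡ ∑ xs f - ∑ xs g
  ∑-minus []       f g = refl
  ∑-minus (x ∷ xs) f g = trans (cong (λ t → f x - g x + t) (∑-minus xs f g)) (lemma (f x) (g x) (∑ xs f) (∑ xs g))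
    where
    lemma : ∀ a b c d → (a - b) + (c - d) ≡ (a + c) - (b + d)
    lemma = solve-∀

  ∑-const : ∀ (xs : List A) c → ∑ xs (λ _ → c) ≡ + length xs * c
  ∑-const []       c = refl
  ∑-const (x ∷ xs) c = trans (cong (λ t → c + t) (∑-const xs c)) (sym (suc-* (+ length xs) c))

  ∑-1 : (xs : List A) → ∑ xs (λ _ → 1ℤ) ≡ + length xs
  ∑-1 xs = trans (∑-const xs 1ℤ) (*-identityʳ _)

  ∑-mono : ∀ (xs : List A) {f g} → (∀ x → f x ≤ g x) → ∑ xs f ≤ ∑ xs g
  ∑-mono []       h = ≤-refl
  ∑-mono (x ∷ xs) h = +-mono-≤ (h x) (∑-mono xs h)

  ∑-nonneg : ∀ (xs : List A) {f} → (∀ x → 0ℤ ≤ f x) → 0ℤ ≤ ∑ xs f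
  ∑-nonneg xs h = ≤-trans (≤-reflexive (sym (∑-ε xs))) (∑-mono xs h)

  term≤∑ : ∀ {xs : List A} {f} → (∀ x → 0ℤ ≤ f x) → ∀ {a} → a ∈ xs → f a ≤ ∑ xs f
  term≤∑ {xs = x ∷ xs} {f} h (here refl) = ≤-trans (≤-reflexive (sym (+-identityʳ _))) (+-monoʳ-≤ (f x) (∑-nonneg xs h))
  term≤∑ {xs = x ∷ xs} {f} h (there a∈)  = ≤-trans (term≤∑ h a∈) (≤-trans (≤-reflexive (sym (+-identityˡ _))) (+-monoˡ-≤ _ (h x)))

  -- The differences `g x - f x` are nonnegative with total zero, so each of them vanishes. This
  -- turns upper bounds, such as bounds on numbers of roots, into exact counts.
  ∑-squeeze : ∀ {xs : List A} {f g} → (∀ x → f x ≤ g x) → ∑ xs f ≡ ∑ xs g → ∀ {a} → a ∈ xs → f a ≡ g a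
  ∑-squeeze {xs = xs} {f} {g} f≤g e {a} a∈ = ≤-antisym (f≤g a) (i-j≤0⇒i≤j (begin
    g a - f a                     ≤⟨ term≤∑ {f = λ x → g x - f x} (λ x → i≤j⇒0≤j-i (f≤g x)) a∈ ⟩
    ∑ xs (λ x → g x - f x)        ≡⟨ ∑-minus xs g f ⟩
    ∑ xs g - ∑ xs f               ≡⟨ cong (_- ∑ xs f) (sym e) ⟩
    ∑ xs f - ∑ xs f               ≡⟨ +-inverseʳ (∑ xs f) ⟩
    0ℤ                            ∎))
    where
    open ≤-Reasoning

  module _ (F : Finite A) where
    open Finite F

    ∑-ι : ∀ a (f : A → ℤ) → ∑ elements (λ x → ι (x ≟ a) * f x) ≡ f a
    ∑-ι a f = trans (∑-cong elements (λ x → sym (when-ι (x ≟ a) (f x)))) (∑-pick F a f)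

    ∑-ι1 : ∀ a → ∑ elements (λ x → ι (x ≟ a)) ≡ 1ℤ
    ∑-ι1 a = trans (∑-cong elements (λ x → sym (*-identityʳ _))) (∑-ι a (λ _ → 1ℤ))

    ∑-at-most-one : {P : A → Set} (P? : ∀ x → Dec (P x)) → (∀ {x y} → P x → P y → x ≡ y) →
                    ∑ elements (λ x → ι (P? x)) ≤ 1ℤ
    ∑-at-most-one P? inj with any? P?
    ... | yes (a , pa) = ≤-reflexive (trans (∑-cong elements (λ x → ι-cong (P? x) (x ≟ a) (λ px → inj px pa) (λ { refl → pa }))) (∑-ι1 a))
    ... | no ¬p        = ≤-trans (≤-reflexive (trans (∑-cong elements (λ x → ι-no (P? x) (λ px → ¬p (x , px)))) (∑-ε elements))) (+≤+ ℕ.z≤n)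

    -- Every fibre has at most one element, and together the fibres have as many elements as `A`;
    -- hence no fibre is empty.
    injective⇒surjective : (g : A → A) → (∀ {x y} → g x ≡ g y → x ≡ y) → ∀ y → ∃ λ x → g x ≡ y
    injective⇒surjective g inj y with any? (λ x → g x ≟ y)
    ... | yes r = r
    ... | no ¬r = contradiction (trans (sym hit) miss) λ ()
      where
      hits : A → ℤ
      hits z = ∑ elements (λ x → ι (g x ≟ z))
      total : ∑ elements hits ≡ ∑ elements (λ _ → 1ℤ)
      total = trans (∑-swap elements elements (λ z x → ι (g x ≟ z)))
        (∑-cong elements (λ x → trans (∑-cong elements (λ z → ι-cong (g x ≟ z) (z ≟ g x) sym sym)) (∑-ι1 (g x))))
      hit : hits y ≡ 1ℤ
      hit = ∑-squeeze (λ z → ∑-at-most-one (λ x → g x ≟ z) (λ e e′ → inj (trans e (sym e′)))) total (complete y)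
      miss : hits y ≡ 0ℤ
      miss = trans (∑-cong elements (λ x → ι-no (g x ≟ y) (λ e → ¬r (x , e)))) (∑-ε elements)

-- Finite fields

module FiniteField where

  open import Data.Nat.Base using (ℕ)
  open import Algebra.Bundles using (CommutativeRing)
  open import Algebra.Structures using (IsCommutativeRing)
  open import Relation.Binary.PropositionalEquality
  open import Relation.Nullary using (yes; no)
  open FiniteSums using (Finite)
  open import Data.Sum using (_⊎_; inj₁; inj₂)
  import Data.Nat.Base as ℕ
  open import Data.Integer.Base using (0ℤ)
  import Algebra.Properties.Semiring.Mult

  -- The inverse is a total function, constrained only away from zero. `card-≡` and `characteristic`
  -- are what makes the Frobenius map `x ↦ x ^ card` of a subfield additive.
  record Field (p : ℕ) : Set₁ where
    infixl 6 _+_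
    infixl 7 _*_
    infix  8 -_ _⁻¹
    field
      Carrier           : Set
      _+_ _*_           : Carrier → Carrier → Carrier
      -_ _⁻¹            : Carrier → Carrier
      0# 1#             : Carrier
      isCommutativeRing : IsCommutativeRing _≡_ _+_ _*_ -_ 0# 1#
      1≢0               : 1# ≢ 0#
      *-inverseʳ        : ∀ {x} → x ≢ 0# → x * x ⁻¹ ≡ 1#
      finite            : Finite Carrier
      exponent          : ℕ
      card-≡            : Finite.card finite ≡ p ℕ.^ exponent

    commutativeRing : CommutativeRing _ _
    commutativeRing = record { isCommutativeRing = isCommutativeRing }

    open Finite finite public using (elements; _≟_; complete; unique; card)
    open Algebra.Properties.Semiring.Mult (CommutativeRing.semiring commutativeRing) public using () renaming (_×_ to _×#_)
    field
      characteristic    : p ×# 1# ≡ 0#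

    open IsCommutativeRing isCommutativeRing public
      using ( +-assoc; +-comm; +-identityˡ; +-identityʳ; *-assoc; *-comm; *-identityˡ; *-identityʳ
            ; distribˡ; distribʳ; zeroˡ; zeroʳ; -‿inverseˡ; -‿inverseʳ; _-_; +-isCommutativeMonoid; *-isCommutativeMonoid)

    module Solver = IntegerSolver commutativeRing

    *-inverseˡ : ∀ {x} → x ≢ 0# → x ⁻¹ * x ≡ 1#
    *-inverseˡ x≢0 = trans (*-comm _ _) (*-inverseʳ x≢0)

    cancelˡ : ∀ {x} → x ≢ 0# → ∀ y → x ⁻¹ * (x * y) ≡ y
    cancelˡ x≢0 y = trans (sym (*-assoc _ _ y)) (trans (cong (_* y) (*-inverseˡ x≢0)) (*-identityˡ y))

    cancelʳ : ∀ {x} → x ≢ 0# → ∀ y → x * (x ⁻¹ * y) ≡ y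
    cancelʳ x≢0 y = trans (sym (*-assoc _ _ y)) (trans (cong (_* y) (*-inverseʳ x≢0)) (*-identityˡ y))

    *-injectiveˡ : ∀ {x} → x ≢ 0# → ∀ {y z} → x * y ≡ x * z → y ≡ z
    *-injectiveˡ {x} x≢0 {y} {z} e = trans (sym (cancelˡ x≢0 y)) (trans (cong (x ⁻¹ *_) e) (cancelˡ x≢0 z))

    zero-product : ∀ {x y} → x * y ≡ 0# → x ≡ 0# ⊎ y ≡ 0#
    zero-product {x} {y} e with x ≟ 0#
    ... | yes x≡0 = inj₁ x≡0
    ... | no  x≢0 = inj₂ (*-injectiveˡ x≢0 (trans e (sym (zeroʳ x))))

    *-≢0 : ∀ {x y} → x ≢ 0# → y ≢ 0# → x * y ≢ 0#
    *-≢0 x≢0 y≢0 e with zero-product e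
    ... | inj₁ x≡0 = x≢0 x≡0
    ... | inj₂ y≡0 = y≢0 y≡0

    ⁻¹-≢0 : ∀ {x} → x ≢ 0# → x ⁻¹ ≢ 0#
    ⁻¹-≢0 {x} x≢0 e = 1≢0 (trans (sym (*-inverseʳ x≢0)) (trans (cong (x *_) e) (zeroʳ x)))

    x-y≡0⇒x≡y : ∀ {x y} → x - y ≡ 0# → x ≡ y
    x-y≡0⇒x≡y {x} {y} e = trans (S.solve 2 (λ x y → x S.:= (x S.:- y) S.:+ y) refl x y) (trans (cong (_+ y) e) (+-identityˡ y))
      where module S = Solver

    x-x≡0 : ∀ x → x - x ≡ 0#
    x-x≡0 = -‿inverseʳ

    neg-0 : - 0# ≡ 0#
    neg-0 = S.solve 0 (S.:- S.con 0ℤ S.:= S.con 0ℤ) refl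
      where module S = Solver

    x-neg-neg : ∀ x → - (- x) ≡ x
    x-neg-neg = S.solve 1 (λ x → S.:- (S.:- x) S.:= x) refl
      where module S = Solver

    x+[y-x]≡y : ∀ x y → x + (y - x) ≡ y
    x+[y-x]≡y = S.solve 2 (λ x y → x S.:+ (y S.:- x) S.:= y) refl
      where module S = Solver

    [x+y]-x≡y : ∀ x y → (x + y) - x ≡ y
    [x+y]-x≡y = S.solve 2 (λ x y → (x S.:+ y) S.:- x S.:= y) refl
      where module S = Solver

open import Relation.Binary.PropositionalEquality
open import Data.Sum using (_⊎_)
open import Algebra.Structures using (IsCommutativeRing)
open FiniteSums using (Finite)

-- Finite integral domains are fields

module FiniteDomain {A : Set} {_+_ _*_ : A → A → A} { -_ : A → A} {0# 1# : A}
  (isCommutativeRing : IsCommutativeRing _≡_ _+_ _*_ -_ 0# 1#) (finite : Finite A)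
  (zero-product : ∀ {x y} → (x * y) ≡ 0# → x ≡ 0# ⊎ y ≡ 0#) where

  open import Data.Product using (proj₁; proj₂)
  import Data.Sum
  open import Relation.Nullary using (Dec; yes; no; contradiction)
  open IntegerSums using (injective⇒surjective)
  import Algebra.Properties.Ring
  import Algebra.Properties.Group

  private
    R : CommutativeRing _ _
    R = record { isCommutativeRing = isCommutativeRing }
    open Algebra.Properties.Ring (CommutativeRing.ring R) using (x[y-z]≈xy-xz)
    open Algebra.Properties.Group (CommutativeRing.+-group R) using (x∙y⁻¹≈ε⇒x≈y; x≈y⇒x∙y⁻¹≈ε)
    open Finite finite using (_≟_)

  *-injective : ∀ {x} → x ≢ 0# → ∀ {y z} → x * y ≡ x * z → y ≡ z
  *-injective {x} x≢0 {y} {z} e = Data.Sum.[ (λ x≡0 → contradiction x≡0 x≢0) , x∙y⁻¹≈ε⇒x≈y y z ]′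
    (zero-product (trans (x[y-z]≈xy-xz x y z) (x≈y⇒x∙y⁻¹≈ε e)))

  private
    -- Multiplication by a nonzero `x` is injective, hence surjective by finiteness, and the inverse
    -- is a preimage of 1. The value at zero is a default.
    inverse : ∀ x → Dec (x ≡ 0#) → A
    inverse x (yes _)  = 0#
    inverse x (no x≢0) = proj₁ (injective⇒surjective finite (x *_) (*-injective x≢0) 1#)

    inverse-correct : ∀ {x} (d : Dec (x ≡ 0#)) → x ≢ 0# → x * inverse x d ≡ 1#
    inverse-correct     (yes x≡0) x≢0 = contradiction x≡0 x≢0
    inverse-correct {x} (no x≢0)  _   = proj₂ (injective⇒surjective finite (x *_) (*-injective x≢0) 1#)

  infix 8 _⁻¹

  _⁻¹ : A → A
  x ⁻¹ = inverse x (x ≟ 0#)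

  *-inverseʳ : ∀ {x} → x ≢ 0# → x * (x ⁻¹) ≡ 1#
  *-inverseʳ {x} = inverse-correct (x ≟ 0#)

open import Data.Nat.Base using (ℕ; NonZero)
open import Data.Nat.Primality using (Prime)

-- The prime field on `Fin p`

module PrimeField (p : ℕ) .{{_ : NonZero p}} (p-prime : Prime p) where

  open import Data.Nat.Base as ℕ using (zero; suc; _<_)
  open import Algebra.Structures using (IsCommutativeRing)
  open import Algebra.Bundles using (CommutativeRing)
  import Data.Nat.Properties as ℕ
  open import Data.Nat.DivMod
  open import Data.Nat.Divisibility using (_∣_; m%n≡0⇒n∣m; n∣m⇒m%n≡0)
  open import Data.Nat.Primality using (euclidsLemma; prime⇒nonTrivial)
  open import Data.Fin.Base using (Fin; toℕ)
  open import Data.Fin.Properties using (toℕ-injective; toℕ<n; toℕ-fromℕ<) renaming (_≟_ to _≟F_)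
  open import Data.List.Base using (allFin)
  open import Data.List.Properties using (length-tabulate)
  open import Data.List.Membership.Propositional.Properties using (∈-allFin)
  open import Data.List.Relation.Unary.Unique.Propositional.Properties using (allFin⁺)
  open import Data.Product using (_,_)
  open import Data.Sum using (_⊎_; inj₁; inj₂)
  open import Relation.Nullary using (contradiction)
  open import Relation.Binary.PropositionalEquality
  open FiniteSums using (Finite)
  open FiniteField using (Field)
  import Algebra.Properties.Semiring.Mult
  open import Defs
  open Zmod p

  open ≡-Reasoning

  _*ₚ_ : Fin p → Fin p → Fin p
  a *ₚ b = (toℕ a ℕ.* toℕ b) mod p

  toℕ-mod : ∀ m → toℕ (m mod p) ≡ m % p
  toℕ-mod m = toℕ-fromℕ< (m%n<n m p)

  mod-cong : ∀ {m n} → m % p ≡ n % p → m mod p ≡ n mod p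
  mod-cong {m} {n} e = toℕ-injective (trans (toℕ-mod m) (trans e (sym (toℕ-mod n))))

  mod-toℕ : ∀ a → toℕ a mod p ≡ a
  mod-toℕ a = toℕ-injective (trans (toℕ-mod (toℕ a)) (m<n⇒m%n≡m (toℕ<n a)))

  -- With `mod-*`, this makes `_mod p` a homomorphism from ℕ onto `Fin p`, through which the
  -- semiring laws of ℕ descend.
  mod-+ : ∀ m n → (m mod p) +ₚ (n mod p) ≡ (m ℕ.+ n) mod p
  mod-+ m n = mod-cong (trans (cong (_% p) (cong₂ ℕ._+_ (toℕ-mod m) (toℕ-mod n))) (sym (%-distribˡ-+ m n p)))

  mod-* : ∀ m n → (m mod p) *ₚ (n mod p) ≡ (m ℕ.* n) mod p
  mod-* m n = mod-cong (trans (cong (_% p) (cong₂ ℕ._*_ (toℕ-mod m) (toℕ-mod n))) (sym (%-distribˡ-* m n p)))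

  mod-+ˡ : ∀ m b → (m mod p) +ₚ b ≡ (m ℕ.+ toℕ b) mod p
  mod-+ˡ m b = trans (cong ((m mod p) +ₚ_) (sym (mod-toℕ b))) (mod-+ m (toℕ b))

  mod-+ʳ : ∀ a n → a +ₚ (n mod p) ≡ (toℕ a ℕ.+ n) mod p
  mod-+ʳ a n = trans (cong (_+ₚ (n mod p)) (sym (mod-toℕ a))) (mod-+ (toℕ a) n)

  mod-*ˡ : ∀ m b → (m mod p) *ₚ b ≡ (m ℕ.* toℕ b) mod p
  mod-*ˡ m b = trans (cong ((m mod p) *ₚ_) (sym (mod-toℕ b))) (mod-* m (toℕ b))

  mod-*ʳ : ∀ a n → a *ₚ (n mod p) ≡ (toℕ a ℕ.* n) mod p
  mod-*ʳ a n = trans (cong (_*ₚ (n mod p)) (sym (mod-toℕ a))) (mod-* (toℕ a) n)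

  1ₚ : Fin p
  1ₚ = 1 mod p

  p-mod : p mod p ≡ 0ₚ
  p-mod = mod-cong (trans (n%n≡0 p) (sym (m<n⇒m%n≡m (ℕ.>-nonZero⁻¹ p))))

  +ₚ-comm : ∀ a b → a +ₚ b ≡ b +ₚ a
  +ₚ-comm a b = cong (_mod p) (ℕ.+-comm (toℕ a) (toℕ b))

  *ₚ-comm : ∀ a b → a *ₚ b ≡ b *ₚ a
  *ₚ-comm a b = cong (_mod p) (ℕ.*-comm (toℕ a) (toℕ b))

  +ₚ-identityˡ : ∀ a → 0ₚ +ₚ a ≡ a
  +ₚ-identityˡ a = trans (mod-+ˡ 0 a) (mod-toℕ a)

  *ₚ-identityˡ : ∀ a → 1ₚ *ₚ a ≡ a
  *ₚ-identityˡ a = trans (mod-*ˡ 1 a) (trans (cong (_mod p) (ℕ.+-identityʳ (toℕ a))) (mod-toℕ a))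

  +ₚ-assoc : ∀ a b c → (a +ₚ b) +ₚ c ≡ a +ₚ (b +ₚ c)
  +ₚ-assoc a b c = trans (mod-+ˡ _ c) (trans (cong (_mod p) (ℕ.+-assoc (toℕ a) (toℕ b) (toℕ c))) (sym (mod-+ʳ a _)))

  *ₚ-assoc : ∀ a b c → (a *ₚ b) *ₚ c ≡ a *ₚ (b *ₚ c)
  *ₚ-assoc a b c = trans (mod-*ˡ _ c) (trans (cong (_mod p) (ℕ.*-assoc (toℕ a) (toℕ b) (toℕ c))) (sym (mod-*ʳ a _)))

  *ₚ-distribˡ : ∀ a b c → a *ₚ (b +ₚ c) ≡ (a *ₚ b) +ₚ (a *ₚ c)
  *ₚ-distribˡ a b c = trans (mod-*ʳ a _) (trans (cong (_mod p) (ℕ.*-distribˡ-+ (toℕ a) (toℕ b) (toℕ c))) (sym (mod-+ _ _)))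

  -ₚ-inverseʳ : ∀ a → a +ₚ (-ₚ a) ≡ 0ₚ
  -ₚ-inverseʳ a = trans (mod-+ʳ a _) (trans (cong (_mod p) (ℕ.m+[n∸m]≡n (ℕ.<⇒≤ (toℕ<n a)))) p-mod)

  isCommutativeRingₚ : IsCommutativeRing _≡_ _+ₚ_ _*ₚ_ -ₚ_ 0ₚ 1ₚ
  isCommutativeRingₚ = record
    { isRing = record
      { +-isAbelianGroup = record
        { isGroup = record
          { isMonoid = record
            { isSemigroup = record
              { isMagma = record { isEquivalence = isEquivalence ; ∙-cong = cong₂ _+ₚ_ }
              ; assoc = +ₚ-assoc }
            ; identity = +ₚ-identityˡ , (λ a → trans (+ₚ-comm a 0ₚ) (+ₚ-identityˡ a)) }
          ; inverse = (λ a → trans (+ₚ-comm (-ₚ a) a) (-ₚ-inverseʳ a)) , -ₚ-inverseʳ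
          ; ⁻¹-cong = cong (-ₚ_) }
        ; comm = +ₚ-comm }
      ; *-cong = cong₂ _*ₚ_
      ; *-assoc = *ₚ-assoc
      ; *-identity = *ₚ-identityˡ , (λ a → trans (*ₚ-comm a 1ₚ) (*ₚ-identityˡ a))
      ; distrib = *ₚ-distribˡ , (λ a b c → trans (*ₚ-comm (b +ₚ c) a) (trans (*ₚ-distribˡ a b c) (cong₂ _+ₚ_ (*ₚ-comm a b) (*ₚ-comm a c)))) }
    ; *-comm = *ₚ-comm }

  finiteₚ : Finite (Fin p)
  finiteₚ = record { elements = allFin p ; _≟_ = _≟F_ ; complete = ∈-allFin ; unique = allFin⁺ p }

  toℕ-0 : toℕ 0ₚ ≡ 0
  toℕ-0 = trans (toℕ-mod 0) (m<n⇒m%n≡m (ℕ.>-nonZero⁻¹ p))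

  p∣⇒0 : ∀ a → p ∣ toℕ a → a ≡ 0ₚ
  p∣⇒0 a p∣a = toℕ-injective (trans (trans (sym (m<n⇒m%n≡m (toℕ<n a))) (n∣m⇒m%n≡0 (toℕ a) p p∣a)) (sym toℕ-0))

  zero-productₚ : ∀ {a b} → a *ₚ b ≡ 0ₚ → a ≡ 0ₚ ⊎ b ≡ 0ₚ
  zero-productₚ {a} {b} e with euclidsLemma (toℕ a) (toℕ b) p-prime
    (m%n≡0⇒n∣m (toℕ a ℕ.* toℕ b) p (trans (sym (toℕ-mod _)) (trans (cong toℕ e) toℕ-0)))
  ... | inj₁ p∣a = inj₁ (p∣⇒0 a p∣a)
  ... | inj₂ p∣b = inj₂ (p∣⇒0 b p∣b)

  1<p : 1 < p
  1<p = ℕ.nonTrivial⇒n>1 p {{prime⇒nonTrivial p-prime}}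

  1≢0ₚ : 1ₚ ≢ 0ₚ
  1≢0ₚ e = contradiction (trans (sym (trans (toℕ-mod 1) (m<n⇒m%n≡m 1<p))) (trans (cong toℕ e) toℕ-0)) λ ()

  private
    Rₚ : CommutativeRing _ _
    Rₚ = record { isCommutativeRing = isCommutativeRingₚ }
    open Algebra.Properties.Semiring.Mult (CommutativeRing.semiring Rₚ) using () renaming (_×_ to _×ₚ_)

    multiples : ∀ m → m ×ₚ 1ₚ ≡ m mod p
    multiples zero    = refl
    multiples (suc m) = trans (cong (1ₚ +ₚ_) (multiples m)) (mod-+ 1 m)

  primeField : Field p
  primeField = record
    { Carrier           = Fin p
    ; isCommutativeRing = isCommutativeRingₚ
    ; 1≢0               = 1≢0ₚ
    ; *-inverseʳ        = FiniteDomain.*-inverseʳ isCommutativeRingₚ finiteₚ zero-productₚ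
    ; finite            = finiteₚ
    ; exponent          = 1
    ; card-≡            = trans (length-tabulate (λ i → i)) (sym (ℕ.*-identityʳ p))
    ; characteristic    = trans (multiples p) p-mod
    }

open import Data.Nat.Base using (ℕ)
open FiniteField using (Field)

-- Polynomials, monic polynomials and division with remainder

module Polynomials {p : ℕ} (K : Field p) where

  open import Algebra.Bundles using (CommutativeRing)
  open import Algebra.Structures using (IsCommutativeRing)
  open import Data.Nat.Base as ℕ using (ℕ; zero; suc; _≤_; z≤n; s≤s; _⊔_) renaming (_+_ to _+ℕ_)
  import Data.Nat.Properties as ℕ
  open import Data.Product using (_×_; _,_; ∃; proj₁)
  open import Data.Sum using (inj₁; inj₂)
  open import Relation.Nullary using (contradiction)
  open import Relation.Binary using (tri<; tri≈; tri>)
  open import Relation.Binary.PropositionalEquality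
  open import Function.Base using (_∘_)

  open Field K
  open Solver using (solve; _:=_; _:+_; _:*_; _:-_; :-_; con)
  open ≡-Reasoning

  Series : Set
  Series = ℕ → Carrier

  shift : Series → Series
  shift f i = f (suc i)

  -- The Cauchy product, by recursion on the index: f * g = f₀ g + X (shift f * g).
  _⊛_ : Series → Series → Series
  (f ⊛ g) zero    = f 0 * g 0
  (f ⊛ g) (suc n) = f 0 * g (suc n) + (shift f ⊛ g) n

  ⊛-cong : ∀ {f f′ g g′ : Series} → f ≗ f′ → g ≗ g′ → f ⊛ g ≗ f′ ⊛ g′
  ⊛-cong e e′ zero    = cong₂ _*_ (e 0) (e′ 0)
  ⊛-cong e e′ (suc n) = cong₂ _+_ (cong₂ _*_ (e 0) (e′ (suc n))) (⊛-cong (e ∘ suc) e′ n)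

  ⊛-sucʳ : ∀ f g n → (f ⊛ g) (suc n) ≡ f (suc n) * g 0 + (f ⊛ shift g) n
  ⊛-sucʳ f g zero    = +-comm _ _
  ⊛-sucʳ f g (suc n) = begin
    f 0 * g (suc (suc n)) + (shift f ⊛ g) (suc n)
      ≡⟨ cong (_ +_) (⊛-sucʳ (shift f) g n) ⟩
    f 0 * g (suc (suc n)) + (f (suc (suc n)) * g 0 + (shift f ⊛ shift g) n)
      ≡⟨ solve 3 (λ a b c → a :+ (b :+ c) := b :+ (a :+ c)) refl _ _ _ ⟩
    f (suc (suc n)) * g 0 + (f 0 * g (suc (suc n)) + (shift f ⊛ shift g) n) ∎

  ⊛-comm : ∀ f g → f ⊛ g ≗ g ⊛ f
  ⊛-comm f g zero    = *-comm _ _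
  ⊛-comm f g (suc n) = begin
    f 0 * g (suc n) + (shift f ⊛ g) n   ≡⟨ cong₂ _+_ (*-comm _ _) (⊛-comm (shift f) g n) ⟩
    g (suc n) * f 0 + (g ⊛ shift f) n   ≡⟨ ⊛-sucʳ g f n ⟨
    (g ⊛ f) (suc n)                     ∎

  ⊛-distribˡ : ∀ f g h → f ⊛ (λ i → g i + h i) ≗ (λ i → (f ⊛ g) i + (f ⊛ h) i)
  ⊛-distribˡ f g h zero    = distribˡ _ _ _
  ⊛-distribˡ f g h (suc n) = trans (cong (_ +_) (⊛-distribˡ (shift f) g h n))
    (solve 5 (λ a b c d e → a :* (b :+ c) :+ (d :+ e) := a :* b :+ d :+ (a :* c :+ e)) refl _ _ _ _ _)

  ⊛-distribʳ : ∀ f g h → (λ i → g i + h i) ⊛ f ≗ (λ i → (g ⊛ f) i + (h ⊛ f) i)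
  ⊛-distribʳ f g h n = trans (⊛-comm _ f n) (trans (⊛-distribˡ f g h n) (cong₂ _+_ (⊛-comm f g n) (⊛-comm f h n)))

  ⊛-scale : ∀ a f g → (λ i → a * f i) ⊛ g ≗ (λ i → a * (f ⊛ g) i)
  ⊛-scale a f g zero    = *-assoc _ _ _
  ⊛-scale a f g (suc n) = trans (cong (_ +_) (⊛-scale a (shift f) g n))
    (solve 4 (λ a b c d → a :* b :* c :+ a :* d := a :* (b :* c :+ d)) refl _ _ _ _)

  ⊛-assoc : ∀ f g h → (f ⊛ g) ⊛ h ≗ f ⊛ (g ⊛ h)
  ⊛-assoc f g h zero    = *-assoc _ _ _
  ⊛-assoc f g h (suc n) = begin
    f 0 * g 0 * h (suc n) + ((λ i → f 0 * g (suc i) + (shift f ⊛ g) i) ⊛ h) n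
      ≡⟨ cong (_ +_) (⊛-distribʳ h (λ i → f 0 * g (suc i)) (shift f ⊛ g) n) ⟩
    f 0 * g 0 * h (suc n) + (((λ i → f 0 * g (suc i)) ⊛ h) n + ((shift f ⊛ g) ⊛ h) n)
      ≡⟨ cong (_ +_) (cong₂ _+_ (⊛-scale (f 0) (shift g) h n) (⊛-assoc (shift f) g h n)) ⟩
    f 0 * g 0 * h (suc n) + (f 0 * (shift g ⊛ h) n + (shift f ⊛ (g ⊛ h)) n)
      ≡⟨ solve 5 (λ a b c d e → a :* b :* c :+ (a :* d :+ e) := a :* (b :* c :+ d) :+ e) refl _ _ _ _ _ ⟩
    f 0 * (g 0 * h (suc n) + (shift g ⊛ h) n) + (shift f ⊛ (g ⊛ h)) n ∎

  constant : Carrier → Series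
  constant a zero    = a
  constant a (suc i) = 0#

  ⊛-zeroˡ : ∀ (f g : Series) → (∀ i → f i ≡ 0#) → ∀ n → (f ⊛ g) n ≡ 0#
  ⊛-zeroˡ f g f≡0 zero    = trans (cong (_* g 0) (f≡0 0)) (zeroˡ _)
  ⊛-zeroˡ f g f≡0 (suc n) = trans (cong₂ _+_ (trans (cong (_* g (suc n)) (f≡0 0)) (zeroˡ _)) (⊛-zeroˡ (shift f) g (f≡0 ∘ suc) n)) (+-identityˡ _)

  ⊛-constant : ∀ a f → constant a ⊛ f ≗ (λ i → a * f i)
  ⊛-constant a f zero    = refl
  ⊛-constant a f (suc n) = trans (cong (_ +_) (⊛-zeroˡ (shift (constant a)) f (λ _ → refl) n)) (+-identityʳ _)

  Below : Series → ℕ → Set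
  Below f n = ∀ i → n ≤ i → f i ≡ 0#

  Below-mono : ∀ {f m n} → m ≤ n → Below f m → Below f n
  Below-mono m≤n h i n≤i = h i (ℕ.≤-trans m≤n n≤i)

  Below-+ : ∀ {f g n} → Below f n → Below g n → Below (λ i → f i + g i) n
  Below-+ h h′ i n≤i = trans (cong₂ _+_ (h i n≤i) (h′ i n≤i)) (+-identityˡ 0#)

  Below-⊛ : ∀ {f g} m {n} → Below f m → Below g n → Below (f ⊛ g) (m +ℕ n)
  Below-⊛ {f} {g} zero    hf hg i m≤i = ⊛-zeroˡ f g (λ j → hf j z≤n) i
  Below-⊛ {f} {g} (suc m) hf hg (suc i) (s≤s m≤i) = trans (cong₂ _+_
    (trans (cong (f 0 *_) (hg (suc i) (ℕ.m≤n⇒m≤1+n (ℕ.m+n≤o⇒n≤o m m≤i)))) (zeroʳ _))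
    (Below-⊛ {shift f} {g} m (λ j → hf (suc j) ∘ s≤s) hg i m≤i)) (+-identityˡ 0#)

  -- `bound` need not be the exact length, so sums and products require no normalisation. Equality
  -- is therefore `_≈_`, which looks at the coefficients alone.
  record Poly : Set where
    constructor poly
    field
      coeff   : Series
      bound   : ℕ
      bounded : Below coeff bound

  open Poly public

  infix  4 _≈_
  infixl 6 _⊕_
  infixl 7 _⊗_

  -- A record and not a mere family of equations, so that `f` and `g` can be inferred from the type
  -- of a proof.
  record _≈_ (f g : Poly) : Set where
    constructor coeffwise
    field
      at : coeff f ≗ coeff g

  open _≈_ public

  constantPoly : Carrier → Poly
  constantPoly a = poly (constant a) 1 (λ { (suc i) _ → refl })

  opaque
    -- Opaque, so that expressions in the polynomial ring are compared as written and not as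
    -- coefficient functions; `coeff-⊕`, `coeff-⊗` and `coeff-negate` give access to the
    -- coefficients.
    _⊕_ _⊗_ : Poly → Poly → Poly
    poly f m hf ⊕ poly g n hg = poly (λ i → f i + g i) (m ⊔ n)
      (Below-+ (Below-mono (ℕ.m≤m⊔n m n) hf) (Below-mono (ℕ.m≤n⊔m m n) hg))
    poly f m hf ⊗ poly g n hg = poly (f ⊛ g) (m +ℕ n) (Below-⊛ m hf hg)

    negate : Poly → Poly
    negate (poly f m hf) = poly (λ i → - f i) m (λ i m≤i → trans (cong -_ (hf i m≤i)) (solve 0 (:- con 0ℤ := con 0ℤ) refl))
      where open import Data.Integer.Base using (0ℤ)

    coeff-⊕ : ∀ f g i → coeff (f ⊕ g) i ≡ coeff f i + coeff g i
    coeff-⊕ f g i = refl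

    coeff-⊗ : ∀ f g i → coeff (f ⊗ g) i ≡ (coeff f ⊛ coeff g) i
    coeff-⊗ f g i = refl

    coeff-negate : ∀ f i → coeff (negate f) i ≡ - coeff f i
    coeff-negate f i = refl

    isCommutativeRing-poly : IsCommutativeRing _≈_ _⊕_ _⊗_ negate (constantPoly 0#) (constantPoly 1#)
    isCommutativeRing-poly = record
        { isRing = record
          { +-isAbelianGroup = record
            { isGroup = record
              { isMonoid = record
                { isSemigroup = record
                  { isMagma = record
                    { isEquivalence = record { refl = coeffwise λ _ → refl ; sym = λ e → coeffwise λ i → sym (at e i)
                                             ; trans = λ e e′ → coeffwise λ i → trans (at e i) (at e′ i) }
                    ; ∙-cong = λ e e′ → coeffwise λ i → cong₂ _+_ (at e i) (at e′ i) }
                  ; assoc = λ f g h → coeffwise λ i → +-assoc _ _ _ }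
                ; identity = (λ f → coeffwise λ { zero → +-identityˡ _ ; (suc i) → +-identityˡ _ })
                           , (λ f → coeffwise λ { zero → +-identityʳ _ ; (suc i) → +-identityʳ _ }) }
              ; inverse = (λ f → coeffwise λ { zero → -‿inverseˡ _ ; (suc i) → -‿inverseˡ _ })
                        , (λ f → coeffwise λ { zero → -‿inverseʳ _ ; (suc i) → -‿inverseʳ _ })
              ; ⁻¹-cong = λ e → coeffwise λ i → cong -_ (at e i) }
            ; comm = λ f g → coeffwise λ i → +-comm _ _ }
          ; *-cong = λ e e′ → coeffwise (⊛-cong (at e) (at e′))
          ; *-assoc = λ f g h → coeffwise (⊛-assoc (coeff f) (coeff g) (coeff h))
          ; *-identity = (λ f → coeffwise λ i → trans (⊛-constant 1# (coeff f) i) (*-identityˡ _))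
                       , (λ f → coeffwise λ i → trans (⊛-comm (coeff f) _ i) (trans (⊛-constant 1# (coeff f) i) (*-identityˡ _)))
          ; distrib = (λ f g h → coeffwise (⊛-distribˡ (coeff f) (coeff g) (coeff h)))
                    , (λ f g h → coeffwise (⊛-distribʳ (coeff f) (coeff g) (coeff h))) }
        ; *-comm = λ f g → coeffwise (⊛-comm (coeff f) (coeff g)) }

  polyRing : CommutativeRing _ _
  polyRing = record { isCommutativeRing = isCommutativeRing-poly }

  module Ring = CommutativeRing polyRing
  module PolySolver = IntegerSolver polyRing

  0ₚ 1ₚ : Poly
  0ₚ = constantPoly 0#
  1ₚ = constantPoly 1#

  zeros : ∀ i → constant 0# i ≡ 0#
  zeros zero    = refl
  zeros (suc i) = refl

  -- Multiplication by the indeterminate; `tail` below is its left inverse, which forgets the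
  -- constant coefficient.
  up : Poly → Poly
  up (poly f n hf) = poly (λ { zero → 0# ; (suc i) → f i }) (suc n) (λ { (suc i) (s≤s n≤i) → hf i n≤i })

  opaque
    unfolding _⊗_

    up-⊗ : ∀ f g → up f ⊗ g ≈ up (f ⊗ g)
    up-⊗ f g = coeffwise λ where
      zero    → zeroˡ _
      (suc n) → trans (cong (_+ (coeff f ⊛ coeff g) n) (zeroˡ _)) (+-identityˡ _)

  up-cong : ∀ {f g} → f ≈ g → up f ≈ up g
  up-cong e = coeffwise λ { zero → refl ; (suc i) → at e i }

  up-⊗ʳ : ∀ f g → g ⊗ up f ≈ up (g ⊗ f)
  up-⊗ʳ f g = Ring.trans (Ring.*-comm g (up f)) (Ring.trans (up-⊗ f g) (up-cong (Ring.*-comm f g)))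

  up-⊕ : ∀ f g → up (f ⊕ g) ≈ up f ⊕ up g
  up-⊕ f g = coeffwise λ where
    zero    → sym (trans (coeff-⊕ (up f) (up g) 0) (+-identityʳ _))
    (suc i) → trans (coeff-⊕ f g i) (sym (coeff-⊕ (up f) (up g) (suc i)))

  tail : Poly → Poly
  tail (poly f n hf) = poly (shift f) (ℕ.pred n) (λ i pn≤i → hf (suc i) (lemma n pn≤i))
    where
    lemma : ∀ n {i} → ℕ.pred n ≤ i → n ≤ suc i
    lemma zero    h = z≤n
    lemma (suc n) h = s≤s h

  record Monic (n : ℕ) (f : Poly) : Set where
    constructor monic
    field
      leading : coeff f n ≡ 1#
      above   : Below (coeff f) (suc n)

  open Monic public

  monic-cong : ∀ {n f g} → f ≈ g → Monic n f → Monic n g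
  monic-cong e (monic t b) = monic (trans (sym (at e _)) t) λ i h → trans (sym (at e i)) (b i h)

  monic-1 : Monic 0 1ₚ
  monic-1 = monic refl λ { (suc i) _ → refl }

  monic-0 : ∀ {f} → Monic 0 f → f ≈ 1ₚ
  monic-0 (monic t b) = coeffwise λ where
    zero    → t
    (suc i) → b (suc i) (s≤s z≤n)

  ⊛-top : ∀ {f g} m {n} → Below f (suc m) → Below g (suc n) → (f ⊛ g) (m +ℕ n) ≡ f m * g n
  ⊛-top {f} {g} zero    {zero}  hf hg = refl
  ⊛-top {f} {g} zero    {suc n} hf hg = trans (cong (_ +_) (⊛-zeroˡ (shift f) g (λ i → hf (suc i) (s≤s z≤n)) n)) (+-identityʳ _)
  ⊛-top {f} {g} (suc m) {n}     hf hg = trans (cong₂ _+_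
    (trans (cong (f 0 *_) (hg (suc (m +ℕ n)) (s≤s (ℕ.m≤n+m n m)))) (zeroʳ _))
    (⊛-top {shift f} {g} m (λ i h → hf (suc i) (s≤s h)) hg)) (+-identityˡ _)

  opaque
    unfolding _⊗_

    monic-⊗ : ∀ {m n f g} → Monic m f → Monic n g → Monic (m +ℕ n) (f ⊗ g)
    monic-⊗ {m} {n} {f} {g} (monic t b) (monic t′ b′) =
      monic (trans (⊛-top {coeff f} {coeff g} m b b′) (trans (cong₂ _*_ t t′) (*-identityˡ 1#))) below
      where
      below : Below (coeff f ⊛ coeff g) (suc (m +ℕ n))
      below = go m (coeff f) b
        where
        go : ∀ m f → Below f (suc m) → Below (f ⊛ coeff g) (suc (m +ℕ n))
        go zero f hf (suc i) (s≤s h) = trans (cong₂ _+_ (trans (cong (f 0 *_) (b′ (suc i) (s≤s h))) (zeroʳ _))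
          (⊛-zeroˡ (shift f) (coeff g) (λ j → hf (suc j) (s≤s z≤n)) i)) (+-identityˡ _)
        go (suc m) f hf (suc i) (s≤s h) = trans (cong₂ _+_ (trans (cong (f 0 *_) (b′ (suc i) (ℕ.≤-trans (s≤s (ℕ.m≤n+m n (suc m))) (s≤s h)))) (zeroʳ _))
          (go m (shift f) (λ j p → hf (suc j) (s≤s p)) i h)) (+-identityˡ _)

  monic-degree : ∀ {m n f} → Monic m f → Monic n f → m ≡ n
  monic-degree {m} {n} (monic t b) (monic t′ b′) with ℕ.<-cmp m n
  ... | tri< m<n _ _ = contradiction (trans (sym t′) (b n m<n)) 1≢0
  ... | tri≈ _ m≡n _ = m≡n
  ... | tri> _ _ n<m = contradiction (trans (sym t) (b′ m n<m)) 1≢0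

  -- For a monic `f` of degree `n` this is minus the sum of the roots. The value 0 in degree 0 makes
  -- it additive on products.
  subleading : ℕ → Poly → Carrier
  subleading zero    f = 0#
  subleading (suc n) f = coeff f n

  opaque
    unfolding _⊗_

    -- The constant coefficient of `f` contributes only if `f` has degree one. In higher degree it
    -- meets a vanishing coefficient of `g`, and `f` may be replaced by `tail f`.
    subleading-⊗ : ∀ {m n f g} → Monic m f → Monic n g → subleading (m +ℕ n) (f ⊗ g) ≡ subleading m f + subleading n g
    subleading-⊗ {zero} {n} {f} {g} mf mg = trans (sub-cong n) (sym (+-identityˡ _))
      where
      sub-cong : ∀ n → subleading n (f ⊗ g) ≡ subleading n g
      sub-cong zero    = refl
      sub-cong (suc n) = trans (⊛-cong (at (monic-0 mf)) (λ _ → refl) n) (at (Ring.*-identityˡ g) n)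
    subleading-⊗ {suc zero} {zero} {f} {g} mf mg = trans (cong (coeff f 0 *_) (leading mg)) (trans (*-identityʳ _) (sym (+-identityʳ _)))
    subleading-⊗ {suc zero} {suc n} {f} {g} mf mg = cong₂ _+_
      (trans (cong (coeff f 0 *_) (leading mg)) (*-identityʳ _))
      (trans (⊛-cong (at (monic-0 {tail f} (monic (leading mf) λ i h → above mf (suc i) (s≤s h)))) (λ _ → refl) n) (at (Ring.*-identityˡ g) n))
    subleading-⊗ {suc (suc m)} {n} {f} {g} mf mg = trans (cong₂ _+_
      (trans (cong (coeff f 0 *_) (above mg (suc (m +ℕ n)) (s≤s (ℕ.m≤n+m n m)))) (zeroʳ _))
      (subleading-⊗ {suc m} {n} {tail f} {g} (monic (leading mf) λ i h → above mf (suc i) (s≤s h)) mg)) (+-identityˡ _)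

  abstract
    -- Division in Horner's manner: the remainder of `tail f` is shifted up and the constant
    -- coefficient of `f` added, which gives `w`; then `c` times `g` is subtracted, where `c` is the
    -- coefficient of `w` in degree `j`.
    divide : ∀ {j g} → Monic j g → ∀ f → ∃ λ q → ∃ λ r → f ≈ g ⊗ q ⊕ r × Below (coeff r) j
    divide {j} {g} (monic t b) f = go (bound f) f (bounded f)
      where
      go : ∀ n f → Below (coeff f) n → ∃ λ q → ∃ λ r → f ≈ g ⊗ q ⊕ r × Below (coeff r) j
      go zero f h = 0ₚ , 0ₚ , Ring.trans (coeffwise λ i → trans (h i z≤n) (sym (zeros i)))
        (Ring.sym (Ring.trans (Ring.+-congʳ (Ring.zeroʳ g)) (Ring.+-identityˡ 0ₚ))) , λ i _ → zeros i
      go (suc n) f h with go n (tail f) (λ i p → h (suc i) (s≤s p))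
      ... | q , r , e , br = up q ⊕ constantPoly c , r′ , e′ , br′
        where
        w r′ : Poly
        w = constantPoly (coeff f 0) ⊕ up r
        c : Carrier
        c = coeff w j
        r′ = w ⊕ negate (g ⊗ constantPoly c)
        f≈ : f ≈ constantPoly (coeff f 0) ⊕ up (g ⊗ q ⊕ r)
        f≈ = coeffwise λ where
          zero    → sym (trans (coeff-⊕ (constantPoly (coeff f 0)) (up (g ⊗ q ⊕ r)) 0) (+-identityʳ _))
          (suc i) → trans (at e i) (sym (trans (coeff-⊕ (constantPoly (coeff f 0)) (up (g ⊗ q ⊕ r)) (suc i)) (+-identityˡ _)))
        rearrange : ∀ a g q r c → a ⊕ (g ⊗ q ⊕ r) ≈ g ⊗ (q ⊕ c) ⊕ ((a ⊕ r) ⊕ negate (g ⊗ c))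
        rearrange = PolySolver.solve 5 (λ a g q r c → a P.:+ (g P.:* q P.:+ r) P.:= g P.:* (q P.:+ c) P.:+ ((a P.:+ r) P.:+ P.:- (g P.:* c))) Ring.refl
          where module P = PolySolver
        e′ : f ≈ g ⊗ (up q ⊕ constantPoly c) ⊕ r′
        e′ = Ring.trans f≈ (Ring.trans (Ring.+-congˡ (Ring.trans (up-⊕ (g ⊗ q) r) (Ring.+-congʳ (Ring.sym (up-⊗ʳ q g)))))
          (rearrange (constantPoly (coeff f 0)) g (up q) (up r) (constantPoly c)))
        coeff-r′ : ∀ i → coeff r′ i ≡ coeff w i + - (c * coeff g i)
        coeff-r′ i = trans (coeff-⊕ w (negate (g ⊗ constantPoly c)) i) (cong (coeff w i +_) (trans (coeff-negate (g ⊗ constantPoly c) i)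
          (cong -_ (trans (coeff-⊗ g (constantPoly c) i) (trans (⊛-comm (coeff g) (constant c) i) (⊛-constant c (coeff g) i))))))
        bw : Below (coeff w) (suc j)
        bw (suc i) (s≤s p) = trans (coeff-⊕ (constantPoly (coeff f 0)) (up r) (suc i)) (trans (cong (0# +_) (br i p)) (+-identityˡ _))
        br′ : Below (coeff r′) j
        br′ i p with ℕ.m≤n⇒m<n∨m≡n p
        ... | inj₁ j<i  = trans (coeff-r′ i) (trans (cong₂ _+_ (bw i j<i) (cong -_ (trans (cong (c *_) (b i j<i)) (zeroʳ c)))) (-‿inverseʳ 0#))
        ... | inj₂ refl = trans (coeff-r′ j) (trans (cong (λ z → c + - z) (trans (cong (c *_) t) (*-identityʳ c))) (-‿inverseʳ c))

  -- As `g` is monic, the top coefficient of `r` reappears in `g ⊗ r` in a degree at least `j`,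
  -- where it must vanish; so the coefficients of `r` vanish from the top down.
  below-multiple : ∀ {j g} → Monic j g → ∀ {r} → Below (coeff (g ⊗ r)) j → r ≈ 0ₚ
  below-multiple {j} {g} (monic t b) {r} h = coeffwise λ i → trans (go (bound r) (bounded r) i z≤n) (sym (zeros i))
    where
    go : ∀ n → Below (coeff r) n → Below (coeff r) 0
    go zero    hr = hr
    go (suc n) hr = go n λ i p → Data.Sum.[ hr i , (λ { refl → top }) ] (ℕ.m≤n⇒m<n∨m≡n p)
      where
      top : coeff r n ≡ 0#
      top = begin
        coeff r n                        ≡⟨ *-identityˡ _ ⟨
        1# * coeff r n                   ≡⟨ cong (_* coeff r n) t ⟨
        coeff g j * coeff r n            ≡⟨ ⊛-top {coeff g} {coeff r} j b hr ⟨
        (coeff g ⊛ coeff r) (j +ℕ n)     ≡⟨ coeff-⊗ g r (j +ℕ n) ⟨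
        coeff (g ⊗ r) (j +ℕ n)           ≡⟨ h (j +ℕ n) (ℕ.m≤m+n j n) ⟩
        0#                               ∎

  difference-0 : ∀ {f g} → f ⊕ negate g ≈ 0ₚ → f ≈ g
  difference-0 {f} {g} e = coeffwise λ i → x-y≡0⇒x≡y (trans (sym (trans (coeff-⊕ f (negate g) i) (cong (coeff f i +_) (coeff-negate g i)))) (trans (at e i) (zeros i)))

  remainder-unique : ∀ {j g} → Monic j g → ∀ {q r q′ r′} → Below (coeff r) j → Below (coeff r′) j →
                     g ⊗ q ⊕ r ≈ g ⊗ q′ ⊕ r′ → q ≈ q′ × r ≈ r′
  remainder-unique {j} {g} mg {q} {r} {q′} {r′} br br′ e = difference-0 zero-diff , Ring.sym (difference-0 (Ring.trans (Ring.sym diff) (Ring.trans (Ring.*-congˡ zero-diff) (Ring.zeroʳ g))))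
    where
    module P = PolySolver
    diff : g ⊗ (q ⊕ negate q′) ≈ r′ ⊕ negate r
    diff = Ring.trans (P.solve 4 (λ g q q′ r → g P.:* (q P.:+ P.:- q′) P.:= g P.:* q P.:+ r P.:+ P.:- (g P.:* q′) P.:+ P.:- r) Ring.refl g q q′ r)
      (Ring.trans (Ring.+-congʳ (Ring.+-congʳ e)) (P.solve 4 (λ g q′ r r′ → g P.:* q′ P.:+ r′ P.:+ P.:- (g P.:* q′) P.:+ P.:- r P.:= r′ P.:+ P.:- r) Ring.refl g q′ r r′))
    zero-diff : q ⊕ negate q′ ≈ 0ₚ
    zero-diff = below-multiple mg λ i p → trans (at diff i) (trans (coeff-⊕ r′ (negate r) i)
      (trans (cong (coeff r′ i +_) (coeff-negate r i)) (trans (cong₂ (λ a b → a + - b) (br′ i p) (br i p)) (-‿inverseʳ 0#))))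

  monic-cancelˡ : ∀ {j g} → Monic j g → ∀ {f h} → g ⊗ f ≈ g ⊗ h → f ≈ h
  monic-cancelˡ {g = g} mg e = proj₁ (remainder-unique mg {r = 0ₚ} {r′ = 0ₚ} (λ i _ → zeros i) (λ i _ → zeros i) (Ring.+-congʳ e))

module PolynomialTheory {p : ℕ} (K : Field p) where

  module 𝔽 = Field K
  module Polys = Polynomials K

  -- Divisibility, irreducible polynomials and Euclid's lemma

  module Factorization where

    open import Data.Nat.Base as ℕ using (ℕ; zero; suc; _≤_; _<_; z≤n; s≤s; _∸_) renaming (_+_ to _+ℕ_)
    import Data.Nat.Properties as ℕ
    open import Data.Vec.Base using (Vec; []; _∷_)
    open import Data.Product using (_×_; _,_; ∃; proj₁; proj₂)
    open import Data.Sum using (_⊎_; inj₁; inj₂)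
    open import Relation.Nullary using (Dec; yes; no; ¬_; contradiction)
    open import Relation.Nullary.Decidable using (map′)
    open import Relation.Binary using (tri<; tri≈; tri>)
    open import Relation.Binary.PropositionalEquality
    open import Function.Base using (_∘_)
    open FiniteSums using (Finite; vecFinite)

    open 𝔽
    open Polys

    private module P = PolySolver

    low : ∀ {n} → Vec Carrier n → Series
    low []      i       = 0#
    low (a ∷ v) zero    = a
    low (a ∷ v) (suc i) = low v i

    low-below : ∀ {n} (v : Vec Carrier n) → Below (low v) n
    low-below []      i       h       = refl
    low-below (a ∷ v) (suc i) (s≤s h) = low-below v i h

    take : ∀ n → Series → Vec Carrier n
    take zero    f = []
    take (suc n) f = f 0 ∷ take n (shift f)

    take-cong : ∀ n {f g : Series} → f ≗ g → take n f ≡ take n g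
    take-cong zero    e = refl
    take-cong (suc n) e = cong₂ _∷_ (e 0) (take-cong n (e ∘ suc))

    low-take : ∀ n {f} → Below f n → low (take n f) ≗ f
    low-take zero    h i       = sym (h i z≤n)
    low-take (suc n) h zero    = refl
    low-take (suc n) h (suc i) = low-take n (λ i p → h (suc i) (s≤s p)) i

    take-low : ∀ {n} (v : Vec Carrier n) → take n (low v) ≡ v
    take-low []      = refl
    take-low (a ∷ v) = cong (a ∷_) (take-low v)

    lowPoly : ∀ {n} → Vec Carrier n → Poly
    lowPoly {n} v = poly (low v) n (low-below v)

    -- A vector lists the coefficients below the leading one, so that the monic polynomials of
    -- degree `n` are enumerated by the vectors of length `n`.
    mon : ∀ {n} → Vec Carrier n → Series
    mon []      i       = constant 1# i
    mon (a ∷ v) zero    = a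
    mon (a ∷ v) (suc i) = mon v i

    mon-leading : ∀ {n} (v : Vec Carrier n) → mon v n ≡ 1#
    mon-leading []      = refl
    mon-leading (a ∷ v) = mon-leading v

    mon-above : ∀ {n} (v : Vec Carrier n) → Below (mon v) (suc n)
    mon-above []      (suc i) h       = refl
    mon-above (a ∷ v) (suc i) (s≤s h) = mon-above v i h

    monPoly : ∀ {n} → Vec Carrier n → Poly
    monPoly {n} v = poly (mon v) (suc n) (mon-above v)

    monic-monPoly : ∀ {n} (v : Vec Carrier n) → Monic n (monPoly v)
    monic-monPoly v = monic (mon-leading v) (mon-above v)

    mon-take : ∀ n {f} → f n ≡ 1# → Below f (suc n) → mon (take n f) ≗ f
    mon-take zero    t b zero    = sym t
    mon-take zero    t b (suc i) = sym (b (suc i) (s≤s z≤n))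
    mon-take (suc n) t b zero    = refl
    mon-take (suc n) t b (suc i) = mon-take n t (λ j h → b (suc j) (s≤s h)) i

    monPoly-take : ∀ {n f} → Monic n f → monPoly (take n (coeff f)) ≈ f
    monPoly-take {n} (monic t b) = coeffwise (mon-take n t b)

    take-mon : ∀ {n} (v : Vec Carrier n) → take n (mon v) ≡ v
    take-mon []      = refl
    take-mon (a ∷ v) = cong (a ∷_) (take-mon v)

    monPoly-injective : ∀ {n} {v w : Vec Carrier n} → monPoly v ≈ monPoly w → v ≡ w
    monPoly-injective {n} {v} {w} e = trans (sym (take-mon v)) (trans (take-cong n (at e)) (take-mon w))

    infix 4 _∣_

    record _∣_ (g f : Poly) : Set where
      constructor divides
      field
        quotient : Poly
        equation : f ≈ g ⊗ quotient

    ∣-cong : ∀ {g g′ f f′} → g ≈ g′ → f ≈ f′ → g ∣ f → g′ ∣ f′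
    ∣-cong e e′ (divides q eq) = divides q (Ring.trans (Ring.sym e′) (Ring.trans eq (Ring.*-congʳ e)))

    abstract
      ≈0? : ∀ f → Dec (f ≈ 0ₚ)
      ≈0? f = go (bound f) (bounded f)
        where
        go : ∀ n → Below (coeff f) n → Dec (f ≈ 0ₚ)
        go zero    h = yes (coeffwise λ i → trans (h i z≤n) (sym (zeros i)))
        go (suc n) h with coeff f n ≟ 0#
        ... | no ≢0  = no λ e → ≢0 (trans (at e n) (zeros n))
        ... | yes ≡0 = go n λ i p → Data.Sum.[ h i , (λ { refl → ≡0 }) ] (ℕ.m≤n⇒m<n∨m≡n p)

      _≈?_ : ∀ f g → Dec (f ≈ g)
      f ≈? g = map′ difference-0 (λ e → Ring.trans (Ring.+-congʳ e) (Ring.-‿inverseʳ g)) (≈0? (f ⊕ negate g))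

      divides? : ∀ {j g} → Monic j g → ∀ f → Dec (g ∣ f)
      divides? {j} {g} mg f with divide mg f
      ... | q , r , e , br with ≈0? r
      ...   | yes r≈0 = yes (divides q (Ring.trans e (Ring.trans (Ring.+-congˡ r≈0) (Ring.+-identityʳ _))))
      ...   | no  r≉0 = no λ (divides q′ e′) → r≉0 (proj₂ (remainder-unique mg {r′ = 0ₚ} br (λ i _ → zeros i)
                (Ring.trans (Ring.sym e) (Ring.trans e′ (Ring.sym (Ring.+-identityʳ _))))))

    record Degree (f : Poly) : Set where
      constructor degree
      field
        deg     : ℕ
        nonzero : coeff f deg ≢ 0#
        above   : Below (coeff f) (suc deg)

    abstract
      findDegree : ∀ f → f ≈ 0ₚ ⊎ Degree f
      findDegree f = go (bound f) (bounded f)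
        where
        go : ∀ n → Below (coeff f) n → f ≈ 0ₚ ⊎ Degree f
        go zero    h = inj₁ (coeffwise λ i → trans (h i z≤n) (sym (zeros i)))
        go (suc n) h with coeff f n ≟ 0#
        ... | no ≢0  = inj₂ (degree n ≢0 h)
        ... | yes ≡0 = go n λ i p → Data.Sum.[ h i , (λ { refl → ≡0 }) ] (ℕ.m≤n⇒m<n∨m≡n p)

    coeff-scale : ∀ c f i → coeff (constantPoly c ⊗ f) i ≡ c * coeff f i
    coeff-scale c f i = trans (coeff-⊗ (constantPoly c) f i) (⊛-constant c (coeff f) i)

    normalise : ∀ {f} (d : Degree f) → Monic (Degree.deg d) (constantPoly (coeff f (Degree.deg d) ⁻¹) ⊗ f)
    normalise {f} (degree d ≢0 b) = monic (trans (coeff-scale _ f d) (*-inverseˡ ≢0))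
      λ i h → trans (coeff-scale _ f i) (trans (cong (coeff f d ⁻¹ *_) (b i h)) (zeroʳ _))

    monic-quotient : ∀ {n j f g q} → Monic n f → Monic j g → f ≈ g ⊗ q → j ≤ n × Monic (n ∸ j) q
    monic-quotient {n} {j} {f} {g} {q} mf mg e with findDegree q
    ... | inj₁ q≈0 = contradiction (trans (sym (leading mf)) (trans (at e n) (trans (at (Ring.trans (Ring.*-congˡ q≈0) (Ring.zeroʳ g)) n) (zeros n)))) 1≢0
    ... | inj₂ (degree d ≢0 b) = subst (j ≤_) j+d≡n (ℕ.m≤m+n j d) , subst (λ k → Monic k q) (trans (sym (ℕ.m+n∸m≡n j d)) (cong (_∸ j) j+d≡n)) (monic lead b)
      where
      top : coeff f (j +ℕ d) ≡ coeff q d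
      top = trans (at e _) (trans (coeff-⊗ g q _) (trans (⊛-top {coeff g} {coeff q} j (above mg) b) (trans (cong (_* _) (leading mg)) (*-identityˡ _))))
      j+d≡n : j +ℕ d ≡ n
      j+d≡n with ℕ.<-cmp (j +ℕ d) n
      ... | tri< lt _ _ = contradiction (trans (sym (leading mf)) (trans (at e n) (trans (coeff-⊗ g q n) (⊛-above n lt)))) 1≢0
        where
        ⊛-above : ∀ i → j +ℕ d < i → (coeff g ⊛ coeff q) i ≡ 0#
        ⊛-above i lt with ℕ.m≤n⇒m<n∨m≡n lt
        ... | inj₁ lt′  = Below-⊛ {coeff g} {coeff q} (suc j) (above mg) b i (subst (_≤ i) (cong suc (sym (ℕ.+-suc j d))) lt′)
        ... | inj₂ refl = trans (cong (coeff g ⊛ coeff q) (sym (ℕ.+-suc j d)))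
          (trans (⊛-top {coeff g} {coeff q} j (above mg) (Below-mono (ℕ.n≤1+n (suc d)) b)) (trans (cong (_ *_) (b (suc d) ℕ.≤-refl)) (zeroʳ _)))
      ... | tri≈ _ eq _ = eq
      ... | tri> _ _ gt = contradiction (trans (sym top) (above mf _ gt)) ≢0
      lead : coeff q d ≡ 1#
      lead = trans (sym top) (trans (cong (coeff f) j+d≡n) (leading mf))

    ∣-degree : ∀ {n j f g} → Monic n f → Monic j g → g ∣ f → j ≤ n
    ∣-degree mf mg (divides q e) = proj₁ (monic-quotient mf mg e)

    record Irreducible (d : ℕ) (f : Poly) : Set where
      field
        isMonic  : Monic d f
        positive : 1 ≤ d
        prime    : ∀ {i g} → Monic i g → g ∣ f → i ≡ 0 ⊎ i ≡ d

    open Irreducible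

    ProperDivisor : ℕ → Poly → ℕ → Set
    ProperDivisor d f i = 1 ≤ i × i < d × ∃ λ (v : Vec Carrier i) → monPoly v ∣ f

    properDivisor? : ∀ d f i → Dec (ProperDivisor d f i)
    properDivisor? d f i = (1 ℕ.≤? i) ×-dec (i ℕ.<? d) ×-dec Finite.any? (vecFinite finite i) (λ v → divides? (monic-monPoly v) f)
      where open import Relation.Nullary.Decidable using (_×-dec_)

    abstract
      irreducible? : ∀ {d f} → Monic d f → 1 ≤ d → (∃ λ i → ProperDivisor d f i) ⊎ Irreducible d f
      irreducible? {d} {f} mf 1≤d with ℕ.anyUpTo? (properDivisor? d f) d
      ... | yes (i , _ , pd) = inj₁ (i , pd)
      ... | no ¬pd = inj₂ (record { isMonic = mf ; positive = 1≤d ; prime = prime′ })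
        where
        prime′ : ∀ {i g} → Monic i g → g ∣ f → i ≡ 0 ⊎ i ≡ d
        prime′ {zero}  mg g∣f = inj₁ refl
        prime′ {suc i} {g} mg g∣f with ℕ.m≤n⇒m<n∨m≡n (∣-degree mf mg g∣f)
        ... | inj₂ eq = inj₂ eq
        ... | inj₁ lt = contradiction (suc i , lt , s≤s z≤n , lt , take (suc i) (coeff g) , ∣-cong (Ring.sym (monPoly-take mg)) Ring.refl g∣f) ¬pd

    ∣-trans : ∀ {f g h} → f ∣ g → g ∣ h → f ∣ h
    ∣-trans {f} (divides q e) (divides q′ e′) = divides (q ⊗ q′) (Ring.trans e′ (Ring.trans (Ring.*-congʳ e) (Ring.*-assoc f q q′)))

    irreducible-factor : ∀ {n f} → Monic n f → 1 ≤ n → ∃ λ d → ∃ λ g → Irreducible d g × g ∣ f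
    irreducible-factor {n} = go n ℕ.≤-refl
      where
      go : ∀ b {n f} → n ≤ b → Monic n f → 1 ≤ n → ∃ λ d → ∃ λ g → Irreducible d g × g ∣ f
      go zero    {n} n≤b mf 1≤n = contradiction (ℕ.≤-trans 1≤n n≤b) λ ()
      go (suc b) {n} {f} n≤b mf 1≤n with irreducible? mf 1≤n
      ... | inj₂ irr = n , f , irr , divides 1ₚ (Ring.sym (Ring.*-identityʳ f))
      ... | inj₁ (i , 1≤i , i<n , v , v∣f) with go b (ℕ.≤-pred (ℕ.≤-trans i<n n≤b)) (monic-monPoly v) 1≤i
      ...   | d , g , irr , g∣v = d , g , irr , ∣-trans g∣v v∣f

    -- Replace `a` by its remainder `r` modulo `f`, and then `r` repeatedly by the remainder of `f`
    -- modulo the normalised `r`. The property `f ∣ r ⊗ b` persists while the length of `r` falls.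
    -- When the remainder is zero, `r` divides `f`, so by irreducibility it is a constant, and
    -- `f ∣ b`.
    euclid : ∀ {d f} → Irreducible d f → ∀ a b → f ∣ a ⊗ b → f ∣ a ⊎ f ∣ b
    euclid {d} {f} irr a b (divides w ab≈) with divide (isMonic irr) a
    ... | q , r , a≈ , br with ≈0? r
    ...   | yes r≈0 = inj₁ (divides q (Ring.trans a≈ (Ring.trans (Ring.+-congˡ r≈0) (Ring.+-identityʳ _))))
    ...   | no  r≉0 = inj₂ (go d r br ℕ.≤-refl r≉0 (divides (w ⊕ negate (q ⊗ b)) rb≈))
      where
      rb≈ : r ⊗ b ≈ f ⊗ (w ⊕ negate (q ⊗ b))
      rb≈ = Ring.trans (P.solve 4 (λ f q r b → r P.:* b P.:= (f P.:* q P.:+ r) P.:* b P.:- f P.:* (q P.:* b)) Ring.refl f q r b)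
        (Ring.trans (Ring.+-congʳ (Ring.trans (Ring.*-congʳ (Ring.sym a≈)) ab≈))
          (P.solve 4 (λ f q w b → f P.:* w P.:- f P.:* (q P.:* b) P.:= f P.:* (w P.:- q P.:* b)) Ring.refl f q w b))
      go : ∀ n r → Below (coeff r) n → n ≤ d → ¬ r ≈ 0ₚ → f ∣ r ⊗ b → f ∣ b
      go n r br n≤d r≉0 (divides z rb≈) with findDegree r
      ... | inj₁ r≈0 = contradiction r≈0 r≉0
      ... | inj₂ D@(degree e re≢0 above-e) = reduce n br n≤d
        where
        c : Poly
        c = constantPoly (coeff r e ⁻¹)
        g : Poly
        g = c ⊗ r
        mg : Monic e g
        mg = normalise D
        gb≈ : g ⊗ b ≈ f ⊗ (c ⊗ z)
        gb≈ = Ring.trans (Ring.*-assoc c r b) (Ring.trans (Ring.*-congˡ rb≈) (P.solve 3 (λ c f z → c P.:* (f P.:* z) P.:= f P.:* (c P.:* z)) Ring.refl c f z))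
        reduce : ∀ n → Below (coeff r) n → n ≤ d → f ∣ b
        reduce zero    br n≤d = contradiction (br e z≤n) re≢0
        reduce (suc n) br n≤d with divide mg f
        ... | q , r′ , f≈ , br′ with ≈0? r′
        ...   | no r′≉0 = go n r′ (Below-mono e≤n br′) (ℕ.<⇒≤ n≤d) r′≉0 (divides (b ⊕ negate (c ⊗ z ⊗ q)) r′b≈)
          where
          e≤n : e ≤ n
          e≤n with e ℕ.≤? n
          ... | yes e≤n = e≤n
          ... | no  e≰n = contradiction (br e (ℕ.≰⇒> e≰n)) re≢0
          r′b≈ : r′ ⊗ b ≈ f ⊗ (b ⊕ negate (c ⊗ z ⊗ q))
          r′b≈ = Ring.trans (P.solve 4 (λ g q r b → r P.:* b P.:= (g P.:* q P.:+ r) P.:* b P.:- (g P.:* b) P.:* q) Ring.refl g q r′ b)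
            (Ring.trans (Ring.+-cong (Ring.*-congʳ (Ring.sym f≈)) (Ring.-‿cong (Ring.*-congʳ gb≈)))
              (P.solve 5 (λ f b c z q → f P.:* b P.:- f P.:* (c P.:* z) P.:* q P.:= f P.:* (b P.:- c P.:* z P.:* q)) Ring.refl f b c z q))
        ...   | yes r′≈0 with prime irr mg (divides q (Ring.trans f≈ (Ring.trans (Ring.+-congˡ r′≈0) (Ring.+-identityʳ _))))
        ...     | inj₂ refl = contradiction (br e n≤d) re≢0
        ...     | inj₁ refl = divides (c ⊗ z) (Ring.trans (Ring.sym (Ring.trans (Ring.*-congʳ (monic-0 mg)) (Ring.*-identityˡ b))) gb≈)

  -- Valuations and sums over prime powers

  module PrimePowers where

    open import Data.Nat.Base as ℕ using (ℕ; zero; suc; _≤_; _<_; z≤n; s≤s; _∸_) renaming (_+_ to _+ℕ_; _*_ to _*ℕ_)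
    import Data.Nat.Properties as ℕ
    open import Data.Integer.Base as ℤ using (ℤ; +_; 0ℤ; 1ℤ) renaming (_+_ to _+ᶻ_; _*_ to _*ᶻ_)
    import Data.Integer.Properties as ℤ
    open import Data.Integer.Tactic.RingSolver using (solve-∀)
    open import Data.List.Base using (List; []; _∷_; concatMap; length)
    open import Data.List.Relation.Unary.Any using (here; there)
    open import Data.List.Membership.Propositional using (_∈_)
    open import Data.Vec.Base using (Vec; []; _∷_)
    open import Data.Product using (_×_; _,_; ∃; proj₂)
    open import Data.Sum using (_⊎_; inj₁; inj₂)
    open import Relation.Nullary using (Dec; yes; no; ¬_; contradiction)
    open import Relation.Nullary.Decidable using (_×-dec_)
    open import Relation.Binary.PropositionalEquality
    open import Function.Base using (_∘_)
    open FiniteSums using (Finite; vecFinite; length-vectors)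
    open IntegerSums

    open 𝔽 hiding (_≟_; complete; unique; elements)
    open Polys
    open Factorization
    import Data.Sum

    V : ∀ n → List (Vec Carrier n)
    V n = Finite.elements (vecFinite finite n)

    Q : ℕ
    Q = card

    length-V : ∀ n → length (V n) ≡ Q ℕ.^ n
    length-V n = length-vectors (Finite.elements finite) n

    range : ℕ → List ℕ
    range zero    = []
    range (suc n) = n ∷ range n

    range-above : ∀ n {a} (f : ℕ → ℤ) → n ≤ a → ∑ (range n) (λ i → ι (i ℕ.≟ a) *ᶻ f i) ≡ 0ℤ
    range-above zero    f n≤a = refl
    range-above (suc n) {a} f n<a = cong₂ _+ᶻ_ (cong (_*ᶻ f n) (ι-no (n ℕ.≟ a) (ℕ.<⇒≢ n<a))) (range-above n f (ℕ.<⇒≤ n<a))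

    range-pick : ∀ n {a} (f : ℕ → ℤ) → a < n → ∑ (range n) (λ i → ι (i ℕ.≟ a) *ᶻ f i) ≡ f a
    range-pick (suc n) {a} f (s≤s a≤n) with n ℕ.≟ a
    ... | yes refl = trans (cong₂ _+ᶻ_ (ℤ.*-identityˡ (f n)) (range-above n f ℕ.≤-refl)) (ℤ.+-identityʳ (f n))
    ... | no  n≢a  = trans (ℤ.+-identityˡ _) (range-pick n f (ℕ.≤∧≢⇒< a≤n (n≢a ∘ sym)))

    range-≤1 : ∀ n a → ∑ (range n) (λ i → ι (i ℕ.≟ a)) ℤ.≤ 1ℤ
    range-≤1 n a with a ℕ.<? n
    ... | yes a<n = ℤ.≤-reflexive (trans (∑-cong (range n) (λ i → sym (ℤ.*-identityʳ _))) (range-pick n (λ _ → 1ℤ) a<n))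
    ... | no  a≮n = ℤ.≤-trans (ℤ.≤-reflexive (trans (∑-cong (range n) (λ i → sym (ℤ.*-identityʳ _))) (range-above n (λ _ → 1ℤ) (ℕ.≮⇒≥ a≮n)))) (ℤ.+≤+ z≤n)

    range-suc : ∀ n (f : ℕ → ℤ) → ∑ (range (suc n)) f ≡ f 0 +ᶻ ∑ (range n) (f ∘ suc)
    range-suc zero    f = refl
    range-suc (suc n) f = trans (cong (f (suc n) +ᶻ_) (range-suc n f)) (swap (f (suc n)) (f 0) (∑ (range n) (f ∘ suc)))
      where
      swap : ∀ a b c → a +ᶻ (b +ᶻ c) ≡ b +ᶻ (a +ᶻ c)
      swap = solve-∀

    ∈-range : ∀ {n a} → a < n → a ∈ range n
    ∈-range {suc n} {a} (s≤s a≤n) with ℕ.m≤n⇒m<n∨m≡n a≤n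
    ... | inj₁ a<n  = there (∈-range a<n)
    ... | inj₂ refl = here refl

    pow : Poly → ℕ → Poly
    pow f zero    = 1ₚ
    pow f (suc k) = f ⊗ pow f k

    pow-cong : ∀ {f g} → f ≈ g → ∀ k → pow f k ≈ pow g k
    pow-cong e zero    = Ring.refl
    pow-cong e (suc k) = Ring.*-cong e (pow-cong e k)

    monic-pow : ∀ {d f} → Monic d f → ∀ k → Monic (k *ℕ d) (pow f k)
    monic-pow mf zero    = monic-1
    monic-pow mf (suc k) = monic-⊗ mf (monic-pow mf k)

    record PrimePoly : Set where
      constructor mkPrime
      field
        deg         : ℕ
        pol         : Poly
        irreducible : Irreducible deg pol

      isMonic : Monic deg pol
      isMonic = Irreducible.isMonic irreducible

      powMonic : ∀ k → Monic (suc k *ℕ deg) (pow pol (suc k))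
      powMonic k = monic-pow isMonic (suc k)

    open PrimePoly

    found : ∀ {d f} → (∃ λ i → ProperDivisor d f i) ⊎ Irreducible d f → List PrimePoly
    found         (inj₁ _)   = []
    found {d} {f} (inj₂ irr) = mkPrime d f irr ∷ []

    primesAt : ∀ d → Vec Carrier (suc d) → List PrimePoly
    primesAt d v = found (irreducible? (monic-monPoly v) (s≤s z≤n))

    -- The irreducible polynomials of degrees 1 to `B`: the entry `d` of `range B` stands for degree
    -- `suc d`.
    primes : ℕ → List PrimePoly
    primes B = concatMap (λ d → concatMap (primesAt d) (V (suc d))) (range B)

    ∑-primes : ∀ B (f : PrimePoly → ℤ) → ∑ (primes B) f ≡ ∑ (range B) (λ d → ∑ (V (suc d)) (λ v → ∑ (primesAt d v) f))
    ∑-primes B f = trans (∑-concatMap (λ d → concatMap (primesAt d) (V (suc d))) (range B) f)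
      (∑-cong (range B) (λ d → ∑-concatMap (primesAt d) (V (suc d)) f))

    -- The list contains exactly one polynomial equal to that of `P₀`. A `PrimePoly` carries proofs,
    -- so it is singled out by `_≈_` on the polynomials, and `h` has to be constant on that class.
    primes-pick : ∀ {B} (P₀ : PrimePoly) → deg P₀ ≤ B → (h : PrimePoly → ℤ) (c : ℤ) → (∀ P → pol P ≈ pol P₀ → h P ≡ c) →
                  ∑ (primes B) (λ P → ι (pol P ≈? pol P₀) *ᶻ h P) ≡ c
    primes-pick {B} (mkPrime zero f₀ irr₀) d₀≤B h c hc = contradiction (Irreducible.positive irr₀) λ ()
    primes-pick {B} (mkPrime (suc d₀) f₀ irr₀) d₀<B h c hc = begin
      ∑ (primes B) term
        ≡⟨ ∑-primes B term ⟩
      ∑ (range B) (λ d → ∑ (V (suc d)) (λ v → ∑ (primesAt d v) term))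
        ≡⟨ ∑-cong (range B) (λ d → trans (∑-cong (V (suc d)) (inner d)) (sym (*-∑ (ι (d ℕ.≟ d₀)) (V (suc d)) (λ v → ι (v ≟ᵥ take (suc d) (coeff f₀)) *ᶻ c)))) ⟩
      ∑ (range B) (λ d → ι (d ℕ.≟ d₀) *ᶻ ∑ (V (suc d)) (λ v → ι (v ≟ᵥ take (suc d) (coeff f₀)) *ᶻ c))
        ≡⟨ ∑-cong (range B) (λ d → cong (ι (d ℕ.≟ d₀) *ᶻ_) (∑-ι (vecFinite finite (suc d)) (take (suc d) (coeff f₀)) (λ _ → c))) ⟩
      ∑ (range B) (λ d → ι (d ℕ.≟ d₀) *ᶻ c)
        ≡⟨ range-pick B (λ _ → c) d₀<B ⟩
      c ∎
      where
      open ≡-Reasoning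
      term : PrimePoly → ℤ
      term P = ι (pol P ≈? f₀) *ᶻ h P
      mf₀ : Monic (suc d₀) f₀
      mf₀ = Irreducible.isMonic irr₀
      _≟ᵥ_ : ∀ {n} (v w : Vec Carrier n) → Dec (v ≡ w)
      _≟ᵥ_ {n} = Finite._≟_ (vecFinite finite n)
      inner′ : ∀ d v → (r : (∃ λ i → ProperDivisor (suc d) (monPoly v) i) ⊎ Irreducible (suc d) (monPoly v)) →
               Dec (d ≡ d₀ × monPoly v ≈ f₀) → ∑ (found r) term ≡ ι (d ℕ.≟ d₀) *ᶻ (ι (v ≟ᵥ take (suc d) (coeff f₀)) *ᶻ c)
      inner′ d v (inj₂ irr) (yes (refl , e)) = begin
        ι (monPoly v ≈? f₀) *ᶻ h P +ᶻ 0ℤ   ≡⟨ ℤ.+-identityʳ _ ⟩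
        ι (monPoly v ≈? f₀) *ᶻ h P         ≡⟨ cong₂ _*ᶻ_ (ι-yes (monPoly v ≈? f₀) e) (hc P e) ⟩
        1ℤ *ᶻ c                            ≡⟨ cong (_*ᶻ c) (ι-yes (v ≟ᵥ take (suc d) (coeff f₀)) (trans (sym (take-mon v)) (take-cong (suc d) (at e)))) ⟨
        ι (v ≟ᵥ take (suc d) (coeff f₀)) *ᶻ c
                                           ≡⟨ ℤ.*-identityˡ _ ⟨
        1ℤ *ᶻ (ι (v ≟ᵥ take (suc d) (coeff f₀)) *ᶻ c)
                                           ≡⟨ cong (_*ᶻ (ι (v ≟ᵥ take (suc d) (coeff f₀)) *ᶻ c)) (ι-yes (d ℕ.≟ d) refl) ⟨
        ι (d ℕ.≟ d) *ᶻ (ι (v ≟ᵥ take (suc d) (coeff f₀)) *ᶻ c) ∎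
        where
        P : PrimePoly
        P = mkPrime (suc d) (monPoly v) irr
      inner′ d v (inj₁ (i , 1≤i , i<d , w , w∣v)) (yes (refl , e)) =
        Data.Sum.[ (λ i≡0 → contradiction (subst (1 ≤_) i≡0 1≤i) λ ()) , (λ i≡d → contradiction i<d (ℕ.<-irrefl i≡d)) ]′
          (Irreducible.prime irr₀ (monic-monPoly w) (∣-cong Ring.refl e w∣v))
      inner′ d v r (no ¬e) = trans (vanish r) (sym (zero-rhs (d ℕ.≟ d₀)))
        where
        vanish : ∀ r → ∑ (found r) term ≡ 0ℤ
        vanish (inj₁ _)   = refl
        vanish (inj₂ irr) = trans (ℤ.+-identityʳ _) (trans (cong (_*ᶻ h (mkPrime (suc d) (monPoly v) irr))
          (ι-no (monPoly v ≈? f₀) (λ e → ¬e (ℕ.suc-injective (monic-degree (monic-cong e (monic-monPoly v)) mf₀) , e)))) (ℤ.*-zeroˡ (h (mkPrime (suc d) (monPoly v) irr))))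
        zero-rhs : (q : Dec (d ≡ d₀)) → ι q *ᶻ (ι (v ≟ᵥ take (suc d) (coeff f₀)) *ᶻ c) ≡ 0ℤ
        zero-rhs (no _)     = refl
        zero-rhs (yes refl) = trans (ℤ.*-identityˡ _) (trans (cong (_*ᶻ c) (ι-no (v ≟ᵥ take (suc d) (coeff f₀)) (λ { refl → ¬e (refl , monPoly-take mf₀) }))) (ℤ.*-zeroˡ c))
      inner : ∀ d v → ∑ (primesAt d v) term ≡ ι (d ℕ.≟ d₀) *ᶻ (ι (v ≟ᵥ take (suc d) (coeff f₀)) *ᶻ c)
      inner d v = inner′ d v (irreducible? (monic-monPoly v) (s≤s z≤n)) ((d ℕ.≟ d₀) ×-dec (monPoly v ≈? f₀))

    module _ (B : ℕ) where

      powDivides? : (P : PrimePoly) → ∀ k f → Dec (pow (pol P) k ∣ f)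
      powDivides? P k f = divides? (monic-pow (isMonic P) k) f

      -- The exponent of `P` in `f`, as the number of positive powers of `P` dividing `f`. The
      -- cutoff `B` loses nothing as long as `f` is monic of degree at most `B`.
      valuation : PrimePoly → Poly → ℤ
      valuation P f = ∑ (range B) (λ k → ι (powDivides? P (suc k) f))

      degree-sum : Poly → ℤ
      degree-sum f = ∑ (primes B) (λ P → + deg P *ᶻ valuation P f)

    prime-∣-prime : ∀ P P₀ → pol P ∣ pol P₀ → pol P ≈ pol P₀
    prime-∣-prime P P₀ P∣P₀ with Irreducible.prime (irreducible P₀) (isMonic P) P∣P₀
    ... | inj₁ d≡0  = contradiction (subst (1 ≤_) d≡0 (Irreducible.positive (irreducible P))) λ ()
    ... | inj₂ refl with P∣P₀
    ...   | divides q e with monic-quotient (isMonic P₀) (isMonic P) e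
    ...     | _ , mq = Ring.sym (Ring.trans e (Ring.trans (Ring.*-congˡ (monic-0 (subst (λ n → Monic n q) (ℕ.n∸n≡0 (deg P)) mq))) (Ring.*-identityʳ (pol P))))

    exchange : ∀ f g h → f ⊗ (g ⊗ h) ≈ g ⊗ (f ⊗ h)
    exchange = PS.solve 3 (λ a b c → a PS.:* (b PS.:* c) PS.:= b PS.:* (a PS.:* c)) Ring.refl
      where module PS = PolySolver

    -- By Euclid's lemma `P` divides `h`; a factor `P` is cancelled on both sides, and the exponent
    -- drops by one.
    coprime-pow-∣ : ∀ P P₀ → ¬ pol P ≈ pol P₀ → ∀ k h → pow (pol P) k ∣ pol P₀ ⊗ h → pow (pol P) k ∣ h
    coprime-pow-∣ P P₀ P≉P₀ zero    h _ = divides h (Ring.sym (Ring.*-identityˡ h))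
    coprime-pow-∣ P P₀ P≉P₀ (suc k) h (divides q e) =
      split (euclid (irreducible P) (pol P₀) h (divides (pow (pol P) k ⊗ q) e′))
      where
      e′ : pol P₀ ⊗ h ≈ pol P ⊗ (pow (pol P) k ⊗ q)
      e′ = Ring.trans e (Ring.*-assoc (pol P) (pow (pol P) k) q)
      descend : ∀ {h′} → h ≈ pol P ⊗ h′ → pow (pol P) k ∣ pol P₀ ⊗ h′
      descend {h′} h≈ = divides q (monic-cancelˡ (isMonic P)
        (Ring.trans (exchange (pol P) (pol P₀) h′) (Ring.trans (Ring.*-congˡ (Ring.sym h≈)) e′)))
      ascend : ∀ {h′} → h ≈ pol P ⊗ h′ → pow (pol P) k ∣ h′ → pow (pol P) (suc k) ∣ h
      ascend h≈ (divides q′ h′≈) = divides q′ (Ring.trans h≈ (Ring.trans (Ring.*-congˡ h′≈) (Ring.sym (Ring.*-assoc (pol P) (pow (pol P) k) q′))))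
      split : pol P ∣ pol P₀ ⊎ pol P ∣ h → pow (pol P) (suc k) ∣ h
      split (inj₁ P∣P₀)            = contradiction (prime-∣-prime P P₀ P∣P₀) P≉P₀
      split (inj₂ (divides h′ h≈)) = ascend h≈ (coprime-pow-∣ P P₀ P≉P₀ k h′ (descend h≈))

    ∣-⊗ˡ : ∀ {f h} g → f ∣ h → f ∣ g ⊗ h
    ∣-⊗ˡ {f} {h} g (divides q e) = divides (g ⊗ q) (Ring.trans (Ring.*-congˡ e) (exchange g f q))

    -- For `P ≈ P₀` the factor shifts the exponent by one. The term `k = 0` then supplies the extra
    -- 1, and the term pushed out of the range is zero, because `P` to the power `suc B` exceeds the
    -- degree `n` of `h`.
    valuation-⊗ : ∀ {B n h} (P P₀ : PrimePoly) → n < B → Monic n h →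
                  valuation B P (pol P₀ ⊗ h) ≡ ι (pol P ≈? pol P₀) +ᶻ valuation B P h
    valuation-⊗ {suc B} {n} {h} P P₀ (s≤s n≤B) mh with pol P ≈? pol P₀
    ... | no P≉P₀ = trans (∑-cong (range (suc B)) (λ k → ι-cong (powDivides? (suc B) P (suc k) (pol P₀ ⊗ h)) (powDivides? (suc B) P (suc k) h)
                     (coprime-pow-∣ P P₀ P≉P₀ (suc k) h) (∣-⊗ˡ (pol P₀)))) (sym (ℤ.+-identityˡ _))
    ... | yes P≈P₀ = begin
      ∑ (range (suc B)) (λ k → ι (powDivides? (suc B) P (suc k) (pol P₀ ⊗ h)))
        ≡⟨ ∑-cong (range (suc B)) (λ k → ι-cong (powDivides? (suc B) P (suc k) (pol P₀ ⊗ h)) (powDivides? (suc B) P k h) (fwd k) (bwd k)) ⟩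
      ∑ (range (suc B)) (λ k → ι (powDivides? (suc B) P k h))
        ≡⟨ range-suc B (λ k → ι (powDivides? (suc B) P k h)) ⟩
      ι (powDivides? (suc B) P 0 h) +ᶻ ∑ (range B) (λ k → ι (powDivides? (suc B) P (suc k) h))
        ≡⟨ cong₂ _+ᶻ_ (ι-yes (powDivides? (suc B) P 0 h) (divides h (Ring.sym (Ring.*-identityˡ h)))) (sym (ℤ.+-identityˡ _)) ⟩
      1ℤ +ᶻ (0ℤ +ᶻ ∑ (range B) (λ k → ι (powDivides? (suc B) P (suc k) h)))
        ≡⟨ cong (λ z → 1ℤ +ᶻ (z +ᶻ ∑ (range B) (λ k → ι (powDivides? (suc B) P (suc k) h)))) (ι-no (powDivides? (suc B) P (suc B) h) too-big) ⟨
      1ℤ +ᶻ valuation (suc B) P h ∎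
      where
      open ≡-Reasoning
      fwd : ∀ k → pow (pol P) (suc k) ∣ pol P₀ ⊗ h → pow (pol P) k ∣ h
      fwd k (divides q e) = divides q (monic-cancelˡ (isMonic P) (Ring.trans (Ring.*-congʳ P≈P₀) (Ring.trans e (Ring.*-assoc (pol P) _ q))))
      bwd : ∀ k → pow (pol P) k ∣ h → pow (pol P) (suc k) ∣ pol P₀ ⊗ h
      bwd k (divides q e) = divides q (Ring.trans (Ring.*-cong (Ring.sym P≈P₀) e) (Ring.sym (Ring.*-assoc (pol P) _ q)))
      too-big : ¬ pow (pol P) (suc B) ∣ h
      too-big d = ℕ.<-irrefl refl (ℕ.≤-trans (s≤s n≤B) (ℕ.≤-trans (ℕ.≤-trans (ℕ.≤-reflexive (sym (ℕ.*-identityʳ (suc B))))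
        (ℕ.*-monoʳ-≤ (suc B) (Irreducible.positive (irreducible P)))) (∣-degree mh (powMonic P B) d)))

    valuation-1 : ∀ B P {f} → Monic 0 f → valuation B P f ≡ 0ℤ
    valuation-1 B P mf = trans (∑-cong (range B) (λ k → ι-no (powDivides? B P (suc k) _) (λ d → contradiction
      (ℕ.≤-trans (ℕ.≤-trans (Irreducible.positive (irreducible P)) (ℕ.m≤m+n (deg P) (k *ℕ deg P))) (∣-degree mf (powMonic P k) d)) λ ()))) (∑-ε (range B))

    valuation-cong : ∀ B P {f g} → f ≈ g → valuation B P f ≡ valuation B P g
    valuation-cong B P e = ∑-cong (range B) (λ k → ι-cong (powDivides? B P (suc k) _) (powDivides? B P (suc k) _) (∣-cong Ring.refl e) (∣-cong Ring.refl (Ring.sym e)))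

    -- Unique factorisation in numerical form. Splitting off one irreducible factor raises the
    -- valuation at that factor by one and leaves the others unchanged.
    degree-sum-≡ : ∀ B {n f} → n ≤ B → Monic n f → degree-sum B f ≡ + n
    degree-sum-≡ B {n} {f} = go n ℕ.≤-refl
      where
      open ≡-Reasoning
      go : ∀ b {n f} → n ≤ b → n ≤ B → Monic n f → degree-sum B f ≡ + n
      go b {zero} n≤b n≤B mf = trans (∑-cong (primes B) (λ P → trans (cong (+ deg P *ᶻ_) (valuation-1 B P mf)) (ℤ.*-zeroʳ (+ deg P)))) (∑-ε (primes B))
      go (suc b) {suc n} {f} (s≤s n≤b) n<B mf with irreducible-factor mf (s≤s z≤n)
      ... | d , g , irr , divides h f≈ with monic-quotient mf (Irreducible.isMonic irr) f≈
      ...   | d≤n , mh = begin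
        degree-sum B f
          ≡⟨ ∑-cong (primes B) (λ P → cong (+ deg P *ᶻ_) (trans (valuation-cong B P f≈) (valuation-⊗ P P₀ h<B mh))) ⟩
        ∑ (primes B) (λ P → + deg P *ᶻ (ι (pol P ≈? g) +ᶻ valuation B P h))
          ≡⟨ ∑-cong (primes B) (λ P → trans (ℤ.*-distribˡ-+ (+ deg P) (ι (pol P ≈? g)) (valuation B P h)) (cong (_+ᶻ (+ deg P *ᶻ valuation B P h)) (ℤ.*-comm (+ deg P) (ι (pol P ≈? g))))) ⟩
        ∑ (primes B) (λ P → ι (pol P ≈? g) *ᶻ + deg P +ᶻ + deg P *ᶻ valuation B P h)
          ≡⟨ ∑-∙ (primes B) (λ P → ι (pol P ≈? g) *ᶻ + deg P) (λ P → + deg P *ᶻ valuation B P h) ⟩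
        ∑ (primes B) (λ P → ι (pol P ≈? g) *ᶻ + deg P) +ᶻ degree-sum B h
          ≡⟨ cong₂ _+ᶻ_ (primes-pick P₀ (ℕ.≤-trans d≤n n<B) (λ P → + deg P) (+ d) (λ P e → cong +_ (monic-degree (monic-cong e (isMonic P)) (Irreducible.isMonic irr))))
                        (go b (ℕ.≤-trans (ℕ.∸-monoʳ-≤ (suc n) 1≤d) n≤b) (ℕ.<⇒≤ h<B) mh) ⟩
        + (d +ℕ (suc n ∸ d))
          ≡⟨ cong +_ (ℕ.m+[n∸m]≡n d≤n) ⟩
        + suc n ∎
        where
        P₀ : PrimePoly
        P₀ = mkPrime d g irr
        1≤d : 1 ≤ d
        1≤d = Irreducible.positive irr
        h<B : suc n ∸ d < B
        h<B = ℕ.≤-trans (s≤s (ℕ.∸-monoʳ-≤ (suc n) 1≤d)) n<B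

    -- The monic multiples of `g` of degree `n` are the products of `g` with the monic polynomials
    -- of degree `n ∸ j`, each obtained once by cancellation. The indicator of divisibility is
    -- expanded over these cofactors.
    divisor-sum : ∀ {n j g} (mg : Monic j g) → j ≤ n → (F : Poly → ℤ) → (∀ {f f′} → f ≈ f′ → F f ≡ F f′) →
                  ∑ (V n) (λ v → ι (divides? mg (monPoly v)) *ᶻ F (monPoly v)) ≡ ∑ (V (n ∸ j)) (λ w → F (g ⊗ monPoly w))
    divisor-sum {n} {j} {g} mg j≤n F F-cong = begin
      ∑ (V n) (λ v → ι (divides? mg (monPoly v)) *ᶻ F (monPoly v))
        ≡⟨ ∑-cong (V n) (λ v → trans (cong (_*ᶻ F (monPoly v)) (multiples v (divides? mg (monPoly v))))
             (∑-* (V (n ∸ j)) (λ w → ι (v ≟ₙ multiple w)) (F (monPoly v)))) ⟩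
      ∑ (V n) (λ v → ∑ (V (n ∸ j)) (λ w → ι (v ≟ₙ multiple w) *ᶻ F (monPoly v)))
        ≡⟨ ∑-swap (V n) (V (n ∸ j)) (λ v w → ι (v ≟ₙ multiple w) *ᶻ F (monPoly v)) ⟩
      ∑ (V (n ∸ j)) (λ w → ∑ (V n) (λ v → ι (v ≟ₙ multiple w) *ᶻ F (monPoly v)))
        ≡⟨ ∑-cong (V (n ∸ j)) (λ w → trans (∑-ι (vecFinite finite n) (multiple w) (F ∘ monPoly)) (F-cong (multiple-≈ w))) ⟩
      ∑ (V (n ∸ j)) (λ w → F (g ⊗ monPoly w)) ∎
      where
      open ≡-Reasoning
      _≟ₙ_ : (v w : Vec Carrier n) → Dec (v ≡ w)
      _≟ₙ_ = Finite._≟_ (vecFinite finite n)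
      _≟ₘ_ : (v w : Vec Carrier (n ∸ j)) → Dec (v ≡ w)
      _≟ₘ_ = Finite._≟_ (vecFinite finite (n ∸ j))
      multiple : Vec Carrier (n ∸ j) → Vec Carrier n
      multiple w = take n (coeff (g ⊗ monPoly w))
      multiple-≈ : ∀ w → monPoly (multiple w) ≈ g ⊗ monPoly w
      multiple-≈ w = monPoly-take (subst (λ k → Monic k (g ⊗ monPoly w)) (ℕ.m+[n∸m]≡n j≤n) (monic-⊗ mg (monic-monPoly w)))
      multiples : ∀ v → (d : Dec (g ∣ monPoly v)) → ι d ≡ ∑ (V (n ∸ j)) (λ w → ι (v ≟ₙ multiple w))
      multiples v (no ¬d) = sym (trans (∑-cong (V (n ∸ j)) (λ w → ι-no (v ≟ₙ multiple w) (λ { refl → ¬d (divides (monPoly w) (multiple-≈ w)) }))) (∑-ε (V (n ∸ j))))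
      multiples v (yes (divides q e)) = sym (trans (∑-cong (V (n ∸ j)) (λ w → ι-cong (v ≟ₙ multiple w) (w ≟ₘ take (n ∸ j) (coeff q)) (to w) (from w)))
        (∑-ι1 (vecFinite finite (n ∸ j)) (take (n ∸ j) (coeff q))))
        where
        mq : Monic (n ∸ j) q
        mq = proj₂ (monic-quotient (monic-monPoly v) mg e)
        to : ∀ w → v ≡ multiple w → w ≡ take (n ∸ j) (coeff q)
        to w refl = trans (sym (take-mon w)) (take-cong (n ∸ j) (at (monic-cancelˡ mg (Ring.trans (Ring.sym (multiple-≈ w)) e))))
        from : ∀ w → w ≡ take (n ∸ j) (coeff q) → v ≡ multiple w
        from w refl = monPoly-injective (Ring.trans e (Ring.trans (Ring.*-congˡ (Ring.sym (monPoly-take mq))) (Ring.sym (multiple-≈ w))))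

    divisor-sum-0 : ∀ {n j g} (mg : Monic j g) → n < j → (F : Poly → ℤ) →
                    ∑ (V n) (λ v → ι (divides? mg (monPoly v)) *ᶻ F (monPoly v)) ≡ 0ℤ
    divisor-sum-0 {n} mg n<j F = trans (∑-cong (V n) (λ v → trans (cong (_*ᶻ F (monPoly v)) (ι-no (divides? mg (monPoly v))
      (λ d → ℕ.<-irrefl refl (ℕ.≤-trans n<j (∣-degree (monic-monPoly v) mg d))))) (ℤ.*-zeroˡ (F (monPoly v))))) (∑-ε (V n))

    -- The von Mangoldt sum of H over the prime powers of degree j.
    Ψ : ℕ → ℕ → (Poly → ℤ) → ℤ
    Ψ B j H = ∑ (primes B) (λ P → + deg P *ᶻ ∑ (range B) (λ k → ι (suc k *ℕ deg P ℕ.≟ j) *ᶻ H (pow (pol P) (suc k))))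

    Ψ-cong : ∀ B j {H H′} → (∀ {g} → Monic j g → H g ≡ H′ g) → Ψ B j H ≡ Ψ B j H′
    Ψ-cong B j {H} {H′} e = ∑-cong (primes B) (λ P → cong (+ deg P *ᶻ_) (∑-cong (range B) (λ k →
      ι-guard (suc k *ℕ deg P ℕ.≟ j) (λ { refl → e (powMonic P k) }))))

    Ψ-∑ : ∀ {A : Set} B j (xs : List A) (H : A → Poly → ℤ) → Ψ B j (λ g → ∑ xs (λ x → H x g)) ≡ ∑ xs (λ x → Ψ B j (H x))
    Ψ-∑ B j xs H = begin
      ∑ (primes B) (λ P → + deg P *ᶻ ∑ (range B) (λ k → δ P k *ᶻ ∑ xs (λ x → H x (g P k))))
        ≡⟨ ∑-cong (primes B) (λ P → cong (+ deg P *ᶻ_) (trans (∑-cong (range B) (λ k → *-∑ (δ P k) xs (λ x → H x (g P k))))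
             (∑-swap (range B) xs (λ k x → δ P k *ᶻ H x (g P k))))) ⟩
      ∑ (primes B) (λ P → + deg P *ᶻ ∑ xs (λ x → ∑ (range B) (λ k → δ P k *ᶻ H x (g P k))))
        ≡⟨ ∑-cong (primes B) (λ P → *-∑ (+ deg P) xs (λ x → ∑ (range B) (λ k → δ P k *ᶻ H x (g P k)))) ⟩
      ∑ (primes B) (λ P → ∑ xs (λ x → + deg P *ᶻ ∑ (range B) (λ k → δ P k *ᶻ H x (g P k))))
        ≡⟨ ∑-swap (primes B) xs (λ P x → + deg P *ᶻ ∑ (range B) (λ k → δ P k *ᶻ H x (g P k))) ⟩
      ∑ xs (λ x → Ψ B j (H x)) ∎
      where
      open ≡-Reasoning
      δ : PrimePoly → ℕ → ℤ
      δ P k = ι (suc k *ℕ deg P ℕ.≟ j)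
      g : PrimePoly → ℕ → Poly
      g P k = pow (pol P) (suc k)

    Ψ-scale : ∀ B j (H : Poly → ℤ) c → Ψ B j (λ g → H g *ᶻ c) ≡ Ψ B j H *ᶻ c
    Ψ-scale B j H c = trans (∑-cong (primes B) (λ P → trans (cong (+ deg P *ᶻ_) (trans
        (∑-cong (range B) (λ k → sym (ℤ.*-assoc (ι (suc k *ℕ deg P ℕ.≟ j)) (H (pow (pol P) (suc k))) c)))
        (sym (∑-* (range B) (λ k → ι (suc k *ℕ deg P ℕ.≟ j) *ᶻ H (pow (pol P) (suc k))) c))))
        (sym (ℤ.*-assoc (+ deg P) (∑ (range B) (λ k → ι (suc k *ℕ deg P ℕ.≟ j) *ᶻ H (pow (pol P) (suc k)))) c))))
      (sym (∑-* (primes B) (λ P → + deg P *ᶻ ∑ (range B) (λ k → ι (suc k *ℕ deg P ℕ.≟ j) *ᶻ H (pow (pol P) (suc k)))) c))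

    -- Weighting each f by n = Σ deg P over the prime powers P^k dividing f, and then
    -- summing over the multiples of each prime power.
    prime-power-expansion : ∀ {B n} → n ≤ B → (F : Poly → ℤ) → (∀ {f f′} → f ≈ f′ → F f ≡ F f′) →
      + n *ᶻ ∑ (V n) (F ∘ monPoly) ≡ ∑ (range n) (λ i → Ψ B (suc i) (λ g → ∑ (V (n ∸ suc i)) (λ w → F (g ⊗ monPoly w))))
    prime-power-expansion {B} {n} n≤B F F-cong = begin
      + n *ᶻ ∑ (V n) (F ∘ monPoly)
        ≡⟨ *-∑ (+ n) (V n) (F ∘ monPoly) ⟩
      ∑ (V n) (λ v → + n *ᶻ F (monPoly v))
        ≡⟨ ∑-cong (V n) (λ v → trans (cong (_*ᶻ F (monPoly v)) (sym (degree-sum-≡ B n≤B (monic-monPoly v))))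
             (trans (∑-* (primes B) (λ P → + deg P *ᶻ valuation B P (monPoly v)) (F (monPoly v)))
               (∑-cong (primes B) (λ P → trans (ℤ.*-assoc (+ deg P) (valuation B P (monPoly v)) (F (monPoly v)))
                 (cong (+ deg P *ᶻ_) (∑-* (range B) (λ k → ι (powDivides? B P (suc k) (monPoly v))) (F (monPoly v)))))))) ⟩
      ∑ (V n) (λ v → ∑ (primes B) (λ P → + deg P *ᶻ ∑ (range B) (λ k → term P k v)))
        ≡⟨ ∑-swap (V n) (primes B) (λ v P → + deg P *ᶻ ∑ (range B) (λ k → term P k v)) ⟩
      ∑ (primes B) (λ P → ∑ (V n) (λ v → + deg P *ᶻ ∑ (range B) (λ k → term P k v)))
        ≡⟨ ∑-cong (primes B) (λ P → trans (sym (*-∑ (+ deg P) (V n) (λ v → ∑ (range B) (λ k → term P k v))))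
             (cong (+ deg P *ᶻ_) (∑-swap (V n) (range B) (λ v k → term P k v)))) ⟩
      ∑ (primes B) (λ P → + deg P *ᶻ ∑ (range B) (λ k → ∑ (V n) (λ v → term P k v)))
        -- Prime powers are sorted by degree. Those of degree above `n` have no monic multiples of
        -- degree `n`, so `range n` covers all that contribute.
        ≡⟨ ∑-cong (primes B) (λ P → cong (+ deg P *ᶻ_) (∑-cong (range B) (λ k → by-degree (powMonic P k) (nonzero P k)))) ⟩
      ∑ (primes B) (λ P → + deg P *ᶻ ∑ (range B) (λ k → ∑ (range n) (λ i → ι (suc k *ℕ deg P ℕ.≟ suc i) *ᶻ cofactors i (pow (pol P) (suc k)))))
        ≡⟨ ∑-cong (primes B) (λ P → trans (cong (+ deg P *ᶻ_) (∑-swap (range B) (range n) (λ k i → ι (suc k *ℕ deg P ℕ.≟ suc i) *ᶻ cofactors i (pow (pol P) (suc k)))))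
             (*-∑ (+ deg P) (range n) (λ i → ∑ (range B) (λ k → ι (suc k *ℕ deg P ℕ.≟ suc i) *ᶻ cofactors i (pow (pol P) (suc k)))))) ⟩
      ∑ (primes B) (λ P → ∑ (range n) (λ i → + deg P *ᶻ ∑ (range B) (λ k → ι (suc k *ℕ deg P ℕ.≟ suc i) *ᶻ cofactors i (pow (pol P) (suc k)))))
        ≡⟨ ∑-swap (primes B) (range n) (λ P i → + deg P *ᶻ ∑ (range B) (λ k → ι (suc k *ℕ deg P ℕ.≟ suc i) *ᶻ cofactors i (pow (pol P) (suc k)))) ⟩
      ∑ (range n) (λ i → Ψ B (suc i) (cofactors i)) ∎
      where
      open ≡-Reasoning
      term : PrimePoly → ℕ → Vec Carrier n → ℤ
      term P k v = ι (powDivides? B P (suc k) (monPoly v)) *ᶻ F (monPoly v)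
      cofactors : ℕ → Poly → ℤ
      cofactors i g = ∑ (V (n ∸ suc i)) (λ w → F (g ⊗ monPoly w))
      nonzero : ∀ P k → 1 ≤ suc k *ℕ deg P
      nonzero P k = ℕ.≤-trans (Irreducible.positive (irreducible P)) (ℕ.m≤m+n (deg P) (k *ℕ deg P))
      by-degree : ∀ {j g} (mg : Monic j g) → 1 ≤ j → ∑ (V n) (λ v → ι (divides? mg (monPoly v)) *ᶻ F (monPoly v)) ≡
                  ∑ (range n) (λ i → ι (j ℕ.≟ suc i) *ᶻ cofactors i g)
      by-degree {suc j} {g} mg _ = trans (by-size (suc j ℕ.≤? n)) (∑-cong (range n) (λ i →
        cong (_*ᶻ cofactors i g) (ι-cong (i ℕ.≟ j) (suc j ℕ.≟ suc i) (λ { refl → refl }) (λ { refl → refl }))))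
        where
        by-size : Dec (suc j ≤ n) → ∑ (V n) (λ v → ι (divides? mg (monPoly v)) *ᶻ F (monPoly v)) ≡
                  ∑ (range n) (λ i → ι (i ℕ.≟ j) *ᶻ cofactors i g)
        by-size (yes j<n) = trans (divisor-sum mg j<n F F-cong) (sym (range-pick n (λ i → cofactors i g) j<n))
        by-size (no j≮n)  = trans (divisor-sum-0 mg (ℕ.≰⇒> j≮n) F) (sym (range-above n (λ i → cofactors i g) (ℕ.≤-pred (ℕ.≰⇒> j≮n))))

  -- Irreducible polynomials of every degree

  module PrimeExistence where

    open import Data.Nat.Base as ℕ using (ℕ; zero; suc; _≤_; _<_; z≤n; s≤s; _∸_) renaming (_+_ to _+ℕ_; _*_ to _*ℕ_)
    import Data.Nat.Properties as ℕ
    open import Data.Integer.Base as ℤ using (ℤ; +_; 0ℤ; 1ℤ) renaming (_+_ to _+ᶻ_; _*_ to _*ᶻ_)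
    import Data.Integer.Properties as ℤ
    open import Data.List.Base using (List; []; _∷_; length)
    open import Data.List.Relation.Unary.Any as Any using (here; there)
    open import Data.List.Membership.Propositional using (_∈_; find)
    open import Data.Product using (_,_; ∃; proj₂; map₂)
    open import Relation.Nullary using (yes; no; contradiction)
    open import Relation.Binary.PropositionalEquality
    open IntegerSums
    import Algebra.Bundles
    open import Algebra.Properties.Group (Algebra.Bundles.AbelianGroup.group ℤ.+-0-abelianGroup) using (∙-cancelʳ)

    open 𝔽 using (finite; 0#; 1#; 1≢0; complete; elements)
    open Polys
    open Factorization
    open PrimePowers

    open PrimePoly

    2≤Q : 2 ≤ Q
    2≤Q = go elements (complete 0#) (complete 1#)
      where
      go : ∀ xs → 0# ∈ xs → 1# ∈ xs → 2 ≤ length xs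
      go (x ∷ [])     (here 0≡x) (here 1≡x) = contradiction (trans 1≡x (sym 0≡x)) 1≢0
      go (x ∷ y ∷ xs) _          _          = s≤s (s≤s z≤n)

    ∑-range-cong : ∀ n {f g : ℕ → ℤ} → (∀ i → i < n → f i ≡ g i) → ∑ (range n) f ≡ ∑ (range n) g
    ∑-range-cong zero    e = refl
    ∑-range-cong (suc n) e = cong₂ _+ᶻ_ (e n ℕ.≤-refl) (∑-range-cong n (λ i i<n → e i (ℕ.m≤n⇒m≤1+n i<n)))

    length-range : ∀ n → length (range n) ≡ n
    length-range zero    = refl
    length-range (suc n) = cong suc (length-range n)

    ∑-V-1 : ∀ n → ∑ (V n) (λ _ → 1ℤ) ≡ + (Q ℕ.^ n)
    ∑-V-1 n = trans (∑-1 (V n)) (cong +_ (length-V n))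

    -- For the constant function 1 the prime power expansion reads `(n + 1) Q^(n+1) = ∑ T i Q^(n-i)`
    -- over `i ≤ n`. By strong induction each term with `i < n` equals `Q^(n+1)`, which leaves just
    -- that value for `T n`.
    Ψ-total : ∀ B n → n < B → Ψ B (suc n) (λ _ → 1ℤ) ≡ + (Q ℕ.^ suc n)
    Ψ-total B n n<B = go n (suc n) ℕ.≤-refl n<B
      where
      open ≡-Reasoning
      T : ℕ → ℤ
      T i = Ψ B (suc i) (λ _ → 1ℤ)
      go : ∀ n b → n < b → n < B → T n ≡ + (Q ℕ.^ suc n)
      go n (suc b) (s≤s n≤b) n<B = ∙-cancelʳ (+ n *ᶻ + Qⁿ) (T n) (+ Qⁿ) (begin
        T n +ᶻ + n *ᶻ + Qⁿ
          ≡⟨ cong₂ _+ᶻ_ (sym (trans (cong (λ z → T n *ᶻ + (Q ℕ.^ z)) (ℕ.n∸n≡0 n)) (ℤ.*-identityʳ (T n))))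
               (trans (cong (λ z → + z *ᶻ + Qⁿ) (sym (length-range n))) (sym (∑-const (range n) (+ Qⁿ)))) ⟩
        T n *ᶻ + (Q ℕ.^ (n ∸ n)) +ᶻ ∑ (range n) (λ _ → + Qⁿ)
          ≡⟨ cong (T n *ᶻ + (Q ℕ.^ (n ∸ n)) +ᶻ_) (∑-range-cong n earlier) ⟨
        ∑ (range (suc n)) (λ i → T i *ᶻ + (Q ℕ.^ (n ∸ i)))
          ≡⟨ ∑-cong (range (suc n)) (λ i → trans (Ψ-cong B (suc i) (λ _ → trans (∑-V-1 (n ∸ i)) (sym (ℤ.*-identityˡ _)))) (Ψ-scale B (suc i) (λ _ → 1ℤ) (+ (Q ℕ.^ (n ∸ i))))) ⟨
        ∑ (range (suc n)) (λ i → Ψ B (suc i) (λ g → ∑ (V (suc n ∸ suc i)) (λ _ → 1ℤ)))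
          ≡⟨ prime-power-expansion n<B (λ _ → 1ℤ) (λ _ → refl) ⟨
        + suc n *ᶻ ∑ (V (suc n)) (λ _ → 1ℤ)
          ≡⟨ cong (+ suc n *ᶻ_) (∑-V-1 (suc n)) ⟩
        + suc n *ᶻ + Qⁿ
          ≡⟨ ℤ.suc-* (+ n) (+ Qⁿ) ⟩
        + Qⁿ +ᶻ + n *ᶻ + Qⁿ ∎)
        where
        Qⁿ : ℕ
        Qⁿ = Q ℕ.^ suc n
        earlier : ∀ i → i < n → T i *ᶻ + (Q ℕ.^ (n ∸ i)) ≡ + Qⁿ
        earlier i i<n = trans (cong (_*ᶻ + (Q ℕ.^ (n ∸ i))) (go i b (ℕ.≤-trans i<n n≤b) (ℕ.<-trans i<n n<B)))
          (trans (sym (ℤ.pos-* (Q ℕ.^ suc i) (Q ℕ.^ (n ∸ i)))) (cong +_ (trans (sym (ℕ.^-distribˡ-+-* Q (suc i) (n ∸ i))) (cong (λ z → Q ℕ.^ suc z) (ℕ.m+[n∸m]≡n (ℕ.<⇒≤ i<n))))))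

    lowerPowers : ℕ → ℕ
    lowerPowers zero    = 0
    lowerPowers (suc n) = Q ℕ.^ suc n +ℕ lowerPowers n

    lowerPowers-< : ∀ n → lowerPowers n < Q ℕ.^ suc n
    lowerPowers-< zero    = ℕ.≤-trans (s≤s z≤n) (ℕ.≤-trans 2≤Q (ℕ.≤-reflexive (sym (ℕ.*-identityʳ Q))))
    lowerPowers-< (suc n) = ℕ.≤-trans (ℕ.≤-reflexive (sym (ℕ.+-suc (Q ℕ.^ suc n) (lowerPowers n))))
      (ℕ.≤-trans (ℕ.+-monoʳ-≤ (Q ℕ.^ suc n) (lowerPowers-< n))
      (ℕ.≤-trans (ℕ.≤-reflexive (cong (Q ℕ.^ suc n +ℕ_) (sym (ℕ.+-identityʳ _)))) (ℕ.*-monoˡ-≤ (Q ℕ.^ suc n) 2≤Q)))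

    -- Without a prime of degree n the n-th von Mangoldt sum Qⁿ would be at most
    -- Q + Q² + ⋯ + Qⁿ⁻¹, which is too small.
    prime-exists : ∀ n → ∃ λ (P : PrimePoly) → deg P ≡ suc n
    prime-exists n with Any.any? (λ P → deg P ℕ.≟ suc n) (primes (suc n))
    ... | yes r = map₂ proj₂ (find r)
    ... | no ¬r = contradiction (ℤ.drop‿+≤+ too-small) (ℕ.<⇒≱ (lowerPowers-< n))
      where
      open ℤ.≤-Reasoning
      B : ℕ
      B = suc n
      δ : PrimePoly → ℕ → ℕ → ℤ
      δ P j k = ι (suc k *ℕ deg P ℕ.≟ j) *ᶻ 1ℤ
      δ-nonneg : ∀ P j k → 0ℤ ℤ.≤ δ P j k
      δ-nonneg P j k = ℤ.≤-trans (ι≥0 (suc k *ℕ deg P ℕ.≟ j)) (ℤ.≤-reflexive (sym (ℤ.*-identityʳ _)))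
      sum-nonneg : ∀ P j → 0ℤ ℤ.≤ ∑ (range B) (δ P j)
      sum-nonneg P j = ∑-nonneg (range B) (δ-nonneg P j)
      -- If a power of `P` has degree `B` while `deg P` differs from `B`, then `P` itself counts in
      -- the smaller degree `deg P`. The exponent is determined by the degree, so `P` counts at most
      -- once in degree `B`.
      bound-for : ∀ P → deg P ≢ B → ∑ (range B) (δ P B) ℤ.≤ ∑ (range n) (λ i → ∑ (range B) (δ P (suc i)))
      bound-for P d≢ with Any.any? (λ k → suc k *ℕ deg P ℕ.≟ B) (range B)
      ... | no ¬k = ℤ.≤-trans (ℤ.≤-reflexive (trans (∑-range-cong B (λ k k<B → trans (ℤ.*-identityʳ _) (ι-no (suc k *ℕ deg P ℕ.≟ B)
                      (λ e → ¬k (Any.map (λ { refl → e }) (∈-range k<B)))))) (∑-ε (range B)))) (∑-nonneg (range n) (λ i → sum-nonneg P (suc i)))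
      ... | yes r with find r
      ...   | k₀ , _ , e₀ = ℤ.≤-trans at-most (ℤ.≤-trans (ℤ.≤-reflexive (sym one)) (ℤ.≤-trans
                (term≤∑ {f = δ P d} (δ-nonneg P d) (∈-range {B} (s≤s z≤n)))
                (ℤ.≤-trans (ℤ.≤-reflexive (cong (λ z → ∑ (range B) (δ P z)) (sym d≡))) (term≤∑ {f = λ i → ∑ (range B) (δ P (suc i))} (λ i → sum-nonneg P (suc i)) (∈-range d<n)))))
        where
        d : ℕ
        d = deg P
        1≤d : 1 ≤ d
        1≤d = Irreducible.positive (irreducible P)
        d≡ : suc (ℕ.pred d) ≡ d
        d≡ = ℕ.suc-pred d {{ℕ.>-nonZero 1≤d}}
        d<n : ℕ.pred d < n
        d<n = ℕ.≤-pred (ℕ.≤-trans (ℕ.≤-reflexive (cong suc d≡)) (ℕ.≤∧≢⇒< (ℕ.≤-trans (ℕ.m≤m+n d (k₀ *ℕ d)) (ℕ.≤-reflexive e₀)) d≢))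
        one : δ P d 0 ≡ 1ℤ
        one = trans (ℤ.*-identityʳ _) (ι-yes (1 *ℕ d ℕ.≟ d) (ℕ.*-identityˡ d))
        at-most : ∑ (range B) (δ P B) ℤ.≤ 1ℤ
        at-most = ℤ.≤-trans (∑-mono (range B) (λ k → ℤ.≤-trans (ℤ.≤-reflexive (ℤ.*-identityʳ _))
          (ι-mono (suc k *ℕ d ℕ.≟ B) (k ℕ.≟ k₀) (λ e → ℕ.suc-injective (ℕ.*-cancelʳ-≡ (suc k) (suc k₀) d {{ℕ.>-nonZero 1≤d}} (trans e (sym e₀))))))) (range-≤1 B k₀)
      ∑-mono-∈ : ∀ {A : Set} (xs : List A) {f g : A → ℤ} → (∀ {x} → x ∈ xs → f x ℤ.≤ g x) → ∑ xs f ℤ.≤ ∑ xs g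
      ∑-mono-∈ []       h = ℤ.≤-refl
      ∑-mono-∈ (x ∷ xs) h = ℤ.+-mono-≤ (h (here refl)) (∑-mono-∈ xs (λ x∈ → h (there x∈)))
      too-small : + (Q ℕ.^ suc n) ℤ.≤ + lowerPowers n
      too-small = begin
        + (Q ℕ.^ suc n)
          ≡⟨ Ψ-total B n ℕ.≤-refl ⟨
        ∑ (primes B) (λ P → + deg P *ᶻ ∑ (range B) (δ P B))
          ≤⟨ ∑-mono-∈ (primes B) (λ {P} P∈ → ℤ.*-monoˡ-≤-nonNeg (+ deg P) (bound-for P (λ d≡ → ¬r (Any.map (λ { refl → d≡ }) P∈)))) ⟩
        ∑ (primes B) (λ P → + deg P *ᶻ ∑ (range n) (λ i → ∑ (range B) (δ P (suc i))))
          ≡⟨ ∑-cong (primes B) (λ P → *-∑ (+ deg P) (range n) (λ i → ∑ (range B) (δ P (suc i)))) ⟩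
        ∑ (primes B) (λ P → ∑ (range n) (λ i → + deg P *ᶻ ∑ (range B) (δ P (suc i))))
          ≡⟨ ∑-swap (primes B) (range n) (λ P i → + deg P *ᶻ ∑ (range B) (δ P (suc i))) ⟩
        ∑ (range n) (λ i → Ψ B (suc i) (λ _ → 1ℤ))
          ≡⟨ ∑-range-cong n (λ i i<n → Ψ-total B i (ℕ.m≤n⇒m≤1+n i<n)) ⟩
        ∑ (range n) (λ i → + (Q ℕ.^ suc i))
          ≡⟨ ∑-powers n ⟩
        + lowerPowers n ∎
        where
        ∑-powers : ∀ n → ∑ (range n) (λ i → + (Q ℕ.^ suc i)) ≡ + lowerPowers n
        ∑-powers zero    = refl
        ∑-powers (suc n) = cong (+ (Q ℕ.^ suc n) +ᶻ_) (∑-powers n)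

  -- Evaluation and the number of roots

  module Evaluation where

    open import Data.Nat.Base as ℕ using (ℕ; zero; suc; _≤_; z≤n; s≤s; _⊔_) renaming (_+_ to _+ℕ_)
    import Data.Nat.Properties as ℕ
    open import Data.Integer.Base as ℤ using (1ℤ) renaming (_+_ to _+ᶻ_)
    import Data.Integer.Properties as ℤ
    open import Data.Vec.Base using (Vec; []; _∷_)
    open import Data.Product using (_,_; ∃)
    open import Relation.Nullary using (Dec; yes; no)
    open import Relation.Binary.PropositionalEquality
    open import Function.Base using (_∘_)
    open IntegerSums

    open 𝔽
    open Solver using (solve; _:=_; _:+_; _:*_; _:-_; :-_; con)
    open Polys
    open Factorization
    open ≡-Reasoning

    horner : ∀ {n} → Vec Carrier n → Carrier → Carrier
    horner []      x = 1#
    horner (a ∷ v) x = a + x * horner v x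

    -- The coefficients of the quotient of v by X - c are the values at c of the tails of v.
    synthetic : ∀ {n} → Carrier → Vec Carrier (suc n) → Vec Carrier n
    synthetic c (a ∷ [])    = []
    synthetic c (a ∷ b ∷ v) = horner (b ∷ v) c ∷ synthetic c (b ∷ v)

    horner-synthetic : ∀ {n} c (v : Vec Carrier (suc n)) x → horner v x ≡ (x - c) * horner (synthetic c v) x + horner v c
    horner-synthetic c (a ∷ [])    x = solve 3 (λ a x c → a :+ x :* con 1ℤ := (x :- c) :* con 1ℤ :+ (a :+ c :* con 1ℤ)) refl a x c
    horner-synthetic c (a ∷ b ∷ v) x = trans (cong (λ z → a + x * z) (horner-synthetic c (b ∷ v) x))
      (solve 5 (λ a x c h s → a :+ x :* ((x :- c) :* s :+ h) := (x :- c) :* (h :+ x :* s) :+ (a :+ c :* h)) refl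
        a x c (horner (b ∷ v) c) (horner (synthetic c (b ∷ v)) x))

    -- Induction on the degree: every root is the found root `c` or a root of the quotient by
    -- `X - c`.
    root-count-horner : ∀ {n} (v : Vec Carrier n) → ∑ elements (λ x → ι (horner v x ≟ 0#)) ℤ.≤ ℤ.+ n
    root-count-horner {zero}  []  = ℤ.≤-reflexive (trans (∑-cong elements (λ x → ι-no (1# ≟ 0#) 1≢0)) (∑-ε elements))
    root-count-horner {suc n} v = by-root (FiniteAny (λ x → horner v x ≟ 0#))
      where
      open FiniteSums using (Finite)
      FiniteAny = Finite.any? finite
      by-root : Dec (∃ λ x → horner v x ≡ 0#) → ∑ elements (λ x → ι (horner v x ≟ 0#)) ℤ.≤ ℤ.+ suc n
      by-root (no ¬r) = ℤ.≤-trans (ℤ.≤-reflexive (trans (∑-cong elements (λ x → ι-no (horner v x ≟ 0#) (λ e → ¬r (x , e)))) (∑-ε elements))) (ℤ.+≤+ z≤n)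
      by-root (yes (c , vc≡0)) = ℤ.≤-trans (∑-mono elements step) (ℤ.≤-trans (ℤ.≤-reflexive (∑-∙ elements (λ x → ι (x ≟ c)) (λ x → ι (horner (synthetic c v) x ≟ 0#))))
        (ℤ.+-mono-≤ (ℤ.≤-reflexive (∑-ι1 finite c)) (root-count-horner (synthetic c v))))
        where
        factor : ∀ x → horner v x ≡ (x - c) * horner (synthetic c v) x
        factor x = trans (horner-synthetic c v x) (trans (cong ((x - c) * horner (synthetic c v) x +_) vc≡0) (+-identityʳ _))
        step : ∀ x → ι (horner v x ≟ 0#) ℤ.≤ ι (x ≟ c) +ᶻ ι (horner (synthetic c v) x ≟ 0#)
        step x with x ≟ c | horner (synthetic c v) x ≟ 0#
        ... | yes _   | d     = ℤ.≤-trans (ι≤1 (horner v x ≟ 0#)) (ℤ.≤-trans (ℤ.≤-reflexive (sym (ℤ.+-identityʳ 1ℤ))) (ℤ.+-monoʳ-≤ 1ℤ (ι≥0 d)))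
        ... | no _    | yes _ = ι≤1 (horner v x ≟ 0#)
        ... | no x≢c  | no s≢0 = ℤ.≤-reflexive (ι-no (horner v x ≟ 0#) λ e → *-≢0 (x≢c ∘ x-y≡0⇒x≡y) s≢0 (trans (sym (factor x)) e))

    evalTo : ℕ → Series → Carrier → Carrier
    evalTo zero    f x = 0#
    evalTo (suc n) f x = f 0 + x * evalTo n (shift f) x

    evalTo-cong : ∀ n {f g : Series} → f ≗ g → ∀ x → evalTo n f x ≡ evalTo n g x
    evalTo-cong zero    e x = refl
    evalTo-cong (suc n) e x = cong₂ (λ a b → a + x * b) (e 0) (evalTo-cong n (e ∘ suc) x)

    evalTo-zero : ∀ n {f} → Below f 0 → ∀ x → evalTo n f x ≡ 0#
    evalTo-zero zero    h x = refl
    evalTo-zero (suc n) h x = trans (cong₂ _+_ (h 0 z≤n) (trans (cong (x *_) (evalTo-zero n (λ i _ → h (suc i) z≤n) x)) (zeroʳ x))) (+-identityˡ 0#)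

    evalTo-stable : ∀ {m n f} → Below f m → m ≤ n → ∀ x → evalTo n f x ≡ evalTo m f x
    evalTo-stable {n = n} h z≤n       x = evalTo-zero n h x
    evalTo-stable {f = f} h (s≤s m≤n) x = cong (λ z → f 0 + x * z) (evalTo-stable (λ i p → h (suc i) (s≤s p)) m≤n x)

    evalTo-+ : ∀ n f g x → evalTo n (λ i → f i + g i) x ≡ evalTo n f x + evalTo n g x
    evalTo-+ zero    f g x = sym (+-identityˡ 0#)
    evalTo-+ (suc n) f g x = trans (cong (λ z → f 0 + g 0 + x * z) (evalTo-+ n (shift f) (shift g) x))
      (solve 5 (λ a b x c d → a :+ b :+ x :* (c :+ d) := a :+ x :* c :+ (b :+ x :* d)) refl (f 0) (g 0) x _ _)

    evalTo-scale : ∀ n c f x → evalTo n (λ i → c * f i) x ≡ c * evalTo n f x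
    evalTo-scale zero    c f x = sym (zeroʳ c)
    evalTo-scale (suc n) c f x = trans (cong (λ z → c * f 0 + x * z) (evalTo-scale n c (shift f) x))
      (solve 4 (λ c a x b → c :* a :+ x :* (c :* b) := c :* (a :+ x :* b)) refl c (f 0) x _)

    evalTo-⊛ : ∀ m n {f g} → Below f m → Below g n → ∀ x → evalTo (m +ℕ n) (f ⊛ g) x ≡ evalTo m f x * evalTo n g x
    evalTo-⊛ zero    n {f} {g} hf hg x = trans (evalTo-zero n (λ i _ → ⊛-zeroˡ f g (λ j → hf j z≤n) i) x) (sym (zeroˡ _))
    evalTo-⊛ (suc m) n {f} {g} hf hg x = begin
      f 0 * g 0 + x * evalTo (m +ℕ n) (λ i → f 0 * g (suc i) + (shift f ⊛ g) i) x
        ≡⟨ cong (λ z → f 0 * g 0 + x * z) (trans (evalTo-+ (m +ℕ n) (λ i → f 0 * g (suc i)) (shift f ⊛ g) x)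
             (cong₂ _+_ (evalTo-scale (m +ℕ n) (f 0) (shift g) x) (evalTo-⊛ m n (λ i p → hf (suc i) (s≤s p)) hg x))) ⟩
      f 0 * g 0 + x * (f 0 * evalTo (m +ℕ n) (shift g) x + evalTo m (shift f) x * evalTo n g x)
        ≡⟨ solve 6 (λ a b x c d e → a :* b :+ x :* (a :* c :+ d :* e) := a :* (b :+ x :* c) :+ x :* (d :* e)) refl (f 0) (g 0) x _ _ _ ⟩
      f 0 * evalTo (suc (m +ℕ n)) g x + x * (evalTo m (shift f) x * evalTo n g x)
        ≡⟨ cong (λ z → f 0 * z + x * (evalTo m (shift f) x * evalTo n g x)) (evalTo-stable hg (ℕ.m≤n+m n (suc m)) x) ⟩
      f 0 * evalTo n g x + x * (evalTo m (shift f) x * evalTo n g x)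
        ≡⟨ solve 4 (λ a e x d → a :* e :+ x :* (d :* e) := (a :+ x :* d) :* e) refl (f 0) (evalTo n g x) x (evalTo m (shift f) x) ⟩
      (f 0 + x * evalTo m (shift f) x) * evalTo n g x ∎

    eval : Poly → Carrier → Carrier
    eval f x = evalTo (bound f) (coeff f) x

    eval-at : ∀ n f → Below (coeff f) n → ∀ x → eval f x ≡ evalTo n (coeff f) x
    eval-at n f h x = trans (sym (evalTo-stable (bounded f) (ℕ.m≤m⊔n (bound f) n) x)) (evalTo-stable h (ℕ.m≤n⊔m (bound f) n) x)

    eval-cong : ∀ {f g} → f ≈ g → ∀ x → eval f x ≡ eval g x
    eval-cong {f} {g} e x = trans (evalTo-cong (bound f) (at e) x) (sym (eval-at (bound f) g (λ i p → trans (sym (at e i)) (bounded f i p)) x))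

    eval-⊗ : ∀ f g x → eval (f ⊗ g) x ≡ eval f x * eval g x
    eval-⊗ f g x = begin
      eval (f ⊗ g) x                                      ≡⟨ eval-at n (f ⊗ g) (λ i p → trans (coeff-⊗ f g i) (Below-⊛ (bound f) (bounded f) (bounded g) i p)) x ⟩
      evalTo n (coeff (f ⊗ g)) x                          ≡⟨ evalTo-cong n (coeff-⊗ f g) x ⟩
      evalTo n (coeff f ⊛ coeff g) x                      ≡⟨ evalTo-⊛ (bound f) (bound g) (bounded f) (bounded g) x ⟩
      eval f x * eval g x                                 ∎
      where
      n : ℕ
      n = bound f +ℕ bound g

    eval-⊕ : ∀ f g x → eval (f ⊕ g) x ≡ eval f x + eval g x
    eval-⊕ f g x = begin
      eval (f ⊕ g) x                                      ≡⟨ eval-at n (f ⊕ g) (λ i p → trans (coeff-⊕ f g i) (Below-+ hf hg i p)) x ⟩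
      evalTo n (coeff (f ⊕ g)) x                          ≡⟨ evalTo-cong n (coeff-⊕ f g) x ⟩
      evalTo n (λ i → coeff f i + coeff g i) x            ≡⟨ evalTo-+ n (coeff f) (coeff g) x ⟩
      evalTo n (coeff f) x + evalTo n (coeff g) x         ≡⟨ cong₂ _+_ (eval-at n f hf x) (eval-at n g hg x) ⟨
      eval f x + eval g x                                 ∎
      where
      n : ℕ
      n = bound f ⊔ bound g
      hf : Below (coeff f) n
      hf = Below-mono (ℕ.m≤m⊔n (bound f) (bound g)) (bounded f)
      hg : Below (coeff g) n
      hg = Below-mono (ℕ.m≤n⊔m (bound f) (bound g)) (bounded g)

    eval-1 : ∀ x → eval 1ₚ x ≡ 1#
    eval-1 x = trans (cong (1# +_) (zeroʳ x)) (+-identityʳ 1#)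

    eval-monPoly : ∀ {n} (v : Vec Carrier n) x → eval (monPoly v) x ≡ horner v x
    eval-monPoly []      x = eval-1 x
    eval-monPoly (a ∷ v) x = cong (λ z → a + x * z) (eval-monPoly v x)

    root-count : ∀ {n f} → Monic n f → ∑ elements (λ x → ι (eval f x ≟ 0#)) ℤ.≤ ℤ.+ n
    root-count {n} {f} mf = ℤ.≤-trans (ℤ.≤-reflexive (∑-cong elements (λ x → cong (λ z → ι (z ≟ 0#))
      (trans (eval-cong (Ring.sym (monPoly-take mf)) x) (eval-monPoly (take n (coeff f)) x))))) (root-count-horner (take n (coeff f)))

-- Field extensions of every degree

module Extensions where

  open import Algebra.Bundles using (CommutativeRing)
  open import Algebra.Structures using (IsCommutativeRing)
  open import Data.Nat.Base as ℕ using (ℕ; zero; suc) renaming (_*_ to _*ℕ_)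
  import Data.Nat.Properties as ℕ
  open import Data.Vec.Base using (Vec; []; _∷_; zipWith; map; replicate)
  open import Data.Vec.Properties using (zipWith-assoc; zipWith-comm; zipWith-identityˡ; zipWith-identityʳ; zipWith-inverseˡ; zipWith-inverseʳ)
  open import Data.Product using (_,_; proj₁; proj₂)
  open import Data.Sum using (_⊎_)
  import Data.Sum
  open import Relation.Nullary using (contradiction)
  open import Relation.Binary.PropositionalEquality
  open FiniteSums using (Finite; vecFinite; length-vectors)
  open FiniteField using (Field)
  import Algebra.Properties.Semiring.Mult

  -- The additive bijection with vectors over `K` is kept as part of the data: composed along the
  -- tower of fields, such bijections identify `L₁ × L₂` with a power of the prime field.
  record Extension {p} (K : Field p) (n : ℕ) : Set₁ where
    private module K = Field K
    field
      extension : Field p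
    private module L = Field extension
    field
      embed   : K.Carrier → L.Carrier
      embed-+ : ∀ a b → embed (a K.+ b) ≡ embed a L.+ embed b
      embed-* : ∀ a b → embed (a K.* b) ≡ embed a L.* embed b
      embed-1 : embed K.1# ≡ L.1#
      card-L  : L.card ≡ K.card ℕ.^ n
      vector  : Vec K.Carrier n → L.Carrier
      coords  : L.Carrier → Vec K.Carrier n
      vector-+      : ∀ v w → vector (zipWith K._+_ v w) ≡ vector v L.+ vector w
      vector-coords : ∀ x → vector (coords x) ≡ x
      coords-vector : ∀ v → coords (vector v) ≡ v

  module Quotient {p : ℕ} (K : Field p) (n : ℕ) (P : Polynomials.Poly K) (irr : PolynomialTheory.Factorization.Irreducible K n P) where

    private module T = PolynomialTheory K
    open T.𝔽
    open T.Polys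
    open T.Factorization
    open Irreducible irr renaming (isMonic to P-monic)

    private
      module S = PolySolver

      Elem : Set
      Elem = Vec Carrier n

    infix 4 _~_

    record _~_ (f g : Poly) : Set where
      constructor congruent
      field
        cofactor : Poly
        equation : f ≈ g ⊕ P ⊗ cofactor

    ≈⇒~ : ∀ {f g} → f ≈ g → f ~ g
    ≈⇒~ {f} {g} e = congruent 0ₚ (Ring.trans e (Ring.sym (Ring.trans (Ring.+-congˡ (Ring.zeroʳ P)) (Ring.+-identityʳ g))))

    ~-sym : ∀ {f g} → f ~ g → g ~ f
    ~-sym {f} {g} (congruent q e) = congruent (negate q) (Ring.trans
      (S.solve 3 (λ g p q → g S.:= g S.:+ p S.:* q S.:+ p S.:* S.:- q) Ring.refl g P q) (Ring.+-congʳ (Ring.sym e)))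

    ~-trans : ∀ {f g h} → f ~ g → g ~ h → f ~ h
    ~-trans {f} {g} {h} (congruent q e) (congruent q′ e′) = congruent (q′ ⊕ q) (Ring.trans e (Ring.trans (Ring.+-congʳ e′)
      (S.solve 4 (λ h p q q′ → h S.:+ p S.:* q′ S.:+ p S.:* q S.:= h S.:+ p S.:* (q′ S.:+ q)) Ring.refl h P q q′)))

    ~-⊕ : ∀ {f f′ g g′} → f ~ f′ → g ~ g′ → f ⊕ g ~ f′ ⊕ g′
    ~-⊕ {f} {f′} {g} {g′} (congruent q e) (congruent q′ e′) = congruent (q ⊕ q′) (Ring.trans (Ring.+-cong e e′)
      (S.solve 5 (λ f g p q q′ → (f S.:+ p S.:* q) S.:+ (g S.:+ p S.:* q′) S.:= f S.:+ g S.:+ p S.:* (q S.:+ q′)) Ring.refl f′ g′ P q q′))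

    ~-⊗ : ∀ {f f′ g g′} → f ~ f′ → g ~ g′ → f ⊗ g ~ f′ ⊗ g′
    ~-⊗ {f} {f′} {g} {g′} (congruent q e) (congruent q′ e′) = congruent (f′ ⊗ q′ ⊕ g′ ⊗ q ⊕ P ⊗ q ⊗ q′) (Ring.trans (Ring.*-cong e e′)
      (S.solve 5 (λ f g p q q′ → (f S.:+ p S.:* q) S.:* (g S.:+ p S.:* q′) S.:= f S.:* g S.:+ p S.:* (f S.:* q′ S.:+ g S.:* q S.:+ p S.:* q S.:* q′)) Ring.refl f′ g′ P q q′))

    abstract
      reduce : Poly → Elem
      reduce f = take n (coeff (proj₁ (proj₂ (divide P-monic f))))

      low-reduce : ∀ f → lowPoly (reduce f) ~ f
      low-reduce f with divide P-monic f
      ... | q , r , e , br = ~-sym (congruent q (Ring.trans e (Ring.trans (Ring.+-comm (P ⊗ q) r) (Ring.+-congʳ (Ring.sym (coeffwise (low-take n br)))))))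

    -- Polynomials shorter than `P` are their own remainders. Since `lowPoly` turns the operations
    -- on `Elem` into those on polynomials modulo `P`, the multiplicative laws of the quotient
    -- follow from those of the polynomial ring.
    low-injective : ∀ {v w : Elem} → lowPoly v ~ lowPoly w → v ≡ w
    low-injective {v} {w} (congruent q e) = trans (sym (take-low v)) (trans (take-cong n (at (proj₂ (remainder-unique P-monic {q = 0ₚ} {q′ = q} (low-below v) (low-below w)
      (Ring.trans (Ring.trans (Ring.+-congʳ (Ring.zeroʳ P)) (Ring.+-identityˡ (lowPoly v))) (Ring.trans e (Ring.+-comm (lowPoly w) (P ⊗ q)))))))) (take-low w))

    _+ᴸ_ _*ᴸ_ : Elem → Elem → Elem
    _+ᴸ_ = zipWith _+_
    v *ᴸ w = reduce (lowPoly v ⊗ lowPoly w)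

    -ᴸ_ : Elem → Elem
    -ᴸ_ = map (λ a → - a)

    0ᴸ 1ᴸ : Elem
    0ᴸ = replicate n 0#
    1ᴸ = reduce 1ₚ

    low-+ : ∀ v w → lowPoly (v +ᴸ w) ~ lowPoly v ⊕ lowPoly w
    low-+ v w = ≈⇒~ (coeffwise λ i → trans (go v w i) (sym (coeff-⊕ (lowPoly v) (lowPoly w) i)))
      where
      go : ∀ {n} (v w : Vec Carrier n) i → low (zipWith _+_ v w) i ≡ low v i + low w i
      go []      []      i       = sym (+-identityˡ 0#)
      go (a ∷ v) (b ∷ w) zero    = refl
      go (a ∷ v) (b ∷ w) (suc i) = go v w i

    low-* : ∀ v w → lowPoly (v *ᴸ w) ~ lowPoly v ⊗ lowPoly w
    low-* v w = low-reduce (lowPoly v ⊗ lowPoly w)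

    low-0 : lowPoly 0ᴸ ~ 0ₚ
    low-0 = ≈⇒~ (coeffwise λ i → trans (go n i) (sym (zeros i)))
      where
      go : ∀ n i → low (replicate n 0#) i ≡ 0#
      go zero    i       = refl
      go (suc n) zero    = refl
      go (suc n) (suc i) = go n i

    low-1 : lowPoly 1ᴸ ~ 1ₚ
    low-1 = low-reduce 1ₚ

    ~-refl : ∀ {f} → f ~ f
    ~-refl = ≈⇒~ Ring.refl

    *ᴸ-comm : ∀ v w → v *ᴸ w ≡ w *ᴸ v
    *ᴸ-comm v w = low-injective (~-trans (low-* v w) (~-trans (≈⇒~ (Ring.*-comm _ _)) (~-sym (low-* w v))))

    *ᴸ-assoc : ∀ u v w → (u *ᴸ v) *ᴸ w ≡ u *ᴸ (v *ᴸ w)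
    *ᴸ-assoc u v w = low-injective (~-trans (low-* (u *ᴸ v) w) (~-trans (~-⊗ (low-* u v) ~-refl) (~-trans (≈⇒~ (Ring.*-assoc (lowPoly u) (lowPoly v) (lowPoly w)))
      (~-sym (~-trans (low-* u (v *ᴸ w)) (~-⊗ ~-refl (low-* v w)))))))

    *ᴸ-identityˡ : ∀ v → 1ᴸ *ᴸ v ≡ v
    *ᴸ-identityˡ v = low-injective (~-trans (low-* 1ᴸ v) (~-trans (~-⊗ low-1 ~-refl) (≈⇒~ (Ring.*-identityˡ _))))

    *ᴸ-distribˡ : ∀ u v w → u *ᴸ (v +ᴸ w) ≡ (u *ᴸ v) +ᴸ (u *ᴸ w)
    *ᴸ-distribˡ u v w = low-injective (~-trans (low-* u (v +ᴸ w)) (~-trans (~-⊗ ~-refl (low-+ v w)) (~-trans (≈⇒~ (Ring.distribˡ (lowPoly u) (lowPoly v) (lowPoly w)))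
      (~-sym (~-trans (low-+ (u *ᴸ v) (u *ᴸ w)) (~-⊕ (low-* u v) (low-* u w)))))))

    isCommutativeRingᴸ : IsCommutativeRing _≡_ _+ᴸ_ _*ᴸ_ -ᴸ_ 0ᴸ 1ᴸ
    isCommutativeRingᴸ = record
      { isRing = record
        { +-isAbelianGroup = record
          { isGroup = record
            { isMonoid = record
              { isSemigroup = record
                { isMagma = record { isEquivalence = isEquivalence ; ∙-cong = cong₂ _+ᴸ_ }
                ; assoc = zipWith-assoc +-assoc }
              ; identity = zipWith-identityˡ +-identityˡ , zipWith-identityʳ +-identityʳ }
            ; inverse = zipWith-inverseˡ -‿inverseˡ , zipWith-inverseʳ -‿inverseʳ
            ; ⁻¹-cong = cong -ᴸ_ }
          ; comm = zipWith-comm +-comm }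
        ; *-cong = cong₂ _*ᴸ_
        ; *-assoc = *ᴸ-assoc
        ; *-identity = *ᴸ-identityˡ , (λ v → trans (*ᴸ-comm v 1ᴸ) (*ᴸ-identityˡ v))
        ; distrib = *ᴸ-distribˡ , (λ u v w → trans (*ᴸ-comm (v +ᴸ w) u) (trans (*ᴸ-distribˡ u v w) (cong₂ _+ᴸ_ (*ᴸ-comm u v) (*ᴸ-comm u w)))) }
      ; *-comm = *ᴸ-comm }

    ringᴸ : CommutativeRing _ _
    ringᴸ = record { isCommutativeRing = isCommutativeRingᴸ }

    private
      module Rᴸ = CommutativeRing ringᴸ
      open Algebra.Properties.Semiring.Mult Rᴸ.semiring using () renaming (_×_ to _×ᴸ_)
      open Algebra.Properties.Semiring.Mult (CommutativeRing.semiring commutativeRing) using (_×_)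

    vectors : Finite Elem
    vectors = vecFinite finite n

    ∣⇒~0 : ∀ {f} → P ∣ f → f ~ 0ₚ
    ∣⇒~0 (divides q e) = congruent q (Ring.trans e (Ring.sym (Ring.+-identityˡ _)))

    ~0⇒∣ : ∀ {f} → f ~ 0ₚ → P ∣ f
    ~0⇒∣ (congruent q e) = divides q (Ring.trans e (Ring.+-identityˡ _))

    zero-productᴸ : ∀ {v w} → v *ᴸ w ≡ 0ᴸ → v ≡ 0ᴸ ⊎ w ≡ 0ᴸ
    zero-productᴸ {v} {w} e = Data.Sum.map vanishes vanishes (euclid irr (lowPoly v) (lowPoly w)
      (~0⇒∣ (~-trans (~-sym (low-* v w)) (~-trans (≈⇒~ (Ring.reflexive (cong lowPoly e))) low-0))))
      where
      vanishes : ∀ {u} → P ∣ lowPoly u → u ≡ 0ᴸ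
      vanishes P∣u = low-injective (~-trans (∣⇒~0 P∣u) (~-sym low-0))

    1≢0ᴸ : 1ᴸ ≢ 0ᴸ
    1≢0ᴸ e = contradiction (∣-degree monic-1 P-monic (~0⇒∣ (~-trans (~-sym low-1) (~-trans (≈⇒~ (Ring.reflexive (cong lowPoly e))) low-0))))
      (ℕ.<⇒≱ positive)

    scalar : Carrier → Elem
    scalar a = reduce (constantPoly a)

    low-scalar : ∀ a → lowPoly (scalar a) ~ constantPoly a
    low-scalar a = low-reduce (constantPoly a)

    constant-+ : ∀ a b → constantPoly (a + b) ≈ constantPoly a ⊕ constantPoly b
    constant-+ a b = coeffwise λ where
      zero    → sym (coeff-⊕ (constantPoly a) (constantPoly b) 0)
      (suc i) → sym (trans (coeff-⊕ (constantPoly a) (constantPoly b) (suc i)) (+-identityˡ 0#))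

    constant-* : ∀ a b → constantPoly (a * b) ≈ constantPoly a ⊗ constantPoly b
    constant-* a b = coeffwise λ where
      zero    → sym (coeff-scale a (constantPoly b) 0)
      (suc i) → sym (trans (coeff-scale a (constantPoly b) (suc i)) (zeroʳ a))

    scalar-+ : ∀ a b → scalar (a + b) ≡ scalar a +ᴸ scalar b
    scalar-+ a b = low-injective (~-trans (low-scalar (a + b)) (~-trans (≈⇒~ (constant-+ a b))
      (~-sym (~-trans (low-+ (scalar a) (scalar b)) (~-⊕ (low-scalar a) (low-scalar b))))))

    scalar-* : ∀ a b → scalar (a * b) ≡ scalar a *ᴸ scalar b
    scalar-* a b = low-injective (~-trans (low-scalar (a * b)) (~-trans (≈⇒~ (constant-* a b))
      (~-sym (~-trans (low-* (scalar a) (scalar b)) (~-⊗ (low-scalar a) (low-scalar b))))))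

    scalar-0 : scalar 0# ≡ 0ᴸ
    scalar-0 = low-injective (~-trans (low-scalar 0#) (~-sym low-0))

    scalar-× : ∀ m → m ×ᴸ 1ᴸ ≡ scalar (m × 1#)
    scalar-× zero    = sym scalar-0
    scalar-× (suc m) = trans (cong (1ᴸ +ᴸ_) (scalar-× m)) (sym (scalar-+ 1# (m × 1#)))

    fieldᴸ : Field p
    fieldᴸ = record
      { Carrier           = Elem
      ; isCommutativeRing = isCommutativeRingᴸ
      ; _⁻¹               = FiniteDomain._⁻¹ isCommutativeRingᴸ vectors zero-productᴸ
      ; 1≢0               = 1≢0ᴸ
      ; *-inverseʳ        = FiniteDomain.*-inverseʳ isCommutativeRingᴸ vectors zero-productᴸ
      ; finite            = vectors
      ; exponent          = exponent *ℕ n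
      ; card-≡            = trans (length-vectors elements n) (trans (cong (ℕ._^ n) card-≡) (ℕ.^-*-assoc p exponent n))
      ; characteristic    = trans (scalar-× p) (trans (cong scalar characteristic) scalar-0)
      }

    quotientExtension : Extension K n
    quotientExtension = record
      { extension = fieldᴸ
      ; embed = scalar ; embed-+ = scalar-+ ; embed-* = scalar-* ; embed-1 = refl
      ; card-L = length-vectors elements n
      ; vector = λ v → v ; coords = λ v → v
      ; vector-+ = λ _ _ → refl ; vector-coords = λ _ → refl ; coords-vector = λ _ → refl }

  abstract
    extensionOfDegree : ∀ {p} (K : Field p) n → Extension K (suc n)
    extensionOfDegree K n with PolynomialTheory.PrimeExistence.prime-exists K n
    ... | PolynomialTheory.PrimePowers.mkPrime _ P irr , refl = Quotient.quotientExtension K (suc n) P irr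

-- The Frobenius map and Fermat's theorem for finite fields

module Frobenius {p : ℕ} (p-prime : Prime p) (F : Field p) where

  open import Algebra.Bundles using (CommutativeRing)
  open import Data.Nat.Base as ℕ using (ℕ; zero; suc; _≤_; _<_; z≤n; s≤s; _∸_)
  import Data.Nat.Properties as ℕ
  open import Data.Nat.Combinatorics using (_C_; nCk+nC[k+1]≡[n+1]C[k+1]; nCn≡1; k>n⇒nCk≡0)
  open import Data.Nat.Divisibility using (_∣_; divides; m∣m*n; >⇒∤)
  open import Data.Nat.Primality using (euclidsLemma; prime⇒nonTrivial)
  open import Data.Nat.Tactic.RingSolver using (solve-∀)
  open import Data.Fin.Base using (Fin; zero; suc; toℕ; fromℕ; inject₁)
  open import Data.Fin.Properties using (toℕ<n; toℕ-fromℕ; toℕ-inject₁)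
  open import Data.List.Base using (List; []; _∷_; length)
  open import Data.Sum using (inj₁; inj₂)
  open import Relation.Nullary using (Dec; yes; no; contradiction)
  open import Relation.Binary.PropositionalEquality
  open FiniteSums using (module MonoidSum)

  open Field F
  open import Algebra.Properties.Semiring.Mult (CommutativeRing.semiring commutativeRing) using (_×_; ×-assocˡ; ×-assoc-*)
  open import Algebra.Properties.Semiring.Exp (CommutativeRing.semiring commutativeRing) using (_^_; ^-assocʳ; ^-homo-*) public
  open import Algebra.Properties.CommutativeSemiring.Exp (CommutativeRing.commutativeSemiring commutativeRing) using (^-distrib-*) public
  open import Algebra.Properties.CommutativeSemiring.Binomial (CommutativeRing.commutativeSemiring commutativeRing) using (theorem; binomialTerm)
  open import Algebra.Properties.Semiring.Sum (CommutativeRing.semiring commutativeRing) using (sum; sum-init-last; sum-cong-≗; sum-replicate-zero)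
  open ≡-Reasoning

  -- By Pascal's rule. For `suc n = p` it shows that `p` divides `suc k` times the binomial
  -- coefficient, hence the coefficient itself when `suc k < p`.
  absorption : ∀ n k → suc k ℕ.* (suc n C suc k) ≡ suc n ℕ.* (n C k)
  absorption zero    zero    = refl
  absorption zero    (suc k) = trans (cong (suc (suc k) ℕ.*_) (k>n⇒nCk≡0 {1} {suc (suc k)} (s≤s (s≤s z≤n))))
    (trans (ℕ.*-zeroʳ (suc (suc k))) (sym (cong (1 ℕ.*_) (k>n⇒nCk≡0 {0} {suc k} (s≤s z≤n)))))
  absorption (suc n) k = begin
    suc k ℕ.* (suc (suc n) C suc k)
      ≡⟨ cong (suc k ℕ.*_) (nCk+nC[k+1]≡[n+1]C[k+1] (suc n) k) ⟨
    suc k ℕ.* ((suc n C k) ℕ.+ (suc n C suc k))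
      ≡⟨ ℕ.*-distribˡ-+ (suc k) (suc n C k) (suc n C suc k) ⟩
    suc k ℕ.* (suc n C k) ℕ.+ suc k ℕ.* (suc n C suc k)
      ≡⟨ cong (suc k ℕ.* (suc n C k) ℕ.+_) (absorption n k) ⟩
    suc k ℕ.* (suc n C k) ℕ.+ suc n ℕ.* (n C k)
      ≡⟨ step k ⟩
    suc (suc n) ℕ.* (suc n C k) ∎
    where
    step : ∀ k → suc k ℕ.* (suc n C k) ℕ.+ suc n ℕ.* (n C k) ≡ suc (suc n) ℕ.* (suc n C k)
    step zero    = refl
    step (suc k) = begin
      (suc n C suc k) ℕ.+ suc k ℕ.* (suc n C suc k) ℕ.+ suc n ℕ.* (n C suc k)
        ≡⟨ cong (λ z → (suc n C suc k) ℕ.+ z ℕ.+ suc n ℕ.* (n C suc k)) (absorption n k) ⟩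
      (suc n C suc k) ℕ.+ suc n ℕ.* (n C k) ℕ.+ suc n ℕ.* (n C suc k)
        ≡⟨ distribute (suc n C suc k) (suc n) (n C k) (n C suc k) ⟩
      (suc n C suc k) ℕ.+ suc n ℕ.* ((n C k) ℕ.+ (n C suc k))
        ≡⟨ cong (λ z → (suc n C suc k) ℕ.+ suc n ℕ.* z) (nCk+nC[k+1]≡[n+1]C[k+1] n k) ⟩
      (suc n C suc k) ℕ.+ suc n ℕ.* (suc n C suc k) ∎
      where
      distribute : ∀ a b c d → a ℕ.+ b ℕ.* c ℕ.+ b ℕ.* d ≡ a ℕ.+ b ℕ.* (c ℕ.+ d)
      distribute = solve-∀

  p∣binomial : ∀ n → p ≡ suc n → ∀ k → suc k < suc n → p ∣ (suc n C suc k)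
  p∣binomial n refl k k<n with euclidsLemma (suc k) (suc n C suc k) p-prime (subst (p ∣_) (sym (absorption n k)) (m∣m*n (n C k)))
  ... | inj₁ p∣k = contradiction p∣k (>⇒∤ k<n)
  ... | inj₂ p∣C = p∣C

  p×x≡0 : ∀ x → p × x ≡ 0#
  p×x≡0 x = begin
    p × x             ≡⟨ cong (p ×_) (*-identityˡ x) ⟨
    p × (1# * x)      ≡⟨ ×-assoc-* p 1# x ⟨
    (p × 1#) * x      ≡⟨ cong (_* x) characteristic ⟩
    0# * x            ≡⟨ zeroˡ x ⟩
    0#                ∎

  multiple-of-p : ∀ {m} → p ∣ m → ∀ x → m × x ≡ 0#
  multiple-of-p (divides q refl) x = trans (sym (×-assocˡ x q p)) (trans (cong (q ×_) (p×x≡0 x)) (×-zero q))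
    where
    ×-zero : ∀ q → q × 0# ≡ 0#
    ×-zero zero    = refl
    ×-zero (suc q) = trans (+-identityˡ _) (×-zero q)

  ^-p-+ : ∀ x y → (x + y) ^ p ≡ x ^ p + y ^ p
  ^-p-+ x y = go p refl
    where
    go : ∀ m → p ≡ m → (x + y) ^ m ≡ x ^ m + y ^ m
    go zero    e = contradiction (ℕ.nonTrivial⇒n>1 p {{prime⇒nonTrivial p-prime}}) (λ 1<p → contradiction (subst (1 <_) e 1<p) λ ())
    go (suc n) e = begin
      (x + y) ^ suc n
        ≡⟨ theorem (suc n) x y ⟩
      t zero + sum (λ k → t (suc k))
        ≡⟨ cong (t zero +_) (sum-init-last (λ k → t (suc k))) ⟩
      t zero + (sum (λ k → t (suc (inject₁ k))) + t (suc (fromℕ n)))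
        ≡⟨ cong₂ (λ a b → a + (b + t (suc (fromℕ n)))) first (trans (sum-cong-≗ middle) (sum-replicate-zero n)) ⟩
      y ^ suc n + (0# + t (suc (fromℕ n)))
        ≡⟨ cong (y ^ suc n +_) (trans (+-identityˡ _) last) ⟩
      y ^ suc n + x ^ suc n
        ≡⟨ +-comm _ _ ⟩
      x ^ suc n + y ^ suc n ∎
      where
      t : Fin (suc (suc n)) → Carrier
      t = binomialTerm x y (suc n)
      first : t zero ≡ y ^ suc n
      first = trans (+-identityʳ _) (*-identityˡ _)
      middle : ∀ k → t (suc (inject₁ k)) ≡ 0#
      middle k = multiple-of-p (subst (λ i → p ∣ (suc n C suc i)) (sym (toℕ-inject₁ k)) (p∣binomial n e (toℕ k) (s≤s (toℕ<n k)))) _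
      last : t (suc (fromℕ n)) ≡ x ^ suc n
      last = begin
        (suc n C suc (toℕ (fromℕ n))) × (x ^ suc (toℕ (fromℕ n)) * y ^ (n ∸ toℕ (fromℕ n)))
          ≡⟨ cong (λ i → (suc n C suc i) × (x ^ suc i * y ^ (n ∸ i))) (toℕ-fromℕ n) ⟩
        (suc n C suc n) × (x ^ suc n * y ^ (n ∸ n))
          ≡⟨ cong₂ (λ c i → c × (x ^ suc n * y ^ i)) (nCn≡1 (suc n)) (ℕ.n∸n≡0 n) ⟩
        x ^ suc n * 1# + 0#
          ≡⟨ trans (+-identityʳ _) (*-identityʳ _) ⟩
        x ^ suc n ∎

  ^-p^-+ : ∀ m x y → (x + y) ^ (p ℕ.^ m) ≡ x ^ (p ℕ.^ m) + y ^ (p ℕ.^ m)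
  ^-p^-+ zero    x y = trans (*-identityʳ _) (sym (cong₂ _+_ (*-identityʳ x) (*-identityʳ y)))
  ^-p^-+ (suc m) x y = begin
    (x + y) ^ (p ℕ.* p ℕ.^ m)                       ≡⟨ ^-assocʳ (x + y) p (p ℕ.^ m) ⟨
    ((x + y) ^ p) ^ (p ℕ.^ m)                       ≡⟨ cong (_^ (p ℕ.^ m)) (^-p-+ x y) ⟩
    (x ^ p + y ^ p) ^ (p ℕ.^ m)                     ≡⟨ ^-p^-+ m (x ^ p) (y ^ p) ⟩
    (x ^ p) ^ (p ℕ.^ m) + (y ^ p) ^ (p ℕ.^ m)       ≡⟨ cong₂ _+_ (^-assocʳ x p (p ℕ.^ m)) (^-assocʳ y p (p ℕ.^ m)) ⟩
    x ^ (p ℕ.* p ℕ.^ m) + y ^ (p ℕ.* p ℕ.^ m)       ∎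

  module ∏ = MonoidSum *-isCommutativeMonoid

  ∏-const : ∀ {A : Set} (xs : List A) x → ∏.∑ xs (λ _ → x) ≡ x ^ length xs
  ∏-const []       x = refl
  ∏-const (_ ∷ xs) x = cong (x *_) (∏-const xs x)

  0^ : ∀ n → 1 ≤ n → 0# ^ n ≡ 0#
  0^ (suc n) _ = zeroˡ _

  -- Multiplication by x permutes the nonzero elements, so it preserves their product.
  fermat : ∀ x → x ^ card ≡ x
  fermat x = by-zero (x ≟ 0#)
    where
    -- Restricts a product to the nonzero `y` by putting 1 at `y = 0`.
    unit : ∀ {y} → Dec (y ≡ 0#) → Carrier → Carrier
    unit (yes _) z = 1#
    unit (no _)  z = z
    unit-≢0 : ∀ {y} (d : Dec (y ≡ 0#)) → unit d y ≢ 0#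
    unit-≢0 (yes _)  = 1≢0
    unit-≢0 (no y≢0) = y≢0
    product : Carrier
    product = ∏.∑ elements (λ y → unit (y ≟ 0#) y)
    ∏-≢0 : ∀ {A : Set} (xs : List A) {f : A → Carrier} → (∀ a → f a ≢ 0#) → ∏.∑ xs f ≢ 0#
    ∏-≢0 []       h = 1≢0
    ∏-≢0 (a ∷ xs) h = *-≢0 (h a) (∏-≢0 xs h)
    1≤card : 1 ≤ card
    1≤card with elements | complete 0#
    ... | _ ∷ _ | _ = s≤s z≤n
    by-zero : Dec (x ≡ 0#) → x ^ card ≡ x
    by-zero (yes refl) = 0^ card 1≤card
    by-zero (no x≢0) = begin
      x ^ card
        ≡⟨ ∏-const elements x ⟨
      ∏.∑ elements (λ y → x)
        -- Of the `card` factors `x`, the one at `y = 0` is separated; the others form the factor by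
        -- which the product of the nonzero elements is scaled, which is 1.
        ≡⟨ ∏.∑-cong elements (λ y → split (y ≟ 0#)) ⟩
      ∏.∑ elements (λ y → ∏.when (y ≟ 0#) x * unit (y ≟ 0#) x)
        ≡⟨ ∏.∑-∙ elements (λ y → ∏.when (y ≟ 0#) x) (λ y → unit (y ≟ 0#) x) ⟩
      ∏.∑ elements (λ y → ∏.when (y ≟ 0#) x) * ∏.∑ elements (λ y → unit (y ≟ 0#) x)
        ≡⟨ cong₂ _*_ (∏.∑-pick finite 0# (λ _ → x)) scales-by-1 ⟩
      x * 1#
        ≡⟨ *-identityʳ x ⟩
      x ∎
      where
      split : ∀ {y} (d : Dec (y ≡ 0#)) → x ≡ ∏.when d x * unit d x
      split (yes _) = sym (*-identityʳ x)
      split (no _)  = sym (*-identityˡ x)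
      scaled : ∀ y (d : Dec (y ≡ 0#)) (d′ : Dec (x * y ≡ 0#)) → unit d′ (x * y) ≡ unit d y * unit d x
      scaled y (yes _)    (yes _)   = sym (*-identityˡ 1#)
      scaled y (yes refl) (no ≢0)   = contradiction (zeroʳ x) ≢0
      scaled y (no y≢0)   (yes ≡0)  = contradiction ≡0 (*-≢0 x≢0 y≢0)
      scaled y (no _)     (no _)    = *-comm x y
      scales-by-1 : ∏.∑ elements (λ y → unit (y ≟ 0#) x) ≡ 1#
      scales-by-1 = *-injectiveˡ (∏-≢0 elements (λ y → unit-≢0 (y ≟ 0#))) (begin
        product * ∏.∑ elements (λ y → unit (y ≟ 0#) x)
          ≡⟨ ∏.∑-∙ elements (λ y → unit (y ≟ 0#) y) (λ y → unit (y ≟ 0#) x) ⟨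
        ∏.∑ elements (λ y → unit (y ≟ 0#) y * unit (y ≟ 0#) x)
          ≡⟨ ∏.∑-cong elements (λ y → scaled y (y ≟ 0#) (x * y ≟ 0#)) ⟨
        ∏.∑ elements (λ y → unit (x * y ≟ 0#) (x * y))
          ≡⟨ ∏.reindex finite finite (x *_) (x ⁻¹ *_) (cancelʳ x≢0) (cancelˡ x≢0) (λ y → unit (y ≟ 0#) y) ⟨
        product
          ≡⟨ *-identityʳ product ⟨
        product * 1# ∎)

open import Relation.Binary.PropositionalEquality using (_≡_)

-- Field homomorphisms applied to coefficients

module PolynomialMaps {p : ℕ} (F F′ : Field p) (h : Field.Carrier F → Field.Carrier F′)
  (h-+ : ∀ a b → h (Field._+_ F a b) ≡ Field._+_ F′ (h a) (h b))
  (h-* : ∀ a b → h (Field._*_ F a b) ≡ Field._*_ F′ (h a) (h b))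
  (h-1 : h (Field.1# F) ≡ Field.1# F′) where

  open import Algebra.Bundles using (CommutativeRing)
  open import Data.Nat.Base as ℕ using (zero; suc)
  open import Relation.Nullary using (yes; no; contradiction)
  open import Relation.Binary.PropositionalEquality
  open import Function.Base using (_∘_)
  import Algebra.Properties.Group

  private
    module A = Field F
    module B = Field F′
    module PA = Polynomials F
    module PB = Polynomials F′

  h-0 : h A.0# ≡ B.0#
  h-0 = identityʳ-unique (h A.0#) (h A.0#) (trans (sym (h-+ A.0# A.0#)) (cong h (A.+-identityˡ A.0#)))
    where open Algebra.Properties.Group (CommutativeRing.+-group B.commutativeRing) using (identityʳ-unique)

  h-neg : ∀ a → h (A.- a) ≡ B.- h a
  h-neg a = inverseʳ-unique (h a) (h (A.- a)) (trans (sym (h-+ a (A.- a))) (trans (cong h (A.-‿inverseʳ a)) h-0))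
    where open Algebra.Properties.Group (CommutativeRing.+-group B.commutativeRing) using (inverseʳ-unique)

  h-≢0 : ∀ {a} → a ≢ A.0# → h a ≢ B.0#
  h-≢0 {a} a≢0 e = B.1≢0 (trans (sym h-1) (trans (cong h (sym (A.*-inverseʳ a≢0))) (trans (h-* a (a A.⁻¹)) (trans (cong (B._* h (a A.⁻¹)) e) (B.zeroˡ _)))))

  h-injective : ∀ {a b} → h a ≡ h b → a ≡ b
  h-injective {a} {b} e with a A.- b A.≟ A.0#
  ... | yes a-b≡0 = A.x-y≡0⇒x≡y a-b≡0
  ... | no  a-b≢0 = contradiction (trans (h-+ a (A.- b)) (trans (cong₂ B._+_ e (h-neg b)) (B.-‿inverseʳ (h b)))) (h-≢0 a-b≢0)

  mapPoly : PA.Poly → PB.Poly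
  mapPoly f = PB.poly (h ∘ PA.coeff f) (PA.bound f) (λ i p → trans (cong h (PA.bounded f i p)) h-0)

  mapPoly-cong : ∀ {f g} → f PA.≈ g → mapPoly f PB.≈ mapPoly g
  mapPoly-cong e = PB.coeffwise λ i → cong h (PA.at e i)

  mapPoly-⊗ : ∀ f g → mapPoly (f PA.⊗ g) PB.≈ mapPoly f PB.⊗ mapPoly g
  mapPoly-⊗ f g = PB.coeffwise λ i → trans (cong h (PA.coeff-⊗ f g i)) (trans (go (PA.coeff f) (PA.coeff g) i) (sym (PB.coeff-⊗ (mapPoly f) (mapPoly g) i)))
    where
    go : ∀ f g i → h ((f PA.⊛ g) i) ≡ ((h ∘ f) PB.⊛ (h ∘ g)) i
    go f g zero    = h-* (f 0) (g 0)
    go f g (suc i) = trans (h-+ _ _) (cong₂ B._+_ (h-* _ _) (go (PA.shift f) g i))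

  mapPoly-1 : mapPoly PA.1ₚ PB.≈ PB.1ₚ
  mapPoly-1 = PB.coeffwise λ { zero → h-1 ; (suc i) → h-0 }

  mapPoly-monic : ∀ {n f} → PA.Monic n f → PB.Monic n (mapPoly f)
  mapPoly-monic (PA.monic t b) = PB.monic (trans (cong h t) h-1) λ i p → trans (cong h (b i p)) h-0

  mapPoly-injective : ∀ {f g} → mapPoly f PB.≈ mapPoly g → f PA.≈ g
  mapPoly-injective e = PA.coeffwise λ i → h-injective (PB.at e i)

-- Gaussian numbers and the norm of minus one

module GaussianNumbers {p : ℕ} (K : Field p) where

  open import Data.Nat.Base as ℕ using (zero; suc) renaming (_+_ to _+ℕ_; _*_ to _*ℕ_)
  import Data.Nat.Properties as ℕ
  open import Relation.Binary.PropositionalEquality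

  private
    module K = Field K
    Q : ℕ
    Q = K.card

  -- The number `(Q^m - 1) / (Q - 1)` by Horner's rule. It is the exponent of the norm from the
  -- extension of degree `m`, and the size of the norm's fibres over nonzero elements.
  gaussian : ℕ → ℕ
  gaussian zero    = 0
  gaussian (suc m) = suc (Q *ℕ gaussian m)

  gaussian-pow : ∀ m → suc (Q *ℕ gaussian m) ≡ gaussian m +ℕ Q ℕ.^ m
  gaussian-pow zero    = cong suc (ℕ.*-zeroʳ Q)
  gaussian-pow (suc m) = cong suc (trans (cong (Q *ℕ_) (gaussian-pow m)) (ℕ.*-distribˡ-+ Q (gaussian m) (Q ℕ.^ m)))

  -- The element `(-1)^m` of `K`, which is the norm of -1 from the extension of degree `m`.
  sign : ℕ → K.Carrier
  sign zero    = K.1#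
  sign (suc m) = K.- sign m

open import Data.Nat.Base using (ℕ; suc)
open Extensions using (Extension)

-- Conjugates, norm, trace and characteristic polynomials

module Galois {p : ℕ} (p-prime : Prime p) (K : Field p) (n′ : ℕ) (E : Extension K (suc n′)) where

  open import Data.Nat.Base as ℕ using (zero; _≤_; _<_; z≤n; s≤s; _∸_) renaming (_+_ to _+ℕ_; _*_ to _*ℕ_)
  import Data.Nat.Properties as ℕ
  open import Data.Nat.DivMod using (_%_; _/_; m≡m%n+[m/n]*n; m%n<n)
  import Data.Integer.Properties as ℤ
  open import Data.Vec.Base using (Vec; []; _∷_)
  open import Data.Product using (_,_; proj₁; proj₂; ∃)
  open import Data.Sum using (_⊎_; inj₁; inj₂; [_,_]′)
  open import Relation.Nullary using (Dec; yes; no; ¬_; contradiction)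
  open import Relation.Binary using (tri<; tri≈; tri>)
  open import Relation.Binary.PropositionalEquality
  open import Function.Base using (_∘_)
  open FiniteSums using (Finite; vecFinite)
  open IntegerSums
  open import Data.Integer.Base as ℤ using (ℤ; 0ℤ; 1ℤ) renaming (_+_ to _+ᶻ_; _*_ to _*ᶻ_; _-_ to _-ᶻ_)
  open import Data.Integer.Tactic.RingSolver using (solve-∀)
  open import Data.List.Base using (List)
  open GaussianNumbers K

  open Extension E public using (embed; embed-+; embed-*; embed-1) renaming (extension to L)

  n : ℕ
  n = suc n′

  private
    module TK = PolynomialTheory K
    module TL = PolynomialTheory L
    module K where
      open TK.𝔽 public
      open TK.Polys public
      open TK.Factorization public
      open TK.PrimePowers public
      open TK.PrimeExistence public
    module FrK = Frobenius p-prime K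

  open TL.𝔽
  open TL.Polys
  open TL.Factorization using (lowPoly; monPoly; monic-monPoly)
  open TL.PrimePowers using (pow; pow-cong; monic-pow)
  open TL.Evaluation
  open Frobenius p-prime L
  open K using (range; ∈-range; range-≤1; mkPrime; Ψ)

  Q : ℕ
  Q = K.card

  2≤Q : 2 ≤ Q
  2≤Q = K.2≤Q

  φ : Carrier → Carrier
  φ x = x ^ Q

  φ-+ : ∀ x y → φ (x + y) ≡ φ x + φ y
  φ-+ x y = subst (λ q → (x + y) ^ q ≡ x ^ q + y ^ q) (sym K.card-≡) (^-p^-+ K.exponent x y)

  φ-* : ∀ x y → φ (x * y) ≡ φ x * φ y
  φ-* x y = ^-distrib-* x y Q

  φ-1 : φ 1# ≡ 1#
  φ-1 = go Q
    where
    go : ∀ m → 1# ^ m ≡ 1#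
    go zero    = refl
    go (suc m) = trans (*-identityˡ _) (go m)

  module Φ = PolynomialMaps L L φ φ-+ φ-* φ-1
  module ↑ = PolynomialMaps K L embed embed-+ embed-* embed-1

  φ-embed : ∀ a → φ (embed a) ≡ embed a
  φ-embed a = trans (sym (embed-^ Q)) (cong embed (FrK.fermat a))
    where
    embed-^ : ∀ m → embed (a FrK.^ m) ≡ embed a ^ m
    embed-^ zero    = embed-1
    embed-^ (suc m) = trans (embed-* a _) (cong (embed a *_) (embed-^ m))

  φ^ : ℕ → Carrier → Carrier
  φ^ zero    x = x
  φ^ (suc i) x = φ^ i (φ x)

  φ^-+ : ∀ i j x → φ^ (i +ℕ j) x ≡ φ^ j (φ^ i x)
  φ^-+ zero    j x = refl
  φ^-+ (suc i) j x = φ^-+ i j (φ x)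

  φ^-pow : ∀ i x → φ^ i x ≡ x ^ (Q ℕ.^ i)
  φ^-pow zero    x = sym (*-identityʳ x)
  φ^-pow (suc i) x = trans (φ^-pow i (φ x)) (^-assocʳ x Q (Q ℕ.^ i))

  φ^n : ∀ x → φ^ n x ≡ x
  φ^n x = trans (φ^-pow n x) (trans (cong (x ^_) (sym (Extension.card-L E))) (fermat x))

  φ^-injective : ∀ i {x y} → φ^ i x ≡ φ^ i y → x ≡ y
  φ^-injective zero    e = e
  φ^-injective (suc i) e = Φ.h-injective (φ^-injective i e)

  monic-⊕ : ∀ {m f g} → Monic m f → Below (coeff g) m → Monic m (f ⊕ g)
  monic-⊕ {m} {f} {g} (monic t b) h = monic (trans (coeff-⊕ f g m) (trans (cong₂ _+_ t (h m ℕ.≤-refl)) (+-identityʳ 1#)))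
    λ i p → trans (coeff-⊕ f g i) (trans (cong₂ _+_ (b i p) (h i (ℕ.≤-trans (ℕ.n≤1+n m) p))) (+-identityʳ 0#))

  X : Poly
  X = monPoly (0# ∷ [])

  eval-X : ∀ x → eval X x ≡ x
  eval-X x = trans (eval-monPoly (0# ∷ []) x) (trans (+-identityˡ _) (*-identityʳ x))

  eval-pow : ∀ f m x → eval (pow f m) x ≡ eval f x ^ m
  eval-pow f zero    x = eval-1 x
  eval-pow f (suc m) x = trans (eval-⊗ f (pow f m) x) (cong (eval f x *_) (eval-pow f m x))

  -- Among the at most Q roots of X^Q - X are the Q elements of K.
  fixed⇒embedded : ∀ {y} → φ y ≡ y → ∃ λ a → embed a ≡ y
  fixed⇒embedded {y} φy≡y = by-search (Finite.any? K.finite (λ a → embed a ≟ y))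
    where
    f : Poly
    f = pow X Q ⊕ lowPoly (0# ∷ (- 1#) ∷ [])
    mf : Monic Q f
    mf = monic-⊕ (subst (λ m → Monic m (pow X Q)) (ℕ.*-identityʳ Q) (monic-pow (monic-monPoly (0# ∷ [])) Q))
      (Below-mono 2≤Q (bounded (lowPoly (0# ∷ (- 1#) ∷ []))))
    eval-f : ∀ x → eval f x ≡ φ x - x
    eval-f x = trans (eval-⊕ (pow X Q) (lowPoly (0# ∷ (- 1#) ∷ [])) x) (cong₂ _+_ (trans (eval-pow X Q x) (cong (_^ Q) (eval-X x)))
      (S.solve 1 (λ x → S.con 0ℤ S.:+ x S.:* (S.:- S.con 1ℤ S.:+ x S.:* S.con 0ℤ) S.:= S.:- x) refl x))
      where module S = Solver
    fixed≤Q : ∑ elements (λ x → ι (φ x ≟ x)) ℤ.≤ ℤ.+ Q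
    fixed≤Q = ℤ.≤-trans (∑-mono elements (λ x → ι-mono (φ x ≟ x) (eval f x ≟ 0#) (λ e → trans (eval-f x) (trans (cong (_- x) e) (x-x≡0 x))))) (root-count mf)
    preimages : Carrier → ℤ
    preimages x = ∑ K.elements (λ a → ι (x ≟ embed a))
    total : ∑ elements preimages ≡ ℤ.+ Q
    total = trans (∑-swap elements K.elements (λ x a → ι (x ≟ embed a)))
      (trans (∑-cong K.elements (λ a → ∑-ι1 finite (embed a))) (∑-1 K.elements))
    preimages≤ : ∀ x → preimages x ℤ.≤ ι (φ x ≟ x)
    preimages≤ x with φ x ≟ x
    ... | yes _ = ∑-at-most-one K.finite (λ a → x ≟ embed a) (λ e e′ → ↑.h-injective (trans (sym e) e′))
    ... | no ≢x = ℤ.≤-reflexive (trans (∑-cong K.elements (λ a → ι-no (x ≟ embed a) (λ { refl → ≢x (φ-embed a) }))) (∑-ε K.elements))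
    one : preimages y ≡ 1ℤ
    one = trans (∑-squeeze preimages≤ (ℤ.≤-antisym (∑-mono elements preimages≤) (ℤ.≤-trans fixed≤Q (ℤ.≤-reflexive (sym total)))) (complete y))
      (ι-yes (φ y ≟ y) φy≡y)
    by-search : Dec (∃ λ a → embed a ≡ y) → ∃ λ a → embed a ≡ y
    by-search (yes r) = r
    by-search (no ¬r) = contradiction (trans (sym one) (trans (∑-cong K.elements (λ a → ι-no (y ≟ embed a) (λ e → ¬r (a , sym e)))) (∑-ε K.elements))) λ ()

  abstract
    -- The inverse of `embed` on its image, which is the set of fixed points of `φ`. Elsewhere the
    -- value 0 is a default.
    retract : Carrier → K.Carrier
    retract y = choose (Finite.any? K.finite (λ a → embed a ≟ y))
      where
      choose : Dec (∃ λ a → embed a ≡ y) → K.Carrier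
      choose (yes (a , _)) = a
      choose (no _)        = K.0#

    embed-retract : ∀ {y} → φ y ≡ y → embed (retract y) ≡ y
    embed-retract {y} e with Finite.any? K.finite (λ a → embed a ≟ y)
    ... | yes (a , ea) = ea
    ... | no ¬r        = contradiction (fixed⇒embedded e) ¬r

  retract-0 : retract 0# ≡ K.0#
  retract-0 = ↑.h-injective (trans (embed-retract Φ.h-0) (sym ↑.h-0))

  descend : Poly → K.Poly
  descend f = K.poly (retract ∘ coeff f) (bound f) (λ i h → trans (cong retract (bounded f i h)) retract-0)

  embed-descend : ∀ {f} → Φ.mapPoly f ≈ f → ↑.mapPoly (descend f) ≈ f
  embed-descend e = coeffwise λ i → embed-retract (at e i)

  descend-monic : ∀ {m f} → Φ.mapPoly f ≈ f → Monic m f → K.Monic m (descend f)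
  descend-monic e (monic t b) = K.monic (↑.h-injective (trans (embed-retract (at e _)) (trans t (sym embed-1))))
    λ i h → trans (cong retract (b i h)) retract-0

  lin : Carrier → Poly
  lin x = monPoly (x ∷ [])

  -- The product of the factors `X + φ^ i x` with `i < m`. The plus sign makes its constant and
  -- subleading coefficients the product and the sum of the conjugates.
  conj : ℕ → Carrier → Poly
  conj zero    x = 1ₚ
  conj (suc m) x = lin x ⊗ conj m (φ x)

  conj-monic : ∀ m x → Monic m (conj m x)
  conj-monic zero    x = monic-1
  conj-monic (suc m) x = monic-⊗ (monic-monPoly (x ∷ [])) (conj-monic m (φ x))

  conj-+ : ∀ a b x → conj (a +ℕ b) x ≈ conj a x ⊗ conj b (φ^ a x)
  conj-+ zero    b x = Ring.sym (Ring.*-identityˡ (conj b x))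
  conj-+ (suc a) b x = Ring.trans (Ring.*-congˡ (conj-+ a b (φ x))) (Ring.sym (Ring.*-assoc (lin x) (conj a (φ x)) (conj b (φ^ a (φ x)))))

  -- Multiplied by `lin x`, both sides become `conj (suc d) x`, because the last factor of that
  -- product is `lin (φ^ d x)`, which is `lin x` again.
  conj-φ : ∀ d {x} → φ^ d x ≡ x → conj d (φ x) ≈ conj d x
  conj-φ d {x} e = monic-cancelˡ (monic-monPoly (x ∷ [])) (Ring.trans (Ring.reflexive (cong (λ m → conj m x) (ℕ.+-comm 1 d)))
    (Ring.trans (conj-+ d 1 x) (Ring.trans (Ring.*-comm (conj d x) (conj 1 (φ^ d x)))
      (Ring.*-congʳ (Ring.trans (Ring.*-identityʳ (lin (φ^ d x))) (Ring.reflexive (cong lin e)))))))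

  map-lin : ∀ x → Φ.mapPoly (lin x) ≈ lin (φ x)
  map-lin x = coeffwise λ { zero → refl ; (suc zero) → φ-1 ; (suc (suc i)) → Φ.h-0 }

  map-conj : ∀ m x → Φ.mapPoly (conj m x) ≈ conj m (φ x)
  map-conj zero    x = Φ.mapPoly-1
  map-conj (suc m) x = Ring.trans (Φ.mapPoly-⊗ (lin x) (conj m (φ x))) (Ring.*-cong (map-lin x) (map-conj m (φ x)))

  conj-fixed : ∀ d {x} → φ^ d x ≡ x → Φ.mapPoly (conj d x) ≈ conj d x
  conj-fixed d {x} e = Ring.trans (map-conj d x) (conj-φ d e)

  charPoly : Carrier → K.Poly
  charPoly x = descend (conj n x)

  charPoly-monic : ∀ x → K.Monic n (charPoly x)
  charPoly-monic x = descend-monic (conj-fixed n (φ^n x)) (conj-monic n x)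

  -- As coefficients of `charPoly x`, so that a function of norm and trace is a function of the
  -- characteristic polynomial and falls under `char-sum`. The descriptions by conjugates are
  -- `embed-norm` and `embed-trace`.
  norm trace : Carrier → K.Carrier
  norm x  = K.coeff (charPoly x) 0
  trace x = K.subleading n (charPoly x)

  conjProduct conjSum : ℕ → Carrier → Carrier
  conjProduct zero    x = 1#
  conjProduct (suc m) x = x * conjProduct m (φ x)
  conjSum zero    x = 0#
  conjSum (suc m) x = x + conjSum m (φ x)

  embed-norm : ∀ x → embed (norm x) ≡ conjProduct n x
  embed-norm x = trans (at (embed-descend (conj-fixed n (φ^n x))) 0) (go n x)
    where
    go : ∀ m x → coeff (conj m x) 0 ≡ conjProduct m x
    go zero    x = refl
    go (suc m) x = trans (coeff-⊗ (lin x) (conj m (φ x)) 0) (cong (x *_) (go m (φ x)))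

  embed-trace : ∀ x → embed (trace x) ≡ conjSum n x
  embed-trace x = trans (at (embed-descend (conj-fixed n (φ^n x))) n′) (go n x)
    where
    go : ∀ m x → subleading m (conj m x) ≡ conjSum m x
    go zero    x = refl
    go (suc m) x = trans (subleading-⊗ (monic-monPoly (x ∷ [])) (conj-monic m (φ x))) (cong (x +_) (go m (φ x)))

  norm-* : ∀ x y → norm (x * y) ≡ norm x K.* norm y
  norm-* x y = ↑.h-injective (trans (embed-norm (x * y)) (trans (go n x y) (sym (trans (embed-* _ _) (cong₂ _*_ (embed-norm x) (embed-norm y))))))
    where
    go : ∀ m x y → conjProduct m (x * y) ≡ conjProduct m x * conjProduct m y
    go zero    x y = sym (*-identityˡ 1#)
    go (suc m) x y = trans (cong (x * y *_) (trans (cong (conjProduct m) (φ-* x y)) (go m (φ x) (φ y))))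
      (S.solve 4 (λ x y a b → x S.:* y S.:* (a S.:* b) S.:= x S.:* a S.:* (y S.:* b)) refl x y _ _)
      where module S = Solver

  norm-≢0 : ∀ {x} → x ≢ 0# → norm x ≢ K.0#
  norm-≢0 {x} x≢0 e = go n x x≢0 (trans (sym (embed-norm x)) (trans (cong embed e) ↑.h-0))
    where
    go : ∀ m x → x ≢ 0# → conjProduct m x ≢ 0#
    go zero    x x≢0 = 1≢0
    go (suc m) x x≢0 = *-≢0 x≢0 (go m (φ x) (Φ.h-≢0 x≢0))

  norm-0 : norm 0# ≡ K.0#
  norm-0 = ↑.h-injective (trans (embed-norm 0#) (trans (zeroˡ _) (sym ↑.h-0)))

  trace-+ : ∀ x y → trace (x + y) ≡ trace x K.+ trace y
  trace-+ x y = ↑.h-injective (trans (embed-trace (x + y)) (trans (go n x y) (sym (trans (embed-+ _ _) (cong₂ _+_ (embed-trace x) (embed-trace y))))))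
    where
    go : ∀ m x y → conjSum m (x + y) ≡ conjSum m x + conjSum m y
    go zero    x y = sym (+-identityˡ 0#)
    go (suc m) x y = trans (cong (x + y +_) (trans (cong (conjSum m) (φ-+ x y)) (go m (φ x) (φ y))))
      (S.solve 4 (λ x y a b → x S.:+ y S.:+ (a S.:+ b) S.:= x S.:+ a S.:+ (y S.:+ b)) refl x y _ _)
      where module S = Solver

  trace-scale : ∀ c x → trace (embed c * x) ≡ c K.* trace x
  trace-scale c x = ↑.h-injective (trans (embed-trace (embed c * x)) (trans (go n x) (sym (trans (embed-* _ _) (cong (embed c *_) (embed-trace x))))))
    where
    go : ∀ m x → conjSum m (embed c * x) ≡ embed c * conjSum m x
    go zero    x = sym (zeroʳ _)
    go (suc m) x = trans (cong (embed c * x +_) (trans (cong (conjSum m) (trans (φ-* (embed c) x) (cong (_* φ x) (φ-embed c)))) (go m (φ x))))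
      (sym (distribˡ (embed c) x _))

  record Period (x : Carrier) : Set where
    field
      d        : ℕ
      positive : 1 ≤ d
      returns  : φ^ d x ≡ x
      minimal  : ∀ i → 1 ≤ i → i < d → φ^ i x ≢ x

  abstract
    period : ∀ x → Period x
    period x = go n 1 (s≤s z≤n) (λ i 1≤i i<1 → contradiction (ℕ.≤-trans i<1 1≤i) (ℕ.<-irrefl refl)) (ℕ.n≤1+n n)
      where
      go : ∀ b d → 1 ≤ d → (∀ i → 1 ≤ i → i < d → φ^ i x ≢ x) → n ≤ d +ℕ b → Period x
      go b d 1≤d below n≤d+b with φ^ d x ≟ x
      ... | yes e = record { d = d ; positive = 1≤d ; returns = e ; minimal = below }
      go zero    d 1≤d below n≤d | no ≢x with ℕ.m≤n⇒m<n∨m≡n (ℕ.≤-trans n≤d (ℕ.≤-reflexive (ℕ.+-identityʳ d)))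
      ... | inj₁ n<d = contradiction (φ^n x) (below n (s≤s z≤n) n<d)
      ... | inj₂ n≡d = contradiction (trans (cong (λ i → φ^ i x) (sym n≡d)) (φ^n x)) ≢x
      go (suc b) d 1≤d below n≤d+b | no ≢x = go b (suc d) (s≤s z≤n) below′ (ℕ.≤-trans n≤d+b (ℕ.≤-reflexive (ℕ.+-suc d b)))
        where
        below′ : ∀ i → 1 ≤ i → i < suc d → φ^ i x ≢ x
        below′ i 1≤i (s≤s i≤d) = [ below i 1≤i , (λ { refl → ≢x }) ]′ (ℕ.m≤n⇒m<n∨m≡n i≤d)

  φ^-neg : ∀ i x → φ^ i (- x) ≡ - φ^ i x
  φ^-neg zero    x = refl
  φ^-neg (suc i) x = trans (cong (φ^ i) (Φ.h-neg x)) (φ^-neg i (φ x))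

  neg-injective : ∀ {x y} → - x ≡ - y → x ≡ y
  neg-injective {x} {y} e = trans (S.solve 1 (λ x → x S.:= S.:- (S.:- x)) refl x) (trans (cong (λ z → - z) e) (S.solve 1 (λ x → S.:- (S.:- x) S.:= x) refl y))
    where module S = Solver

  evalK : K.Poly → Carrier → Carrier
  evalK f = eval (↑.mapPoly f)

  evalK-φ : ∀ f y → evalK f (φ y) ≡ φ (evalK f y)
  evalK-φ f y = go (K.bound f) (K.coeff f)
    where
    go : ∀ m c → evalTo m (embed ∘ c) (φ y) ≡ φ (evalTo m (embed ∘ c) y)
    go zero    c = sym Φ.h-0
    go (suc m) c = sym (trans (φ-+ _ _) (cong₂ _+_ (φ-embed (c 0)) (trans (φ-* y _) (cong (φ y *_) (sym (go m (c ∘ suc)))))))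

  evalK-φ^ : ∀ f i {y} → evalK f y ≡ 0# → evalK f (φ^ i y) ≡ 0#
  evalK-φ^ f zero    e = e
  evalK-φ^ f (suc i) e = evalK-φ^ f i (trans (evalK-φ f _) (trans (cong φ e) Φ.h-0))

  ∑-range-mono : ∀ m {f g : ℕ → ℤ} → (∀ i → i < m → f i ℤ.≤ g i) → ∑ (range m) f ℤ.≤ ∑ (range m) g
  ∑-range-mono zero    h = ℤ.≤-refl
  ∑-range-mono (suc m) h = ℤ.+-mono-≤ (h m ℕ.≤-refl) (∑-range-mono m (λ i i<m → h i (ℕ.m≤n⇒m≤1+n i<m)))

  range-at-most-one : ∀ m {P : ℕ → Set} (P? : ∀ i → Dec (P i)) → (∀ i j → i < m → j < m → P i → P j → i ≡ j) →
                      ∑ (range m) (λ i → ι (P? i)) ℤ.≤ 1ℤ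
  range-at-most-one m P? unique with ℕ.anyUpTo? P? m
  ... | yes (i₀ , i₀<m , pi₀) = ℤ.≤-trans (∑-range-mono m (λ i i<m → ι-mono (P? i) (i ℕ.≟ i₀) (λ pi → unique i i₀ i<m i₀<m pi pi₀))) (range-≤1 m i₀)
  ... | no ¬p = ℤ.≤-trans (∑-range-mono m (λ i i<m → ℤ.≤-reflexive (ι-no (P? i) (λ pi → ¬p (i , i<m , pi)))))
    (ℤ.≤-trans (ℤ.≤-reflexive (∑-ε (range m))) (ℤ.+≤+ z≤n))

  module _ (x : Carrier) where

    open Period (period x)

    conjugates-apart : ∀ {i j} → i < j → j < d → φ^ i (- x) ≢ φ^ j (- x)
    conjugates-apart {i} {j} i<j j<d e = minimal (j ∸ i) (ℕ.m<n⇒0<n∸m i<j) (ℕ.≤-trans (s≤s (ℕ.m∸n≤m j i)) j<d)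
      (neg-injective (trans (sym (φ^-neg (j ∸ i) x)) (φ^-injective i (trans (sym (φ^-+ (j ∸ i) i (- x)))
        (trans (cong (λ k → φ^ k (- x)) (ℕ.m∸n+n≡m (ℕ.<⇒≤ i<j))) (sym e))))))

    conjugates-distinct : ∀ i j → i < d → j < d → φ^ i (- x) ≡ φ^ j (- x) → i ≡ j
    conjugates-distinct i j i<d j<d e with ℕ.<-cmp i j
    ... | tri< i<j _ _ = contradiction e (conjugates-apart i<j j<d)
    ... | tri≈ _ i≡j _ = i≡j
    ... | tri> _ _ j<i = contradiction (sym e) (conjugates-apart j<i i<d)

    -- A polynomial over `K` that vanishes at `- x` vanishes at its `d` distinct conjugates, and a
    -- monic polynomial of degree `j` has at most `j` roots.
    degree-bound : ∀ {j f} → K.Monic j f → evalK f (- x) ≡ 0# → d ≤ j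
    degree-bound {j} {f} mf e = ℤ.drop‿+≤+ (ℤ.≤-trans (ℤ.≤-reflexive (sym total)) (ℤ.≤-trans (∑-mono elements few) (root-count (↑.mapPoly-monic mf))))
      where
      total : ∑ elements (λ z → ∑ (range d) (λ i → ι (z ≟ φ^ i (- x)))) ≡ ℤ.+ d
      total = trans (∑-swap elements (range d) (λ z i → ι (z ≟ φ^ i (- x)))) (trans (∑-cong (range d) (λ i → ∑-ι1 finite (φ^ i (- x))))
        (trans (∑-1 (range d)) (cong ℤ.+_ (K.length-range d))))
      few : ∀ z → ∑ (range d) (λ i → ι (z ≟ φ^ i (- x))) ℤ.≤ ι (evalK f z ≟ 0#)
      few z with evalK f z ≟ 0#
      ... | yes _ = range-at-most-one d (λ i → z ≟ φ^ i (- x)) (λ i j i<d j<d e e′ → conjugates-distinct i j i<d j<d (trans (sym e) e′))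
      ... | no ≢0 = ℤ.≤-reflexive (trans (∑-cong (range d) (λ i → ι-no (z ≟ φ^ i (- x)) (λ { refl → ≢0 (evalK-φ^ f i e) }))) (∑-ε (range d)))

    minPoly : K.Poly
    minPoly = descend (conj d x)

    map-minPoly : ↑.mapPoly minPoly ≈ conj d x
    map-minPoly = embed-descend (conj-fixed d returns)

    minPoly-monic : K.Monic d minPoly
    minPoly-monic = descend-monic (conj-fixed d returns) (conj-monic d x)

    minPoly-root : evalK minPoly (- x) ≡ 0#
    minPoly-root = trans (eval-cong map-minPoly (- x)) (go d positive)
      where
      go : ∀ d → 1 ≤ d → eval (conj d x) (- x) ≡ 0#
      go (suc d) _ = trans (eval-⊗ (lin x) (conj d (φ x)) (- x)) (trans (cong (_* eval (conj d (φ x)) (- x))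
        (trans (eval-monPoly (x ∷ []) (- x)) (trans (cong (x +_) (*-identityʳ (- x))) (-‿inverseʳ x)))) (zeroˡ _))

    -- If `minPoly` is a product, then `- x` is a root of one of the two factors, and by
    -- `degree-bound` this factor has the full degree `d`.
    minPoly-irreducible : K.Irreducible d minPoly
    minPoly-irreducible = record { isMonic = minPoly-monic ; positive = positive ; prime = prime }
      where
      prime : ∀ {i g} → K.Monic i g → g K.∣ minPoly → i ≡ 0 ⊎ i ≡ d
      prime {i} {g} mg (K.divides q e) = [ left , right ]′ (zero-product (trans (sym (eval-⊗ (↑.mapPoly g) (↑.mapPoly q) (- x)))
        (trans (eval-cong (Ring.trans (Ring.sym (↑.mapPoly-⊗ g q)) (↑.mapPoly-cong (K.Ring.sym e))) (- x)) minPoly-root)))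
        where
        i≤d : i ≤ d
        i≤d = proj₁ (K.monic-quotient minPoly-monic mg e)
        mq : K.Monic (d ∸ i) q
        mq = proj₂ (K.monic-quotient minPoly-monic mg e)
        left : evalK g (- x) ≡ 0# → i ≡ 0 ⊎ i ≡ d
        left g0 = inj₂ (ℕ.≤-antisym i≤d (degree-bound mg g0))
        right : evalK q (- x) ≡ 0# → i ≡ 0 ⊎ i ≡ d
        right q0 = inj₁ (ℕ.n≤0⇒n≡0 (ℕ.+-cancelʳ-≤ d i 0 (ℕ.≤-trans (ℕ.+-monoʳ-≤ i (degree-bound mq q0)) (ℕ.≤-reflexive (ℕ.m+[n∸m]≡n i≤d)))))

    multiplicity : ℕ
    multiplicity = (n / d) {{ℕ.>-nonZero positive}}

    φ^-period : ∀ k → φ^ (k *ℕ d) x ≡ x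
    φ^-period zero    = refl
    φ^-period (suc k) = trans (φ^-+ d (k *ℕ d) x) (trans (cong (φ^ (k *ℕ d)) returns) (φ^-period k))

    n≡k*d : n ≡ multiplicity *ℕ d
    n≡k*d = trans (m≡m%n+[m/n]*n n d) (cong (_+ℕ (multiplicity *ℕ d)) (no-remainder (n % d) refl))
      where
      instance
        d-nonZero : ℕ.NonZero d
        d-nonZero = ℕ.>-nonZero positive
      no-remainder : ∀ r → n % d ≡ r → n % d ≡ 0
      no-remainder zero    e = e
      no-remainder (suc r) e = contradiction (trans (cong (φ^ (n % d)) (sym (φ^-period multiplicity))) (trans (sym (φ^-+ (multiplicity *ℕ d) (n % d) x))
        (trans (cong (λ k → φ^ k x) (trans (ℕ.+-comm (multiplicity *ℕ d) (n % d)) (sym (m≡m%n+[m/n]*n n d)))) (φ^n x))))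
        (minimal (n % d) (subst (1 ≤_) (sym e) (s≤s z≤n)) (m%n<n n d))

    -- The first `n` conjugates run through the period of length `d` exactly `multiplicity` times.
    charPoly≈pow : charPoly x K.≈ K.pow minPoly multiplicity
    charPoly≈pow = ↑.mapPoly-injective (Ring.trans (embed-descend (conj-fixed n (φ^n x)))
      (Ring.trans (Ring.reflexive (cong (λ k → conj k x) n≡k*d)) (Ring.trans (conj-power multiplicity)
        (Ring.trans (pow-cong (Ring.sym map-minPoly) multiplicity) (Ring.sym (map-pow minPoly multiplicity))))))
      where
      conj-power : ∀ k → conj (k *ℕ d) x ≈ pow (conj d x) k
      conj-power zero    = Ring.refl
      conj-power (suc k) = Ring.trans (conj-+ d (k *ℕ d) x) (Ring.*-congˡ (Ring.trans (Ring.reflexive (cong (conj (k *ℕ d)) returns)) (conj-power k)))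
      map-pow : ∀ f k → ↑.mapPoly (K.pow f k) ≈ pow (↑.mapPoly f) k
      map-pow f zero    = ↑.mapPoly-1
      map-pow f (suc k) = Ring.trans (↑.mapPoly-⊗ f (K.pow f k)) (Ring.*-congˡ (map-pow f k))

  ι*ι≥0 : {A C : Set} (p : Dec A) (q : Dec C) → 0ℤ ℤ.≤ ι p *ᶻ ι q
  ι*ι≥0 (yes _) q = ℤ.≤-trans (ι≥0 q) (ℤ.≤-reflexive (sym (ℤ.*-identityˡ (ι q))))
  ι*ι≥0 (no _)  q = ℤ.≤-refl

  map-root : ∀ P k {y} → evalK (K.pow P k) y ≡ 0# → evalK P y ≡ 0#
  map-root P zero    {y} e = contradiction (trans (sym (trans (eval-cong ↑.mapPoly-1 y) (eval-1 y))) e) 1≢0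
  map-root P (suc k) {y} e = [ (λ z → z) , map-root P k ]′ (zero-product (trans (sym (eval-⊗ (↑.mapPoly P) (↑.mapPoly (K.pow P k)) y))
    (trans (eval-cong (Ring.sym (↑.mapPoly-⊗ P (K.pow P k))) y) e)))

  card-L : card ≡ Q ℕ.^ n
  card-L = Extension.card-L E

  -- The elements of L with a given characteristic polynomial P^k are roots of P, hence
  -- at most deg P in number; as both sides have the same total Qⁿ, equality holds throughout.
  char-sum : ∀ {B} → n ≤ B → (F : K.Poly → ℤ) → (∀ {f g} → f K.≈ g → F f ≡ F g) →
             ∑ elements (λ x → F (charPoly x)) ≡ Ψ B n F
  char-sum {B} n≤B F F-cong = begin
    ∑ elements (λ x → F (charPoly x))
      ≡⟨ ∑-cong elements (λ x → expand (charPoly-monic x)) ⟩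
    ∑ elements (λ x → ∑ Vₙ (λ v → δ (charPoly x) v *ᶻ F (K.monPoly v)))
      ≡⟨ ∑-swap elements Vₙ (λ x v → δ (charPoly x) v *ᶻ F (K.monPoly v)) ⟩
    ∑ Vₙ (λ v → ∑ elements (λ x → δ (charPoly x) v *ᶻ F (K.monPoly v)))
      ≡⟨ ∑-cong Vₙ (λ v → sym (∑-* elements (λ x → δ (charPoly x) v) (F (K.monPoly v)))) ⟩
    ∑ Vₙ (λ v → a v *ᶻ F (K.monPoly v))
      ≡⟨ ∑-cong Vₙ (λ v → cong (_*ᶻ F (K.monPoly v)) (∑-squeeze a≤b total (Finite.complete (vecFinite K.finite n) v))) ⟩
    ∑ Vₙ (λ v → b v *ᶻ F (K.monPoly v))
      ≡⟨ ∑-cong Vₙ (λ v → sym (K.Ψ-scale B n (λ f → δ f v) (F (K.monPoly v)))) ⟩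
    ∑ Vₙ (λ v → Ψ B n (λ f → δ f v *ᶻ F (K.monPoly v)))
      ≡⟨ K.Ψ-∑ B n Vₙ (λ v f → δ f v *ᶻ F (K.monPoly v)) ⟨
    Ψ B n (λ f → ∑ Vₙ (λ v → δ f v *ᶻ F (K.monPoly v)))
      ≡⟨ K.Ψ-cong B n (λ mf → sym (expand mf)) ⟩
    Ψ B n F ∎
    where
    open ≡-Reasoning
    Vₙ : List (Vec K.Carrier n)
    Vₙ = K.V n
    δ : K.Poly → Vec K.Carrier n → ℤ
    δ f v = ι (f K.≈? K.monPoly v)
    _≟ᵥ_ : (v w : Vec K.Carrier n) → Dec (v ≡ w)
    _≟ᵥ_ = Finite._≟_ (vecFinite K.finite n)
    expand : ∀ {f} → K.Monic n f → F f ≡ ∑ Vₙ (λ v → δ f v *ᶻ F (K.monPoly v))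
    expand {f} mf = trans (F-cong (K.Ring.sym (K.monPoly-take mf))) (sym (trans
      (∑-cong Vₙ (λ v → cong (_*ᶻ F (K.monPoly v)) (ι-cong (f K.≈? K.monPoly v) (v ≟ᵥ K.take n (K.coeff f))
        (λ e → K.monPoly-injective (K.Ring.trans (K.Ring.sym e) (K.Ring.sym (K.monPoly-take mf)))) (λ { refl → K.Ring.sym (K.monPoly-take mf) }))))
      (∑-ι (vecFinite K.finite n) (K.take n (K.coeff f)) (F ∘ K.monPoly))))
    a b : Vec K.Carrier n → ℤ
    a v = ∑ elements (λ x → δ (charPoly x) v)
    b v = Ψ B n (λ f → δ f v)
    inner-nonneg : ∀ v P → 0ℤ ℤ.≤ ∑ (range B) (λ k → ι (suc k *ℕ K.PrimePoly.deg P ℕ.≟ n) *ᶻ δ (K.pow (K.PrimePoly.pol P) (suc k)) v)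
    inner-nonneg v P = ∑-nonneg (range B) (λ k → ι*ι≥0 (suc k *ℕ K.PrimePoly.deg P ℕ.≟ n) (K.pow (K.PrimePoly.pol P) (suc k) K.≈? K.monPoly v))
    b-nonneg : ∀ v → 0ℤ ℤ.≤ b v
    b-nonneg v = ∑-nonneg (K.primes B) (λ P → ℤ.≤-trans (ℤ.≤-reflexive (sym (ℤ.*-zeroʳ (ℤ.+ K.PrimePoly.deg P)))) (ℤ.*-monoˡ-≤-nonNeg (ℤ.+ K.PrimePoly.deg P) (inner-nonneg v P)))
    total : ∑ Vₙ a ≡ ∑ Vₙ b
    total = begin
      ∑ Vₙ a
        ≡⟨ ∑-swap elements Vₙ (λ x v → δ (charPoly x) v) ⟨
      ∑ elements (λ x → ∑ Vₙ (δ (charPoly x)))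
        ≡⟨ ∑-cong elements (λ x → hits (charPoly-monic x)) ⟩
      ∑ elements (λ _ → 1ℤ)
        ≡⟨ trans (∑-1 elements) (cong ℤ.+_ card-L) ⟩
      ℤ.+ (Q ℕ.^ n)
        ≡⟨ K.Ψ-total B n′ n≤B ⟨
      Ψ B n (λ _ → 1ℤ)
        ≡⟨ K.Ψ-cong B n (λ mf → sym (hits mf)) ⟩
      Ψ B n (λ f → ∑ Vₙ (δ f))
        ≡⟨ K.Ψ-∑ B n Vₙ (λ v f → δ f v) ⟩
      ∑ Vₙ b ∎
      where
      hits : ∀ {f} → K.Monic n f → ∑ Vₙ (δ f) ≡ 1ℤ
      hits {f} mf = trans (∑-cong Vₙ (λ v → ι-cong (f K.≈? K.monPoly v) (v ≟ᵥ K.take n (K.coeff f))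
        (λ e → K.monPoly-injective (K.Ring.trans (K.Ring.sym e) (K.Ring.sym (K.monPoly-take mf)))) (λ { refl → K.Ring.sym (K.monPoly-take mf) })))
        (∑-ι1 (vecFinite K.finite n) (K.take n (K.coeff f)))
    a≤b : ∀ v → a v ℤ.≤ b v
    a≤b v = by-search (Finite.any? finite (λ x → charPoly x K.≈? K.monPoly v))
      where
      by-search : Dec (∃ λ x → charPoly x K.≈ K.monPoly v) → a v ℤ.≤ b v
      by-search (no ¬x) = ℤ.≤-trans (ℤ.≤-reflexive (trans (∑-cong elements (λ x → ι-no (charPoly x K.≈? K.monPoly v) (λ e → ¬x (x , e)))) (∑-ε elements))) (b-nonneg v)
      by-search (yes (x₀ , e₀)) = ℤ.≤-trans a≤d d≤b
        where
        open Period (period x₀)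
        P₀ : K.PrimePoly
        P₀ = mkPrime d (minPoly x₀) (minPoly-irreducible x₀)
        k₀ : ℕ
        k₀ = multiplicity x₀
        P₀^k≈v : K.pow (minPoly x₀) k₀ K.≈ K.monPoly v
        P₀^k≈v = K.Ring.trans (K.Ring.sym (charPoly≈pow x₀)) e₀
        root : ∀ x → charPoly x K.≈ K.monPoly v → evalK (minPoly x₀) (- x) ≡ 0#
        root x e = map-root (minPoly x₀) k₀ (trans (eval-cong (↑.mapPoly-cong (K.Ring.trans P₀^k≈v (K.Ring.trans (K.Ring.sym e) (charPoly≈pow x)))) (- x))
          (power-root (multiplicity x) (λ k≡0 → contradiction (trans (n≡k*d x) (cong (_*ℕ Period.d (period x)) k≡0)) λ ())))
          where
          power-root : ∀ k → k ≢ 0 → evalK (K.pow (minPoly x) k) (- x) ≡ 0#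
          power-root zero    k≢0 = contradiction refl k≢0
          power-root (suc k) _   = trans (eval-cong (↑.mapPoly-⊗ (minPoly x) (K.pow (minPoly x) k)) (- x))
            (trans (eval-⊗ (↑.mapPoly (minPoly x)) (↑.mapPoly (K.pow (minPoly x) k)) (- x)) (trans (cong (_* evalK (K.pow (minPoly x) k) (- x)) (minPoly-root x)) (zeroˡ _)))
        a≤d : a v ℤ.≤ ℤ.+ d
        a≤d = ℤ.≤-trans (∑-mono elements (λ x → ι-mono (charPoly x K.≈? K.monPoly v) (evalK (minPoly x₀) (- x) ≟ 0#) (root x)))
          -- The polynomial `charPoly x` has the root `- x`, so the roots are counted after the
          -- substitution `x ↦ - x`.
          (ℤ.≤-trans (ℤ.≤-reflexive (sym (reindex finite finite (λ x → - x) (λ x → - x) neg-neg neg-neg (λ y → ι (evalK (minPoly x₀) y ≟ 0#)))))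
            (root-count (↑.mapPoly-monic (minPoly-monic x₀))))
          where
          neg-neg : ∀ x → - (- x) ≡ x
          neg-neg x = S.solve 1 (λ x → S.:- (S.:- x) S.:= x) refl x
            where module S = Solver
        d≤n : d ≤ n
        d≤n = ℕ.≤-trans (ℕ.≤-trans (ℕ.≤-reflexive (sym (ℕ.*-identityˡ d))) (ℕ.*-monoˡ-≤ d (1≤k k₀ (n≡k*d x₀)))) (ℕ.≤-reflexive (sym (n≡k*d x₀)))
          where
          1≤k : ∀ k → n ≡ k *ℕ d → 1 ≤ k
          1≤k (suc k) e = s≤s z≤n
        -- The other terms of the sum are nonnegative, and the prime power `P₀ ^ k₀` alone
        -- contributes its von Mangoldt weight `d`.
        d≤b : ℤ.+ d ℤ.≤ b v
        d≤b = ℤ.≤-trans (ℤ.≤-reflexive (sym (K.primes-pick P₀ (ℕ.≤-trans d≤n n≤B) (λ P → ℤ.+ K.PrimePoly.deg P) (ℤ.+ d)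
                  (λ P e → cong ℤ.+_ (K.monic-degree (K.monic-cong e (K.PrimePoly.isMonic P)) (minPoly-monic x₀))))))
                (∑-mono (K.primes B) (λ P → each P (K.PrimePoly.pol P K.≈? minPoly x₀)))
          where
          each : ∀ P (e : Dec (K.PrimePoly.pol P K.≈ minPoly x₀)) → ι e *ᶻ ℤ.+ K.PrimePoly.deg P ℤ.≤
                 ℤ.+ K.PrimePoly.deg P *ᶻ ∑ (range B) (λ k → ι (suc k *ℕ K.PrimePoly.deg P ℕ.≟ n) *ᶻ δ (K.pow (K.PrimePoly.pol P) (suc k)) v)
          each P (no _)  = ℤ.≤-trans (ℤ.≤-reflexive (sym (ℤ.*-zeroʳ (ℤ.+ K.PrimePoly.deg P)))) (ℤ.*-monoˡ-≤-nonNeg (ℤ.+ K.PrimePoly.deg P) (inner-nonneg v P))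
          each P (yes e) = ℤ.≤-trans (ℤ.≤-reflexive (ℤ.*-comm 1ℤ (ℤ.+ K.PrimePoly.deg P))) (ℤ.*-monoˡ-≤-nonNeg (ℤ.+ K.PrimePoly.deg P) (at-least-one k₀ refl))
            where
            deg≡d : K.PrimePoly.deg P ≡ d
            deg≡d = K.monic-degree (K.monic-cong e (K.PrimePoly.isMonic P)) (minPoly-monic x₀)
            term : ℕ → ℤ
            term k = ι (suc k *ℕ K.PrimePoly.deg P ℕ.≟ n) *ᶻ δ (K.pow (K.PrimePoly.pol P) (suc k)) v
            term-nonneg : ∀ k → 0ℤ ℤ.≤ term k
            term-nonneg k = ι*ι≥0 (suc k *ℕ K.PrimePoly.deg P ℕ.≟ n) (K.pow (K.PrimePoly.pol P) (suc k) K.≈? K.monPoly v)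
            at-least-one : ∀ k → k₀ ≡ k → 1ℤ ℤ.≤ ∑ (range B) term
            at-least-one zero    k≡ = contradiction (trans (n≡k*d x₀) (cong (_*ℕ d) k≡)) λ ()
            at-least-one (suc k) k≡ = ℤ.≤-trans (ℤ.≤-reflexive (sym (cong₂ _*ᶻ_
                (ι-yes (suc k *ℕ K.PrimePoly.deg P ℕ.≟ n) (sym (trans (n≡k*d x₀) (cong₂ _*ℕ_ k≡ (sym deg≡d)))))
                (ι-yes (K.pow (K.PrimePoly.pol P) (suc k) K.≈? K.monPoly v) (K.Ring.trans (K.pow-cong e (suc k)) (subst (λ j → K.pow (minPoly x₀) j K.≈ K.monPoly v) k≡ P₀^k≈v))))))
              (term≤∑ {f = term} term-nonneg (∈-range k<B))
              where
              k<B : k < B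
              k<B = ℕ.≤-trans (ℕ.≤-trans (ℕ.≤-reflexive (sym (ℕ.*-identityʳ (suc k)))) (ℕ.≤-trans (ℕ.*-monoʳ-≤ (suc k) positive)
                (ℕ.≤-reflexive (sym (trans (n≡k*d x₀) (cong (_*ℕ d) k≡)))))) n≤B

  conjProduct-φ : ∀ m x → conjProduct m (φ x) ≡ φ (conjProduct m x)
  conjProduct-φ zero    x = sym φ-1
  conjProduct-φ (suc m) x = trans (cong (φ x *_) (conjProduct-φ m (φ x))) (sym (φ-* x _))

  conjSum-φ : ∀ m x → conjSum m (φ x) ≡ φ (conjSum m x)
  conjSum-φ zero    x = sym Φ.h-0
  conjSum-φ (suc m) x = trans (cong (φ x +_) (conjSum-φ m (φ x))) (sym (φ-+ x _))

  -- The monomial with exponent `gaussian m`, in Horner form, whose values are the products of the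
  -- first `m` conjugates.
  normPoly : ℕ → Poly
  normPoly zero    = 1ₚ
  normPoly (suc m) = X ⊗ pow (normPoly m) Q

  normPoly-monic : ∀ m → Monic (gaussian m) (normPoly m)
  normPoly-monic zero    = monic-1
  normPoly-monic (suc m) = monic-⊗ (monic-monPoly (0# ∷ [])) (monic-pow (normPoly-monic m) Q)

  eval-normPoly : ∀ m x → eval (normPoly m) x ≡ conjProduct m x
  eval-normPoly zero    x = eval-1 x
  eval-normPoly (suc m) x = trans (eval-⊗ X (pow (normPoly m) Q) x) (cong₂ _*_ (eval-X x)
    (trans (eval-pow (normPoly m) Q x) (trans (cong (_^ Q) (eval-normPoly m x)) (sym (conjProduct-φ m x)))))

  norm-fibre≤ : ∀ u → ∑ elements (λ x → ι (norm x K.≟ u)) ℤ.≤ ℤ.+ gaussian n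
  norm-fibre≤ u = ℤ.≤-trans (∑-mono elements (λ x → ι-mono (norm x K.≟ u) (eval f x ≟ 0#) (root x)))
    (root-count (monic-⊕ (normPoly-monic n) (Below-mono (s≤s z≤n) (bounded (constantPoly (- embed u))))))
    where
    f : Poly
    f = normPoly n ⊕ constantPoly (- embed u)
    root : ∀ x → norm x ≡ u → eval f x ≡ 0#
    root x e = trans (eval-⊕ (normPoly n) (constantPoly (- embed u)) x) (trans (cong₂ _+_
      (trans (eval-normPoly n x) (trans (sym (embed-norm x)) (cong embed e))) (trans (cong (- embed u +_) (zeroʳ x)) (+-identityʳ _))) (-‿inverseʳ (embed u)))

  norm≡0 : ∀ x → norm x ≡ K.0# → x ≡ 0#
  norm≡0 x e with x ≟ 0#
  ... | yes x≡0 = x≡0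
  ... | no  x≢0 = contradiction e (norm-≢0 x≢0)

  -- A fibre consists of roots of a monic polynomial of degree `gaussian n`, and the fibre over 0 is
  -- a single point. These bounds add up to the cardinality `Q^n`, so all of them are attained.
  norm-fibre : ∀ {u} → u ≢ K.0# → ∑ elements (λ x → ι (norm x K.≟ u)) ≡ ℤ.+ gaussian n
  norm-fibre {u} u≢0 = trans (∑-squeeze bounded-by total (K.complete u)) (nonzero-bound (u K.≟ K.0#))
    where
    open ≡-Reasoning
    g : ℤ
    g = ℤ.+ gaussian n
    fibre bound′ : K.Carrier → ℤ
    fibre w = ∑ elements (λ x → ι (norm x K.≟ w))
    bound′ w = ι (w K.≟ K.0#) *ᶻ (1ℤ -ᶻ g) +ᶻ g
    nonzero-bound : (d : Dec (u ≡ K.0#)) → ι d *ᶻ (1ℤ -ᶻ g) +ᶻ g ≡ g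
    nonzero-bound (yes u≡0) = contradiction u≡0 u≢0
    nonzero-bound (no _)    = ℤ.+-identityˡ g
    bounded-by : ∀ w → fibre w ℤ.≤ bound′ w
    bounded-by w with w K.≟ K.0#
    ... | no _     = ℤ.≤-trans (norm-fibre≤ w) (ℤ.≤-reflexive (sym (ℤ.+-identityˡ g)))
    ... | yes refl = ℤ.≤-reflexive (trans (∑-cong elements (λ x → ι-cong (norm x K.≟ K.0#) (x ≟ 0#) (norm≡0 x) (λ { refl → norm-0 })))
      (trans (∑-ι1 finite 0#) (lemma g)))
      where
      lemma : ∀ g → 1ℤ ≡ 1ℤ *ᶻ (1ℤ -ᶻ g) +ᶻ g
      lemma = solve-∀
    total : ∑ K.elements fibre ≡ ∑ K.elements bound′
    total = begin
      ∑ K.elements fibre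
        ≡⟨ ∑-swap elements K.elements (λ x w → ι (norm x K.≟ w)) ⟨
      ∑ elements (λ x → ∑ K.elements (λ w → ι (norm x K.≟ w)))
        ≡⟨ ∑-cong elements (λ x → trans (∑-cong K.elements (λ w → ι-cong (norm x K.≟ w) (w K.≟ norm x) sym sym)) (∑-ι1 K.finite (norm x))) ⟩
      ∑ elements (λ _ → 1ℤ)
        ≡⟨ trans (∑-1 elements) (cong ℤ.+_ card-L) ⟩
      ℤ.+ (Q ℕ.^ n)
        ≡⟨ lemma (ℤ.+ Q) g (ℤ.+ (Q ℕ.^ n)) (trans (cong (1ℤ +ᶻ_) (sym (ℤ.pos-* Q (gaussian n)))) (trans (cong ℤ.+_ (gaussian-pow n)) (ℤ.pos-+ (gaussian n) (Q ℕ.^ n)))) ⟩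
      (1ℤ -ᶻ g) +ᶻ ℤ.+ Q *ᶻ g
        ≡⟨ cong₂ _+ᶻ_ (∑-ι K.finite K.0# (λ _ → 1ℤ -ᶻ g)) (∑-const K.elements g) ⟨
      ∑ K.elements (λ w → ι (w K.≟ K.0#) *ᶻ (1ℤ -ᶻ g)) +ᶻ ∑ K.elements (λ _ → g)
        ≡⟨ ∑-∙ K.elements (λ w → ι (w K.≟ K.0#) *ᶻ (1ℤ -ᶻ g)) (λ _ → g) ⟨
      ∑ K.elements bound′ ∎
      where
      lemma : ∀ q g qn → 1ℤ +ᶻ q *ᶻ g ≡ g +ᶻ qn → qn ≡ (1ℤ -ᶻ g) +ᶻ q *ᶻ g
      lemma q g qn e = trans (rearrange g qn) (trans (cong (_-ᶻ g) (sym e)) (rearrange′ q g))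
        where
        rearrange : ∀ g qn → qn ≡ (g +ᶻ qn) -ᶻ g
        rearrange = solve-∀
        rearrange′ : ∀ q g → (1ℤ +ᶻ q *ᶻ g) -ᶻ g ≡ (1ℤ -ᶻ g) +ᶻ q *ᶻ g
        rearrange′ = solve-∀

  -- Takes the values `x + x^Q + ⋯ + x^(Q^m)`, so the index is one less than the number of
  -- conjugates.
  tracePoly : ℕ → Poly
  tracePoly zero    = X
  tracePoly (suc m) = pow (tracePoly m) Q ⊕ X

  1≤Q^ : ∀ m → 1 ≤ Q ℕ.^ m
  1≤Q^ m = ℕ.m^n>0 Q {{ℕ.>-nonZero (ℕ.≤-trans (s≤s z≤n) 2≤Q)}} m

  tracePoly-monic : ∀ m → Monic (Q ℕ.^ m) (tracePoly m)
  tracePoly-monic zero    = monic-monPoly (0# ∷ [])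
  tracePoly-monic (suc m) = monic-⊕ (monic-pow (tracePoly-monic m) Q)
    (Below-mono (ℕ.≤-trans 2≤Q (ℕ.≤-trans (ℕ.≤-reflexive (sym (ℕ.*-identityʳ Q))) (ℕ.*-monoʳ-≤ Q (1≤Q^ m)))) (bounded X))

  eval-tracePoly : ∀ m x → eval (tracePoly m) x ≡ conjSum (suc m) x
  eval-tracePoly zero    x = trans (eval-X x) (sym (+-identityʳ x))
  eval-tracePoly (suc m) x = trans (eval-⊕ (pow (tracePoly m) Q) X x) (trans (cong₂ _+_
    (trans (eval-pow (tracePoly m) Q x) (trans (cong (_^ Q) (eval-tracePoly m x)) (sym (conjSum-φ (suc m) x)))) (eval-X x)) (+-comm _ x))

  -- The trace is given by a monic polynomial of degree `Q^(n-1)`, which cannot vanish at all `Q^n`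
  -- elements.
  trace-nonzero : ∃ λ x → trace x ≢ K.0#
  trace-nonzero = by-search (Finite.any? finite (λ x → ≢? (trace x K.≟ K.0#)))
    where
    ≢? : {P : Set} → Dec P → Dec (¬ P)
    ≢? (yes p) = no (λ ¬p → ¬p p)
    ≢? (no ¬p) = yes ¬p
    by-search : Dec (∃ λ x → trace x ≢ K.0#) → ∃ λ x → trace x ≢ K.0#
    by-search (yes r) = r
    by-search (no ¬r) = contradiction (ℤ.drop‿+≤+ (ℤ.≤-trans (ℤ.≤-reflexive (sym all-roots)) (root-count (tracePoly-monic n′)))) (ℕ.<⇒≱ Q^n′<Q^n)
      where
      trace≡0 : ∀ x → trace x ≡ K.0#
      trace≡0 x with trace x K.≟ K.0#
      ... | yes e = e
      ... | no ≢0 = contradiction (x , ≢0) ¬r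
      all-roots : ∑ elements (λ x → ι (eval (tracePoly n′) x ≟ 0#)) ≡ ℤ.+ (Q ℕ.^ n)
      all-roots = trans (∑-cong elements (λ x → ι-yes (eval (tracePoly n′) x ≟ 0#)
        (trans (eval-tracePoly n′ x) (trans (sym (embed-trace x)) (trans (cong embed (trace≡0 x)) ↑.h-0))))) (trans (∑-1 elements) (cong ℤ.+_ card-L))
      Q^n′<Q^n : Q ℕ.^ n′ < Q ℕ.^ n
      Q^n′<Q^n = ℕ.^-monoʳ-< Q 2≤Q (ℕ.n<1+n n′)

  trace-surjective : ∀ t → ∃ λ x → trace x ≡ t
  trace-surjective t = embed (t K.* c K.⁻¹) * x₀ , trans (trace-scale (t K.* c K.⁻¹) x₀)
    (trans (K.*-assoc t (c K.⁻¹) c) (trans (cong (t K.*_) (K.*-inverseˡ (proj₂ trace-nonzero))) (K.*-identityʳ t)))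
    where
    x₀ : Carrier
    x₀ = proj₁ trace-nonzero
    c : K.Carrier
    c = trace x₀

  -- The factor `s` is removed by a substitution, and the fibres of the trace are translates of each
  -- other because the trace is surjective.
  trace-fibre : ∀ {s} → s ≢ 0# → ∀ t t′ → ∑ elements (λ x → ι (trace (s * x) K.≟ t)) ≡ ∑ elements (λ x → ι (trace (s * x) K.≟ t′))
  trace-fibre {s} s≢0 t t′ = trans (unscale t) (trans shifted (sym (unscale t′)))
    where
    unscale : ∀ t → ∑ elements (λ x → ι (trace (s * x) K.≟ t)) ≡ ∑ elements (λ x → ι (trace x K.≟ t))
    unscale t = sym (reindex finite finite (s *_) (s ⁻¹ *_) (cancelʳ s≢0) (cancelˡ s≢0) (λ x → ι (trace x K.≟ t)))
    δ : Carrier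
    δ = proj₁ (trace-surjective (t K.- t′))
    trace-δ : trace δ ≡ t K.- t′
    trace-δ = proj₂ (trace-surjective (t K.- t′))
    shifted : ∑ elements (λ x → ι (trace x K.≟ t)) ≡ ∑ elements (λ x → ι (trace x K.≟ t′))
    shifted = trans (reindex finite finite (_+ δ) (_- δ) (λ x → S.solve 2 (λ x d → x S.:- d S.:+ d S.:= x) refl x δ) (λ x → S.solve 2 (λ x d → x S.:+ d S.:- d S.:= x) refl x δ) (λ x → ι (trace x K.≟ t)))
      (∑-cong elements (λ x → ι-cong (trace (x + δ) K.≟ t) (trace x K.≟ t′)
        (λ e → trans (SK.solve 3 (λ a b c → a SK.:= a SK.:+ (b SK.:- c) SK.:- (b SK.:- c)) refl (trace x) t t′)
          (trans (cong (K._- (t K.- t′)) (trans (cong (trace x K.+_) (sym trace-δ)) (trans (sym (trace-+ x δ)) e))) (SK.solve 2 (λ b c → b SK.:- (b SK.:- c) SK.:= c) refl t t′)))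
        (λ e → trans (trace-+ x δ) (trans (cong₂ K._+_ e trace-δ) (SK.solve 2 (λ b c → c SK.:+ (b SK.:- c) SK.:= b) refl t t′)))))
      where
      module S = Solver
      module SK = K.Solver

  norm-neg-1 : norm (- 1#) ≡ sign n
  norm-neg-1 = ↑.h-injective (trans (embed-norm (- 1#)) (go n))
    where
    φ-neg-1 : φ (- 1#) ≡ - 1#
    φ-neg-1 = trans (Φ.h-neg 1#) (cong (λ z → - z) φ-1)
    go : ∀ m → conjProduct m (- 1#) ≡ embed (sign m)
    go zero    = sym embed-1
    go (suc m) = trans (cong (- 1# *_) (trans (cong (conjProduct m) φ-neg-1) (go m)))
      (trans (S.solve 1 (λ a → S.:- S.con 1ℤ S.:* a S.:= S.:- a) refl (embed (sign m))) (sym (↑.h-neg (sign m))))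
      where module S = Solver

-- The interface of norm and trace used by the counting arguments

module NormTraces where

  open import Data.Nat.Base using (ℕ; suc; _≤_; _^_)
  open import Data.Nat.Primality using (Prime)
  open import Data.Integer.Base using (ℤ; +_)
  open import Relation.Binary.PropositionalEquality using (_≡_; _≢_)
  open FiniteField using (Field)
  open Extensions using (Extension; extensionOfDegree)
  open import Data.Vec.Base using (Vec; zipWith)
  open IntegerSums using (∑; ι)

  -- Separates the properties of an extension from its construction. The link to polynomials is
  -- `char-sum`; the vectors at the end serve the identification with coordinates.
  record NormTrace {p : ℕ} (K : Field p) (n : ℕ) : Set₁ where
    private module K = Field K
    field
      L        : Field p
    private module L = Field L
    field
      card-L   : L.card ≡ K.card ^ n
      charPoly : L.Carrier → Polynomials.Poly K

    -- charPoly x is the characteristic polynomial of -x, so that no signs occur here.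
    norm : L.Carrier → K.Carrier
    norm x = Polynomials.coeff (charPoly x) 0

    trace : L.Carrier → K.Carrier
    trace x = Polynomials.subleading K n (charPoly x)

    field
      char-sum    : ∀ {B} → n ≤ B → (F : Polynomials.Poly K → ℤ) → (∀ {f g} → Polynomials._≈_ K f g → F f ≡ F g) →
                    ∑ L.elements (λ x → F (charPoly x)) ≡ PolynomialTheory.PrimePowers.Ψ K B n F
      norm-*      : ∀ x y → norm (x L.* y) ≡ norm x K.* norm y
      norm-0      : norm L.0# ≡ K.0#
      norm-≢0     : ∀ {x} → x ≢ L.0# → norm x ≢ K.0#
      norm-neg-1  : norm (L.- L.1#) ≡ GaussianNumbers.sign K n
      norm-fibre  : ∀ {u} → u ≢ K.0# → ∑ L.elements (λ x → ι (norm x K.≟ u)) ≡ + GaussianNumbers.gaussian K n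
      trace-+     : ∀ x y → trace (x L.+ y) ≡ trace x K.+ trace y
      trace-fibre : ∀ {s} → s ≢ L.0# → ∀ t t′ → ∑ L.elements (λ x → ι (trace (s L.* x) K.≟ t)) ≡ ∑ L.elements (λ x → ι (trace (s L.* x) K.≟ t′))

      vector        : Vec K.Carrier n → L.Carrier
      coords        : L.Carrier → Vec K.Carrier n
      vector-+      : ∀ v w → vector (zipWith K._+_ v w) ≡ vector v L.+ vector w
      vector-coords : ∀ x → vector (coords x) ≡ x
      coords-vector : ∀ v → coords (vector v) ≡ v

  normTrace : ∀ {p} → Prime p → (K : Field p) → ∀ n → Extension K (suc n) → NormTrace K (suc n)
  normTrace p-prime K n E = record
    { L           = Extension.extension E
    ; card-L      = Extension.card-L E
    ; charPoly    = Galois.charPoly p-prime K n E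
    ; char-sum    = Galois.char-sum p-prime K n E
    ; norm-*      = Galois.norm-* p-prime K n E
    ; norm-0      = Galois.norm-0 p-prime K n E
    ; norm-≢0     = Galois.norm-≢0 p-prime K n E
    ; norm-neg-1  = Galois.norm-neg-1 p-prime K n E
    ; norm-fibre  = Galois.norm-fibre p-prime K n E
    ; trace-+     = Galois.trace-+ p-prime K n E
    ; trace-fibre = Galois.trace-fibre p-prime K n E
    ; vector = Extension.vector E ; coords = Extension.coords E ; vector-+ = Extension.vector-+ E
    ; vector-coords = Extension.vector-coords E ; coords-vector = Extension.coords-vector E
    }

  abstract
    normTraceOfDegree : ∀ {p} → Prime p → (K : Field p) → ∀ n → NormTrace K (suc n)
    normTraceOfDegree p-prime K n = normTrace p-prime K n (extensionOfDegree K n)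

open NormTraces using (NormTrace)

-- The two counts compared by the Hasse-Davenport relation

module Counts {p : ℕ} (K : Field p) (l′ : ℕ) (T₁ : NormTrace K (suc l′)) (T₂ : NormTrace K (suc (suc l′))) where

  open import Data.Integer.Base using (ℤ) renaming (_*_ to _*ᶻ_)
  open IntegerSums

  module N₁ = NormTrace T₁
  module N₂ = NormTrace T₂
  module L₁ = Field N₁.L
  module L₂ = Field N₂.L

  open Field K

  -- In `count₁` the element `z` stands for the extension of degree one, whose norm and trace are
  -- the identity. The two counts are those behind the Gauss sum of `L₂` and the product of the
  -- Gauss sums of `L₁` and `K`.
  count₂ count₁ : Carrier → Carrier → ℤ
  count₂ u t = ∑ L₂.elements (λ y → ι (N₂.norm y ≟ u) *ᶻ ι (N₂.trace y ≟ t))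
  count₁ u t = ∑ L₁.elements (λ x → ∑ elements (λ z → ι (N₁.norm x * z ≟ u) *ᶻ ι (N₁.trace x + z ≟ t)))

-- The Hasse-Davenport relation in terms of counts

module HasseDavenport {p : ℕ} (K : Field p) (l′ : ℕ) (T₁ : NormTrace K (suc l′)) (T₂ : NormTrace K (suc (suc l′))) where

  import Algebra.Bundles
  open import Data.Nat.Base as ℕ using (zero; _<_; s≤s; _∸_) renaming (_+_ to _+ℕ_)
  import Data.Nat.Properties as ℕ
  open import Data.Integer.Base as ℤ using (ℤ; 1ℤ) renaming (_+_ to _+ᶻ_; _*_ to _*ᶻ_)
  import Data.Integer.Properties as ℤ
  open import Data.Vec.Base using (Vec; [])
  open import Relation.Binary.PropositionalEquality
  open import Function.Base using (_∘_)
  open IntegerSums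
  open Counts K l′ T₁ T₂

  private module TK = PolynomialTheory K
  open TK.𝔽
  open TK.Polys
  open TK.Factorization
  open TK.PrimePowers hiding (Q)
  open TK.PrimeExistence

  private
    n : ℕ
    n = suc (suc l′)

  ∑-translate : ∀ s t → ∑ elements (λ a → ι (s + a ≟ t)) ≡ 1ℤ
  ∑-translate s t = trans (∑-cong elements (λ a → ι-cong (s + a ≟ t) (a ≟ t - s)
    (λ e → trans (S.solve 2 (λ s a → a S.:= s S.:+ a S.:- s) refl s a) (cong (_- s) e))
    (λ { refl → S.solve 2 (λ s t → s S.:+ (t S.:- s) S.:= t) refl s t }))) (∑-ι1 finite (t - s))
    where module S = Solver

  subleading-uniform : ∀ m s t t′ → ∑ (V (suc m)) (λ w → ι (s + mon w m ≟ t)) ≡ ∑ (V (suc m)) (λ w → ι (s + mon w m ≟ t′))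
  subleading-uniform m s t t′ = trans (go m t) (sym (go m t′))
    where
    go : ∀ m t → ∑ (V (suc m)) (λ w → ι (s + mon w m ≟ t)) ≡ ℤ.+ (card ℕ.^ m)
    go zero    t = trans (∑-vectors 0 elements (λ w → ι (s + mon w 0 ≟ t))) (trans (∑-cong elements (λ a → ℤ.+-identityʳ (ι (s + a ≟ t)))) (∑-translate s t))
    go (suc m) t = trans (∑-vectors (suc m) elements (λ w → ι (s + mon w (suc m) ≟ t))) (trans (∑-cong elements (λ a → go m t))
      (trans (∑-const elements (ℤ.+ (card ℕ.^ m))) (sym (ℤ.pos-* card (card ℕ.^ m)))))

  module _ (u : Carrier) where

    weight : Carrier → Poly → ℤ
    weight t f = ι (coeff f 0 ≟ u) *ᶻ ι (subleading n f ≟ t)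

    weight-cong : ∀ t {f g} → f ≈ g → weight t f ≡ weight t g
    weight-cong t e = cong₂ (λ a b → ι (a ≟ u) *ᶻ ι (b ≟ t)) (at e 0) (at e (suc l′))

    -- For monic `g` of degree `suc l′` this is the sum of `weight t` over the products of `g` with
    -- the linear polynomials `X + z`.
    pairWeight : Carrier → Poly → ℤ
    pairWeight t g = ∑ elements (λ z → ι (coeff g 0 * z ≟ u) *ᶻ ι (subleading (suc l′) g + z ≟ t))

    pairWeight-cong : ∀ t {f g} → f ≈ g → pairWeight t f ≡ pairWeight t g
    pairWeight-cong t {f} {g} e = ∑-cong elements (λ z → cong₂ (λ a b → ι (a * z ≟ u) *ᶻ ι (b + z ≟ t)) (at e 0) (subleading-cong (suc l′) e))
      where
      subleading-cong : ∀ m {f g} → f ≈ g → subleading m f ≡ subleading m g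
      subleading-cong zero    e = refl
      subleading-cong (suc m) e = at e m

    weight-⊗ : ∀ t {j m g} → j +ℕ m ≡ n → Monic j g → (w : Vec Carrier m) →
               weight t (g ⊗ monPoly w) ≡ ι (coeff g 0 * mon w 0 ≟ u) *ᶻ ι (subleading j g + subleading m (monPoly w) ≟ t)
    weight-⊗ t {j} {m} {g} e mg w = cong₂ (λ a b → ι (a ≟ u) *ᶻ ι (b ≟ t)) (coeff-⊗ g (monPoly w) 0)
      (trans (cong (λ k → subleading k (g ⊗ monPoly w)) (sym e)) (subleading-⊗ mg (monic-monPoly w)))

    -- A cofactor of degree at least two has distinct constant and subleading coefficients. The
    -- latter is free once the former is fixed, so it takes every value equally often.
    cofactors-uniform : ∀ t t′ {j m g} → j +ℕ suc (suc m) ≡ n → Monic j g →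
                        ∑ (V (suc (suc m))) (λ w → weight t (g ⊗ monPoly w)) ≡ ∑ (V (suc (suc m))) (λ w → weight t′ (g ⊗ monPoly w))
    cofactors-uniform t t′ {j} {m} {g} e mg = trans (split t) (trans (∑-cong elements (λ a →
      cong (ι (coeff g 0 * a ≟ u) *ᶻ_) (subleading-uniform m (subleading j g) t t′))) (sym (split t′)))
      where
      split : ∀ t → ∑ (V (suc (suc m))) (λ w → weight t (g ⊗ monPoly w)) ≡
              ∑ elements (λ a → ι (coeff g 0 * a ≟ u) *ᶻ ∑ (V (suc m)) (λ w → ι (subleading j g + mon w m ≟ t)))
      split t = trans (∑-cong (V (suc (suc m))) (weight-⊗ t e mg)) (trans (∑-vectors (suc m) elements (λ w → ι (coeff g 0 * mon w 0 ≟ u) *ᶻ ι (subleading j g + mon w (suc m) ≟ t)))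
        (∑-cong elements (λ a → sym (*-∑ (ι (coeff g 0 * a ≟ u)) (V (suc m)) (λ w → ι (subleading j g + mon w m ≟ t))))))

    cofactorSum : Carrier → ℕ → ℤ
    cofactorSum t i = Ψ n (suc i) (λ g → ∑ (V (n ∸ suc i)) (λ w → weight t (g ⊗ monPoly w)))

    count₂-≡ : ∀ t → count₂ u t ≡ cofactorSum t (suc l′)
    count₂-≡ t = trans (N₂.char-sum {n} ℕ.≤-refl (weight t) (weight-cong t)) (Ψ-cong n n (λ {g} mg → sym (trans
      (cong (λ m → ∑ (V m) (λ w → weight t (g ⊗ monPoly w))) (ℕ.n∸n≡0 l′)) (trans (ℤ.+-identityʳ (weight t (g ⊗ monPoly [])))
        (weight-cong t (Ring.trans (Ring.*-congˡ (coeffwise λ _ → refl)) (Ring.*-identityʳ g)))))))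

    -- A prime power of degree `n - 1` has linear cofactors `X + z`; this is where the second
    -- component `z` of `count₁` comes from.
    count₁-≡ : ∀ t → count₁ u t ≡ cofactorSum t l′
    count₁-≡ t = trans (N₁.char-sum {n} (ℕ.n≤1+n (suc l′)) (pairWeight t) (pairWeight-cong t)) (Ψ-cong n (suc l′) (λ {g} mg → sym (trans
      (cong (λ m → ∑ (V m) (λ w → weight t (g ⊗ monPoly w))) (ℕ.m+n∸n≡m 1 l′))
      (trans (∑-cong (V 1) (weight-⊗ t (ℕ.+-comm (suc l′) 1) mg)) (trans (∑-vectors 0 elements (λ w → ι (coeff g 0 * mon w 0 ≟ u) *ᶻ ι (subleading (suc l′) g + mon w 0 ≟ t)))
        (∑-cong elements (λ z → ℤ.+-identityʳ (ι (coeff g 0 * z ≟ u) *ᶻ ι (subleading (suc l′) g + z ≟ t)))))))))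

    -- Of the prime power expansion of Σ_f [f(0) = u][f has subleading coefficient t], only the
    -- terms of degree n and n - 1 depend on t.
    hasse-davenport : ∀ t t′ → count₂ u t +ᶻ count₁ u t ≡ count₂ u t′ +ᶻ count₁ u t′
    hasse-davenport t t′ = cancel (trans (sym (expansion t)) (trans (cong (ℤ.+ n *ᶻ_) all-uniform)
      (trans (expansion t′) (cong (λ z → (count₂ u t′ +ᶻ count₁ u t′) +ᶻ z) (∑-range-cong l′ rest-uniform)))))
      where
      rest : Carrier → ℤ
      rest t = ∑ (range l′) (cofactorSum t)
      expansion : ∀ t → ℤ.+ n *ᶻ ∑ (V n) (weight t ∘ monPoly) ≡ (count₂ u t +ᶻ count₁ u t) +ᶻ rest t
      expansion t = trans (prime-power-expansion {n} ℕ.≤-refl (weight t) (weight-cong t))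
        (trans (cong₂ (λ a b → a +ᶻ (b +ᶻ rest t)) (sym (count₂-≡ t)) (sym (count₁-≡ t))) (sym (ℤ.+-assoc (count₂ u t) (count₁ u t) (rest t))))
      all-uniform : ∑ (V n) (weight t ∘ monPoly) ≡ ∑ (V n) (weight t′ ∘ monPoly)
      all-uniform = trans (one t) (trans (cofactors-uniform t t′ refl monic-1) (sym (one t′)))
        where
        one : ∀ t → ∑ (V n) (weight t ∘ monPoly) ≡ ∑ (V n) (λ w → weight t (1ₚ ⊗ monPoly w))
        one t = ∑-cong (V n) (λ w → weight-cong t (Ring.sym (Ring.*-identityˡ (monPoly w))))
      rest-uniform : ∀ i → i < l′ → cofactorSum t′ i ≡ cofactorSum t i
      rest-uniform i i<l′ = Ψ-cong n (suc i) (λ {g} mg → subst (λ m → ∑ (V m) (λ w → weight t′ (g ⊗ monPoly w)) ≡ ∑ (V m) (λ w → weight t (g ⊗ monPoly w)))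
        (sym size) (cofactors-uniform t′ t (trans (cong (suc i +ℕ_) (sym size)) (ℕ.m+[n∸m]≡n {suc i} {n} (s≤s (ℕ.≤-trans (ℕ.<⇒≤ i<l′) (ℕ.n≤1+n l′))))) mg))
        where
        size′ : ∀ m → i < m → suc m ∸ i ≡ suc (suc (m ∸ suc i))
        size′ (suc m) (s≤s i≤m) = trans (ℕ.+-∸-assoc 1 (ℕ.m≤n⇒m≤1+n i≤m)) (cong suc (ℕ.+-∸-assoc 1 i≤m))
        size : n ∸ suc i ≡ suc (suc (l′ ∸ suc i))
        size = size′ l′ i<l′
      cancel : (count₂ u t +ᶻ count₁ u t) +ᶻ rest t ≡ (count₂ u t′ +ᶻ count₁ u t′) +ᶻ rest t → count₂ u t +ᶻ count₁ u t ≡ count₂ u t′ +ᶻ count₁ u t′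
      cancel = ∙-cancelʳ (rest t) (count₂ u t +ᶻ count₁ u t) (count₂ u t′ +ᶻ count₁ u t′)
        where
        import Algebra.Bundles
        open import Algebra.Properties.Group (Algebra.Bundles.AbelianGroup.group ℤ.+-0-abelianGroup) using (∙-cancelʳ)

open import Data.Integer.Base as ℤ using (ℤ; 0ℤ; 1ℤ) renaming (_+_ to _+ᶻ_; _*_ to _*ᶻ_; _-_ to _-ᶻ_)

-- Pushforwards to `K` in place of characters

module Inversion {p : ℕ} (K : Field p) (σ τ : ℤ) where

  open import Data.Integer.Tactic.RingSolver using (solve-∀)
  import Data.Integer.Properties as ℤ
  open import Data.List.Base using (List; _∷_; length)
  open import Data.List.Membership.Propositional using (_∈_)
  open import Data.Product using (_,_)
  open import Data.Sum using ([_,_]′)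
  open import Relation.Nullary using (Dec; yes; no; contradiction)
  open import Relation.Binary.PropositionalEquality
  open FiniteSums using (Finite)
  open IntegerSums

  open Field K

  -- The constant functions are those whose sum against every nontrivial additive character
  -- vanishes; this predicate replaces the vanishing of character sums.
  Uniform : (Carrier → ℤ) → Set
  Uniform f = ∀ t t′ → f t ≡ f t′

  correlation : (Carrier → ℤ) → Carrier → ℤ
  correlation π t = ∑ elements (λ s → π (s + t) *ᶻ π s)

  -- The convolution identity of a partial difference set with eigenvalue sum σ and product τ,
  -- up to constants.
  Good : (Carrier → ℤ) → Set
  Good π = Uniform (λ t → correlation π t -ᶻ σ *ᶻ π t +ᶻ τ *ᶻ ι (t ≟ 0#))

  δ : Carrier → ℤ
  δ t = ι (t ≟ 0#)

  ∑-δ-shift : ∀ t (f : Carrier → ℤ) → ∑ elements (λ s → δ (s + t) *ᶻ f s) ≡ f (- t)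
  ∑-δ-shift t f = trans (∑-cong elements (λ s → cong (_*ᶻ f s) (ι-cong (s + t ≟ 0#) (s ≟ - t)
    (λ e → trans (S.solve 2 (λ s t → s S.:= s S.:+ t S.:- t) refl s t) (trans (cong (_- t) e) (+-identityˡ (- t))))
    (λ { refl → -‿inverseˡ t })))) (∑-ι finite (- t) f)
    where module S = Solver

  ∑-shift : ∀ t (f : Carrier → ℤ) → ∑ elements (λ s → f (s + t)) ≡ ∑ elements f
  ∑-shift t f = sym (reindex finite finite (_+ t) (_- t) (λ x → S.solve 2 (λ x d → x S.:- d S.:+ d S.:= x) refl x t)
    (λ x → S.solve 2 (λ x d → x S.:+ d S.:- d S.:= x) refl x t) f)
    where module S = Solver

  -- A record, so that the summands of a long combination built with `_⊞_` can be inferred from its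
  -- parts.
  record HasSum (f : Carrier → ℤ) (s : ℤ) : Set where
    constructor hasSum
    field
      sum : ∑ elements f ≡ s

  open HasSum

  scaled : ∀ c f {s} → ∑ elements f ≡ s → HasSum (λ x → c *ᶻ f x) (c *ᶻ s)
  scaled c f e = hasSum (trans (sym (*-∑ c elements f)) (cong (c *ᶻ_) e))

  infixl 6 _⊞_

  _⊞_ : ∀ {f g a b} → HasSum f a → HasSum g b → HasSum (λ x → f x +ᶻ g x) (a +ᶻ b)
  _⊞_ {f} {g} (hasSum e) (hasSum e′) = hasSum (trans (∑-∙ elements f g) (cong₂ _+ᶻ_ e e′))

  -- On a nontrivial additive character, `W-corr` and `W-even` force the transform of `W` to be 0 or
  -- `e`, so that of `π` is `γ` or `β e + γ`. By the two equations both values satisfy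
  -- `X² - σ X + τ = 0`, which is what `Good` expresses.
  record Profile (π : Carrier → ℤ) : Set where
    field
      C β γ e    : ℤ
      W          : Carrier → ℤ
      profile    : ∀ t → π t ≡ C +ᶻ β *ᶻ W t +ᶻ γ *ᶻ δ t
      W-corr     : ∀ t → ∑ elements (λ s → W (s + t) *ᶻ W s) ≡ e *ᶻ W t
      W-even     : ∀ t → W (- t) ≡ W t
      β-equation : β *ᶻ β *ᶻ e +ᶻ (β *ᶻ γ +ᶻ β *ᶻ γ) ≡ σ *ᶻ β
      γ-equation : γ *ᶻ γ -ᶻ σ *ᶻ γ +ᶻ τ ≡ 0ℤ

    good : Good π
    good t t′ = trans (value t) (sym (value t′))
      where
      1s S₁ : ℤ
      1s = ∑ elements (λ _ → 1ℤ)
      S₁ = ∑ elements W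
      K₀ : ℤ
      K₀ = C *ᶻ C *ᶻ 1s +ᶻ C *ᶻ β *ᶻ S₁ +ᶻ C *ᶻ γ *ᶻ 1ℤ +ᶻ β *ᶻ C *ᶻ S₁ +ᶻ γ *ᶻ C *ᶻ 1ℤ -ᶻ σ *ᶻ C
      expand : ∀ t s → π (s + t) *ᶻ π s ≡ C *ᶻ C *ᶻ 1ℤ +ᶻ C *ᶻ β *ᶻ W s +ᶻ C *ᶻ γ *ᶻ δ s +ᶻ β *ᶻ C *ᶻ W (s + t) +ᶻ β *ᶻ β *ᶻ (W (s + t) *ᶻ W s)
               +ᶻ β *ᶻ γ *ᶻ (δ s *ᶻ W (s + t)) +ᶻ γ *ᶻ C *ᶻ δ (s + t) +ᶻ γ *ᶻ β *ᶻ (δ (s + t) *ᶻ W s) +ᶻ γ *ᶻ γ *ᶻ (δ (s + t) *ᶻ δ s)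
      expand t s = trans (cong₂ _*ᶻ_ (profile (s + t)) (profile s)) (lemma C β γ (W (s + t)) (W s) (δ (s + t)) (δ s))
        where
        lemma : ∀ C β γ w w′ d d′ → (C +ᶻ β *ᶻ w +ᶻ γ *ᶻ d) *ᶻ (C +ᶻ β *ᶻ w′ +ᶻ γ *ᶻ d′) ≡
                C *ᶻ C *ᶻ 1ℤ +ᶻ C *ᶻ β *ᶻ w′ +ᶻ C *ᶻ γ *ᶻ d′ +ᶻ β *ᶻ C *ᶻ w +ᶻ β *ᶻ β *ᶻ (w *ᶻ w′)
                +ᶻ β *ᶻ γ *ᶻ (d′ *ᶻ w) +ᶻ γ *ᶻ C *ᶻ d +ᶻ γ *ᶻ β *ᶻ (d *ᶻ w′) +ᶻ γ *ᶻ γ *ᶻ (d *ᶻ d′)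
        lemma = solve-∀
      δ-total : ∑ elements δ ≡ 1ℤ
      δ-total = ∑-ι1 finite 0#
      δ-even : ∀ t → δ (- t) ≡ δ t
      δ-even t = ι-cong (- t ≟ 0#) (t ≟ 0#) (λ e → trans (S.solve 1 (λ t → t S.:= S.:- (S.:- t)) refl t) (trans (cong (λ z → - z) e) -0≡0)) (λ { refl → -0≡0 })
        where
        module S = Solver
        -0≡0 : - 0# ≡ 0#
        -0≡0 = S.solve 0 (S.:- S.con 0ℤ S.:= S.con 0ℤ) refl
      correlation-≡ : ∀ t → correlation π t ≡ C *ᶻ C *ᶻ 1s +ᶻ C *ᶻ β *ᶻ S₁ +ᶻ C *ᶻ γ *ᶻ 1ℤ +ᶻ β *ᶻ C *ᶻ S₁ +ᶻ β *ᶻ β *ᶻ (e *ᶻ W t)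
               +ᶻ β *ᶻ γ *ᶻ W t +ᶻ γ *ᶻ C *ᶻ 1ℤ +ᶻ γ *ᶻ β *ᶻ W t +ᶻ γ *ᶻ γ *ᶻ δ t
      correlation-≡ t = trans (∑-cong elements (expand t)) (sum
        (scaled (C *ᶻ C) (λ _ → 1ℤ) refl ⊞ scaled (C *ᶻ β) W refl ⊞ scaled (C *ᶻ γ) δ δ-total
        ⊞ scaled (β *ᶻ C) (λ s → W (s + t)) (∑-shift t W)
        ⊞ scaled (β *ᶻ β) (λ s → W (s + t) *ᶻ W s) (W-corr t)
        ⊞ scaled (β *ᶻ γ) (λ s → δ s *ᶻ W (s + t)) (trans (∑-ι finite 0# (λ s → W (s + t))) (cong W (+-identityˡ t)))
        ⊞ scaled (γ *ᶻ C) (λ s → δ (s + t)) (trans (∑-shift t δ) δ-total)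
        ⊞ scaled (γ *ᶻ β) (λ s → δ (s + t) *ᶻ W s) (trans (∑-δ-shift t W) (W-even t))
        ⊞ scaled (γ *ᶻ γ) (λ s → δ (s + t) *ᶻ δ s) (trans (∑-δ-shift t δ) (δ-even t))))
      value : ∀ t → correlation π t -ᶻ σ *ᶻ π t +ᶻ τ *ᶻ δ t ≡ K₀
      value t = begin
        correlation π t -ᶻ σ *ᶻ π t +ᶻ τ *ᶻ δ t
          ≡⟨ cong₂ (λ a b → a -ᶻ σ *ᶻ b +ᶻ τ *ᶻ δ t) (correlation-≡ t) (profile t) ⟩
        _
          ≡⟨ lemma C β γ e σ τ 1s S₁ (W t) (δ t) ⟩
        K₀ +ᶻ ((β *ᶻ β *ᶻ e +ᶻ (β *ᶻ γ +ᶻ β *ᶻ γ)) -ᶻ σ *ᶻ β) *ᶻ W t +ᶻ (γ *ᶻ γ -ᶻ σ *ᶻ γ +ᶻ τ) *ᶻ δ t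
          ≡⟨ cong₂ (λ a b → K₀ +ᶻ (a -ᶻ σ *ᶻ β) *ᶻ W t +ᶻ b *ᶻ δ t) β-equation γ-equation ⟩
        K₀ +ᶻ (σ *ᶻ β -ᶻ σ *ᶻ β) *ᶻ W t +ᶻ 0ℤ *ᶻ δ t
          ≡⟨ vanish K₀ (σ *ᶻ β) (W t) (δ t) ⟩
        K₀ ∎
        where
        open ≡-Reasoning
        lemma : ∀ C β γ e σ τ n S w d →
          (C *ᶻ C *ᶻ n +ᶻ C *ᶻ β *ᶻ S +ᶻ C *ᶻ γ *ᶻ 1ℤ +ᶻ β *ᶻ C *ᶻ S +ᶻ β *ᶻ β *ᶻ (e *ᶻ w) +ᶻ β *ᶻ γ *ᶻ w +ᶻ γ *ᶻ C *ᶻ 1ℤ +ᶻ γ *ᶻ β *ᶻ w +ᶻ γ *ᶻ γ *ᶻ d)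
            -ᶻ σ *ᶻ (C +ᶻ β *ᶻ w +ᶻ γ *ᶻ d) +ᶻ τ *ᶻ d ≡
          (C *ᶻ C *ᶻ n +ᶻ C *ᶻ β *ᶻ S +ᶻ C *ᶻ γ *ᶻ 1ℤ +ᶻ β *ᶻ C *ᶻ S +ᶻ γ *ᶻ C *ᶻ 1ℤ -ᶻ σ *ᶻ C)
            +ᶻ ((β *ᶻ β *ᶻ e +ᶻ (β *ᶻ γ +ᶻ β *ᶻ γ)) -ᶻ σ *ᶻ β) *ᶻ w +ᶻ (γ *ᶻ γ -ᶻ σ *ᶻ γ +ᶻ τ) *ᶻ d
        lemma = solve-∀
        vanish : ∀ k s w d → k +ᶻ (s -ᶻ s) *ᶻ w +ᶻ 0ℤ *ᶻ d ≡ k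
        vanish = solve-∀

  module _ {G : Set} (finiteG : Finite G) (_⊕_ _⊖_ : G → G → G) (𝟎 : G)
    (⊕-⊖ : ∀ h g → h ⊕ (g ⊖ h) ≡ g) (⊖-⊕ : ∀ h g → (h ⊕ g) ⊖ h ≡ g) (⊕-𝟎 : ∀ g → g ⊕ 𝟎 ≡ g)
    (⟨_,_⟩ : G → G → Carrier) (⟨⟩-⊕ : ∀ a g h → ⟨ a , g ⊕ h ⟩ ≡ ⟨ a , g ⟩ + ⟨ a , h ⟩)
    (⟨⟩-𝟎 : ∀ a → ⟨ a , 𝟎 ⟩ ≡ 0#) (𝟎-⟨⟩ : ∀ g → ⟨ 𝟎 , g ⟩ ≡ 0#)
    (uniformˡ : ∀ {g} → g ≢ 𝟎 → Uniform (λ t → ∑ (Finite.elements finiteG) (λ a → ι (⟨ a , g ⟩ ≟ t))))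
    (uniformʳ : ∀ {a} → a ≢ 𝟎 → Uniform (λ t → ∑ (Finite.elements finiteG) (λ g → ι (⟨ a , g ⟩ ≟ t)))) where

    private
      gs : List G
      gs = Finite.elements finiteG
      _≟ᴳ_ : (g h : G) → Dec (g ≡ h)
      _≟ᴳ_ = Finite._≟_ finiteG

    project : (G → ℤ) → G → Carrier → ℤ
    project f a t = ∑ gs (λ g → f g *ᶻ ι (⟨ a , g ⟩ ≟ t))

    -- Fourier inversion. Sum `f (g) * difference a ⟨ a , g ⟩` over all `a` and `g`. For fixed `a`
    -- the sum over `g` vanishes, by uniformity or, for `a = 𝟎`, by the hypothesis on the total. For
    -- fixed `g` the sum over `a` is zero unless `g = x`, where it is the order of `G`; this
    -- isolates `f x`.
    vanishing : (f : G → ℤ) → (∀ a → a ≢ 𝟎 → Uniform (project f a)) → ∑ gs f ≡ 0ℤ → ∀ x → f x ≡ 0ℤ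
    vanishing f uniform total x = [ (λ fx≡0 → fx≡0) , (λ size≡0 → contradiction size≡0 (nonempty gs (Finite.complete finiteG 𝟎))) ]′
      (ℤ.i*j≡0⇒i≡0∨j≡0 (f x) product≡0)
      where
      nonempty : ∀ xs → 𝟎 ∈ xs → ℤ.+ length xs ≢ 0ℤ
      nonempty (_ ∷ _) _ ()
      *-distribˡ-- : ∀ a b c → a *ᶻ (b -ᶻ c) ≡ a *ᶻ b -ᶻ a *ᶻ c
      *-distribˡ-- = solve-∀
      open ≡-Reasoning
      -- Subtracting the indicator of a second value removes the unknown constant of a uniform
      -- pushforward; the shift by 1 ensures that the two values differ.
      difference : G → Carrier → ℤ
      difference a s = ι (s ≟ ⟨ a , x ⟩) -ᶻ ι (s ≟ ⟨ a , x ⟩ + 1#)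
      by-functional : ∀ a → ∑ gs (λ g → f g *ᶻ difference a ⟨ a , g ⟩) ≡ 0ℤ
      by-functional a = trans (∑-cong gs (λ g → *-distribˡ-- (f g) (ι (⟨ a , g ⟩ ≟ ⟨ a , x ⟩)) (ι (⟨ a , g ⟩ ≟ ⟨ a , x ⟩ + 1#))))
        (trans (∑-minus gs (λ g → f g *ᶻ ι (⟨ a , g ⟩ ≟ ⟨ a , x ⟩)) (λ g → f g *ᶻ ι (⟨ a , g ⟩ ≟ ⟨ a , x ⟩ + 1#))) (by-zero (a ≟ᴳ 𝟎)))
        where
        by-zero : Dec (a ≡ 𝟎) → project f a ⟨ a , x ⟩ -ᶻ project f a (⟨ a , x ⟩ + 1#) ≡ 0ℤ
        by-zero (no a≢𝟎) = trans (cong (_-ᶻ project f a (⟨ a , x ⟩ + 1#)) (uniform a a≢𝟎 ⟨ a , x ⟩ (⟨ a , x ⟩ + 1#))) (ℤ.+-inverseʳ (project f a (⟨ a , x ⟩ + 1#)))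
        by-zero (yes refl) = cong₂ _-ᶻ_
          (trans (∑-cong gs (λ g → trans (cong (f g *ᶻ_) (ι-yes (⟨ 𝟎 , g ⟩ ≟ ⟨ 𝟎 , x ⟩) (trans (𝟎-⟨⟩ g) (sym (𝟎-⟨⟩ x))))) (ℤ.*-identityʳ (f g)))) total)
          (trans (∑-cong gs (λ g → trans (cong (f g *ᶻ_) (ι-no (⟨ 𝟎 , g ⟩ ≟ ⟨ 𝟎 , x ⟩ + 1#)
            (λ e → 1≢0 (trans (sym (+-identityˡ 1#)) (trans (cong (_+ 1#) (sym (𝟎-⟨⟩ x))) (trans (sym e) (𝟎-⟨⟩ g))))))) (ℤ.*-zeroʳ (f g)))) (∑-ε gs))
      by-element : ∀ g → ∑ gs (λ a → difference a ⟨ a , x ⊕ g ⟩) ≡ ι (g ≟ᴳ 𝟎) *ᶻ ℤ.+ length gs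
      by-element g = trans (∑-cong gs (λ a → cong₂ _-ᶻ_
          (ι-cong (⟨ a , x ⊕ g ⟩ ≟ ⟨ a , x ⟩) (⟨ a , g ⟩ ≟ 0#)
            (λ e → S.cancel (trans (sym (⟨⟩-⊕ a x g)) (trans e (sym (+-identityʳ _))))) (λ e → trans (⟨⟩-⊕ a x g) (trans (cong (⟨ a , x ⟩ +_) e) (+-identityʳ _))))
          (ι-cong (⟨ a , x ⊕ g ⟩ ≟ ⟨ a , x ⟩ + 1#) (⟨ a , g ⟩ ≟ 1#)
            (λ e → S.cancel (trans (sym (⟨⟩-⊕ a x g)) e)) (λ e → trans (⟨⟩-⊕ a x g) (cong (⟨ a , x ⟩ +_) e)))))
        (trans (∑-minus gs (λ a → ι (⟨ a , g ⟩ ≟ 0#)) (λ a → ι (⟨ a , g ⟩ ≟ 1#))) (by-zero (g ≟ᴳ 𝟎)))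
        where
        module S where
          cancel : ∀ {s t t′} → s + t ≡ s + t′ → t ≡ t′
          cancel {s} {t} {t′} e = trans (F.solve 2 (λ s t → t F.:= (s F.:+ t) F.:- s) refl s t) (trans (cong (_- s) e) (F.solve 2 (λ s t → (s F.:+ t) F.:- s F.:= t) refl s t′))
            where module F = Solver
        by-zero : (d : Dec (g ≡ 𝟎)) → ∑ gs (λ a → ι (⟨ a , g ⟩ ≟ 0#)) -ᶻ ∑ gs (λ a → ι (⟨ a , g ⟩ ≟ 1#)) ≡ ι d *ᶻ ℤ.+ length gs
        by-zero (no g≢𝟎) = trans (cong (_-ᶻ ∑ gs (λ a → ι (⟨ a , g ⟩ ≟ 1#))) (uniformˡ g≢𝟎 0# 1#)) (ℤ.+-inverseʳ (∑ gs (λ a → ι (⟨ a , g ⟩ ≟ 1#))))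
        by-zero (yes refl) = trans (cong₂ _-ᶻ_
            (trans (∑-cong gs (λ a → ι-yes (⟨ a , 𝟎 ⟩ ≟ 0#) (⟨⟩-𝟎 a))) (∑-1 gs))
            (trans (∑-cong gs (λ a → ι-no (⟨ a , 𝟎 ⟩ ≟ 1#) (λ e → 1≢0 (trans (sym e) (⟨⟩-𝟎 a))))) (∑-ε gs)))
          (trans (ℤ.+-identityʳ (ℤ.+ length gs)) (sym (ℤ.*-identityˡ (ℤ.+ length gs))))
      product≡0 : f x *ᶻ ℤ.+ length gs ≡ 0ℤ
      product≡0 = begin
        f x *ᶻ ℤ.+ length gs
          ≡⟨ cong (λ z → f z *ᶻ ℤ.+ length gs) (⊕-𝟎 x) ⟨
        f (x ⊕ 𝟎) *ᶻ ℤ.+ length gs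
          ≡⟨ ∑-ι finiteG 𝟎 (λ g → f (x ⊕ g) *ᶻ ℤ.+ length gs) ⟨
        ∑ gs (λ g → ι (g ≟ᴳ 𝟎) *ᶻ (f (x ⊕ g) *ᶻ ℤ.+ length gs))
          ≡⟨ ∑-cong gs (λ g → trans (exchange (ι (g ≟ᴳ 𝟎)) (f (x ⊕ g)) (ℤ.+ length gs)) (trans (cong (f (x ⊕ g) *ᶻ_) (sym (by-element g))) (*-∑ (f (x ⊕ g)) gs (λ a → difference a ⟨ a , x ⊕ g ⟩)))) ⟩
        ∑ gs (λ g → ∑ gs (λ a → f (x ⊕ g) *ᶻ difference a ⟨ a , x ⊕ g ⟩))
          ≡⟨ reindex finiteG finiteG (x ⊕_) (_⊖ x) (⊕-⊖ x) (⊖-⊕ x) (λ g → ∑ gs (λ a → f g *ᶻ difference a ⟨ a , g ⟩)) ⟨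
        ∑ gs (λ g → ∑ gs (λ a → f g *ᶻ difference a ⟨ a , g ⟩))
          ≡⟨ ∑-swap gs gs (λ g a → f g *ᶻ difference a ⟨ a , g ⟩) ⟩
        ∑ gs (λ a → ∑ gs (λ g → f g *ᶻ difference a ⟨ a , g ⟩))
          ≡⟨ trans (∑-cong gs by-functional) (∑-ε gs) ⟩
        0ℤ ∎
        where
        exchange : ∀ a b c → a *ᶻ (b *ᶻ c) ≡ b *ᶻ (a *ᶻ c)
        exchange = solve-∀

    autocorrelation : (G → ℤ) → G → ℤ
    autocorrelation f x = ∑ gs (λ h → f (h ⊕ x) *ᶻ f h)

    -- Pushing forward along a homomorphism carries the correlation on `G` to the correlation on
    -- `K`.
    project-autocorrelation : ∀ f a t → project (autocorrelation f) a t ≡ correlation (project f a) t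
    project-autocorrelation f a t = begin
      ∑ gs (λ x → autocorrelation f x *ᶻ ι (⟨ a , x ⟩ ≟ t))
        ≡⟨ ∑-cong gs (λ x → ∑-* gs (λ h → f (h ⊕ x) *ᶻ f h) (ι (⟨ a , x ⟩ ≟ t))) ⟩
      ∑ gs (λ x → ∑ gs (λ h → f (h ⊕ x) *ᶻ f h *ᶻ ι (⟨ a , x ⟩ ≟ t)))
        ≡⟨ ∑-swap gs gs (λ x h → f (h ⊕ x) *ᶻ f h *ᶻ ι (⟨ a , x ⟩ ≟ t)) ⟩
      ∑ gs (λ h → ∑ gs (λ x → f (h ⊕ x) *ᶻ f h *ᶻ ι (⟨ a , x ⟩ ≟ t)))
        ≡⟨ ∑-cong gs (λ h → trans (∑-cong gs (λ x → cong (f (h ⊕ x) *ᶻ f h *ᶻ_) (shifted h x)))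
             (sym (reindex finiteG finiteG (h ⊕_) (_⊖ h) (⊕-⊖ h) (⊖-⊕ h) (λ g → f g *ᶻ f h *ᶻ ι (⟨ a , g ⟩ ≟ ⟨ a , h ⟩ + t))))) ⟩
      ∑ gs (λ h → ∑ gs (λ g → f g *ᶻ f h *ᶻ ι (⟨ a , g ⟩ ≟ ⟨ a , h ⟩ + t)))
        ≡⟨ ∑-cong gs (λ h → trans (∑-cong gs (λ g → commute (f g) (f h) (ι (⟨ a , g ⟩ ≟ ⟨ a , h ⟩ + t)))) (sym (∑-* gs (λ g → f g *ᶻ ι (⟨ a , g ⟩ ≟ ⟨ a , h ⟩ + t)) (f h)))) ⟩
      ∑ gs (λ h → project f a (⟨ a , h ⟩ + t) *ᶻ f h)
        ≡⟨ ∑-cong gs (λ h → sym (∑-ι finite ⟨ a , h ⟩ (λ s → project f a (s + t) *ᶻ f h))) ⟩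
      ∑ gs (λ h → ∑ elements (λ s → ι (s ≟ ⟨ a , h ⟩) *ᶻ (project f a (s + t) *ᶻ f h)))
        ≡⟨ ∑-swap gs elements (λ h s → ι (s ≟ ⟨ a , h ⟩) *ᶻ (project f a (s + t) *ᶻ f h)) ⟩
      ∑ elements (λ s → ∑ gs (λ h → ι (s ≟ ⟨ a , h ⟩) *ᶻ (project f a (s + t) *ᶻ f h)))
        ≡⟨ ∑-cong elements (λ s → trans (∑-cong gs (λ h → trans (cong (_*ᶻ (project f a (s + t) *ᶻ f h)) (ι-cong (s ≟ ⟨ a , h ⟩) (⟨ a , h ⟩ ≟ s) sym sym))
             (rotate (ι (⟨ a , h ⟩ ≟ s)) (project f a (s + t)) (f h)))) (sym (*-∑ (project f a (s + t)) gs (λ h → f h *ᶻ ι (⟨ a , h ⟩ ≟ s))))) ⟩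
      correlation (project f a) t ∎
      where
      open ≡-Reasoning
      commute : ∀ a b c → a *ᶻ b *ᶻ c ≡ a *ᶻ c *ᶻ b
      commute = solve-∀
      rotate : ∀ a b c → a *ᶻ (b *ᶻ c) ≡ b *ᶻ (c *ᶻ a)
      rotate = solve-∀
      shifted : ∀ h x → ι (⟨ a , x ⟩ ≟ t) ≡ ι (⟨ a , h ⊕ x ⟩ ≟ ⟨ a , h ⟩ + t)
      shifted h x = ι-cong (⟨ a , x ⟩ ≟ t) (⟨ a , h ⊕ x ⟩ ≟ ⟨ a , h ⟩ + t) (λ e → trans (⟨⟩-⊕ a h x) (cong (⟨ a , h ⟩ +_) e))
        (λ e → trans (F.solve 2 (λ s t → t F.:= (s F.:+ t) F.:- s) refl ⟨ a , h ⟩ ⟨ a , x ⟩)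
          (trans (cong (_- ⟨ a , h ⟩) (trans (sym (⟨⟩-⊕ a h x)) e)) (F.solve 2 (λ s t → (s F.:+ t) F.:- s F.:= t) refl ⟨ a , h ⟩ t)))
        where module F = Solver

    -- The left side is the defect `H` in the equation of a partial difference set. Its pushforwards
    -- along nonzero functionals are uniform by `Good` and `uniformʳ`, and its total is zero by the
    -- equation for the total of `f`; so `vanishing` applies.
    difference-identity : ∀ f μ → (∀ a → a ≢ 𝟎 → Good (project f a)) →
      ∑ gs f *ᶻ ∑ gs f -ᶻ σ *ᶻ ∑ gs f +ᶻ τ ≡ μ *ᶻ ℤ.+ length gs →
      ∀ x → autocorrelation f x -ᶻ σ *ᶻ f x +ᶻ τ *ᶻ ι (x ≟ᴳ 𝟎) -ᶻ μ ≡ 0ℤ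
    difference-identity f μ goods total = vanishing H uniform total-H
      where
      open ≡-Reasoning
      H : G → ℤ
      H x = autocorrelation f x -ᶻ σ *ᶻ f x +ᶻ τ *ᶻ ι (x ≟ᴳ 𝟎) -ᶻ μ
      weighted : (w : G → ℤ) → ∑ gs (λ x → H x *ᶻ w x) ≡
        ∑ gs (λ x → autocorrelation f x *ᶻ w x) -ᶻ σ *ᶻ ∑ gs (λ x → f x *ᶻ w x) +ᶻ τ *ᶻ w 𝟎 -ᶻ μ *ᶻ ∑ gs w
      weighted w = trans (∑-cong gs (λ x → expand (autocorrelation f x) σ (f x) τ (ι (x ≟ᴳ 𝟎)) μ (w x)))
        (trans (∑-minus gs (λ x → A x -ᶻ σ *ᶻ B x +ᶻ τ *ᶻ D x) (λ x → μ *ᶻ w x)) (cong₂ _-ᶻ_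
          (trans (∑-∙ gs (λ x → A x -ᶻ σ *ᶻ B x) (λ x → τ *ᶻ D x)) (cong₂ _+ᶻ_
            (trans (∑-minus gs A (λ x → σ *ᶻ B x)) (cong (∑ gs A -ᶻ_) (sym (*-∑ σ gs B))))
            (trans (sym (*-∑ τ gs D)) (cong (τ *ᶻ_) (∑-ι finiteG 𝟎 w)))))
          (sym (*-∑ μ gs w))))
        where
        A B D : G → ℤ
        A x = autocorrelation f x *ᶻ w x
        B x = f x *ᶻ w x
        D x = ι (x ≟ᴳ 𝟎) *ᶻ w x
        expand : ∀ c σ f τ d μ w → (c -ᶻ σ *ᶻ f +ᶻ τ *ᶻ d -ᶻ μ) *ᶻ w ≡ c *ᶻ w -ᶻ σ *ᶻ (f *ᶻ w) +ᶻ τ *ᶻ (d *ᶻ w) -ᶻ μ *ᶻ w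
        expand = solve-∀
      uniform : ∀ a → a ≢ 𝟎 → Uniform (project H a)
      uniform a a≢𝟎 t t′ = trans (value t) (trans (cong₂ _-ᶻ_ (goods a a≢𝟎 t t′) (cong (μ *ᶻ_) (uniformʳ a≢𝟎 t t′))) (sym (value t′)))
        where
        value : ∀ t → project H a t ≡ (correlation (project f a) t -ᶻ σ *ᶻ project f a t +ᶻ τ *ᶻ ι (t ≟ 0#)) -ᶻ μ *ᶻ ∑ gs (λ g → ι (⟨ a , g ⟩ ≟ t))
        value t = trans (weighted (λ x → ι (⟨ a , x ⟩ ≟ t))) (cong₂ (λ c d → c -ᶻ σ *ᶻ project f a t +ᶻ τ *ᶻ d -ᶻ μ *ᶻ ∑ gs (λ g → ι (⟨ a , g ⟩ ≟ t)))
          (project-autocorrelation f a t) (ι-cong (⟨ a , 𝟎 ⟩ ≟ t) (t ≟ 0#) (λ e → trans (sym e) (⟨⟩-𝟎 a)) (λ e → trans (⟨⟩-𝟎 a) (sym e))))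
      total-H : ∑ gs H ≡ 0ℤ
      total-H = begin
        ∑ gs H
          ≡⟨ ∑-cong gs (λ x → ℤ.*-identityʳ (H x)) ⟨
        ∑ gs (λ x → H x *ᶻ 1ℤ)
          ≡⟨ weighted (λ _ → 1ℤ) ⟩
        ∑ gs (λ x → autocorrelation f x *ᶻ 1ℤ) -ᶻ σ *ᶻ ∑ gs (λ x → f x *ᶻ 1ℤ) +ᶻ τ *ᶻ 1ℤ -ᶻ μ *ᶻ ∑ gs (λ _ → 1ℤ)
          ≡⟨ cong₂ (λ a b → a -ᶻ σ *ᶻ b +ᶻ τ *ᶻ 1ℤ -ᶻ μ *ᶻ ∑ gs (λ _ → 1ℤ)) (trans (∑-cong gs (λ x → ℤ.*-identityʳ (autocorrelation f x))) square) (∑-cong gs (λ x → ℤ.*-identityʳ (f x))) ⟩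
        ∑ gs f *ᶻ ∑ gs f -ᶻ σ *ᶻ ∑ gs f +ᶻ τ *ᶻ 1ℤ -ᶻ μ *ᶻ ∑ gs (λ _ → 1ℤ)
          ≡⟨ cong₂ (λ a b → ∑ gs f *ᶻ ∑ gs f -ᶻ σ *ᶻ ∑ gs f +ᶻ a -ᶻ μ *ᶻ b) (ℤ.*-identityʳ τ) (∑-1 gs) ⟩
        ∑ gs f *ᶻ ∑ gs f -ᶻ σ *ᶻ ∑ gs f +ᶻ τ -ᶻ μ *ᶻ ℤ.+ length gs
          ≡⟨ cong (_-ᶻ μ *ᶻ ℤ.+ length gs) total ⟩
        μ *ᶻ ℤ.+ length gs -ᶻ μ *ᶻ ℤ.+ length gs
          ≡⟨ ℤ.+-inverseʳ (μ *ᶻ ℤ.+ length gs) ⟩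
        0ℤ ∎
        where
        square : ∑ gs (autocorrelation f) ≡ ∑ gs f *ᶻ ∑ gs f
        square = begin
          ∑ gs (λ x → ∑ gs (λ h → f (h ⊕ x) *ᶻ f h))
            ≡⟨ ∑-swap gs gs (λ x h → f (h ⊕ x) *ᶻ f h) ⟩
          ∑ gs (λ h → ∑ gs (λ x → f (h ⊕ x) *ᶻ f h))
            ≡⟨ ∑-cong gs (λ h → sym (reindex finiteG finiteG (h ⊕_) (_⊖ h) (⊕-⊖ h) (⊖-⊕ h) (λ g → f g *ᶻ f h))) ⟩
          ∑ gs (λ h → ∑ gs (λ g → f g *ᶻ f h))
            ≡⟨ ∑-cong gs (λ h → sym (∑-* gs f (f h))) ⟩
          ∑ gs (λ h → ∑ gs f *ᶻ f h)
            ≡⟨ *-∑ (∑ gs f) gs f ⟨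
          ∑ gs f *ᶻ ∑ gs f ∎

-- The pushforward of a class of fixed norm ratio

module Denniston {p : ℕ} (K : Field p) (l′ : ℕ) (T₁ : NormTrace K (suc l′)) (T₂ : NormTrace K (suc (suc l′))) where

  import Data.Nat.Base as ℕ
  open import Data.Integer.Base as ℤ using (ℤ; 0ℤ; 1ℤ) renaming (_+_ to _+ᶻ_; _*_ to _*ᶻ_; _-_ to _-ᶻ_)
  import Data.Integer.Properties as ℤ
  open import Data.Integer.Tactic.RingSolver using (solve-∀)
  open import Relation.Nullary using (Dec; yes; no)
  open import Relation.Binary.PropositionalEquality
  open IntegerSums
  open GaussianNumbers K
  open Counts K l′ T₁ T₂
  import Algebra.Properties.Group
  import Algebra.Bundles

  open Field K

  q S₁ S₂ g h : ℤ
  q  = ℤ.+ card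
  S₁ = ℤ.+ L₁.card
  S₂ = ℤ.+ L₂.card
  g  = ℤ.+ gaussian (suc l′)
  h  = ℤ.+ gaussian (suc (suc l′))

  h-≡ : h ≡ 1ℤ +ᶻ q *ᶻ g
  h-≡ = cong (1ℤ +ᶻ_) (ℤ.pos-* card (gaussian (suc l′)))

  private
    size-from-gaussian : ∀ m → ℤ.+ (card ℕ.^ m) ≡ (q -ᶻ 1ℤ) *ᶻ ℤ.+ gaussian m +ᶻ 1ℤ
    size-from-gaussian m = trans (lemma (ℤ.+ (card ℕ.^ m)) (ℤ.+ gaussian m)) (trans (cong (_-ᶻ ℤ.+ gaussian m)
      (trans (sym (ℤ.pos-+ (gaussian m) (card ℕ.^ m))) (trans (cong ℤ.+_ (sym (gaussian-pow m))) (cong (1ℤ +ᶻ_) (ℤ.pos-* card (gaussian m)))))) (lemma′ q (ℤ.+ gaussian m)))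
      where
      lemma : ∀ s g → s ≡ (g +ᶻ s) -ᶻ g
      lemma = solve-∀
      lemma′ : ∀ q g → (1ℤ +ᶻ q *ᶻ g) -ᶻ g ≡ (q -ᶻ 1ℤ) *ᶻ g +ᶻ 1ℤ
      lemma′ = solve-∀

  S₁-≡ : S₁ ≡ (q -ᶻ 1ℤ) *ᶻ g +ᶻ 1ℤ
  S₁-≡ = trans (cong ℤ.+_ N₁.card-L) (size-from-gaussian (suc l′))

  S₂-≡ : S₂ ≡ (q -ᶻ 1ℤ) *ᶻ h +ᶻ 1ℤ
  S₂-≡ = trans (cong ℤ.+_ N₂.card-L) (size-from-gaussian (suc (suc l′)))

  δ : Carrier → ℤ
  δ t = ι (t ≟ 0#)

  module Nonzero {q : ℕ} (F : Field q) where
    private module F = Field F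

    ν : F.Carrier → ℤ
    ν x = 1ℤ -ᶻ ι (x F.≟ F.0#)

    ν-guard : ∀ x {a b} → (x ≢ F.0# → a ≡ b) → ν x *ᶻ a ≡ ν x *ᶻ b
    ν-guard x e with x F.≟ F.0#
    ... | yes _  = refl
    ... | no x≢0 = cong (1ℤ *ᶻ_) (e x≢0)

    ν-no : ∀ {x} → x ≢ F.0# → ν x ≡ 1ℤ
    ν-no {x} x≢0 = cong (1ℤ -ᶻ_) (ι-no (x F.≟ F.0#) x≢0)

    ∑-ν : ∀ f → ∑ F.elements (λ x → ν x *ᶻ f x) ≡ ∑ F.elements f -ᶻ f F.0#
    ∑-ν f = trans (∑-cong F.elements (λ x → lemma (ι (x F.≟ F.0#)) (f x))) (trans (∑-minus F.elements f (λ x → ι (x F.≟ F.0#) *ᶻ f x))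
      (cong (∑ F.elements f -ᶻ_) (∑-ι F.finite F.0# f)))
      where
      lemma : ∀ i a → (1ℤ -ᶻ i) *ᶻ a ≡ a -ᶻ i *ᶻ a
      lemma = solve-∀

  module ν₁ = Nonzero N₁.L
  module ν₂ = Nonzero N₂.L
  module ν₀ = Nonzero K

  private
    Tr₁ = N₁.trace
    Tr₂ = N₂.trace
    Nm₁ = N₁.norm
    Nm₂ = N₂.norm

  homomorphism-0 : {q : ℕ} (F : Field q) (f : Field.Carrier F → Carrier) → (∀ x y → f (Field._+_ F x y) ≡ f x + f y) → f (Field.0# F) ≡ 0#
  homomorphism-0 F f f-+ = identityʳ-unique (f F.0#) (f F.0#) (trans (sym (f-+ F.0# F.0#)) (cong f (F.+-identityˡ F.0#)))
    where
    module F = Field F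
    open Algebra.Properties.Group (Algebra.Bundles.CommutativeRing.+-group commutativeRing) using (identityʳ-unique)

  trace₁-0 : Tr₁ L₁.0# ≡ 0#
  trace₁-0 = homomorphism-0 N₁.L Tr₁ N₁.trace-+

  trace₂-0 : Tr₂ L₂.0# ≡ 0#
  trace₂-0 = homomorphism-0 N₂.L Tr₂ N₂.trace-+

  s₁ : Carrier
  s₁ = sign (suc l′)

  sign-≢0 : s₁ ≢ 0#
  sign-≢0 e = N₁.norm-≢0 -1≢0 (trans N₁.norm-neg-1 e)
    where
    -1≢0 : L₁.- L₁.1# ≢ L₁.0#
    -1≢0 e = L₁.1≢0 (trans (S.solve 0 (S.con 1ℤ S.:= S.:- (S.:- S.con 1ℤ)) refl) (trans (cong (λ z → L₁.- z) e) (S.solve 0 (S.:- S.con 0ℤ S.:= S.con 0ℤ) refl)))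
      where module S = L₁.Solver

  -- The common size of the fibres of the trace. Its value is not computed, since it finally enters
  -- only the constant of a pushforward.
  c₁ : ℤ
  c₁ = ∑ L₁.elements (λ x → ι (Tr₁ (L₁.1# L₁.* x) ≟ 0#))

  trace-fibre-1 : ∀ {s} → s ≢ L₁.0# → ∀ t → ∑ L₁.elements (λ x → ι (Tr₁ (s L₁.* x) ≟ t)) ≡ c₁
  trace-fibre-1 {s} s≢0 t = trans (N₁.trace-fibre s≢0 t 0#) (trans (sym (unscale s≢0)) (unscale L₁.1≢0))
    where
    unscale : ∀ {s} → s ≢ L₁.0# → ∑ L₁.elements (λ x → ι (Tr₁ x ≟ 0#)) ≡ ∑ L₁.elements (λ x → ι (Tr₁ (s L₁.* x) ≟ 0#))
    unscale {s} s≢0 = reindex L₁.finite L₁.finite (s L₁.*_) (s L₁.⁻¹ L₁.*_) (L₁.cancelʳ s≢0) (L₁.cancelˡ s≢0) (λ x → ι (Tr₁ x ≟ 0#))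

  open ν₁ public using () renaming (ν to ν¹; ν-guard to ν¹-guard; ν-no to ν¹-no; ∑-ν to ∑-ν¹)
  open ν₂ public using () renaming (ν to ν²; ν-guard to ν²-guard; ν-no to ν²-no; ∑-ν to ∑-ν²)
  open ν₀ public using (ν; ν-guard; ν-no; ∑-ν)

  private module S = Solver

  -- Substituting x′ = x s makes the trace condition linear in x, so only s = -1 contributes
  -- a dependence on t beyond the excluded term x = 0.
  twistedSum : Carrier → Carrier → ℤ
  twistedSum w t = ∑ L₁.elements (λ x → ν¹ x *ᶻ ∑ L₁.elements (λ x′ → ι (Nm₁ x′ ≟ w * Nm₁ x) *ᶻ ι (Tr₁ x + Tr₁ x′ ≟ t)))

  -- The counterpart of `G(χ) G(χ⁻¹) = χ(N(-1)) |L₁|` for the Gauss sums of `L₁`: apart from a part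
  -- independent of `w`, all is concentrated at `w = s₁`, the norm of -1.
  twistedSum-≡ : ∀ w t → w ≢ 0# → twistedSum w t ≡ g *ᶻ (c₁ -ᶻ δ t) +ᶻ ι (s₁ ≟ w) *ᶻ (S₁ *ᶻ δ t -ᶻ c₁)
  twistedSum-≡ w t w≢0 = begin
    twistedSum w t
      ≡⟨ ∑-cong L₁.elements (λ x → trans (ν¹-guard x (substitute x)) (*-∑ (ν¹ x) L₁.elements (λ s → ι (Nm₁ s ≟ w) *ᶻ β s x))) ⟩
    ∑ L₁.elements (λ x → ∑ L₁.elements (λ s → ν¹ x *ᶻ (ι (Nm₁ s ≟ w) *ᶻ β s x)))
      ≡⟨ ∑-swap L₁.elements L₁.elements (λ x s → ν¹ x *ᶻ (ι (Nm₁ s ≟ w) *ᶻ β s x)) ⟩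
    ∑ L₁.elements (λ s → ∑ L₁.elements (λ x → ν¹ x *ᶻ (ι (Nm₁ s ≟ w) *ᶻ β s x)))
      ≡⟨ ∑-cong L₁.elements (λ s → trans (∑-cong L₁.elements (λ x → exchange (ν¹ x) (ι (Nm₁ s ≟ w)) (β s x)))
           (trans (sym (*-∑ (ι (Nm₁ s ≟ w)) L₁.elements (λ x → ν¹ x *ᶻ β s x))) (cong (ι (Nm₁ s ≟ w) *ᶻ_) (inner s)))) ⟩
    ∑ L₁.elements (λ s → ι (Nm₁ s ≟ w) *ᶻ ((c₁ -ᶻ δ t) +ᶻ ι (s L₁.≟ L₁.- L₁.1#) *ᶻ X))
      ≡⟨ ∑-cong L₁.elements (λ s → split (ι (Nm₁ s ≟ w)) (c₁ -ᶻ δ t) (ι (s L₁.≟ L₁.- L₁.1#)) X) ⟩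
    ∑ L₁.elements (λ s → ι (Nm₁ s ≟ w) *ᶻ (c₁ -ᶻ δ t) +ᶻ ι (s L₁.≟ L₁.- L₁.1#) *ᶻ (ι (Nm₁ s ≟ w) *ᶻ X))
      ≡⟨ ∑-∙ L₁.elements (λ s → ι (Nm₁ s ≟ w) *ᶻ (c₁ -ᶻ δ t)) (λ s → ι (s L₁.≟ L₁.- L₁.1#) *ᶻ (ι (Nm₁ s ≟ w) *ᶻ X)) ⟩
    ∑ L₁.elements (λ s → ι (Nm₁ s ≟ w) *ᶻ (c₁ -ᶻ δ t)) +ᶻ ∑ L₁.elements (λ s → ι (s L₁.≟ L₁.- L₁.1#) *ᶻ (ι (Nm₁ s ≟ w) *ᶻ X))
      ≡⟨ cong₂ _+ᶻ_ (trans (sym (∑-* L₁.elements (λ s → ι (Nm₁ s ≟ w)) (c₁ -ᶻ δ t))) (cong (_*ᶻ (c₁ -ᶻ δ t)) (N₁.norm-fibre w≢0)))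
           (trans (∑-ι L₁.finite (L₁.- L₁.1#) (λ s → ι (Nm₁ s ≟ w) *ᶻ X)) (cong (λ z → ι (z ≟ w) *ᶻ X) N₁.norm-neg-1)) ⟩
    g *ᶻ (c₁ -ᶻ δ t) +ᶻ ι (s₁ ≟ w) *ᶻ X ∎
    where
    open ≡-Reasoning
    module S₁′ = L₁.Solver
    X : ℤ
    X = S₁ *ᶻ δ t -ᶻ c₁
    β : L₁.Carrier → L₁.Carrier → ℤ
    β s x = ι (Tr₁ ((L₁.1# L₁.+ s) L₁.* x) ≟ t)
    exchange : ∀ a b c → a *ᶻ (b *ᶻ c) ≡ b *ᶻ (a *ᶻ c)
    exchange = solve-∀
    split : ∀ a b c d → a *ᶻ (b +ᶻ c *ᶻ d) ≡ a *ᶻ b +ᶻ c *ᶻ (a *ᶻ d)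
    split = solve-∀
    substitute : ∀ x → x ≢ L₁.0# → ∑ L₁.elements (λ x′ → ι (Nm₁ x′ ≟ w * Nm₁ x) *ᶻ ι (Tr₁ x + Tr₁ x′ ≟ t)) ≡ ∑ L₁.elements (λ s → ι (Nm₁ s ≟ w) *ᶻ β s x)
    substitute x x≢0 = trans (reindex L₁.finite L₁.finite (x L₁.*_) (x L₁.⁻¹ L₁.*_) (L₁.cancelʳ x≢0) (L₁.cancelˡ x≢0) (λ x′ → ι (Nm₁ x′ ≟ w * Nm₁ x) *ᶻ ι (Tr₁ x + Tr₁ x′ ≟ t)))
      (∑-cong L₁.elements (λ s → cong₂ _*ᶻ_
        (ι-cong (Nm₁ (x L₁.* s) ≟ w * Nm₁ x) (Nm₁ s ≟ w)
          (λ e → *-injectiveˡ (N₁.norm-≢0 x≢0) (trans (sym (N₁.norm-* x s)) (trans e (*-comm w (Nm₁ x)))))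
          (λ { refl → trans (N₁.norm-* x s) (*-comm (Nm₁ x) (Nm₁ s)) }))
        (cong (λ z → ι (z ≟ t)) (trans (sym (N₁.trace-+ x (x L₁.* s))) (cong Tr₁ (S₁′.solve 2 (λ x s → x S₁′.:+ x S₁′.:* s S₁′.:= (S₁′.con 1ℤ S₁′.:+ s) S₁′.:* x) refl x s))))))
    inner : ∀ s → ∑ L₁.elements (λ x → ν¹ x *ᶻ β s x) ≡ (c₁ -ᶻ δ t) +ᶻ ι (s L₁.≟ L₁.- L₁.1#) *ᶻ X
    inner s = trans (∑-ν¹ (β s)) (trans (cong₂ _-ᶻ_ (full (s L₁.≟ L₁.- L₁.1#)) at-0) (regroup c₁ (ι (s L₁.≟ L₁.- L₁.1#)) X (δ t)))
      where
      regroup : ∀ c i x d → (c +ᶻ i *ᶻ x) -ᶻ d ≡ (c -ᶻ d) +ᶻ i *ᶻ x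
      regroup = solve-∀
      at-0 : β s L₁.0# ≡ δ t
      at-0 = ι-cong (Tr₁ ((L₁.1# L₁.+ s) L₁.* L₁.0#) ≟ t) (t ≟ 0#)
        (λ e → trans (sym e) (trans (cong Tr₁ (L₁.zeroʳ _)) trace₁-0)) (λ { refl → trans (cong Tr₁ (L₁.zeroʳ _)) trace₁-0 })
      full : (d : Dec (s ≡ L₁.- L₁.1#)) → ∑ L₁.elements (β s) ≡ c₁ +ᶻ ι d *ᶻ X
      full (no s≢-1) = trans (trace-fibre-1 (λ e → s≢-1 (trans (S₁′.solve 1 (λ s → s S₁′.:= (S₁′.con 1ℤ S₁′.:+ s) S₁′.:- S₁′.con 1ℤ) refl s)
        (trans (cong (L₁._- L₁.1#) e) (L₁.+-identityˡ _)))) t) (sym (ℤ.+-identityʳ c₁))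
      full (yes refl) = trans (∑-cong L₁.elements (λ x → ι-cong (Tr₁ ((L₁.1# L₁.+ L₁.- L₁.1#) L₁.* x) ≟ t) (t ≟ 0#)
          (λ e → trans (sym e) (vanish x)) (λ { refl → vanish x })))
        (trans (∑-const L₁.elements (δ t)) (lemma c₁ (S₁ *ᶻ δ t)))
        where
        vanish : ∀ x → Tr₁ ((L₁.1# L₁.+ L₁.- L₁.1#) L₁.* x) ≡ 0#
        vanish x = trans (cong Tr₁ (trans (cong (L₁._* x) (L₁.-‿inverseʳ L₁.1#)) (L₁.zeroˡ x))) trace₁-0
        lemma : ∀ c s → s ≡ c +ᶻ 1ℤ *ᶻ (s -ᶻ c)
        lemma = solve-∀

  -- The pushforward, along the functional with `a` and `b` equal to 1, of the points with `x ≠ 0`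
  -- and `N(y) = u N(x)`.
  section : Carrier → Carrier → ℤ
  section u t = ∑ L₁.elements (λ x → ν¹ x *ᶻ ∑ L₂.elements (λ y → ι (Nm₂ y ≟ u * Nm₁ x) *ᶻ ι (Tr₁ x + Tr₂ y ≟ t)))

  sectionConstant : Carrier → ℤ
  sectionConstant u = ∑ L₁.elements (λ x → ν¹ x *ᶻ (count₂ (u * Nm₁ x) 0# +ᶻ count₁ (u * Nm₁ x) 0#)) -ᶻ ((q -ᶻ 1ℤ) *ᶻ g *ᶻ c₁ -ᶻ g -ᶻ c₁)

  -- By the Hasse-Davenport relation `count₂` is minus `count₁` up to a term independent of `t`.
  -- This replaces `y` by a pair `(x′ , z)` in `L₁ × K`; for fixed `z ≠ 0` the sum over `x` and `x′`
  -- is a `twistedSum` of ratio `u / z`, which is exceptional exactly at `z = u / s₁`.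
  section-≡ : ∀ {u} t → u ≢ 0# → section u t ≡ sectionConstant u -ᶻ g *ᶻ δ t -ᶻ S₁ *ᶻ ι (t ≟ u * s₁ ⁻¹)
  section-≡ {u} t u≢0 = begin
    section u t
      ≡⟨ ∑-cong L₁.elements (λ x → trans (ν¹-guard x (λ _ → by-hasse-davenport x)) (ℤ-distrib (ν¹ x) (total x) (count₁ (u * Nm₁ x) (t - Tr₁ x)))) ⟩
    ∑ L₁.elements (λ x → ν¹ x *ᶻ total x -ᶻ ν¹ x *ᶻ count₁ (u * Nm₁ x) (t - Tr₁ x))
      ≡⟨ ∑-minus L₁.elements (λ x → ν¹ x *ᶻ total x) (λ x → ν¹ x *ᶻ count₁ (u * Nm₁ x) (t - Tr₁ x)) ⟩
    T -ᶻ ∑ L₁.elements (λ x → ν¹ x *ᶻ count₁ (u * Nm₁ x) (t - Tr₁ x))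
      ≡⟨ cong (T -ᶻ_) split-count ⟩
    T -ᶻ ∑ elements (λ z → ν z *ᶻ twistedSum (u * z ⁻¹) (t - z))
      ≡⟨ cong (T -ᶻ_) (trans (∑-cong elements (λ z → ν-guard z (twisted z))) (∑-ν X)) ⟩
    T -ᶻ (∑ elements X -ᶻ X 0#)
      ≡⟨ cong (T -ᶻ_) (cong₂ _-ᶻ_ ∑X X0) ⟩
    T -ᶻ ((g *ᶻ (q *ᶻ c₁ -ᶻ 1ℤ) +ᶻ (S₁ *ᶻ ι (t ≟ z₀) -ᶻ c₁)) -ᶻ g *ᶻ (c₁ -ᶻ δ t))
      ≡⟨ collect T g q c₁ (S₁ *ᶻ ι (t ≟ z₀)) (δ t) ⟩
    sectionConstant u -ᶻ g *ᶻ δ t -ᶻ S₁ *ᶻ ι (t ≟ z₀) ∎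
    where
    open ≡-Reasoning
    z₀ : Carrier
    z₀ = u * s₁ ⁻¹
    total : L₁.Carrier → ℤ
    total x = count₂ (u * Nm₁ x) 0# +ᶻ count₁ (u * Nm₁ x) 0#
    T : ℤ
    T = ∑ L₁.elements (λ x → ν¹ x *ᶻ total x)
    -- The closed form of the twisted sum, written so that it also makes sense at `z = 0`; the sum
    -- over the nonzero `z` is then the full sum minus `X 0#`.
    X : Carrier → ℤ
    X z = g *ᶻ (c₁ -ᶻ δ (t - z)) +ᶻ ι (z ≟ z₀) *ᶻ (S₁ *ᶻ δ (t - z) -ᶻ c₁)
    ℤ-distrib : ∀ a b c → a *ᶻ (b -ᶻ c) ≡ a *ᶻ b -ᶻ a *ᶻ c
    ℤ-distrib = solve-∀
    collect : ∀ T g q c s d → T -ᶻ ((g *ᶻ (q *ᶻ c -ᶻ 1ℤ) +ᶻ (s -ᶻ c)) -ᶻ g *ᶻ (c -ᶻ d)) ≡ (T -ᶻ ((q -ᶻ 1ℤ) *ᶻ g *ᶻ c -ᶻ g -ᶻ c)) -ᶻ g *ᶻ d -ᶻ s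
    collect = solve-∀
    difference : ∀ {a b t} → a + b ≡ t → b ≡ t - a
    difference {a} {b} refl = S.solve 2 (λ a b → b S.:= (a S.:+ b) S.:- a) refl a b
    undo : ∀ a t → a + (t - a) ≡ t
    undo = S.solve 2 (λ a t → a S.:+ (t S.:- a) S.:= t) refl
    by-hasse-davenport : ∀ x → ∑ L₂.elements (λ y → ι (Nm₂ y ≟ u * Nm₁ x) *ᶻ ι (Tr₁ x + Tr₂ y ≟ t)) ≡ total x -ᶻ count₁ (u * Nm₁ x) (t - Tr₁ x)
    by-hasse-davenport x = trans (∑-cong L₂.elements (λ y → cong (ι (Nm₂ y ≟ u * Nm₁ x) *ᶻ_)
        (ι-cong (Tr₁ x + Tr₂ y ≟ t) (Tr₂ y ≟ t - Tr₁ x) difference (λ e → trans (cong (Tr₁ x +_) e) (undo (Tr₁ x) t)))))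
      (trans (isolate (count₂ (u * Nm₁ x) (t - Tr₁ x)) (count₁ (u * Nm₁ x) (t - Tr₁ x))) (cong (_-ᶻ count₁ (u * Nm₁ x) (t - Tr₁ x)) (HasseDavenport.hasse-davenport K l′ T₁ T₂ (u * Nm₁ x) (t - Tr₁ x) 0#)))
      where
      isolate : ∀ a b → a ≡ (a +ᶻ b) -ᶻ b
      isolate = solve-∀
    summand : L₁.Carrier → Carrier → L₁.Carrier → ℤ
    summand x z x′ = ι (Nm₁ x′ * z ≟ u * Nm₁ x) *ᶻ ι (Tr₁ x′ + z ≟ t - Tr₁ x)
    split-count : ∑ L₁.elements (λ x → ν¹ x *ᶻ count₁ (u * Nm₁ x) (t - Tr₁ x)) ≡ ∑ elements (λ z → ν z *ᶻ twistedSum (u * z ⁻¹) (t - z))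
    split-count = begin
      ∑ L₁.elements (λ x → ν¹ x *ᶻ count₁ (u * Nm₁ x) (t - Tr₁ x))
        ≡⟨ ∑-cong L₁.elements (λ x → trans (cong (ν¹ x *ᶻ_) (∑-swap L₁.elements elements (λ x′ z → summand x z x′)))
             (trans (ν¹-guard x (λ x≢0 → ∑-cong elements (λ z → twist x x≢0 z (z ≟ 0#)))) (*-∑ (ν¹ x) elements (λ z → ν z *ᶻ ∑ L₁.elements (twisted-summand x z))))) ⟩
      ∑ L₁.elements (λ x → ∑ elements (λ z → ν¹ x *ᶻ (ν z *ᶻ ∑ L₁.elements (twisted-summand x z))))
        ≡⟨ ∑-swap L₁.elements elements (λ x z → ν¹ x *ᶻ (ν z *ᶻ ∑ L₁.elements (twisted-summand x z))) ⟩
      ∑ elements (λ z → ∑ L₁.elements (λ x → ν¹ x *ᶻ (ν z *ᶻ ∑ L₁.elements (twisted-summand x z))))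
        ≡⟨ ∑-cong elements (λ z → trans (∑-cong L₁.elements (λ x → exchange (ν¹ x) (ν z) (∑ L₁.elements (twisted-summand x z))))
             (sym (*-∑ (ν z) L₁.elements (λ x → ν¹ x *ᶻ ∑ L₁.elements (twisted-summand x z))))) ⟩
      ∑ elements (λ z → ν z *ᶻ twistedSum (u * z ⁻¹) (t - z)) ∎
      where
      exchange : ∀ a b c → a *ᶻ (b *ᶻ c) ≡ b *ᶻ (a *ᶻ c)
      exchange = solve-∀
      twisted-summand : L₁.Carrier → Carrier → L₁.Carrier → ℤ
      twisted-summand x z x′ = ι (Nm₁ x′ ≟ (u * z ⁻¹) * Nm₁ x) *ᶻ ι (Tr₁ x + Tr₁ x′ ≟ t - z)
      twist : ∀ x → x ≢ L₁.0# → ∀ z (d : Dec (z ≡ 0#)) → ∑ L₁.elements (summand x z) ≡ (1ℤ -ᶻ ι d) *ᶻ ∑ L₁.elements (twisted-summand x z)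
      twist x x≢0 z (yes refl) = trans (∑-cong L₁.elements (λ x′ → trans (cong (_*ᶻ ι (Tr₁ x′ + 0# ≟ t - Tr₁ x))
        (ι-no (Nm₁ x′ * 0# ≟ u * Nm₁ x) (λ e → *-≢0 u≢0 (N₁.norm-≢0 x≢0) (trans (sym e) (zeroʳ _))))) (ℤ.*-zeroˡ (ι (Tr₁ x′ + 0# ≟ t - Tr₁ x)))))
        (∑-ε L₁.elements)
      twist x x≢0 z (no z≢0) = trans (∑-cong L₁.elements (λ x′ → cong₂ _*ᶻ_
          (ι-cong (Nm₁ x′ * z ≟ u * Nm₁ x) (Nm₁ x′ ≟ (u * z ⁻¹) * Nm₁ x)
            (λ e → *-injectiveˡ z≢0 (trans (*-comm z (Nm₁ x′)) (trans e (sym (absorb (Nm₁ x))))))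
            (λ e → trans (*-comm (Nm₁ x′) z) (trans (cong (z *_) e) (absorb (Nm₁ x)))))
          (ι-cong (Tr₁ x′ + z ≟ t - Tr₁ x) (Tr₁ x + Tr₁ x′ ≟ t - z)
            (λ e → trans (S.solve 3 (λ a b z → a S.:+ b S.:= a S.:+ (b S.:+ z) S.:- z) refl (Tr₁ x) (Tr₁ x′) z) (trans (cong (λ r → Tr₁ x + r - z) e) (cong (_- z) (undo (Tr₁ x) t))))
            (λ e → trans (S.solve 3 (λ a b z → b S.:+ z S.:= (a S.:+ b) S.:+ z S.:- a) refl (Tr₁ x) (Tr₁ x′) z) (trans (cong (λ r → r + z - Tr₁ x) e)
              (S.solve 3 (λ a t z → t S.:- z S.:+ z S.:- a S.:= t S.:- a) refl (Tr₁ x) t z))))))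
        (sym (ℤ.*-identityˡ _))
        where
        absorb : ∀ a → z * ((u * z ⁻¹) * a) ≡ u * a
        absorb a = trans (S.solve 4 (λ z u i a → z S.:* ((u S.:* i) S.:* a) S.:= (z S.:* i) S.:* (u S.:* a)) refl z u (z ⁻¹) a)
          (trans (cong (_* (u * a)) (*-inverseʳ z≢0)) (*-identityˡ (u * a)))
    twisted : ∀ z → z ≢ 0# → twistedSum (u * z ⁻¹) (t - z) ≡ X z
    twisted z z≢0 = trans (twistedSum-≡ (u * z ⁻¹) (t - z) (*-≢0 u≢0 (⁻¹-≢0 z≢0))) (cong (λ i → g *ᶻ (c₁ -ᶻ δ (t - z)) +ᶻ i *ᶻ (S₁ *ᶻ δ (t - z) -ᶻ c₁))
      (ι-cong (s₁ ≟ u * z ⁻¹) (z ≟ z₀)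
        (λ e → *-injectiveˡ sign-≢0 (trans (cong (_* z) e) (trans (*-assoc u (z ⁻¹) z) (trans (cong (u *_) (*-inverseˡ z≢0)) (trans (*-identityʳ u) (sym unit))))))
        (λ e → *-injectiveˡ z≢0 (trans (cong (_* s₁) e) (trans (trans (*-comm z₀ s₁) unit) (trans (sym (*-identityʳ u)) (trans (cong (u *_) (sym (*-inverseʳ z≢0)))
          (S.solve 3 (λ u z i → u S.:* (z S.:* i) S.:= z S.:* (u S.:* i)) refl u z (z ⁻¹)))))))))
      where
      unit : s₁ * z₀ ≡ u
      unit = trans (S.solve 3 (λ s u i → s S.:* (u S.:* i) S.:= u S.:* (s S.:* i)) refl s₁ u (s₁ ⁻¹)) (trans (cong (u *_) (*-inverseʳ sign-≢0)) (*-identityʳ u))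
    z₀≢0 : z₀ ≢ 0#
    z₀≢0 = *-≢0 u≢0 (⁻¹-≢0 sign-≢0)
    δ-difference : ∀ z → δ (t - z) ≡ ι (z ≟ t)
    δ-difference z = ι-cong (t - z ≟ 0#) (z ≟ t) (λ e → sym (x-y≡0⇒x≡y e)) (λ { refl → x-x≡0 z })
    ∑X : ∑ elements X ≡ g *ᶻ (q *ᶻ c₁ -ᶻ 1ℤ) +ᶻ (S₁ *ᶻ ι (t ≟ z₀) -ᶻ c₁)
    ∑X = trans (∑-∙ elements (λ z → g *ᶻ (c₁ -ᶻ δ (t - z))) (λ z → ι (z ≟ z₀) *ᶻ (S₁ *ᶻ δ (t - z) -ᶻ c₁))) (cong₂ _+ᶻ_
      (trans (sym (*-∑ g elements (λ z → c₁ -ᶻ δ (t - z)))) (cong (g *ᶻ_) (trans (∑-minus elements (λ _ → c₁) (λ z → δ (t - z)))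
        (cong₂ _-ᶻ_ (∑-const elements c₁) (trans (∑-cong elements δ-difference) (∑-ι1 finite t))))))
      (trans (∑-ι finite z₀ (λ z → S₁ *ᶻ δ (t - z) -ᶻ c₁)) (cong (λ i → S₁ *ᶻ i -ᶻ c₁) (trans (δ-difference z₀) (ι-cong (z₀ ≟ t) (t ≟ z₀) sym sym)))))
    X0 : X 0# ≡ g *ᶻ (c₁ -ᶻ δ t)
    X0 = trans (cong₂ (λ a b → g *ᶻ (c₁ -ᶻ a) +ᶻ b *ᶻ (S₁ *ᶻ δ (t - 0#) -ᶻ c₁))
      (cong δ (S.solve 1 (λ t → t S.:- S.con 0ℤ S.:= t) refl t)) (ι-no (0# ≟ z₀) (λ e → z₀≢0 (sym e)))) (ℤ.+-identityʳ (g *ᶻ (c₁ -ᶻ δ t)))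

open import Relation.Nullary using (Dec)

-- The set D, its eigenvalues and the difference equation

module DifferenceSet {p : ℕ} (K : Field p) (l′ : ℕ) (T₁ : NormTrace K (suc l′)) (T₂ : NormTrace K (suc (suc l′)))
  (U : Field.Carrier K → Set) (U? : ∀ c → Dec (U c)) (U-0 : U (Field.0# K))
  (U-+ : ∀ {a b} → U a → U b → U (Field._+_ K a b)) (U-neg : ∀ {a} → U a → U (Field.-_ K a)) where

  open import Data.Integer.Base as ℤ using (ℤ; 0ℤ; 1ℤ) renaming (_+_ to _+ᶻ_; _*_ to _*ᶻ_; _-_ to _-ᶻ_)
  import Data.Integer.Properties as ℤ
  open import Data.Integer.Tactic.RingSolver using (solve-∀)
  open import Data.List.Base using (List; length)
  open import Data.Product using (_,_; _×_)
  open import Data.Sum using (_⊎_; inj₁; inj₂; [_,_]′)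
  open import Relation.Nullary using (yes; no; ¬_; contradiction)
  open import Relation.Nullary.Decidable using (_×-dec_; _⊎-dec_; ¬?)
  open import Relation.Binary.PropositionalEquality
  open FiniteSums using (Finite; _×ᶠ_)
  open IntegerSums
  open GaussianNumbers K
  open Counts K l′ T₁ T₂
  open Denniston K l′ T₁ T₂ public

  open Field K

  private module S = Solver

  -- `e` is the order of `U`, and `θ₁`, `θ₂` are the eigenvalues other than the size `k` of D, so
  -- that `σ = λ - μ` and `τ = μ - k`. For `l = 1` and even `q` these are the values of the
  -- complement of a Denniston maximal arc of degree `e` in the projective plane over `K`.
  e θ₁ θ₂ σ τ μ s : ℤ
  e  = ∑ elements (λ c → ι (U? c))
  s  = 1ℤ +ᶻ (q -ᶻ e) *ᶻ g
  θ₁ = (e -ᶻ 1ℤ) *ᶻ h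
  θ₂ = ℤ.- s
  σ  = θ₁ +ᶻ θ₂
  τ  = θ₁ *ᶻ θ₂
  μ  = (q -ᶻ e) *ᶻ h *ᶻ s

  open Inversion K σ τ using (Uniform; Good; Profile; difference-identity; autocorrelation)

  G : Set
  G = L₁.Carrier × L₂.Carrier

  G-finite : Finite G
  G-finite = L₁.finite ×ᶠ L₂.finite

  gs : List G
  gs = Finite.elements G-finite

  _⊕_ _⊖_ : G → G → G
  (x , y) ⊕ (x′ , y′) = x L₁.+ x′ , y L₂.+ y′
  (x , y) ⊖ (x′ , y′) = x L₁.- x′ , y L₂.- y′

  𝟎 : G
  𝟎 = L₁.0# , L₂.0#

  ⟨_,_⟩ : G → G → Carrier
  ⟨ (a , b) , (x , y) ⟩ = N₁.trace (a L₁.* x) + N₂.trace (b L₂.* y)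

  ∑-pairs : (f : G → ℤ) → ∑ gs f ≡ ∑ L₁.elements (λ x → ∑ L₂.elements (λ y → f (x , y)))
  ∑-pairs = ∑-cartesianProduct L₁.elements L₂.elements

  weightᵁ : Carrier → ℤ
  weightᵁ u = 1ℤ -ᶻ ι (U? u)

  weightᵁ-guard : ∀ u {a b} → (u ≢ 0# → a ≡ b) → weightᵁ u *ᶻ a ≡ weightᵁ u *ᶻ b
  weightᵁ-guard u eq with U? u
  ... | yes _ = refl
  ... | no ¬U = cong (1ℤ *ᶻ_) (eq (λ { refl → ¬U U-0 }))

  ∑-weightᵁ : ∑ elements weightᵁ ≡ q -ᶻ e
  ∑-weightᵁ = trans (∑-minus elements (λ _ → 1ℤ) (λ u → ι (U? u))) (cong (_-ᶻ e) (∑-1 elements))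

  ∑-weightᵁ-* : ∀ c → ∑ elements (λ u → weightᵁ u *ᶻ c) ≡ (q -ᶻ e) *ᶻ c
  ∑-weightᵁ-* c = trans (sym (∑-* elements weightᵁ c)) (cong (_*ᶻ c) ∑-weightᵁ)

  InD : G → Set
  InD (x , y) = y ≢ L₂.0# × (x ≡ L₁.0# ⊎ ¬ U (N₂.norm y * N₁.norm x ⁻¹))

  InD? : ∀ z → Dec (InD z)
  InD? (x , y) = ¬? (y L₂.≟ L₂.0#) ×-dec ((x L₁.≟ L₁.0#) ⊎-dec ¬? (U? (N₂.norm y * N₁.norm x ⁻¹)))

  f : G → ℤ
  f z = ι (InD? z)

  -- For `x ≠ 0` only the term with `u` equal to the ratio of the norms survives. For `y = 0` that
  -- ratio is 0, which lies in `U`, so such points are excluded by the weight.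
  f-≡ : ∀ x y → f (x , y) ≡ ι (x L₁.≟ L₁.0#) *ᶻ ν² y +ᶻ ν¹ x *ᶻ ∑ elements (λ u → weightᵁ u *ᶻ ι (N₂.norm y ≟ u * N₁.norm x))
  f-≡ x y = by-cases (x L₁.≟ L₁.0#) (y L₂.≟ L₂.0#)
    where
    r : Carrier
    r = N₂.norm y * N₁.norm x ⁻¹
    R : ℤ
    R = ∑ elements (λ u → weightᵁ u *ᶻ ι (N₂.norm y ≟ u * N₁.norm x))
    R-≡ : x ≢ L₁.0# → R ≡ weightᵁ r
    R-≡ x≢0 = trans (∑-cong elements (λ u → trans (ℤ.*-comm (weightᵁ u) (ι (N₂.norm y ≟ u * N₁.norm x))) (cong (_*ᶻ weightᵁ u)
        (ι-cong (N₂.norm y ≟ u * N₁.norm x) (u ≟ r)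
          (λ eq → trans (sym (cancel u)) (cong (_* N₁.norm x ⁻¹) (sym eq)))
          (λ { refl → sym (trans (*-assoc (N₂.norm y) (N₁.norm x ⁻¹) (N₁.norm x)) (trans (cong (N₂.norm y *_) (*-inverseˡ (N₁.norm-≢0 x≢0))) (*-identityʳ _))) })))))
      (∑-ι finite r weightᵁ)
      where
      cancel : ∀ u → u * N₁.norm x * N₁.norm x ⁻¹ ≡ u
      cancel u = trans (*-assoc u _ _) (trans (cong (u *_) (*-inverseʳ (N₁.norm-≢0 x≢0))) (*-identityʳ u))
    complement : (d : Dec (U r)) → ι (¬? d) ≡ 1ℤ -ᶻ ι d
    complement (yes _) = refl
    complement (no _)  = refl
    by-cases : (dx : Dec (x ≡ L₁.0#)) (dy : Dec (y ≡ L₂.0#)) →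
               ι (¬? dy ×-dec (dx ⊎-dec ¬? (U? r))) ≡ ι dx *ᶻ (1ℤ -ᶻ ι dy) +ᶻ (1ℤ -ᶻ ι dx) *ᶻ R
    by-cases (yes _) (yes _) = refl
    by-cases (yes _) (no _)  = refl
    by-cases (no x≢0) (no y≢0) = trans (trans (absorb (¬? (U? r))) (complement (U? r))) (sym (trans (cong (λ z → 0ℤ +ᶻ 1ℤ *ᶻ z) (R-≡ x≢0)) (lemma (ι (U? r)))))
      where
      absorb : {P : Set} (d : Dec P) → ι (¬? (no y≢0) ×-dec (no x≢0 ⊎-dec d)) ≡ ι d
      absorb (yes _) = refl
      absorb (no _)  = refl
      lemma : ∀ i → 0ℤ +ᶻ 1ℤ *ᶻ (1ℤ -ᶻ i) ≡ 1ℤ -ᶻ i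
      lemma = solve-∀
    by-cases (no x≢0) (yes refl) = sym (trans (cong (λ z → 0ℤ +ᶻ 1ℤ *ᶻ z) (trans (R-≡ x≢0) (trans (cong (1ℤ -ᶻ_)
      (ι-yes (U? r) (subst U (sym (trans (cong (_* N₁.norm x ⁻¹) N₂.norm-0) (zeroˡ _))) U-0))) refl))) refl)

  weightedSection : G → Carrier → Carrier → ℤ
  weightedSection (a , b) u t = ∑ L₁.elements (λ x → ν¹ x *ᶻ ∑ L₂.elements (λ y → ι (N₂.norm y ≟ u * N₁.norm x) *ᶻ ι (⟨ (a , b) , (x , y) ⟩ ≟ t)))

  π : G → Carrier → ℤ
  π a t = ∑ gs (λ z → f z *ᶻ ι (⟨ a , z ⟩ ≟ t))

  axisSum : G → Carrier → ℤ
  axisSum a t = ∑ L₂.elements (λ y → ν² y *ᶻ ι (⟨ a , (L₁.0# , y) ⟩ ≟ t))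

  π-≡ : ∀ a t → π a t ≡ axisSum a t +ᶻ ∑ elements (λ u → weightᵁ u *ᶻ weightedSection a u t)
  π-≡ a t = begin
    ∑ gs (λ z → f z *ᶻ w z)
      ≡⟨ ∑-pairs (λ z → f z *ᶻ w z) ⟩
    ∑ L₁.elements (λ x → ∑ L₂.elements (λ y → f (x , y) *ᶻ w (x , y)))
      ≡⟨ ∑-cong L₁.elements (λ x → trans (∑-cong L₂.elements (λ y → trans (cong (_*ᶻ w (x , y)) (f-≡ x y))
           (expand (ι (x L₁.≟ L₁.0#)) (ν² y) (ν¹ x) (R x y) (w (x , y)))))
           (trans (∑-∙ L₂.elements (λ y → ι (x L₁.≟ L₁.0#) *ᶻ (ν² y *ᶻ w (x , y))) (λ y → ν¹ x *ᶻ (R x y *ᶻ w (x , y))))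
             (cong₂ _+ᶻ_ (sym (*-∑ (ι (x L₁.≟ L₁.0#)) L₂.elements (λ y → ν² y *ᶻ w (x , y)))) (sym (*-∑ (ν¹ x) L₂.elements (λ y → R x y *ᶻ w (x , y))))))) ⟩
    ∑ L₁.elements (λ x → ι (x L₁.≟ L₁.0#) *ᶻ ∑ L₂.elements (λ y → ν² y *ᶻ w (x , y)) +ᶻ ν¹ x *ᶻ ∑ L₂.elements (λ y → R x y *ᶻ w (x , y)))
      ≡⟨ ∑-∙ L₁.elements (λ x → ι (x L₁.≟ L₁.0#) *ᶻ ∑ L₂.elements (λ y → ν² y *ᶻ w (x , y))) (λ x → ν¹ x *ᶻ ∑ L₂.elements (λ y → R x y *ᶻ w (x , y))) ⟩
    ∑ L₁.elements (λ x → ι (x L₁.≟ L₁.0#) *ᶻ ∑ L₂.elements (λ y → ν² y *ᶻ w (x , y))) +ᶻ ∑ L₁.elements (λ x → ν¹ x *ᶻ ∑ L₂.elements (λ y → R x y *ᶻ w (x , y)))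
      ≡⟨ cong₂ _+ᶻ_ (∑-ι L₁.finite L₁.0# (λ x → ∑ L₂.elements (λ y → ν² y *ᶻ w (x , y)))) regroup ⟩
    ∑ L₂.elements (λ y → ν² y *ᶻ w (L₁.0# , y)) +ᶻ ∑ elements (λ u → weightᵁ u *ᶻ weightedSection a u t) ∎
    where
    open ≡-Reasoning
    w : G → ℤ
    w z = ι (⟨ a , z ⟩ ≟ t)
    r : L₁.Carrier → L₂.Carrier → Carrier → ℤ
    r x y u = ι (N₂.norm y ≟ u * N₁.norm x)
    R : L₁.Carrier → L₂.Carrier → ℤ
    R x y = ∑ elements (λ u → weightᵁ u *ᶻ r x y u)
    expand : ∀ i n m R w → (i *ᶻ n +ᶻ m *ᶻ R) *ᶻ w ≡ i *ᶻ (n *ᶻ w) +ᶻ m *ᶻ (R *ᶻ w)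
    expand = solve-∀
    rotate : ∀ m c s → m *ᶻ (c *ᶻ s) ≡ c *ᶻ (m *ᶻ s)
    rotate = solve-∀
    inner : ∀ x → ∑ L₂.elements (λ y → R x y *ᶻ w (x , y)) ≡ ∑ elements (λ u → weightᵁ u *ᶻ ∑ L₂.elements (λ y → r x y u *ᶻ w (x , y)))
    inner x = trans (∑-cong L₂.elements (λ y → trans (∑-* elements (λ u → weightᵁ u *ᶻ r x y u) (w (x , y)))
        (∑-cong elements (λ u → ℤ.*-assoc (weightᵁ u) (r x y u) (w (x , y))))))
      (trans (∑-swap L₂.elements elements (λ y u → weightᵁ u *ᶻ (r x y u *ᶻ w (x , y))))
        (∑-cong elements (λ u → sym (*-∑ (weightᵁ u) L₂.elements (λ y → r x y u *ᶻ w (x , y))))))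
    regroup : ∑ L₁.elements (λ x → ν¹ x *ᶻ ∑ L₂.elements (λ y → R x y *ᶻ w (x , y))) ≡ ∑ elements (λ u → weightᵁ u *ᶻ weightedSection a u t)
    regroup = begin
      ∑ L₁.elements (λ x → ν¹ x *ᶻ ∑ L₂.elements (λ y → R x y *ᶻ w (x , y)))
        ≡⟨ ∑-cong L₁.elements (λ x → trans (cong (ν¹ x *ᶻ_) (inner x)) (*-∑ (ν¹ x) elements (λ u → weightᵁ u *ᶻ ∑ L₂.elements (λ y → r x y u *ᶻ w (x , y))))) ⟩
      ∑ L₁.elements (λ x → ∑ elements (λ u → ν¹ x *ᶻ (weightᵁ u *ᶻ ∑ L₂.elements (λ y → r x y u *ᶻ w (x , y)))))
        ≡⟨ ∑-swap L₁.elements elements (λ x u → ν¹ x *ᶻ (weightᵁ u *ᶻ ∑ L₂.elements (λ y → r x y u *ᶻ w (x , y)))) ⟩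
      ∑ elements (λ u → ∑ L₁.elements (λ x → ν¹ x *ᶻ (weightᵁ u *ᶻ ∑ L₂.elements (λ y → r x y u *ᶻ w (x , y)))))
        ≡⟨ ∑-cong elements (λ u → trans (∑-cong L₁.elements (λ x → rotate (ν¹ x) (weightᵁ u) (∑ L₂.elements (λ y → r x y u *ᶻ w (x , y)))))
             (sym (*-∑ (weightᵁ u) L₁.elements (λ x → ν¹ x *ᶻ ∑ L₂.elements (λ y → r x y u *ᶻ w (x , y)))))) ⟩
      ∑ elements (λ u → weightᵁ u *ᶻ weightedSection a u t) ∎

  trace₁-*0 : ∀ a → N₁.trace (a L₁.* L₁.0#) ≡ 0#
  trace₁-*0 a = trans (cong N₁.trace (L₁.zeroʳ a)) trace₁-0

  trace₂-*0 : ∀ b → N₂.trace (b L₂.* L₂.0#) ≡ 0#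
  trace₂-*0 b = trans (cong N₂.trace (L₂.zeroʳ b)) trace₂-0

  trace₁-0* : ∀ x → N₁.trace (L₁.0# L₁.* x) ≡ 0#
  trace₁-0* x = trans (cong N₁.trace (L₁.zeroˡ x)) trace₁-0

  trace₂-0* : ∀ y → N₂.trace (L₂.0# L₂.* y) ≡ 0#
  trace₂-0* y = trans (cong N₂.trace (L₂.zeroˡ y)) trace₂-0

  ι-≡ˡ : ∀ {a b} t → a ≡ b → ι (a ≟ t) ≡ ι (b ≟ t)
  ι-≡ˡ t eq = cong (λ c → ι (c ≟ t)) eq

  ι-sym : ∀ a b → ι (a ≟ b) ≡ ι (b ≟ a)
  ι-sym a b = ι-cong (a ≟ b) (b ≟ a) sym sym

  C₁ : L₁.Carrier → ℤ
  C₁ a = ∑ L₁.elements (λ x → ι (N₁.trace (a L₁.* x) ≟ 0#))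

  C₂ : L₂.Carrier → ℤ
  C₂ b = ∑ L₂.elements (λ y → ι (N₂.trace (b L₂.* y) ≟ 0#))

  ∑-trace₁ : ∀ {a} t → a ≢ L₁.0# → ∑ L₁.elements (λ x → ν¹ x *ᶻ ι (N₁.trace (a L₁.* x) ≟ t)) ≡ C₁ a -ᶻ δ t
  ∑-trace₁ {a} t a≢0 = trans (∑-ν¹ (λ x → ι (N₁.trace (a L₁.* x) ≟ t))) (cong₂ _-ᶻ_ (N₁.trace-fibre a≢0 t 0#)
    (trans (ι-≡ˡ t (trace₁-*0 a)) (ι-sym 0# t)))

  ∑-trace₂ : ∀ {b} t → b ≢ L₂.0# → ∑ L₂.elements (λ y → ν² y *ᶻ ι (N₂.trace (b L₂.* y) ≟ t)) ≡ C₂ b -ᶻ δ t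
  ∑-trace₂ {b} t b≢0 = trans (∑-ν² (λ y → ι (N₂.trace (b L₂.* y) ≟ t))) (cong₂ _-ᶻ_ (N₂.trace-fibre b≢0 t 0#)
    (trans (ι-≡ˡ t (trace₂-*0 b)) (ι-sym 0# t)))

  axis : ∀ a {b} t → b ≢ L₂.0# → axisSum (a , b) t ≡ C₂ b -ᶻ δ t
  axis a {b} t b≢0 = trans (∑-cong L₂.elements (λ y → cong (ν² y *ᶻ_) (ι-≡ˡ t (trans (cong (_+ N₂.trace (b L₂.* y)) (trace₁-*0 a)) (+-identityˡ _))))) (∑-trace₂ t b≢0)

  γ-θ₁ : θ₁ *ᶻ θ₁ -ᶻ σ *ᶻ θ₁ +ᶻ τ ≡ 0ℤ
  γ-θ₁ = lemma θ₁ θ₂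
    where
    lemma : ∀ a b → a *ᶻ a -ᶻ (a +ᶻ b) *ᶻ a +ᶻ a *ᶻ b ≡ 0ℤ
    lemma = solve-∀

  γ-θ₂ : θ₂ *ᶻ θ₂ -ᶻ σ *ᶻ θ₂ +ᶻ τ ≡ 0ℤ
  γ-θ₂ = lemma θ₁ θ₂
    where
    lemma : ∀ a b → b *ᶻ b -ᶻ (a +ᶻ b) *ᶻ b +ᶻ a *ᶻ b ≡ 0ℤ
    lemma = solve-∀

  flatProfile : ∀ {ψ : Carrier → ℤ} C γ → (∀ t → ψ t ≡ C +ᶻ γ *ᶻ δ t) → γ *ᶻ γ -ᶻ σ *ᶻ γ +ᶻ τ ≡ 0ℤ → Profile ψ
  flatProfile C γ eq γ-eq = record
    { C = C ; β = 0ℤ ; γ = γ ; e = 0ℤ ; W = λ _ → 0ℤ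
    ; profile = λ t → trans (eq t) (cong (_+ᶻ γ *ᶻ δ t) (sym (ℤ.+-identityʳ C)))
    ; W-corr = λ t → ∑-ε elements
    ; W-even = λ t → refl
    ; β-equation = sym (ℤ.*-zeroʳ σ)
    ; γ-equation = γ-eq }

  -- Over each nonzero `y` lie `s = 1 + (q - e) g` points of D: the one with `x = 0`, and `g` for
  -- each `u ∉ U`. So the pushforward is `s` times that of the nonzero elements of `L₂`, whose
  -- nontrivial character sums are -1.
  profile-0b : ∀ {b} → b ≢ L₂.0# → Profile (π (L₁.0# , b))
  profile-0b {b} b≢0 = flatProfile (C₂ b +ᶻ (q -ᶻ e) *ᶻ (g *ᶻ C₂ b)) θ₂ (λ t → begin
    π (L₁.0# , b) t
      ≡⟨ π-≡ (L₁.0# , b) t ⟩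
    axisSum (L₁.0# , b) t +ᶻ ∑ elements (λ u → weightᵁ u *ᶻ weightedSection (L₁.0# , b) u t)
      ≡⟨ cong₂ _+ᶻ_ (axis L₁.0# t b≢0) (trans (∑-cong elements (λ u → weightᵁ-guard u (sections t u))) (∑-weightᵁ-* (g *ᶻ (C₂ b -ᶻ δ t)))) ⟩
    (C₂ b -ᶻ δ t) +ᶻ (q -ᶻ e) *ᶻ (g *ᶻ (C₂ b -ᶻ δ t))
      ≡⟨ collect (C₂ b) (δ t) (q -ᶻ e) g ⟩
    C₂ b +ᶻ (q -ᶻ e) *ᶻ (g *ᶻ C₂ b) +ᶻ θ₂ *ᶻ δ t ∎) γ-θ₂
    where
    open ≡-Reasoning
    collect : ∀ c d r g → (c -ᶻ d) +ᶻ r *ᶻ (g *ᶻ (c -ᶻ d)) ≡ c +ᶻ r *ᶻ (g *ᶻ c) +ᶻ ℤ.- (1ℤ +ᶻ r *ᶻ g) *ᶻ d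
    collect = solve-∀
    rotate : ∀ a b c → a *ᶻ (b *ᶻ c) ≡ c *ᶻ (a *ᶻ b)
    rotate = solve-∀
    rotate′ : ∀ a b c → a *ᶻ (b *ᶻ c) ≡ c *ᶻ (b *ᶻ a)
    rotate′ = solve-∀
    fibre : ∀ u → u ≢ 0# → ∀ y → ∑ L₁.elements (λ x → ν¹ x *ᶻ ι (N₂.norm y ≟ u * N₁.norm x)) ≡ ν² y *ᶻ g
    fibre u u≢0 y = by-zero (y L₂.≟ L₂.0#)
      where
      by-zero : (d : Dec (y ≡ L₂.0#)) → ∑ L₁.elements (λ x → ν¹ x *ᶻ ι (N₂.norm y ≟ u * N₁.norm x)) ≡ (1ℤ -ᶻ ι d) *ᶻ g
      by-zero (yes refl) = trans (∑-cong L₁.elements (λ x → trans (ν¹-guard x (λ x≢0 → ι-no (N₂.norm L₂.0# ≟ u * N₁.norm x)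
        (λ eq → *-≢0 u≢0 (N₁.norm-≢0 x≢0) (trans (sym eq) N₂.norm-0)))) (ℤ.*-zeroʳ (ν¹ x)))) (trans (∑-ε L₁.elements) (sym (ℤ.*-zeroˡ g)))
      by-zero (no y≢0) = trans (∑-ν¹ (λ x → ι (N₂.norm y ≟ u * N₁.norm x))) (trans (cong₂ _-ᶻ_
        (trans (∑-cong L₁.elements (λ x → ι-cong (N₂.norm y ≟ u * N₁.norm x) (N₁.norm x ≟ u ⁻¹ * N₂.norm y)
          (λ eq → trans (sym (cancelˡ u≢0 _)) (cong (u ⁻¹ *_) (sym eq))) (λ eq → trans (sym (cancelʳ u≢0 _)) (cong (u *_) (sym eq)))))
          (N₁.norm-fibre (*-≢0 (⁻¹-≢0 u≢0) (N₂.norm-≢0 y≢0))))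
        (ι-no (N₂.norm y ≟ u * N₁.norm L₁.0#) (λ eq → N₂.norm-≢0 y≢0 (trans eq (trans (cong (u *_) N₁.norm-0) (zeroʳ u))))))
        (lemma g))
        where
        lemma : ∀ g → g -ᶻ 0ℤ ≡ 1ℤ *ᶻ g
        lemma = solve-∀
    sections : ∀ t u → u ≢ 0# → weightedSection (L₁.0# , b) u t ≡ g *ᶻ (C₂ b -ᶻ δ t)
    sections t u u≢0 = begin
      weightedSection (L₁.0# , b) u t
        ≡⟨ ∑-cong L₁.elements (λ x → trans (cong (ν¹ x *ᶻ_) (∑-cong L₂.elements (λ y → cong (r x y *ᶻ_)
             (ι-≡ˡ t (trans (cong (_+ N₂.trace (b L₂.* y)) (trace₁-0* x)) (+-identityˡ _)))))) (*-∑ (ν¹ x) L₂.elements (λ y → r x y *ᶻ w y))) ⟩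
      ∑ L₁.elements (λ x → ∑ L₂.elements (λ y → ν¹ x *ᶻ (r x y *ᶻ w y)))
        ≡⟨ ∑-swap L₁.elements L₂.elements (λ x y → ν¹ x *ᶻ (r x y *ᶻ w y)) ⟩
      ∑ L₂.elements (λ y → ∑ L₁.elements (λ x → ν¹ x *ᶻ (r x y *ᶻ w y)))
        ≡⟨ ∑-cong L₂.elements (λ y → trans (∑-cong L₁.elements (λ x → rotate (ν¹ x) (r x y) (w y))) (trans (sym (*-∑ (w y) L₁.elements (λ x → ν¹ x *ᶻ r x y)))
             (trans (cong (w y *ᶻ_) (fibre u u≢0 y)) (rotate′ (w y) (ν² y) g)))) ⟩
      ∑ L₂.elements (λ y → g *ᶻ (ν² y *ᶻ w y))
        ≡⟨ trans (sym (*-∑ g L₂.elements (λ y → ν² y *ᶻ w y))) (cong (g *ᶻ_) (∑-trace₂ t b≢0)) ⟩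
      g *ᶻ (C₂ b -ᶻ δ t) ∎
      where
      r : L₁.Carrier → L₂.Carrier → ℤ
      r x y = ι (N₂.norm y ≟ u * N₁.norm x)
      w : L₂.Carrier → ℤ
      w y = ι (N₂.trace (b L₂.* y) ≟ t)

  norm-fibre-ratio : ∀ {u} → u ≢ 0# → ∀ {x} → x ≢ L₁.0# → ∑ L₂.elements (λ y → ι (N₂.norm y ≟ u * N₁.norm x)) ≡ h
  norm-fibre-ratio u≢0 x≢0 = N₂.norm-fibre (*-≢0 u≢0 (N₁.norm-≢0 x≢0))

  -- Over `x = 0` lie `S₂ - 1 = (q - 1) h` points of D, over any other `x` only `(q - e) h`; the
  -- excess at 0 is `θ₁`.
  profile-a0 : ∀ {a} → a ≢ L₁.0# → Profile (π (a , L₂.0#))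
  profile-a0 {a} a≢0 = flatProfile ((q -ᶻ e) *ᶻ (h *ᶻ C₁ a)) θ₁ (λ t → begin
    π (a , L₂.0#) t
      ≡⟨ π-≡ (a , L₂.0#) t ⟩
    axisSum (a , L₂.0#) t +ᶻ ∑ elements (λ u → weightᵁ u *ᶻ weightedSection (a , L₂.0#) u t)
      ≡⟨ cong₂ _+ᶻ_ (axis₀ t) (trans (∑-cong elements (λ u → weightᵁ-guard u (sections t u))) (∑-weightᵁ-* (h *ᶻ (C₁ a -ᶻ δ t)))) ⟩
    (S₂ *ᶻ δ t -ᶻ δ t) +ᶻ (q -ᶻ e) *ᶻ (h *ᶻ (C₁ a -ᶻ δ t))
      ≡⟨ cong (λ z → (z *ᶻ δ t -ᶻ δ t) +ᶻ (q -ᶻ e) *ᶻ (h *ᶻ (C₁ a -ᶻ δ t))) S₂-≡ ⟩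
    (((q -ᶻ 1ℤ) *ᶻ h +ᶻ 1ℤ) *ᶻ δ t -ᶻ δ t) +ᶻ (q -ᶻ e) *ᶻ (h *ᶻ (C₁ a -ᶻ δ t))
      ≡⟨ collect (C₁ a) (δ t) q e h ⟩
    (q -ᶻ e) *ᶻ (h *ᶻ C₁ a) +ᶻ θ₁ *ᶻ δ t ∎) γ-θ₁
    where
    open ≡-Reasoning
    collect : ∀ c d q e h → (((q -ᶻ 1ℤ) *ᶻ h +ᶻ 1ℤ) *ᶻ d -ᶻ d) +ᶻ (q -ᶻ e) *ᶻ (h *ᶻ (c -ᶻ d)) ≡ (q -ᶻ e) *ᶻ (h *ᶻ c) +ᶻ (e -ᶻ 1ℤ) *ᶻ h *ᶻ d
    collect = solve-∀
    axis₀ : ∀ t → axisSum (a , L₂.0#) t ≡ S₂ *ᶻ δ t -ᶻ δ t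
    axis₀ t = trans (∑-cong L₂.elements (λ y → cong (ν² y *ᶻ_) (trans (ι-≡ˡ t (trans (cong₂ _+_ (trace₁-*0 a) (trace₂-0* y)) (+-identityˡ 0#))) (ι-sym 0# t))))
      (trans (∑-ν² (λ _ → δ t)) (cong (_-ᶻ δ t) (∑-const L₂.elements (δ t))))
    sections : ∀ t u → u ≢ 0# → weightedSection (a , L₂.0#) u t ≡ h *ᶻ (C₁ a -ᶻ δ t)
    sections t u u≢0 = trans (∑-cong L₁.elements (λ x → trans (ν¹-guard x (λ x≢0 → trans (∑-cong L₂.elements (λ y → cong (ι (N₂.norm y ≟ u * N₁.norm x) *ᶻ_)
        (ι-≡ˡ t (trans (cong (N₁.trace (a L₁.* x) +_) (trace₂-0* y)) (+-identityʳ _)))))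
        (trans (sym (∑-* L₂.elements (λ y → ι (N₂.norm y ≟ u * N₁.norm x)) (ι (N₁.trace (a L₁.* x) ≟ t)))) (cong (_*ᶻ ι (N₁.trace (a L₁.* x) ≟ t)) (norm-fibre-ratio u≢0 x≢0)))))
        (rotate (ν¹ x) h (ι (N₁.trace (a L₁.* x) ≟ t)))))
      (trans (sym (*-∑ h L₁.elements (λ x → ν¹ x *ᶻ ι (N₁.trace (a L₁.* x) ≟ t)))) (cong (h *ᶻ_) (∑-trace₁ t a≢0)))
      where
      rotate : ∀ a b c → a *ᶻ (b *ᶻ c) ≡ b *ᶻ (a *ᶻ c)
      rotate = solve-∀

  -- Scaling `x` by `a` and `y` by `b` multiplies the norm ratio by `ρ`, which reduces the claim to
  -- `section`. Each `u ∉ U` then takes away `S₁` at the point `u λ₀`; up to a constant this adds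
  -- `S₁` on the subgroup `λ₀ U`, whose indicator is `W`.
  profile-ab : ∀ {a b} → a ≢ L₁.0# → b ≢ L₂.0# → Profile (π (a , b))
  profile-ab {a} {b} a≢0 b≢0 = record
    { C = C₂ b +ᶻ T ; β = S₁ ; γ = θ₂ ; e = e ; W = W ; profile = profile
    ; W-corr = W-corr ; W-even = W-even ; β-equation = β-equation ; γ-equation = γ-θ₂ }
    where
    open ≡-Reasoning
    A B ρ λ₀ : Carrier
    A = N₁.norm a
    B = N₂.norm b
    ρ = B * A ⁻¹
    λ₀ = ρ * s₁ ⁻¹
    A≢0 : A ≢ 0#
    A≢0 = N₁.norm-≢0 a≢0
    B≢0 : B ≢ 0#
    B≢0 = N₂.norm-≢0 b≢0
    ρ≢0 : ρ ≢ 0#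
    ρ≢0 = *-≢0 B≢0 (⁻¹-≢0 A≢0)
    λ≢0 : λ₀ ≢ 0#
    λ≢0 = *-≢0 ρ≢0 (⁻¹-≢0 sign-≢0)
    W : Carrier → ℤ
    W t = ι (U? (t * λ₀ ⁻¹))
    T : ℤ
    T = ∑ elements (λ u → weightᵁ u *ᶻ sectionConstant (u * ρ)) -ᶻ S₁ *ᶻ 1ℤ
    weightedSection-≡ : ∀ u t → weightedSection (a , b) u t ≡ section (u * ρ) t
    weightedSection-≡ u t = sym (trans (reindex L₁.finite L₁.finite (a L₁.*_) (a L₁.⁻¹ L₁.*_) (L₁.cancelʳ a≢0) (L₁.cancelˡ a≢0)
        (λ x → ν¹ x *ᶻ ∑ L₂.elements (λ y → ι (N₂.norm y ≟ u * ρ * N₁.norm x) *ᶻ ι (N₁.trace x + N₂.trace y ≟ t))))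
      (∑-cong L₁.elements (λ x → cong₂ _*ᶻ_ (ν¹-scale x)
        (trans (reindex L₂.finite L₂.finite (b L₂.*_) (b L₂.⁻¹ L₂.*_) (L₂.cancelʳ b≢0) (L₂.cancelˡ b≢0) (λ y → ι (N₂.norm y ≟ u * ρ * N₁.norm (a L₁.* x)) *ᶻ ι (N₁.trace (a L₁.* x) + N₂.trace y ≟ t)))
          (∑-cong L₂.elements (λ y → cong (_*ᶻ ι (N₁.trace (a L₁.* x) + N₂.trace (b L₂.* y) ≟ t)) (unscale x y)))))))
      where
      ν¹-scale : ∀ x → ν¹ (a L₁.* x) ≡ ν¹ x
      ν¹-scale x = cong (1ℤ -ᶻ_) (ι-cong (a L₁.* x L₁.≟ L₁.0#) (x L₁.≟ L₁.0#)
        (λ eq → L₁.*-injectiveˡ a≢0 (trans eq (sym (L₁.zeroʳ a)))) (λ { refl → L₁.zeroʳ a }))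
      rescale : ∀ x → u * ρ * N₁.norm (a L₁.* x) ≡ B * (u * N₁.norm x)
      rescale x = trans (cong (u * ρ *_) (N₁.norm-* a x)) (trans (S.solve 5 (λ u B i A x → u S.:* (B S.:* i) S.:* (A S.:* x) S.:= (A S.:* i) S.:* (B S.:* (u S.:* x))) refl u B (A ⁻¹) A (N₁.norm x))
        (trans (cong (_* (B * (u * N₁.norm x))) (*-inverseʳ A≢0)) (*-identityˡ _)))
      unscale : ∀ x y → ι (N₂.norm (b L₂.* y) ≟ u * ρ * N₁.norm (a L₁.* x)) ≡ ι (N₂.norm y ≟ u * N₁.norm x)
      unscale x y = ι-cong (N₂.norm (b L₂.* y) ≟ u * ρ * N₁.norm (a L₁.* x)) (N₂.norm y ≟ u * N₁.norm x)
        (λ eq → *-injectiveˡ B≢0 (trans (sym (N₂.norm-* b y)) (trans eq (rescale x))))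
        (λ eq → trans (N₂.norm-* b y) (trans (cong (B *_) eq) (sym (rescale x))))
    profile : ∀ t → π (a , b) t ≡ C₂ b +ᶻ T +ᶻ S₁ *ᶻ W t +ᶻ θ₂ *ᶻ δ t
    profile t = begin
      π (a , b) t
        ≡⟨ π-≡ (a , b) t ⟩
      axisSum (a , b) t +ᶻ ∑ elements (λ u → weightᵁ u *ᶻ weightedSection (a , b) u t)
        ≡⟨ cong₂ _+ᶻ_ (axis a t b≢0) (trans (∑-cong elements (λ u → trans (weightᵁ-guard u (λ u≢0 → trans (weightedSection-≡ u t) (section-≡ t (*-≢0 u≢0 ρ≢0))))
             (expand (weightᵁ u) (sectionConstant (u * ρ)) (g *ᶻ δ t) S₁ (ι (t ≟ u * ρ * s₁ ⁻¹))))) sum-sections) ⟩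
      (C₂ b -ᶻ δ t) +ᶻ ((Σ₀ -ᶻ (q -ᶻ e) *ᶻ (g *ᶻ δ t)) -ᶻ S₁ *ᶻ (1ℤ -ᶻ W t))
        ≡⟨ collect (C₂ b) (δ t) Σ₀ (q -ᶻ e) g S₁ (W t) ⟩
      C₂ b +ᶻ T +ᶻ S₁ *ᶻ W t +ᶻ θ₂ *ᶻ δ t ∎
      where
      Σ₀ : ℤ
      Σ₀ = ∑ elements (λ u → weightᵁ u *ᶻ sectionConstant (u * ρ))
      expand : ∀ w c d s i → w *ᶻ (c -ᶻ d -ᶻ s *ᶻ i) ≡ (w *ᶻ c -ᶻ w *ᶻ d) -ᶻ s *ᶻ (i *ᶻ w)
      expand = solve-∀
      collect : ∀ c d Σ r g s w → (c -ᶻ d) +ᶻ ((Σ -ᶻ r *ᶻ (g *ᶻ d)) -ᶻ s *ᶻ (1ℤ -ᶻ w)) ≡ c +ᶻ (Σ -ᶻ s *ᶻ 1ℤ) +ᶻ s *ᶻ w +ᶻ ℤ.- (1ℤ +ᶻ r *ᶻ g) *ᶻ d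
      collect = solve-∀
      tangent : ∑ elements (λ u → ι (t ≟ u * ρ * s₁ ⁻¹) *ᶻ weightᵁ u) ≡ 1ℤ -ᶻ W t
      tangent = trans (∑-cong elements (λ u → cong (_*ᶻ weightᵁ u) (ι-cong (t ≟ u * ρ * s₁ ⁻¹) (u ≟ t * λ₀ ⁻¹)
          (λ { refl → sym (trans (cong (_* λ₀ ⁻¹) (*-assoc u ρ (s₁ ⁻¹))) (trans (*-assoc u λ₀ (λ₀ ⁻¹)) (trans (cong (u *_) (*-inverseʳ λ≢0)) (*-identityʳ u)))) })
          (λ { refl → sym (trans (*-assoc (t * λ₀ ⁻¹) ρ (s₁ ⁻¹)) (trans (*-assoc t (λ₀ ⁻¹) λ₀) (trans (cong (t *_) (*-inverseˡ λ≢0)) (*-identityʳ t)))) }))))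
        (∑-ι finite (t * λ₀ ⁻¹) weightᵁ)
      sum-sections : ∑ elements (λ u → (weightᵁ u *ᶻ sectionConstant (u * ρ) -ᶻ weightᵁ u *ᶻ (g *ᶻ δ t)) -ᶻ S₁ *ᶻ (ι (t ≟ u * ρ * s₁ ⁻¹) *ᶻ weightᵁ u)) ≡
                     (Σ₀ -ᶻ (q -ᶻ e) *ᶻ (g *ᶻ δ t)) -ᶻ S₁ *ᶻ (1ℤ -ᶻ W t)
      sum-sections = trans (∑-minus elements (λ u → weightᵁ u *ᶻ sectionConstant (u * ρ) -ᶻ weightᵁ u *ᶻ (g *ᶻ δ t)) (λ u → S₁ *ᶻ (ι (t ≟ u * ρ * s₁ ⁻¹) *ᶻ weightᵁ u)))
        (cong₂ _-ᶻ_ (trans (∑-minus elements (λ u → weightᵁ u *ᶻ sectionConstant (u * ρ)) (λ u → weightᵁ u *ᶻ (g *ᶻ δ t))) (cong (Σ₀ -ᶻ_) (∑-weightᵁ-* (g *ᶻ δ t))))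
          (trans (sym (*-∑ S₁ elements (λ u → ι (t ≟ u * ρ * s₁ ⁻¹) *ᶻ weightᵁ u))) (cong (S₁ *ᶻ_) tangent)))
    -- This uses that `U` is an additive subgroup: for `c` in `U`, the element `c + w` lies in `U`
    -- exactly when `w` does.
    W-corr : ∀ t → ∑ elements (λ s → W (s + t) *ᶻ W s) ≡ e *ᶻ W t
    W-corr t = begin
      ∑ elements (λ s → W (s + t) *ᶻ W s)
        ≡⟨ reindex finite finite (_* λ₀) (_* λ₀ ⁻¹) (λ x → trans (*-assoc x _ _) (trans (cong (x *_) (*-inverseˡ λ≢0)) (*-identityʳ x)))
             (λ x → trans (*-assoc x _ _) (trans (cong (x *_) (*-inverseʳ λ≢0)) (*-identityʳ x))) (λ s → W (s + t) *ᶻ W s) ⟩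
      ∑ elements (λ c → W (c * λ₀ + t) *ᶻ W (c * λ₀))
        ≡⟨ ∑-cong elements (λ c → trans (cong₂ (λ x y → ι (U? x) *ᶻ ι (U? y)) (shifted c) (cancel c)) (absorb c (U? c))) ⟩
      ∑ elements (λ c → ι (U? c) *ᶻ W t)
        ≡⟨ ∑-* elements (λ c → ι (U? c)) (W t) ⟨
      e *ᶻ W t ∎
      where
      cancel : ∀ c → c * λ₀ * λ₀ ⁻¹ ≡ c
      cancel c = trans (*-assoc c _ _) (trans (cong (c *_) (*-inverseʳ λ≢0)) (*-identityʳ c))
      shifted : ∀ c → (c * λ₀ + t) * λ₀ ⁻¹ ≡ c + t * λ₀ ⁻¹
      shifted c = trans (distribʳ (λ₀ ⁻¹) (c * λ₀) t) (cong (_+ t * λ₀ ⁻¹) (cancel c))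
      absorb : ∀ c (d : Dec (U c)) → ι (U? (c + t * λ₀ ⁻¹)) *ᶻ ι d ≡ ι d *ᶻ W t
      absorb c (no _)   = ℤ.*-zeroʳ (ι (U? (c + t * λ₀ ⁻¹)))
      absorb c (yes Uc) = trans (ℤ.*-comm (ι (U? (c + t * λ₀ ⁻¹))) 1ℤ) (cong (1ℤ *ᶻ_) (ι-cong (U? (c + t * λ₀ ⁻¹)) (U? (t * λ₀ ⁻¹))
        (λ Us → subst U (S.solve 2 (λ c w → (c S.:+ w) S.:+ S.:- c S.:= w) refl c (t * λ₀ ⁻¹)) (U-+ Us (U-neg Uc))) (U-+ Uc)))
    W-even : ∀ t → W (- t) ≡ W t
    W-even t = ι-cong (U? (- t * λ₀ ⁻¹)) (U? (t * λ₀ ⁻¹))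
      (λ Ut → subst U (S.solve 2 (λ t i → S.:- (S.:- t S.:* i) S.:= t S.:* i) refl t (λ₀ ⁻¹)) (U-neg Ut))
      (λ Ut → subst U (S.solve 2 (λ t i → S.:- (t S.:* i) S.:= S.:- t S.:* i) refl t (λ₀ ⁻¹)) (U-neg Ut))
    -- After division by `S₁` this says `S₁ * e = θ₁ - θ₂`: adding the order of `U`, scaled by `S₁`,
    -- leads from one eigenvalue to the other.
    β-equation : S₁ *ᶻ S₁ *ᶻ e +ᶻ (S₁ *ᶻ θ₂ +ᶻ S₁ *ᶻ θ₂) ≡ σ *ᶻ S₁
    β-equation = trans (factor S₁ e θ₂) (cong (_*ᶻ S₁) (trans (cong (λ z → (z *ᶻ e +ᶻ θ₂) +ᶻ θ₂) S₁-≡) (trans (lemma q g e θ₂) (cong (λ z → (e -ᶻ 1ℤ) *ᶻ z +ᶻ θ₂) (sym h-≡)))))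
      where
      factor : ∀ s e t → s *ᶻ s *ᶻ e +ᶻ (s *ᶻ t +ᶻ s *ᶻ t) ≡ ((s *ᶻ e +ᶻ t) +ᶻ t) *ᶻ s
      factor = solve-∀
      lemma : ∀ q g e t → (((q -ᶻ 1ℤ) *ᶻ g +ᶻ 1ℤ) *ᶻ e +ᶻ ℤ.- (1ℤ +ᶻ (q -ᶻ e) *ᶻ g)) +ᶻ t ≡ (e -ᶻ 1ℤ) *ᶻ (1ℤ +ᶻ q *ᶻ g) +ᶻ t
      lemma = solve-∀

  good : ∀ a → a ≢ 𝟎 → Good (π a)
  good (a , b) ≢𝟎 = by-cases (a L₁.≟ L₁.0#) (b L₂.≟ L₂.0#)
    where
    by-cases : Dec (a ≡ L₁.0#) → Dec (b ≡ L₂.0#) → Good (π (a , b))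
    by-cases (yes refl) (yes refl) = contradiction refl ≢𝟎
    by-cases (yes refl) (no b≢0)   = Profile.good (profile-0b b≢0)
    by-cases (no a≢0)   (yes refl) = Profile.good (profile-a0 a≢0)
    by-cases (no a≢0)   (no b≢0)   = Profile.good (profile-ab a≢0 b≢0)

  -- The pushforward along the zero functional puts all of D at 0, so the decomposition `π-≡` also
  -- yields the total.
  k-≡ : ∑ gs f ≡ (q -ᶻ 1ℤ) *ᶻ h *ᶻ s
  k-≡ = begin
    ∑ gs f
      ≡⟨ ∑-cong gs (λ z → sym (trans (cong (f z *ᶻ_) (trans (ι-≡ˡ 0# (𝟎-⟨⟩ z)) (ι-yes (0# ≟ 0#) refl))) (ℤ.*-identityʳ (f z)))) ⟩
    π 𝟎 0#
      ≡⟨ π-≡ 𝟎 0# ⟩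
    axisSum 𝟎 0# +ᶻ ∑ elements (λ u → weightᵁ u *ᶻ weightedSection 𝟎 u 0#)
      ≡⟨ cong₂ _+ᶻ_ axis-total (trans (∑-cong elements (λ u → weightᵁ-guard u (sections u))) (∑-weightᵁ-* (S₁ *ᶻ h -ᶻ h))) ⟩
    (S₂ -ᶻ 1ℤ) +ᶻ (q -ᶻ e) *ᶻ (S₁ *ᶻ h -ᶻ h)
      ≡⟨ cong₂ (λ x y → (x -ᶻ 1ℤ) +ᶻ (q -ᶻ e) *ᶻ (y *ᶻ h -ᶻ h)) S₂-≡ S₁-≡ ⟩
    ((q -ᶻ 1ℤ) *ᶻ h +ᶻ 1ℤ -ᶻ 1ℤ) +ᶻ (q -ᶻ e) *ᶻ (((q -ᶻ 1ℤ) *ᶻ g +ᶻ 1ℤ) *ᶻ h -ᶻ h)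
      ≡⟨ lemma q e g h ⟩
    (q -ᶻ 1ℤ) *ᶻ h *ᶻ s ∎
    where
    open ≡-Reasoning
    𝟎-⟨⟩ : ∀ z → ⟨ 𝟎 , z ⟩ ≡ 0#
    𝟎-⟨⟩ (x , y) = trans (cong₂ _+_ (trace₁-0* x) (trace₂-0* y)) (+-identityˡ 0#)
    lemma : ∀ q e g h → ((q -ᶻ 1ℤ) *ᶻ h +ᶻ 1ℤ -ᶻ 1ℤ) +ᶻ (q -ᶻ e) *ᶻ (((q -ᶻ 1ℤ) *ᶻ g +ᶻ 1ℤ) *ᶻ h -ᶻ h) ≡ (q -ᶻ 1ℤ) *ᶻ h *ᶻ (1ℤ +ᶻ (q -ᶻ e) *ᶻ g)
    lemma = solve-∀
    hit : ∀ z → ι (⟨ 𝟎 , z ⟩ ≟ 0#) ≡ 1ℤ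
    hit z = ι-yes (⟨ 𝟎 , z ⟩ ≟ 0#) (𝟎-⟨⟩ z)
    axis-total : axisSum 𝟎 0# ≡ S₂ -ᶻ 1ℤ
    axis-total = trans (∑-cong L₂.elements (λ y → cong (ν² y *ᶻ_) (hit (L₁.0# , y)))) (trans (∑-ν² (λ _ → 1ℤ)) (cong (_-ᶻ 1ℤ) (∑-1 L₂.elements)))
    sections : ∀ u → u ≢ 0# → weightedSection 𝟎 u 0# ≡ S₁ *ᶻ h -ᶻ h
    sections u u≢0 = trans (∑-cong L₁.elements (λ x → ν¹-guard x (λ x≢0 → trans (∑-cong L₂.elements (λ y → trans (cong (ι (N₂.norm y ≟ u * N₁.norm x) *ᶻ_) (hit (x , y))) (ℤ.*-identityʳ _)))
        (norm-fibre-ratio u≢0 x≢0)))) (trans (∑-ν¹ (λ _ → h)) (cong (_-ᶻ h) (∑-const L₁.elements h)))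

  length-gs : ℤ.+ length gs ≡ S₁ *ᶻ S₂
  length-gs = trans (sym (∑-1 gs)) (trans (∑-pairs (λ _ → 1ℤ)) (trans (∑-cong L₁.elements (λ _ → ∑-1 L₂.elements)) (∑-const L₁.elements S₂)))

  total : ∑ gs f *ᶻ ∑ gs f -ᶻ σ *ᶻ ∑ gs f +ᶻ τ ≡ μ *ᶻ ℤ.+ length gs
  total = begin
    ∑ gs f *ᶻ ∑ gs f -ᶻ σ *ᶻ ∑ gs f +ᶻ τ
      ≡⟨ cong (λ k → k *ᶻ k -ᶻ σ *ᶻ k +ᶻ τ) k-≡ ⟩
    K₁ h *ᶻ K₁ h -ᶻ ((e -ᶻ 1ℤ) *ᶻ h +ᶻ θ₂) *ᶻ K₁ h +ᶻ (e -ᶻ 1ℤ) *ᶻ h *ᶻ θ₂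
      ≡⟨ lemma q e g h ⟩
    μ *ᶻ (((q -ᶻ 1ℤ) *ᶻ g +ᶻ 1ℤ) *ᶻ ((q -ᶻ 1ℤ) *ᶻ h +ᶻ 1ℤ))
      ≡⟨ cong (μ *ᶻ_) (trans length-gs (cong₂ _*ᶻ_ S₁-≡ S₂-≡)) ⟨
    μ *ᶻ ℤ.+ length gs ∎
    where
    open ≡-Reasoning
    K₁ : ℤ → ℤ
    K₁ h = (q -ᶻ 1ℤ) *ᶻ h *ᶻ s
    lemma : ∀ q e g h → (q -ᶻ 1ℤ) *ᶻ h *ᶻ (1ℤ +ᶻ (q -ᶻ e) *ᶻ g) *ᶻ ((q -ᶻ 1ℤ) *ᶻ h *ᶻ (1ℤ +ᶻ (q -ᶻ e) *ᶻ g))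
      -ᶻ ((e -ᶻ 1ℤ) *ᶻ h +ᶻ ℤ.- (1ℤ +ᶻ (q -ᶻ e) *ᶻ g)) *ᶻ ((q -ᶻ 1ℤ) *ᶻ h *ᶻ (1ℤ +ᶻ (q -ᶻ e) *ᶻ g)) +ᶻ (e -ᶻ 1ℤ) *ᶻ h *ᶻ ℤ.- (1ℤ +ᶻ (q -ᶻ e) *ᶻ g) ≡
      (q -ᶻ e) *ᶻ h *ᶻ (1ℤ +ᶻ (q -ᶻ e) *ᶻ g) *ᶻ (((q -ᶻ 1ℤ) *ᶻ g +ᶻ 1ℤ) *ᶻ ((q -ᶻ 1ℤ) *ᶻ h +ᶻ 1ℤ))
    lemma = solve-∀

  pairing-comm : ∀ a z → ⟨ a , z ⟩ ≡ ⟨ z , a ⟩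
  pairing-comm (a , b) (x , y) = cong₂ _+_ (cong N₁.trace (L₁.*-comm a x)) (cong N₂.trace (L₂.*-comm b y))

  -- One nonzero component of the functional is enough: with the other variable fixed, its trace is
  -- already equidistributed.
  uniformʳ : ∀ {a} → a ≢ 𝟎 → Uniform (λ t → ∑ gs (λ z → ι (⟨ a , z ⟩ ≟ t)))
  uniformʳ {a , b} ≢𝟎 t t′ = trans (∑-pairs (λ z → ι (⟨ (a , b) , z ⟩ ≟ t))) (trans (by-cases (a L₁.≟ L₁.0#) (b L₂.≟ L₂.0#)) (sym (∑-pairs (λ z → ι (⟨ (a , b) , z ⟩ ≟ t′)))))
    where
    double : Carrier → ℤ
    double t = ∑ L₁.elements (λ x → ∑ L₂.elements (λ y → ι (⟨ (a , b) , (x , y) ⟩ ≟ t)))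
    isolate : ∀ c d t → ι (c + d ≟ t) ≡ ι (d ≟ t - c)
    isolate c d t = ι-cong (c + d ≟ t) (d ≟ t - c) (λ { refl → S.solve 2 (λ c d → d S.:= c S.:+ d S.:- c) refl c d }) (λ { refl → S.solve 2 (λ c t → c S.:+ (t S.:- c) S.:= t) refl c t })
    by-cases : Dec (a ≡ L₁.0#) → Dec (b ≡ L₂.0#) → double t ≡ double t′
    by-cases (yes refl) (yes refl) = contradiction refl ≢𝟎
    by-cases _ (no b≢0) = ∑-cong L₁.elements (λ x → trans (∑-cong L₂.elements (λ y → isolate (N₁.trace (a L₁.* x)) (N₂.trace (b L₂.* y)) t))
      (trans (N₂.trace-fibre b≢0 (t - N₁.trace (a L₁.* x)) (t′ - N₁.trace (a L₁.* x))) (∑-cong L₂.elements (λ y → sym (isolate (N₁.trace (a L₁.* x)) (N₂.trace (b L₂.* y)) t′)))))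
    by-cases (no a≢0) (yes _) = trans (swapped t) (trans (∑-cong L₂.elements (λ y → N₁.trace-fibre a≢0 (t - N₂.trace (b L₂.* y)) (t′ - N₂.trace (b L₂.* y)))) (sym (swapped t′)))
      where
      swapped : ∀ t → double t ≡ ∑ L₂.elements (λ y → ∑ L₁.elements (λ x → ι (N₁.trace (a L₁.* x) ≟ t - N₂.trace (b L₂.* y))))
      swapped t = trans (∑-swap L₁.elements L₂.elements (λ x y → ι (⟨ (a , b) , (x , y) ⟩ ≟ t))) (∑-cong L₂.elements (λ y → ∑-cong L₁.elements (λ x →
        trans (ι-≡ˡ t (+-comm (N₁.trace (a L₁.* x)) (N₂.trace (b L₂.* y)))) (isolate (N₂.trace (b L₂.* y)) (N₁.trace (a L₁.* x)) t))))

  uniformˡ : ∀ {z} → z ≢ 𝟎 → Uniform (λ t → ∑ gs (λ a → ι (⟨ a , z ⟩ ≟ t)))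
  uniformˡ {z} ≢𝟎 t t′ = trans (∑-cong gs (λ a → ι-≡ˡ t (pairing-comm a z))) (trans (uniformʳ ≢𝟎 t t′) (∑-cong gs (λ a → ι-≡ˡ t′ (pairing-comm z a))))

  difference-count : ∀ z → ∑ gs (λ w → f (w ⊕ z) *ᶻ f w) -ᶻ σ *ᶻ f z +ᶻ τ *ᶻ ι (Finite._≟_ G-finite z 𝟎) -ᶻ μ ≡ 0ℤ
  difference-count = difference-identity G-finite _⊕_ _⊖_ 𝟎
    (λ (x , y) (x′ , y′) → cong₂ _,_ (L₁.x+[y-x]≡y x x′) (L₂.x+[y-x]≡y y y′))
    (λ (x , y) (x′ , y′) → cong₂ _,_ (L₁.[x+y]-x≡y x x′) (L₂.[x+y]-x≡y y y′))
    (λ (x , y) → cong₂ _,_ (L₁.+-identityʳ x) (L₂.+-identityʳ y))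
    ⟨_,_⟩
    (λ (a , b) (x , y) (x′ , y′) → trans (cong₂ _+_ (trans (cong N₁.trace (L₁.distribˡ a x x′)) (N₁.trace-+ _ _)) (trans (cong N₂.trace (L₂.distribˡ b y y′)) (N₂.trace-+ _ _)))
      (S.solve 4 (λ a b c d → a S.:+ b S.:+ (c S.:+ d) S.:= a S.:+ c S.:+ (b S.:+ d)) refl _ _ _ _))
    (λ (a , b) → trans (cong₂ _+_ (trace₁-*0 a) (trace₂-*0 b)) (+-identityˡ 0#))
    (λ (x , y) → trans (cong₂ _+_ (trace₁-0* x) (trace₂-0* y)) (+-identityˡ 0#))
    uniformˡ uniformʳ f μ good total

  neg : G → G
  neg (x , y) = L₁.- x , L₂.- y

  -- The norm of -1 is `s₁` from `L₁` and `- s₁` from `L₂`, because the degrees differ by one. So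
  -- negation changes the sign of the norm ratio, and `U` is closed under negation.
  InD-neg : ∀ z → InD z → InD (neg z)
  InD-neg (x , y) (y≢0 , x≡0⊎¬U) = (λ eq → y≢0 (trans (sym (L₂.x-neg-neg y)) (trans (cong (λ z → L₂.- z) eq) L₂.neg-0))) , [ (λ { refl → inj₁ L₁.neg-0 }) , by-zero (x L₁.≟ L₁.0#) ]′ x≡0⊎¬U
    where
    by-zero : Dec (x ≡ L₁.0#) → ¬ U (N₂.norm y * N₁.norm x ⁻¹) → L₁.- x ≡ L₁.0# ⊎ ¬ U (N₂.norm (L₂.- y) * N₁.norm (L₁.- x) ⁻¹)
    by-zero (yes refl) _  = inj₁ L₁.neg-0
    by-zero (no x≢0)   ¬U = inj₂ (λ Ur → ¬U (subst U (trans (cong (λ z → - z) ratio) (S.solve 1 (λ r → S.:- (S.:- r) S.:= r) refl r)) (U-neg Ur)))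
      where
      r : Carrier
      r = N₂.norm y * N₁.norm x ⁻¹
      norm₁-neg : N₁.norm (L₁.- x) ≡ s₁ * N₁.norm x
      norm₁-neg = trans (cong N₁.norm (L₁.Solver.solve 1 (λ x → L₁.Solver.:- x L₁.Solver.:= (L₁.Solver.:- L₁.Solver.con 1ℤ) L₁.Solver.:* x) refl x)) (trans (N₁.norm-* (L₁.- L₁.1#) x) (cong (_* N₁.norm x) N₁.norm-neg-1))
      norm₂-neg : N₂.norm (L₂.- y) ≡ - s₁ * N₂.norm y
      norm₂-neg = trans (cong N₂.norm (L₂.Solver.solve 1 (λ x → L₂.Solver.:- x L₂.Solver.:= (L₂.Solver.:- L₂.Solver.con 1ℤ) L₂.Solver.:* x) refl y)) (trans (N₂.norm-* (L₂.- L₂.1#) y) (cong (_* N₂.norm y) N₂.norm-neg-1))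
      n≢0 : N₁.norm (L₁.- x) ≢ 0#
      n≢0 eq = *-≢0 sign-≢0 (N₁.norm-≢0 x≢0) (trans (sym norm₁-neg) eq)
      ratio : N₂.norm (L₂.- y) * N₁.norm (L₁.- x) ⁻¹ ≡ - r
      ratio = *-injectiveˡ n≢0 (trans (S.solve 3 (λ n m i → n S.:* (m S.:* i) S.:= m S.:* (n S.:* i)) refl (N₁.norm (L₁.- x)) (N₂.norm (L₂.- y)) (N₁.norm (L₁.- x) ⁻¹))
        (trans (cong (N₂.norm (L₂.- y) *_) (*-inverseʳ n≢0)) (trans (*-identityʳ _) (trans norm₂-neg (sym (trans (cong (_* - r) norm₁-neg)
          (trans (S.solve 4 (λ s n m i → s S.:* n S.:* (S.:- (m S.:* i)) S.:= S.:- s S.:* m S.:* (n S.:* i)) refl s₁ (N₁.norm x) (N₂.norm y) (N₁.norm x ⁻¹))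
            (trans (cong (- s₁ * N₂.norm y *_) (*-inverseʳ (N₁.norm-≢0 x≢0))) (*-identityʳ _)))))))))

  neg-neg : ∀ z → neg (neg z) ≡ z
  neg-neg (x , y) = cong₂ _,_ (L₁.x-neg-neg x) (L₂.x-neg-neg y)

  f-neg : ∀ z → f (neg z) ≡ f z
  f-neg z = ι-cong (InD? (neg z)) (InD? z) (λ d → subst InD (neg-neg z) (InD-neg (neg z) d)) (InD-neg z)

  𝟎∉D : ¬ InD 𝟎
  𝟎∉D (≢0 , _) = ≢0 refl

  axis∈D : ∀ {y} → y ≢ L₂.0# → InD (L₁.0# , y)
  axis∈D y≢0 = y≢0 , inj₁ refl

open import Data.Bool.Base using (Bool; true; false)
open import Data.Integer.Base using (ℤ; 0ℤ; 1ℤ) renaming (_+_ to _+ᶻ_; _*_ to _*ᶻ_)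
open import Relation.Binary.PropositionalEquality using (_≡_; _≢_)
open IntegerSums using (∑)
open import Defs using (module Zmod)

-- From the difference equation to partial difference sets and Cayley graphs

module Transport (p : ℕ) .{{_ : NonZero p}} (p-prime : Prime p) (N : ℕ) where

  open import Algebra.Bundles using (AbelianGroup; Group)
  open import Data.Nat.Base as ℕ using (zero; suc)
  import Data.Nat.Properties as ℕ
  import Data.Integer.Base as ℤ
  import Data.Integer.Properties as ℤ
  open import Data.Bool.Base using (_∧_; not)
  open import Data.List.Base using (List; []; _∷_; length; filterᵇ; concatMap; map; allFin; cartesianProduct)
  open import Data.List.Properties using (length-tabulate)
  open import Data.Vec.Base as Vec using (Vec; []; _∷_)
  open import Data.Vec.Properties using (zipWith-assoc; zipWith-comm; zipWith-identityˡ; zipWith-identityʳ; zipWith-inverseˡ; zipWith-inverseʳ)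
  open import Data.Product using (_,_; proj₁; proj₂)
  open import Relation.Nullary using (Dec; yes; no; contradiction)
  open import Relation.Nullary.Decidable using (⌊_⌋)
  open import Relation.Binary.PropositionalEquality
  open import Function.Base using (_∘_)
  open FiniteSums using (Finite; vecFinite; vectors; length-vectors)
  open IntegerSums
  open PrimeField p p-prime
  open import Defs
  open Zmod p
  import Algebra.Properties.Group

  finiteG : Finite (G N)
  finiteG = vecFinite finiteₚ N

  elems≡vectors : ∀ n → elems n ≡ vectors (allFin p) n
  elems≡vectors zero    = refl
  elems≡vectors (suc n) = cong (λ vs → concatMap (λ a → map (a Vec.∷_) vs) (allFin p)) (elems≡vectors n)

  group : AbelianGroup _ _
  group = record
    { Carrier = G N ; _≈_ = _≡_ ; _∙_ = _⊕_ ; ε = 𝟘 ; _⁻¹ = ⊖_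
    ; isAbelianGroup = record
      { isGroup = record
        { isMonoid = record
          { isSemigroup = record { isMagma = record { isEquivalence = isEquivalence ; ∙-cong = cong₂ _⊕_ } ; assoc = zipWith-assoc +ₚ-assoc }
          ; identity = zipWith-identityˡ +ₚ-identityˡ , zipWith-identityʳ (λ a → trans (+ₚ-comm a 0ₚ) (+ₚ-identityˡ a)) }
        ; inverse = zipWith-inverseˡ (λ a → trans (+ₚ-comm (-ₚ a) a) (-ₚ-inverseʳ a)) , zipWith-inverseʳ -ₚ-inverseʳ
        ; ⁻¹-cong = cong ⊖_ }
      ; comm = zipWith-comm +ₚ-comm } }

  open AbelianGroup group using (assoc; comm; identityʳ; inverseʳ)
  open Algebra.Properties.Group (AbelianGroup.group group) using (//-rightDividesˡ; //-rightDividesʳ; ⁻¹-anti-homo-//; x∙y⁻¹≈ε⇒x≈y)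

  sum-minus : ∀ h x → (h ⊕ x) ⊝ h ≡ x
  sum-minus h x = trans (cong (_⊝ h) (comm h x)) (//-rightDividesʳ h x)

  plus-difference : ∀ h g → h ⊕ (g ⊝ h) ≡ g
  plus-difference h g = trans (comm h (g ⊝ h)) (//-rightDividesˡ h g)

  minus-difference : ∀ x y h → x ⊝ (y ⊝ h) ≡ h ⊕ (x ⊝ y)
  minus-difference x y h = trans (cong (x ⊕_) (⁻¹-anti-homo-// y h)) (trans (sym (assoc x h (⊖ y))) (trans (cong (_⊝ y) (comm x h)) (assoc h x (⊖ y))))

  double-difference : ∀ x z → x ⊝ (x ⊝ z) ≡ z
  double-difference x z = trans (minus-difference x x z) (trans (cong (z ⊕_) (inverseʳ x)) (identityʳ z))

  𝟙 : Bool → ℤ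
  𝟙 true  = 1ℤ
  𝟙 false = 0ℤ

  𝟙-∧ : ∀ a b → 𝟙 (a ∧ b) ≡ 𝟙 a *ᶻ 𝟙 b
  𝟙-∧ true  true  = refl
  𝟙-∧ true  false = refl
  𝟙-∧ false b     = refl

  𝟙-⌊⌋ : {P : Set} (d : Dec P) → 𝟙 ⌊ d ⌋ ≡ ι d
  𝟙-⌊⌋ (yes _) = refl
  𝟙-⌊⌋ (no _)  = refl

  countB-∑ : {A : Set} (P : A → Bool) (xs : List A) → ℤ.+ countB P xs ≡ ∑ xs (𝟙 ∘ P)
  countB-∑ P []       = refl
  countB-∑ P (x ∷ xs) with P x
  ... | true  = cong (1ℤ +ᶻ_) (countB-∑ P xs)
  ... | false = trans (countB-∑ P xs) (sym (ℤ.+-identityˡ _))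

  length-filterᵇ : {A : Set} (P : A → Bool) (xs : List A) → length (filterᵇ P xs) ≡ countB P xs
  length-filterᵇ P []       = refl
  length-filterᵇ P (x ∷ xs) with P x
  ... | true  = cong suc (length-filterᵇ P xs)
  ... | false = length-filterᵇ P xs

  ==⇒≢ : ∀ {x y : G N} → (x == y) ≡ false → x ≢ y
  ==⇒≢ {x} {y} e x≡y = contradiction (trans (sym (ι-yes (Finite._≟_ finiteG x y) x≡y)) (trans (sym (𝟙-⌊⌋ (Finite._≟_ finiteG x y))) (cong 𝟙 e))) λ ()

  ≢⇒== : ∀ {x y : G N} → x ≢ y → (x == y) ≡ false
  ≢⇒== {x} {y} x≢y with Finite._≟_ finiteG x y
  ... | yes x≡y = contradiction x≡y x≢y
  ... | no _    = refl

  module FromIdentity (D : G N → Bool) (D-neg : ∀ x → D (⊖ x) ≡ D x) (D-0 : D 𝟘 ≡ false) (σ μ : ℤ)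
    (identity : ∀ x → x ≢ 𝟘 → ∑ (elems N) (λ h → 𝟙 (D (h ⊕ x)) *ᶻ 𝟙 (D h)) ≡ σ *ᶻ 𝟙 (D x) +ᶻ μ)
    (w₁ w₀ : G N) (w₁≢𝟘 : w₁ ≢ 𝟘) (w₀≢𝟘 : w₀ ≢ 𝟘) (w₁∈D : D w₁ ≡ true) (w₀∉D : D w₀ ≡ false) where

    private
      es : List (G N)
      es = elems N

      reindexᵍ : (φ ψ : G N → G N) → (∀ x → φ (ψ x) ≡ x) → (∀ x → ψ (φ x) ≡ x) → (f : G N → ℤ) → ∑ es f ≡ ∑ es (f ∘ φ)
      reindexᵍ φ ψ φψ ψφ f = subst (λ xs → ∑ xs f ≡ ∑ xs (f ∘ φ)) (sym (elems≡vectors N)) (reindex finiteG finiteG φ ψ φψ ψφ f)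

      pick : ∀ a (f : G N → ℤ) → ∑ es (λ x → ι (Finite._≟_ finiteG x a) *ᶻ f x) ≡ f a
      pick a f = subst (λ xs → ∑ xs (λ x → ι (Finite._≟_ finiteG x a) *ᶻ f x) ≡ f a) (sym (elems≡vectors N)) (∑-ι finiteG a f)

      isDifference : G N → G N → G N → Bool
      isDifference x g h = D g ∧ D h ∧ not (g == h) ∧ ((g ⊝ h) == x)

    -- A pair with difference `x` is determined by `h`, with `g = h ⊕ x`, and `x ≠ 𝟘` makes `g` and
    -- `h` distinct.
    differences : ∀ x → x ≢ 𝟘 → ℤ.+ countPairs N (isDifference x) ≡ σ *ᶻ 𝟙 (D x) +ᶻ μ
    differences x x≢𝟘 = begin
      ℤ.+ countPairs N (isDifference x)
        ≡⟨ countB-∑ (λ gh → isDifference x (proj₁ gh) (proj₂ gh)) (cartesianProduct es es) ⟩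
      ∑ (cartesianProduct es es) (λ gh → 𝟙 (isDifference x (proj₁ gh) (proj₂ gh)))
        ≡⟨ ∑-cartesianProduct es es (λ gh → 𝟙 (isDifference x (proj₁ gh) (proj₂ gh))) ⟩
      ∑ es (λ g → ∑ es (λ h → 𝟙 (isDifference x g h)))
        ≡⟨ ∑-swap es es (λ g h → 𝟙 (isDifference x g h)) ⟩
      ∑ es (λ h → ∑ es (λ g → 𝟙 (isDifference x g h)))
        ≡⟨ ∑-cong es (λ h → trans (∑-cong es (λ g → simplify g h)) (pick (h ⊕ x) (λ g → 𝟙 (D g) *ᶻ 𝟙 (D h)))) ⟩
      ∑ es (λ h → 𝟙 (D (h ⊕ x)) *ᶻ 𝟙 (D h))
        ≡⟨ identity x x≢𝟘 ⟩
      σ *ᶻ 𝟙 (D x) +ᶻ μ ∎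
      where
      open ≡-Reasoning
      simplify : ∀ g h → 𝟙 (isDifference x g h) ≡ ι (Finite._≟_ finiteG g (h ⊕ x)) *ᶻ (𝟙 (D g) *ᶻ 𝟙 (D h))
      simplify g h = by-cases (Finite._≟_ finiteG g (h ⊕ x))
        where
        by-cases : (d : Dec (g ≡ h ⊕ x)) → 𝟙 (isDifference x g h) ≡ ι d *ᶻ (𝟙 (D g) *ᶻ 𝟙 (D h))
        by-cases (yes refl) = trans (cong (λ b → 𝟙 (D (h ⊕ x) ∧ D h ∧ b)) (cong₂ (λ a b → not a ∧ b) (≢⇒== h+x≢h) hits))
          (trans (𝟙-∧ (D (h ⊕ x)) (D h ∧ true)) (trans (cong (𝟙 (D (h ⊕ x)) *ᶻ_) (trans (𝟙-∧ (D h) true) (ℤ.*-identityʳ (𝟙 (D h))))) (sym (ℤ.*-identityˡ (𝟙 (D (h ⊕ x)) *ᶻ 𝟙 (D h))))))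
          where
          h+x≢h : h ⊕ x ≢ h
          h+x≢h e = x≢𝟘 (trans (sym (sum-minus h x)) (trans (cong (_⊝ h) e) (inverseʳ h)))
          hits : (((h ⊕ x) ⊝ h) == x) ≡ true
          hits with Finite._≟_ finiteG ((h ⊕ x) ⊝ h) x
          ... | yes _  = refl
          ... | no ≢x  = contradiction (sum-minus h x) ≢x
        by-cases (no g≢) = trans (cong (λ b → 𝟙 (D g ∧ D h ∧ not (g == h) ∧ b)) (≢⇒== (λ e → g≢ (trans (sym (plus-difference h g)) (cong (h ⊕_) e)))))
          (trans (𝟙-∧ (D g) _) (trans (cong (𝟙 (D g) *ᶻ_) (trans (𝟙-∧ (D h) _) (trans (cong (𝟙 (D h) *ᶻ_) (trans (𝟙-∧ (not (g == h)) false) (ℤ.*-zeroʳ (𝟙 (not (g == h)))))) (ℤ.*-zeroʳ (𝟙 (D h)))))) (ℤ.*-zeroʳ (𝟙 (D g)))))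

    -- Two of these natural numbers are counts at the sample points `w₁` in D and `w₀` outside D. By
    -- `differences` a count depends only on membership in D, so the samples represent all other
    -- points.
    k lam mu : ℕ
    k   = countB D es
    lam = countPairs N (isDifference w₁)
    mu  = countPairs N (isDifference w₀)

    k-sum : ℤ.+ k ≡ ∑ es (𝟙 ∘ D)
    k-sum = countB-∑ D es

    inside : ∀ {x} → D x ≡ true → σ *ᶻ 𝟙 (D x) +ᶻ μ ≡ σ +ᶻ μ
    inside e = cong (_+ᶻ μ) (trans (cong (λ b → σ *ᶻ 𝟙 b) e) (ℤ.*-identityʳ σ))

    outside : ∀ {x} → D x ≡ false → σ *ᶻ 𝟙 (D x) +ᶻ μ ≡ μ
    outside e = trans (cong (_+ᶻ μ) (trans (cong (λ b → σ *ᶻ 𝟙 b) e) (ℤ.*-zeroʳ σ))) (ℤ.+-identityˡ μ)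

    lam-≡ : ℤ.+ lam ≡ σ +ᶻ μ
    lam-≡ = trans (differences w₁ w₁≢𝟘) (inside w₁∈D)

    mu-≡ : ℤ.+ mu ≡ μ
    mu-≡ = trans (differences w₀ w₀≢𝟘) (outside w₀∉D)

    order : length es ≡ p ℕ.^ N
    order = trans (cong length (elems≡vectors N)) (trans (length-vectors (allFin p) N) (cong (ℕ._^ N) (length-tabulate (λ i → i))))

    isPDS : IsPDS N D (p ℕ.^ N) k lam mu
    isPDS = record
      { order     = order
      ; size      = refl
      ; zero∉D    = D-0
      ; diffs-in  = λ x x≢𝟘 x∈D → ℤ.+-injective (trans (differences x (==⇒≢ x≢𝟘)) (trans (inside x∈D) (sym lam-≡)))
      ; diffs-out = λ x x≢𝟘 x∉D → ℤ.+-injective (trans (differences x (==⇒≢ x≢𝟘)) (trans (outside x∉D) (sym mu-≡)))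
      }

    private
      adjacency : G N → G N → Bool
      adjacency = CayAdj N D

      -- The substitution `z = y ⊝ h` turns the common neighbours of `x` and `y` into the `h` in D
      -- with `h ⊕ (x ⊝ y)` in D, that is, into representations of `x ⊝ y` as a difference.
      common : ∀ x y → x ≢ y → ℤ.+ length (filterᵇ (λ z → adjacency x z ∧ adjacency y z) es) ≡ σ *ᶻ 𝟙 (D (x ⊝ y)) +ᶻ μ
      common x y x≢y = begin
        ℤ.+ length (filterᵇ (λ z → adjacency x z ∧ adjacency y z) es)
          ≡⟨ trans (cong ℤ.+_ (length-filterᵇ (λ z → adjacency x z ∧ adjacency y z) es)) (countB-∑ (λ z → adjacency x z ∧ adjacency y z) es) ⟩
        ∑ es (λ z → 𝟙 (D (x ⊝ z) ∧ D (y ⊝ z)))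
          ≡⟨ reindexᵍ (y ⊝_) (y ⊝_) (double-difference y) (double-difference y) (λ z → 𝟙 (D (x ⊝ z) ∧ D (y ⊝ z))) ⟩
        ∑ es (λ h → 𝟙 (D (x ⊝ (y ⊝ h)) ∧ D (y ⊝ (y ⊝ h))))
          ≡⟨ ∑-cong es (λ h → trans (cong₂ (λ a b → 𝟙 (D a ∧ D b)) (minus-difference x y h) (double-difference y h)) (𝟙-∧ (D (h ⊕ (x ⊝ y))) (D h))) ⟩
        ∑ es (λ h → 𝟙 (D (h ⊕ (x ⊝ y))) *ᶻ 𝟙 (D h))
          ≡⟨ identity (x ⊝ y) (λ e → x≢y (x∙y⁻¹≈ε⇒x≈y x y e)) ⟩
        σ *ᶻ 𝟙 (D (x ⊝ y)) +ᶻ μ ∎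
        where open ≡-Reasoning

    isSRG : IsSRG es _==_ adjacency (p ℕ.^ N) k lam mu
    isSRG = record
      { irreflexive = λ x → trans (cong D (inverseʳ x)) D-0
      ; symmetric   = λ x y → trans (sym (D-neg (x ⊝ y))) (cong D (⁻¹-anti-homo-// x y))
      ; order       = order
      ; regular     = λ x → ℤ.+-injective (trans (cong ℤ.+_ (length-filterᵇ (adjacency x) es)) (trans (countB-∑ (adjacency x) es)
          (trans (sym (reindexᵍ (x ⊝_) (x ⊝_) (double-difference x) (double-difference x) (𝟙 ∘ D))) (sym k-sum))))
      ; adjacent    = λ x y x≢y xy∈D → ℤ.+-injective (trans (common x y (==⇒≢ x≢y)) (trans (inside xy∈D) (sym lam-≡)))
      ; nonadjacent = λ x y x≢y xy∉D → ℤ.+-injective (trans (common x y (==⇒≢ x≢y)) (trans (outside xy∉D) (sym mu-≡)))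
      }

open import Data.Nat.Base using (ℕ; suc; NonZero) renaming (_+_ to _+ℕ_; _*_ to _*ℕ_)

-- Identification of `L₁ × L₂` with vectors over the prime field, and the subgroup `U`

module Coordinates (p : ℕ) .{{_ : NonZero p}} (p-prime : Prime p) (M′ l′ R N : ℕ)
  (N-≡ : suc l′ *ℕ suc M′ +ℕ suc (suc l′) *ℕ suc M′ ≡ N) where

  open import Data.Nat.Base as ℕ using (zero; _∸_)
  import Data.Nat.Properties as ℕ
  open import Data.Integer.Base as ℤ using (ℤ; 0ℤ; 1ℤ) renaming (_+_ to _+ᶻ_; _*_ to _*ᶻ_; _-_ to _-ᶻ_)
  import Data.Integer.Properties as ℤ
  open import Data.Integer.Tactic.RingSolver using (solve-∀)
  open import Data.Bool.Base using (Bool; true; false)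
  open import Data.List.Base using (allFin)
  open import Data.List.Properties using (length-tabulate)
  open import Data.Vec.Base as Vec using (Vec; []; _∷_; _++_; zipWith)
  open import Data.Product using (_,_; proj₁; proj₂; _×_)
  open import Data.Unit.Base using (⊤; tt)
  open import Relation.Nullary using (Dec; yes; no; ¬_; contradiction)
  open import Relation.Nullary.Decidable using (⌊_⌋; _×-dec_)
  open import Relation.Binary.PropositionalEquality
  open import Function.Base using (_∘_)
  open FiniteSums using (Finite; vecFinite; vectors; length-vectors)
  open IntegerSums
  open FiniteField using (Field)
  open Extensions using (Extension; extensionOfDegree)
  open PrimeField p p-prime
  open import Defs
  open Zmod p renaming (_⊕_ to _⊞_)
  open NormTraces using (NormTrace; normTraceOfDegree)

  record AdditiveBijection (n : ℕ) (X : Set) (_+_ : X → X → X) : Set where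
    field
      to      : G n → X
      from    : X → G n
      to-from : ∀ x → to (from x) ≡ x
      from-to : ∀ v → from (to v) ≡ v
      to-+    : ∀ u v → to (u ⊞ v) ≡ to u + to v

  open AdditiveBijection

  halves : {A : Set} → ∀ a {b} → Vec A (a +ℕ b) → Vec A a × Vec A b
  halves zero    v       = [] , v
  halves (suc a) (x ∷ v) = x ∷ proj₁ (halves a v) , proj₂ (halves a v)

  halves-++ : {A : Set} → ∀ {a b} (u : Vec A a) (v : Vec A b) → halves a (u ++ v) ≡ (u , v)
  halves-++ []      v = refl
  halves-++ (x ∷ u) v = cong (λ (l , r) → x ∷ l , r) (halves-++ u v)

  ++-halves : {A : Set} → ∀ a {b} (v : Vec A (a +ℕ b)) → proj₁ (halves a v) ++ proj₂ (halves a v) ≡ v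
  ++-halves zero    v       = refl
  ++-halves (suc a) (x ∷ v) = cong (x ∷_) (++-halves a v)

  halves-⊞ : ∀ a {b} (u v : G (a +ℕ b)) → halves a (u ⊞ v) ≡ (proj₁ (halves a u) ⊞ proj₁ (halves a v) , proj₂ (halves a u) ⊞ proj₂ (halves a v))
  halves-⊞ zero    u       v       = refl
  halves-⊞ (suc a) (x ∷ u) (y ∷ v) = cong (λ (l , r) → x +ₚ y ∷ l , r) (halves-⊞ a u v)

  pairBijection : ∀ {a b X Y} {_+_ : X → X → X} {_∙_ : Y → Y → Y} → AdditiveBijection a X _+_ → AdditiveBijection b Y _∙_ →
                  AdditiveBijection (a +ℕ b) (X × Y) (λ (x , y) (x′ , y′) → x + x′ , y ∙ y′)
  pairBijection {a} f g = record
    { to      = λ v → to f (proj₁ (halves a v)) , to g (proj₂ (halves a v))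
    ; from    = λ (x , y) → from f x ++ from g y
    ; to-from = λ (x , y) → trans (cong (λ (l , r) → to f l , to g r) (halves-++ (from f x) (from g y))) (cong₂ _,_ (to-from f x) (to-from g y))
    ; from-to = λ v → trans (cong₂ _++_ (from-to f _) (from-to g _)) (++-halves a v)
    ; to-+    = λ u v → trans (cong (λ (l , r) → to f l , to g r) (halves-⊞ a u v)) (cong₂ _,_ (to-+ f _ _) (to-+ g _ _))
    }

  transfer : ∀ {n X Y} {_+_ : X → X → X} {_∙_ : Y → Y → Y} → AdditiveBijection n X _+_ → (φ : X → Y) (ψ : Y → X) →
             (∀ y → φ (ψ y) ≡ y) → (∀ x → ψ (φ x) ≡ x) → (∀ x y → φ (x + y) ≡ φ x ∙ φ y) → AdditiveBijection n Y _∙_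
  transfer f φ ψ φψ ψφ φ-+ = record
    { to      = φ ∘ to f
    ; from    = from f ∘ ψ
    ; to-from = λ y → trans (cong φ (to-from f (ψ y))) (φψ y)
    ; from-to = λ v → trans (cong (from f) (ψφ (to f v))) (from-to f v)
    ; to-+    = λ u v → trans (cong φ (to-+ f u v)) (φ-+ (to f u) (to f v))
    }

  vecBijection : ∀ {m X} {_+_ : X → X → X} → AdditiveBijection m X _+_ → ∀ l → AdditiveBijection (l *ℕ m) (Vec X l) (zipWith _+_)
  vecBijection f zero    = record { to = λ _ → [] ; from = λ _ → [] ; to-from = λ { [] → refl } ; from-to = λ { [] → refl } ; to-+ = λ _ _ → refl }
  vecBijection f (suc l) = transfer (pairBijection f (vecBijection f l)) (λ (x , xs) → x ∷ xs) (λ { (x ∷ xs) → x , xs })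
    (λ { (x ∷ xs) → refl }) (λ _ → refl) (λ _ _ → refl)

  Eₖ : Extension primeField (suc M′)
  Eₖ = extensionOfDegree primeField M′

  K : Field p
  K = Extension.extension Eₖ

  T₁ : NormTrace K (suc l′)
  T₁ = normTraceOfDegree p-prime K l′

  T₂ : NormTrace K (suc (suc l′))
  T₂ = normTraceOfDegree p-prime K (suc l′)

  private
    module K where
      open Field K public
      open Extension Eₖ public using (vector; coords; vector-+; vector-coords; coords-vector)
    module L₁ = Field (NormTrace.L T₁)
    module L₂ = Field (NormTrace.L T₂)

  bijection : AdditiveBijection N (L₁.Carrier × L₂.Carrier) (λ (x , y) (x′ , y′) → x L₁.+ x′ , y L₂.+ y′)
  bijection = subst (λ n → AdditiveBijection n (L₁.Carrier × L₂.Carrier) (λ (x , y) (x′ , y′) → x L₁.+ x′ , y L₂.+ y′)) N-≡ (pairBijection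
    (transfer (vecBijection baseBijection (suc l′)) X₁.vector X₁.coords X₁.vector-coords X₁.coords-vector X₁.vector-+)
    (transfer (vecBijection baseBijection (suc (suc l′))) X₂.vector X₂.coords X₂.vector-coords X₂.coords-vector X₂.vector-+))
    where
    module X₁ = NormTrace T₁
    module X₂ = NormTrace T₂
    baseBijection : AdditiveBijection (suc M′) K.Carrier K._+_
    baseBijection = record { to = K.vector ; from = K.coords ; to-from = K.vector-coords ; from-to = K.coords-vector ; to-+ = K.vector-+ }

  idempotent⇒0 : (F : Field p) → ∀ {x} → Field._+_ F x x ≡ x → x ≡ Field.0# F
  idempotent⇒0 F {x} e = trans (S.solve 1 (λ x → x S.:= x S.:+ x S.:- x) refl x) (trans (cong (λ z → z F.- x) e) (F.x-x≡0 x))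
    where
    module F = Field F
    module S = F.Solver

  -- Cuts out a subgroup by the vanishing of the first `r` coordinates. If `r` exceeds the length,
  -- all coordinates vanish, in accordance with the truncated subtraction in `firstZero-count`.
  FirstZero : ∀ {n} → ℕ → G n → Set
  FirstZero zero    v       = ⊤
  FirstZero (suc r) []      = ⊤
  FirstZero (suc r) (x ∷ v) = x ≡ 0ₚ × FirstZero r v

  firstZero? : ∀ {n} r (v : G n) → Dec (FirstZero r v)
  firstZero? zero    v       = yes tt
  firstZero? (suc r) []      = yes tt
  firstZero? (suc r) (x ∷ v) = Finite._≟_ finiteₚ x 0ₚ ×-dec firstZero? r v

  firstZero-+ : ∀ {n} r {u v : G n} → FirstZero r u → FirstZero r v → FirstZero r (u ⊞ v)
  firstZero-+ zero    _ _ = tt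
  firstZero-+ (suc r) {[]}    {[]}    _ _ = tt
  firstZero-+ (suc r) {x ∷ u} {y ∷ v} (refl , zu) (refl , zv) = +ₚ-identityˡ 0ₚ , firstZero-+ r zu zv

  firstZero-cancel : ∀ {n} r {u v : G n} → FirstZero r u → FirstZero r (u ⊞ v) → FirstZero r v
  firstZero-cancel zero    _ _ = tt
  firstZero-cancel (suc r) {[]}    {[]}    _ _ = tt
  firstZero-cancel (suc r) {x ∷ u} {y ∷ v} (refl , zu) (x+y≡0 , zuv) = trans (sym (+ₚ-identityˡ y)) x+y≡0 , firstZero-cancel r zu zuv

  -- The zero vector is recognised by `u ⊞ u ≡ u`, because the additivity of `coords` gives just
  -- this equation for the coordinates of `0#`.
  firstZero-idempotent : ∀ {n} r {u : G n} → u ⊞ u ≡ u → FirstZero r u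
  firstZero-idempotent zero    _ = tt
  firstZero-idempotent (suc r) {[]}    _ = tt
  firstZero-idempotent (suc r) {x ∷ u} e = idempotent⇒0 primeField (cong Vec.head e) , firstZero-idempotent r (cong Vec.tail e)

  firstZero-count : ∀ n r → ∑ (vectors (allFin p) n) (λ v → ι (firstZero? r v)) ≡ ℤ.+ (p ℕ.^ (n ∸ r))
  firstZero-count n       zero    = trans (∑-1 (vectors (allFin p) n)) (cong ℤ.+_ (trans (length-vectors (allFin p) n) (cong (ℕ._^ n) (length-tabulate (λ i → i)))))
  firstZero-count zero    (suc r) = refl
  firstZero-count (suc n) (suc r) = begin
    ∑ (vectors (allFin p) (suc n)) (λ v → ι (firstZero? (suc r) v))
      ≡⟨ ∑-vectors n (allFin p) (λ v → ι (firstZero? (suc r) v)) ⟩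
    ∑ (allFin p) (λ x → ∑ (vectors (allFin p) n) (λ v → ι (Finite._≟_ finiteₚ x 0ₚ ×-dec firstZero? r v)))
      ≡⟨ ∑-cong (allFin p) (λ x → trans (∑-cong (vectors (allFin p) n) (λ v → ι-× (Finite._≟_ finiteₚ x 0ₚ) (firstZero? r v)))
           (sym (*-∑ (ι (Finite._≟_ finiteₚ x 0ₚ)) (vectors (allFin p) n) (λ v → ι (firstZero? r v))))) ⟩
    ∑ (allFin p) (λ x → ι (Finite._≟_ finiteₚ x 0ₚ) *ᶻ ∑ (vectors (allFin p) n) (λ v → ι (firstZero? r v)))
      ≡⟨ ∑-ι finiteₚ 0ₚ (λ _ → ∑ (vectors (allFin p) n) (λ v → ι (firstZero? r v))) ⟩
    ∑ (vectors (allFin p) n) (λ v → ι (firstZero? r v))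
      ≡⟨ firstZero-count n r ⟩
    ℤ.+ (p ℕ.^ (n ∸ r)) ∎
    where open ≡-Reasoning

  U : K.Carrier → Set
  U c = FirstZero R (K.coords c)

  U? : ∀ c → Dec (U c)
  U? c = firstZero? R (K.coords c)

  coords-+ : ∀ a b → K.coords (a K.+ b) ≡ K.coords a ⊞ K.coords b
  coords-+ a b = trans (cong K.coords (trans (cong₂ K._+_ (sym (K.vector-coords a)) (sym (K.vector-coords b))) (sym (K.vector-+ (K.coords a) (K.coords b))))) (K.coords-vector _)

  U-0 : U K.0#
  U-0 = firstZero-idempotent R (trans (sym (coords-+ K.0# K.0#)) (cong K.coords (K.+-identityˡ K.0#)))

  U-+ : ∀ {a b} → U a → U b → U (a K.+ b)
  U-+ {a} {b} Ua Ub = subst (FirstZero R) (sym (coords-+ a b)) (firstZero-+ R Ua Ub)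

  U-neg : ∀ {a} → U a → U (K.- a)
  U-neg {a} Ua = firstZero-cancel R Ua (subst (FirstZero R) (trans (cong K.coords (sym (K.-‿inverseʳ a))) (coords-+ a (K.- a))) U-0)

  module DS = DifferenceSet K l′ T₁ T₂ U U? U-0 U-+ U-neg
  open DS using (InD; InD?; f; 𝟎; neg; gs; G-finite; σ; τ; μ)

  card-K : K.card ≡ p ℕ.^ suc M′
  card-K = trans (Extension.card-L Eₖ) (cong (ℕ._^ suc M′) (trans (Field.card-≡ primeField) (ℕ.*-identityʳ p)))

  q-≡ : DS.q ≡ ℤ.+ (p ℕ.^ suc M′)
  q-≡ = cong ℤ.+_ card-K

  e-≡ : DS.e ≡ ℤ.+ (p ℕ.^ (suc M′ ∸ R))
  e-≡ = trans (reindex K.finite (vecFinite finiteₚ (suc M′)) K.vector K.coords K.vector-coords K.coords-vector (λ c → ι (U? c)))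
    (trans (∑-cong (vectors (allFin p) (suc M′)) (λ v → cong (λ w → ι (firstZero? R w)) (K.coords-vector v))) (firstZero-count (suc M′) R))

  S₁-size : ℤ.+ ((p ℕ.^ suc M′) ℕ.^ suc l′) ≡ DS.S₁
  S₁-size = cong ℤ.+_ (sym (trans (NormTrace.card-L T₁) (cong (ℕ._^ suc l′) card-K)))

  S₂-size : ℤ.+ ((p ℕ.^ suc M′) ℕ.^ suc (suc l′)) ≡ DS.S₂
  S₂-size = cong ℤ.+_ (sym (trans (NormTrace.card-L T₂) (cong (ℕ._^ suc (suc l′)) card-K)))

  module T = Transport p p-prime N

  D : G N → Bool
  D v = ⌊ InD? (to bijection v) ⌋

  D-f : ∀ v → T.𝟙 (D v) ≡ f (to bijection v)
  D-f v = T.𝟙-⌊⌋ (InD? (to bijection v))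

  inverse-unique : (F : Field p) → ∀ {x y} → Field._+_ F x y ≡ Field.0# F → y ≡ Field.-_ F x
  inverse-unique F {x} {y} e = trans (S.solve 2 (λ x y → y S.:= (x S.:+ y) S.:- x) refl x y) (trans (cong (λ z → z F.- x) e) (F.+-identityˡ (F.- x)))
    where
    module F = Field F
    module S = F.Solver

  open import Algebra.Bundles using (AbelianGroup)
  open AbelianGroup T.group using (identityʳ; inverseʳ)

  to-𝟘 : to bijection 𝟘 ≡ 𝟎
  to-𝟘 = cong₂ _,_ (idempotent⇒0 (NormTrace.L T₁) (cong proj₁ doubled)) (idempotent⇒0 (NormTrace.L T₂) (cong proj₂ doubled))
    where
    doubled : to bijection 𝟘 DS.⊕ to bijection 𝟘 ≡ to bijection 𝟘
    doubled = trans (sym (to-+ bijection 𝟘 𝟘)) (cong (to bijection) (identityʳ 𝟘))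

  to-⊖ : ∀ v → to bijection (⊖ v) ≡ neg (to bijection v)
  to-⊖ v = cong₂ _,_ (inverse-unique (NormTrace.L T₁) (cong proj₁ cancelled)) (inverse-unique (NormTrace.L T₂) (cong proj₂ cancelled))
    where
    cancelled : to bijection v DS.⊕ to bijection (⊖ v) ≡ 𝟎
    cancelled = trans (sym (to-+ bijection v (⊖ v))) (trans (cong (to bijection) (inverseʳ v)) to-𝟘)

  ⌊⌋-yes : {P : Set} (d : Dec P) → P → ⌊ d ⌋ ≡ true
  ⌊⌋-yes (yes _) x = refl
  ⌊⌋-yes (no ¬x) x = contradiction x ¬x

  ⌊⌋-no : {P : Set} (d : Dec P) → ¬ P → ⌊ d ⌋ ≡ false
  ⌊⌋-no (yes x) ¬x = contradiction x ¬x
  ⌊⌋-no (no _)  ¬x = refl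

  𝟙-injective : ∀ {a b} → T.𝟙 a ≡ T.𝟙 b → a ≡ b
  𝟙-injective {true}  {true}  _ = refl
  𝟙-injective {false} {false} _ = refl

  D-neg : ∀ v → D (⊖ v) ≡ D v
  D-neg v = 𝟙-injective (trans (D-f (⊖ v)) (trans (cong f (to-⊖ v)) (trans (DS.f-neg (to bijection v)) (sym (D-f v)))))

  D-0 : D 𝟘 ≡ false
  D-0 = ⌊⌋-no (InD? (to bijection 𝟘)) (λ d → DS.𝟎∉D (subst InD to-𝟘 d))

  sum-over-pairs : (h : DS.G → ℤ) → ∑ (elems N) (h ∘ to bijection) ≡ ∑ gs h
  sum-over-pairs h = trans (cong (λ xs → ∑ xs (h ∘ to bijection)) (T.elems≡vectors N))
    (sym (reindex G-finite T.finiteG (to bijection) (from bijection) (to-from bijection) (from-to bijection) h))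

  identity : ∀ x → x ≢ 𝟘 → ∑ (elems N) (λ h → T.𝟙 (D (h ⊞ x)) *ᶻ T.𝟙 (D h)) ≡ σ *ᶻ T.𝟙 (D x) +ᶻ μ
  identity x x≢𝟘 = begin
    ∑ (elems N) (λ h → T.𝟙 (D (h ⊞ x)) *ᶻ T.𝟙 (D h))
      ≡⟨ ∑-cong (elems N) (λ h → cong₂ _*ᶻ_ (trans (D-f (h ⊞ x)) (cong f (to-+ bijection h x))) (D-f h)) ⟩
    ∑ (elems N) (λ h → f (to bijection h DS.⊕ to bijection x) *ᶻ f (to bijection h))
      ≡⟨ sum-over-pairs (λ z → f (z DS.⊕ to bijection x) *ᶻ f z) ⟩
    c
      ≡⟨ solve-for c (σ *ᶻ f (to bijection x)) (ι (Finite._≟_ G-finite (to bijection x) 𝟎)) τ μ (DS.difference-count (to bijection x))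
           (ι-no (Finite._≟_ G-finite (to bijection x) 𝟎) (λ e → x≢𝟘 (trans (sym (from-to bijection x)) (trans (cong (from bijection) (trans e (sym to-𝟘))) (from-to bijection 𝟘))))) ⟩
    σ *ᶻ f (to bijection x) +ᶻ μ
      ≡⟨ cong (λ z → σ *ᶻ z +ᶻ μ) (D-f x) ⟨
    σ *ᶻ T.𝟙 (D x) +ᶻ μ ∎
    where
    open ≡-Reasoning
    c : ℤ
    c = ∑ gs (λ z → f (z DS.⊕ to bijection x) *ᶻ f z)
    solve-for : ∀ c s i τ μ → c -ᶻ s +ᶻ τ *ᶻ i -ᶻ μ ≡ 0ℤ → i ≡ 0ℤ → c ≡ s +ᶻ μ
    solve-for c s .0ℤ τ μ e refl = trans (lemma c s τ μ) (trans (cong (_+ᶻ (s +ᶻ μ)) e) (ℤ.+-identityˡ (s +ᶻ μ)))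
      where
      lemma : ∀ c s τ μ → c ≡ (c -ᶻ s +ᶻ τ *ᶻ 0ℤ -ᶻ μ) +ᶻ (s +ᶻ μ)
      lemma = solve-∀

  w₁ w₀ : G N
  w₁ = from bijection (L₁.0# , L₂.1#)
  w₀ = from bijection (L₁.1# , L₂.0#)

  w₁≢𝟘 : w₁ ≢ 𝟘
  w₁≢𝟘 e = L₂.1≢0 (cong proj₂ (trans (sym (to-from bijection _)) (trans (cong (to bijection) e) to-𝟘)))

  w₀≢𝟘 : w₀ ≢ 𝟘
  w₀≢𝟘 e = L₁.1≢0 (cong proj₁ (trans (sym (to-from bijection _)) (trans (cong (to bijection) e) to-𝟘)))

  w₁∈D : D w₁ ≡ true
  w₁∈D = ⌊⌋-yes (InD? (to bijection w₁)) (subst InD (sym (to-from bijection _)) (DS.axis∈D L₂.1≢0))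

  w₀∉D : D w₀ ≡ false
  w₀∉D = ⌊⌋-no (InD? (to bijection w₀)) (λ d → proj₁ (subst InD (to-from bijection _) d) refl)

  private module PDS = T.FromIdentity D D-neg D-0 σ μ identity w₁ w₀ w₁≢𝟘 w₀≢𝟘 w₁∈D w₀∉D

  open PDS public using (k; lam; mu; isPDS; isSRG; lam-≡; mu-≡)

  k-≡ : ℤ.+ k ≡ (DS.q -ᶻ 1ℤ) *ᶻ DS.h *ᶻ DS.s
  k-≡ = trans PDS.k-sum (trans (∑-cong (elems N) D-f) (trans (sum-over-pairs f) DS.k-≡))

-- Summary of the construction with all parameters

module Graphs where

  open import Data.Nat.Base as ℕ using (ℕ; suc; NonZero; _∸_)
  open import Data.Nat.Primality using (Prime)
  open import Data.Bool.Base using (Bool)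
  open import Data.Integer.Base using (ℤ; 1ℤ; +_; _+_; _-_; _*_) renaming (-_ to neg)
  open import Relation.Binary.PropositionalEquality using (_≡_; sym; trans)
  open import Defs

  -- The parameters of the difference set in terms of Q = p ^ M and e = p ^ (M ∸ R), where
  -- g and h are the Gaussian integers (Q ^ l - 1) / (Q - 1) and (Q ^ suc l - 1) / (Q - 1).
  record DennistonGraph (p : ℕ) .{{_ : NonZero p}} (M l R N : ℕ) : Set where
    open Zmod p
    field
      q e g h  : ℤ
      k lam mu : ℕ
      D        : G N → Bool
      q-≡      : + (p ℕ.^ M) ≡ q
      e-≡      : + (p ℕ.^ (M ∸ R)) ≡ e
      g-≡      : + ((p ℕ.^ M) ℕ.^ l) ≡ (q - 1ℤ) * g + 1ℤ
      h-size   : + ((p ℕ.^ M) ℕ.^ suc l) ≡ (q - 1ℤ) * h + 1ℤ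
      h-≡      : h ≡ 1ℤ + q * g
      k-≡      : + k ≡ (q - 1ℤ) * h * (1ℤ + (q - e) * g)
      lam-≡    : + lam ≡ ((e - 1ℤ) * h + neg (1ℤ + (q - e) * g)) + (q - e) * h * (1ℤ + (q - e) * g)
      mu-≡     : + mu ≡ (q - e) * h * (1ℤ + (q - e) * g)
      isPDS    : IsPDS N D (p ℕ.^ N) k lam mu
      D-neg    : Symmetric N D
      isSRG    : IsSRG (elems N) _==_ (CayAdj N D) (p ℕ.^ N) k lam mu

  abstract
    -- Abstract, so that the remaining arithmetic sees only the listed equations and never unfolds
    -- the fields.
    dennistonGraph : (p : ℕ) .{{_ : NonZero p}} → Prime p → ∀ M l R N → suc l ℕ.* suc M ℕ.+ suc (suc l) ℕ.* suc M ≡ N →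
                     DennistonGraph p (suc M) (suc l) R N
    dennistonGraph p p-prime M l R N N-≡ = record
      { q      = Coordinates.DS.q p p-prime M l R N N-≡
      ; e      = Coordinates.DS.e p p-prime M l R N N-≡
      ; g      = Coordinates.DS.g p p-prime M l R N N-≡
      ; h      = Coordinates.DS.h p p-prime M l R N N-≡
      ; k      = Coordinates.k p p-prime M l R N N-≡
      ; lam    = Coordinates.lam p p-prime M l R N N-≡
      ; mu     = Coordinates.mu p p-prime M l R N N-≡
      ; D      = Coordinates.D p p-prime M l R N N-≡
      ; q-≡    = sym (Coordinates.q-≡ p p-prime M l R N N-≡)
      ; e-≡    = sym (Coordinates.e-≡ p p-prime M l R N N-≡)
      ; g-≡    = trans (Coordinates.S₁-size p p-prime M l R N N-≡) (Coordinates.DS.S₁-≡ p p-prime M l R N N-≡)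
      ; h-size = trans (Coordinates.S₂-size p p-prime M l R N N-≡) (Coordinates.DS.S₂-≡ p p-prime M l R N N-≡)
      ; h-≡    = Coordinates.DS.h-≡ p p-prime M l R N N-≡
      ; k-≡    = Coordinates.k-≡ p p-prime M l R N N-≡
      ; lam-≡  = Coordinates.lam-≡ p p-prime M l R N N-≡
      ; mu-≡   = Coordinates.mu-≡ p p-prime M l R N N-≡
      ; isPDS  = Coordinates.isPDS p p-prime M l R N N-≡
      ; D-neg  = Coordinates.D-neg p p-prime M l R N N-≡
      ; isSRG  = Coordinates.isSRG p p-prime M l R N N-≡
      }

-- The parameters in closed form, with denominators cleared

module Parameters where

  open import Data.Nat.Base as ℕ using (ℕ; suc; _∸_; _≤_)
  import Data.Nat.Properties as ℕ
  import Data.Nat.Tactic.RingSolver as ℕ-Solver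
  open import Data.Integer.Base using (1ℤ; +_; _+_; _-_; _*_) renaming (-_ to neg)
  open import Data.Integer.Properties using (pos-*)
  open import Data.Integer.Tactic.RingSolver using (solve-∀)
  open import Relation.Binary.PropositionalEquality

  -- The equations are taken as hypotheses on variables, so that matching on them leaves a
  -- polynomial identity in `q`, `e`, `g` and `h`.
  size-formula : ∀ {Q Qr A B k q e g h} → Q ≡ q → Qr ≡ e → A ≡ (q - 1ℤ) * h + 1ℤ → B ≡ (q - 1ℤ) * g + 1ℤ →
                 k ≡ (q - 1ℤ) * h * (1ℤ + (q - e) * g) →
                 (Q - + 1) * k ≡ (Q - Qr) * (B - + 1) * (A - + 1) + (A - + 1) * (Q - + 1)
  size-formula {q = q} {e} {g} {h} refl refl refl refl refl = identity q e g h
    where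
    identity : ∀ q e g h → (q - + 1) * ((q - 1ℤ) * h * (1ℤ + (q - e) * g)) ≡
               (q - e) * ((q - 1ℤ) * g + 1ℤ - + 1) * ((q - 1ℤ) * h + 1ℤ - + 1) + ((q - 1ℤ) * h + 1ℤ - + 1) * (q - + 1)
    identity = solve-∀

  -- Here `h` is eliminated too: with `h = 1 + q g` the factor `A - Ar + Qr - 1` becomes
  -- `(q - 1) (1 + (q - e) g)`, which explains the square of `Q - 1` on the left.
  μ-formula : ∀ {Q Qr A Ar B μ q e g h} → Q ≡ q → Qr ≡ e → A ≡ (q - 1ℤ) * h + 1ℤ → B ≡ (q - 1ℤ) * g + 1ℤ → h ≡ 1ℤ + q * g → Ar ≡ B * Qr →
              μ ≡ (q - e) * h * (1ℤ + (q - e) * g) →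
              (Q - + 1) * (Q - + 1) * μ ≡ (Q - Qr) * (A - + 1) * (A - Ar + Qr - + 1)
  μ-formula {q = q} {e} {g} refl refl refl refl refl refl refl = identity q e g
    where
    identity : ∀ q e g → (q - + 1) * (q - + 1) * ((q - e) * (1ℤ + q * g) * (1ℤ + (q - e) * g)) ≡
               (q - e) * ((q - 1ℤ) * (1ℤ + q * g) + 1ℤ - + 1) * ((q - 1ℤ) * (1ℤ + q * g) + 1ℤ - ((q - 1ℤ) * g + 1ℤ) * e + e - + 1)
    identity = solve-∀

  λ-formula : ∀ {Q Qr A Ar B Cr l q e g h} → Q ≡ q → Qr ≡ e → A ≡ (q - 1ℤ) * h + 1ℤ → B ≡ (q - 1ℤ) * g + 1ℤ → h ≡ 1ℤ + q * g →
              Ar ≡ B * Qr → Cr ≡ A * Qr →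
              l ≡ ((e - 1ℤ) * h + neg (1ℤ + (q - e) * g)) + (q - e) * h * (1ℤ + (q - e) * g) →
              (Q - + 1) * (Q - + 1) * l ≡ (Q - Qr) * (A - + 1) * (A - Ar + Qr - + 1) + (Q - + 1) * (Cr + Ar - + 2 * A - + 2 * Qr + + 2)
  λ-formula {q = q} {e} {g} refl refl refl refl refl refl refl refl = identity q e g
    where
    identity : ∀ q e g → (q - + 1) * (q - + 1) * (((e - 1ℤ) * (1ℤ + q * g) + neg (1ℤ + (q - e) * g)) + (q - e) * (1ℤ + q * g) * (1ℤ + (q - e) * g)) ≡
               (q - e) * ((q - 1ℤ) * (1ℤ + q * g) + 1ℤ - + 1) * ((q - 1ℤ) * (1ℤ + q * g) + 1ℤ - ((q - 1ℤ) * g + 1ℤ) * e + e - + 1)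
               + (q - + 1) * (((q - 1ℤ) * (1ℤ + q * g) + 1ℤ) * e + ((q - 1ℤ) * g + 1ℤ) * e - + 2 * ((q - 1ℤ) * (1ℤ + q * g) + 1ℤ) - + 2 * e + + 2)
    identity = solve-∀

  dimension : ∀ s m l → l ℕ.* (s ℕ.* m) ℕ.+ suc l ℕ.* (s ℕ.* m) ≡ s ℕ.* (m ℕ.* (2 ℕ.* l ℕ.+ 1))
  dimension = ℕ-Solver.solve-∀

  tower : ∀ p s m l → (p ℕ.^ s) ℕ.^ (m ℕ.* l) ≡ (p ℕ.^ (s ℕ.* m)) ℕ.^ l
  tower p s m l = trans (sym (ℕ.^-*-assoc (p ℕ.^ s) m l)) (cong (ℕ._^ l) (ℕ.^-*-assoc p s m))

  subgroup-size : ∀ p s m r → (p ℕ.^ s) ℕ.^ (m ∸ r) ≡ p ℕ.^ (s ℕ.* m ∸ s ℕ.* r)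
  subgroup-size p s m r = trans (ℕ.^-*-assoc p s (m ∸ r)) (cong (p ℕ.^_) (ℕ.*-distribˡ-∸ s m r))

  split-exponent : ∀ q m l r → r ≤ m → + (q ℕ.^ (m ℕ.* (l ℕ.+ 1) ∸ r)) ≡ + (q ℕ.^ (m ℕ.* l)) * + (q ℕ.^ (m ∸ r))
  split-exponent q m l r r≤m = trans (cong +_ (trans (cong (q ℕ.^_) exponent) (ℕ.^-distribˡ-+-* q (m ℕ.* l) (m ∸ r)))) (pos-* (q ℕ.^ (m ℕ.* l)) (q ℕ.^ (m ∸ r)))
    where
    exponent : m ℕ.* (l ℕ.+ 1) ∸ r ≡ m ℕ.* l ℕ.+ (m ∸ r)
    exponent = trans (cong (_∸ r) (trans (ℕ.*-distribˡ-+ m l 1) (cong (m ℕ.* l ℕ.+_) (ℕ.*-identityʳ m)))) (ℕ.+-∸-assoc (m ℕ.* l) r≤m)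

-- Specialisation to the field of order `q^m` and a subgroup of order `q^(m-r)`

open import Defs
open import Data.Nat using (ℕ; _≤_; _∸_; NonZero) renaming (_*_ to _*ℕ_; _+_ to _+ℕ_; _^_ to _^ℕ_)
open import Data.Nat.Primality using (Prime)
open import Data.Integer using (ℤ; +_; _+_; _-_; _*_)
open import Data.Product using (Σ; _×_)
open import Relation.Binary.PropositionalEquality using (_≡_)

open import Data.Nat using (suc)
open import Data.Nat.Properties using (+-comm; +-assoc; ^-*-assoc)
open import Data.Product using (_,_)
open import Relation.Binary.PropositionalEquality using (refl; sym; trans; cong; subst)
open Graphs using (DennistonGraph; dennistonGraph)

theorem1p12 :
    (p : ℕ) .{{_ : NonZero p}} → Prime p →
    (s m l r : ℕ) → 1 ≤ s → 1 ≤ m → 1 ≤ l → r ≤ m →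
    let q = p ^ℕ s
        n = s *ℕ (m *ℕ (2 *ℕ l +ℕ 1))
        v = q ^ℕ (m *ℕ (2 *ℕ l +ℕ 1))
        Q = + (q ^ℕ m)
        A = + (q ^ℕ (m *ℕ (l +ℕ 1)))
        B = + (q ^ℕ (m *ℕ l))
        Qr = + (q ^ℕ (m ∸ r))
        Ar = + (q ^ℕ (m *ℕ (l +ℕ 1) ∸ r))
        Cr = + (q ^ℕ (m *ℕ (l +ℕ 2) ∸ r))
        N = (Q - Qr) * (A - + 1) * (A - Ar + Qr - + 1)
        open Zmod p
    in Σ ℕ λ k → Σ ℕ λ lam → Σ ℕ λ mu →
         ((Q - + 1) * + k ≡ (Q - Qr) * (B - + 1) * (A - + 1) + (A - + 1) * (Q - + 1))
       × ((Q - + 1) * (Q - + 1) * + lam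
           ≡ N + (Q - + 1) * (Cr + Ar - + 2 * A - + 2 * Qr + + 2))
       × ((Q - + 1) * (Q - + 1) * + mu ≡ N)
       × Σ (G n → _) λ D →
           IsPDS n D v k lam mu
         × Symmetric n D
         × IsSRG (elems n) _==_ (CayAdj n D) v k lam mu
theorem1p12 p p-prime s@(suc s′) m@(suc m′) l@(suc l′) r _ _ _ r≤m =
  k , lam , mu
  , size-formula Q≡ Qr≡ A≡ B≡ k-≡
  , λ-formula Q≡ Qr≡ A≡ B≡ h-≡ (split-exponent q m l r r≤m) Cr≡ lam-≡
  , μ-formula Q≡ Qr≡ A≡ B≡ h-≡ (split-exponent q m l r r≤m) mu-≡
  , D
  , subst (λ v → IsPDS n D v k lam mu) v≡ isPDS
  , D-neg
  , subst (λ v → IsSRG (elems n) _==_ (CayAdj n D) v k lam mu) v≡ isSRG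
  where
  open Zmod p
  open Parameters
  n q : ℕ
  n = s *ℕ (m *ℕ (2 *ℕ l +ℕ 1))
  q = p ^ℕ s
  graph : DennistonGraph p (s *ℕ m) l (s *ℕ r) n
  -- The argument `m′ +ℕ s′ *ℕ m` is the predecessor of `s *ℕ m`. The first `s *ℕ r` of the `s *ℕ m`
  -- coordinates of `K` vanish on `U`, which gives `U` the order `q^(m-r)`.
  graph = dennistonGraph p p-prime (m′ +ℕ s′ *ℕ m) l′ (s *ℕ r) n (dimension s m l)
  open DennistonGraph graph renaming (q to q′)
  Q≡ : + (q ^ℕ m) ≡ q′
  Q≡ = trans (cong +_ (^-*-assoc p s m)) q-≡
  Qr≡ : + (q ^ℕ (m ∸ r)) ≡ e
  Qr≡ = trans (cong +_ (subgroup-size p s m r)) e-≡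
  A≡ : + (q ^ℕ (m *ℕ (l +ℕ 1))) ≡ (q′ - + 1) * h + + 1
  A≡ = trans (cong +_ (tower p s m (l +ℕ 1))) (trans (cong (λ j → + ((p ^ℕ (s *ℕ m)) ^ℕ j)) (+-comm l 1)) h-size)
  B≡ : + (q ^ℕ (m *ℕ l)) ≡ (q′ - + 1) * g + + 1
  B≡ = trans (cong +_ (tower p s m l)) g-≡
  Cr≡ : + (q ^ℕ (m *ℕ (l +ℕ 2) ∸ r)) ≡ + (q ^ℕ (m *ℕ (l +ℕ 1))) * + (q ^ℕ (m ∸ r))
  Cr≡ = trans (cong (λ j → + (q ^ℕ (m *ℕ j ∸ r))) (sym (+-assoc l 1 1))) (split-exponent q m (l +ℕ 1) r r≤m)
  v≡ : p ^ℕ n ≡ q ^ℕ (m *ℕ (2 *ℕ l +ℕ 1))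
  v≡ = sym (^-*-assoc p s (m *ℕ (2 *ℕ l +ℕ 1)))
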